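{- Let $k,r,s,t$ be positive integers. There is a constant $C=C(k,r,s,t)>0$ such that for all positive integers $2\leq m\leq n$, \[\mathrm{ex}(m,n,K_{s,t}^{(2k)}(r))\leq C\left(m^{\frac{1}{2}+\frac{1}{2k}}n^{\frac{1}{2}}+n\log m\right)\quad\text{and}\quad \mathrm{ex}(m,n,K_{s,t}^{(2k)})\leq C\left(m^{\frac{1}{2}+\frac{1}{2k}-\frac{1}{2ks}}n^{\frac{1}{2}}+n\log m\right).\]
   Context: For a graph $H$ and positive integers $m\le n$, $\mathrm{ex}(m,n,H)$ is the maximum number of edges in an $H$-free bipartite graph with parts of sizes $m$ and $n$. For a graph $H$ and positive integers $k,r$, $H^{(k)}(r)$ is the graph obtained from $H$ by replacing each edge $uv$ by $r$ paths of length $k$ between $u$ and $v$, such that all these $r\,e(H)$ paths are pairwise internally vertex-disjoint (and internally disjoint from $V(H)$); $H^{(k)}=H^{(k)}(1)$ is the $k$-subdivision of $H$. $K_{s,t}$ is the complete bipartite graph with parts of sizes $s$ and $t$. -}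

module Defs where

open import Data.Nat using (ℕ; zero; suc; _+_; _*_; _∸_; _^_; _≤_; _<_)
open import Data.Nat.Logarithm using (⌊log₂_⌋) public
open import Data.Fin using (Fin; toℕ)
open import Data.List using (List; map)
open import Data.Nat.ListAction using (sum)
open import Data.Bool using (Bool; true; false; if_then_else_)
open import Data.Sum using (_⊎_; inj₁; inj₂)
open import Data.Product using (Σ; _×_)
open import Data.Empty using (⊥)
open import Relation.Binary.PropositionalEquality using (_≡_)
open import Relation.Nullary using (¬_)
open import Function.Definitions using (Injective)
import Data.List as L
import Data.Fin as F

BipGraph : ℕ → ℕ → Set
BipGraph m n = Fin m → Fin n → Bool

edges : ∀ {m n} → BipGraph m n → ℕ
edges {m} {n} G =
  sum (map (λ i → sum (map (λ j → if G i j then 1 else 0) (L.allFin n))) (L.allFin m))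

Adj : ∀ {m n} → BipGraph m n → (Fin m ⊎ Fin n) → (Fin m ⊎ Fin n) → Set
Adj G (inj₁ i) (inj₂ j) = G i j ≡ true
Adj G (inj₂ j) (inj₁ i) = G i j ≡ true
Adj G (inj₁ _) (inj₁ _) = ⊥
Adj G (inj₂ _) (inj₂ _) = ⊥

-- A (pattern) graph H is given by a vertex type V and an edge relation E
-- (E u v means uv is an edge of H; orientation is irrelevant since Adj is symmetric).
-- G contains H (as a subgraph, not necessarily induced) iff there is an
-- injective map V → V(G) sending edges of H to edges of G.
Contains : (V : Set) → (V → V → Set) → ∀ {m n} → BipGraph m n → Set
Contains V E {m} {n} G =
  Σ (V → Fin m ⊎ Fin n) λ f → Injective _≡_ _≡_ f × (∀ {u v} → E u v → Adj G (f u) (f v))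

Free : (V : Set) → (V → V → Set) → ∀ {m n} → BipGraph m n → Set
Free V E G = ¬ Contains V E G

-- The graph K_{s,t}^{(k')}(r) with k' = path length (we use k' = 2k ≥ 2).
-- Vertices: the s + t branch vertices of K_{s,t}, plus, for every edge (a,b)
-- of K_{s,t} and every ρ < r, the k'-1 internal vertices p_1,…,p_{k'-1} of the
-- ρ-th path from a to b (internal vertex p_{i+1} is indexed by i : Fin (k'∸1)).
data SVert (s t r k' : ℕ) : Set where
  left  : Fin s → SVert s t r k'
  right : Fin t → SVert s t r k'
  mid   : Fin s → Fin t → Fin r → Fin (k' ∸ 1) → SVert s t r k'

data SEdge (s t r k' : ℕ) : SVert s t r k' → SVert s t r k' → Set where
  start : ∀ a b ρ (i : Fin (k' ∸ 1)) → toℕ i ≡ 0 →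
          SEdge s t r k' (left a) (mid a b ρ i)
  step  : ∀ a b ρ (i j : Fin (k' ∸ 1)) → suc (toℕ i) ≡ toℕ j →
          SEdge s t r k' (mid a b ρ i) (mid a b ρ j)
  end   : ∀ a b ρ (i : Fin (k' ∸ 1)) → suc (toℕ i) ≡ k' ∸ 1 →
          SEdge s t r k' (mid a b ρ i) (right b)

SubdivFree : (s t r k : ℕ) → ∀ {m n} → BipGraph m n → Set
SubdivFree s t r k G = Free (SVert s t r (2 * k)) (SEdge s t r (2 * k)) G

{-# OPTIONS --safe #-}

-- After deleting vertices of low degree, weight walks as a random walk does: a step out of v has weight
-- ω v = W / d v for a common multiple W of the degrees.  The resulting kernel p is reversible with respect
-- to d, which replaces the usual reduction to almost regular graphs.
--
-- A pair of vertices is rich at distance ℓ if no vertex carries a constant proportion of the ℓ-walks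
-- between them.  If rich pairs have positive density, then deleting the badly behaved configurations
-- leaves a closed system, in which every piece of a configuration can be replaced avoiding any bounded set
-- of vertices, and the subdivision is built greedily.  Otherwise most walks have no heavy segment:
-- a heavy pair that is not rich has a popular intermediate vertex and so a shorter heavy pair.  Counting
-- light walks of length 2k over the m² pairs of end vertices gives the first bound.
--
-- For the second bound count spiders, s legs of length 2k with a common centre, over the m^s tuples of
-- leaves.  Starting from the leaves, fix one after the other positions in which a constant proportion of
-- the spiders that agree so far share a vertex.  If this stops before the centre is fixed, then the
-- spiders on the fixed positions (the kernel) form a closed system, and the subdivision arises by moving
-- the first kernel vertices of the legs two steps at a time.  If the centre gets fixed, then lightness of
-- the legs bounds the number of spiders.

module Submission where

open import Defs hiding (left; right; mid; start; step; end)
open import Data.Bool using (Bool; true; false; _∧_; _∨_; not; if_then_else_)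
open import Data.Empty using (⊥; ⊥-elim)
open import Data.Fin using (Fin; zero; suc; toℕ; fromℕ; inject₁; cast; combine; remQuot)
open import Data.Fin.Properties using (toℕ<n; toℕ-injective; toℕ-fromℕ; toℕ-inject₁; toℕ-cast; combine-injective; remQuot-combine)
open import Data.List using (List; []; _∷_; map; _++_; concatMap; length; allFin; upTo)
open import Data.List.Membership.Propositional using (_∈_; _∉_)
open import Data.List.Membership.Propositional.Properties using (∈-map⁺; ∈-map⁻; ∈-++⁺ˡ; ∈-++⁺ʳ; ∈-++⁻; ∈-concatMap⁺; ∈-concatMap⁻; ∈-allFin; ∈-upTo⁺; ∈-upTo⁻; ∈-lookup)
open import Data.List.Properties using (length-map; length-++; length-tabulate; map-++; map-∘)
open import Data.List.Relation.Unary.All using ([]; _∷_)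
open import Data.List.Relation.Unary.Any using (here; there)
open import Data.List.Relation.Unary.Unique.Propositional using (Unique; []; _∷_)
open import Data.Nat hiding (_≟_)
open import Data.Nat.Divisibility using (divides; m≤n⇒m!∣n!; ∣-trans; m∣m*n)
open import Data.Nat.ListAction using (sum)
open import Data.Nat.Logarithm using (⌊log₂⌋-mono-≤)
open import Data.Nat.Properties hiding (_≟_)
open import Data.Nat.Solver using (module +-*-Solver)
open import Data.Product using (Σ; ∃; _×_; _,_; proj₁; proj₂)
open import Data.Sum using (_⊎_; inj₁; inj₂)
open import Data.Unit using (⊤; tt)
open import Data.Vec using (Vec; []; _∷_; lookup)
open import Relation.Binary.Definitions using (DecidableEquality; tri<; tri≈; tri>)
open import Relation.Binary.PropositionalEquality hiding (J)
open import Relation.Nullary using (Dec; yes; no; does)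
open import Algebra.Properties.CommutativeSemigroup +-commutativeSemigroup using (interchange)
import Data.Bool
import Data.Fin as Fin
import Data.List.Relation.Unary.All as All
import Data.List.Relation.Unary.Any as Any
import Data.List.Relation.Unary.Unique.Propositional.Properties as Uniqueₚ
import Data.Vec.Properties
open +-*-Solver using (solve; _:*_; _:+_; _:=_; con)

-- Finite sums

-- Probabilities are kept integral: an ℓ-step probability is stored multiplied by `W ^ ℓ`, a
-- statement about a proportion takes the form `x ≤ A * y`, and `W` cancels only in the final
-- inequalities. All deletions, of low degrees as well as of badly behaved configurations, are
-- instances of one lemma, `closure`. The embeddings ask only for a constant minimum degree, so the
-- argument applies as soon as the number of edges exceeds a constant times n; the logarithm serves
-- only as a number that is at least 1. The shape of the embedding is dictated by parity. Tips move
-- two steps at a time, while the paths of the subdivision have an odd number of interior vertices.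
-- When the parity does not fit, a path starts at the predecessor of the tip. This breaks down when
-- the tips of two legs are adjacent to the centre, because both paths would then start at the
-- centre. Such a kernel is treated by a second embedding, whose right branch vertices are
-- neighbours of a common centre. Rich pairs are viewed as spiders with two legs and use the second
-- embedding as well.

private variable
  X Y : Set

∑ : List X → (X → ℕ) → ℕ
∑ []       f = 0
∑ (x ∷ xs) f = f x + ∑ xs f

syntax ∑ xs (λ x → e) = ∑[ x ∈ xs ] e
infix 5 ∑

∑-cong : ∀ (xs : List X) {f g : X → ℕ} → (∀ x → f x ≡ g x) → ∑ xs f ≡ ∑ xs g
∑-cong []       e = refl
∑-cong (x ∷ xs) e = cong₂ _+_ (e x) (∑-cong xs e)

∑-mono : ∀ (xs : List X) {f g : X → ℕ} → (∀ x → f x ≤ g x) → ∑ xs f ≤ ∑ xs g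
∑-mono []       e = z≤n
∑-mono (x ∷ xs) e = +-mono-≤ (e x) (∑-mono xs e)

∑-mono-∈ : ∀ (xs : List X) {f g : X → ℕ} → (∀ {x} → x ∈ xs → f x ≤ g x) → ∑ xs f ≤ ∑ xs g
∑-mono-∈ []       e = z≤n
∑-mono-∈ (x ∷ xs) e = +-mono-≤ (e (here refl)) (∑-mono-∈ xs (λ i → e (there i)))

∑-+ : ∀ (xs : List X) (f g : X → ℕ) → ∑ xs (λ x → f x + g x) ≡ ∑ xs f + ∑ xs g
∑-+ []       f g = refl
∑-+ (x ∷ xs) f g = trans (cong (f x + g x +_) (∑-+ xs f g)) (interchange (f x) (g x) _ _)

∑-*ˡ : ∀ (xs : List X) c (f : X → ℕ) → ∑ xs (λ x → c * f x) ≡ c * ∑ xs f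
∑-*ˡ []       c f = sym (*-zeroʳ c)
∑-*ˡ (x ∷ xs) c f = trans (cong (c * f x +_) (∑-*ˡ xs c f)) (sym (*-distribˡ-+ c (f x) _))

∑-*ʳ : ∀ (xs : List X) c (f : X → ℕ) → ∑ xs (λ x → f x * c) ≡ ∑ xs f * c
∑-*ʳ xs c f = trans (∑-cong xs (λ x → *-comm (f x) c)) (trans (∑-*ˡ xs c f) (*-comm c _))

∑-const : ∀ (xs : List X) c → ∑ xs (λ _ → c) ≡ length xs * c
∑-const []       c = refl
∑-const (x ∷ xs) c = cong (c +_) (∑-const xs c)

∑-zero : ∀ (xs : List X) → ∑ xs (λ _ → 0) ≡ 0
∑-zero xs = trans (∑-const xs 0) (*-zeroʳ (length xs))

∑-swap : ∀ (xs : List X) (ys : List Y) (f : X → Y → ℕ) →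
         ∑ xs (λ x → ∑ ys (f x)) ≡ ∑ ys (λ y → ∑ xs (λ x → f x y))
∑-swap []       ys f = sym (∑-zero ys)
∑-swap (x ∷ xs) ys f = trans (cong (∑ ys (f x) +_) (∑-swap xs ys f)) (sym (∑-+ ys (f x) _))

∑-++ : ∀ (xs ys : List X) f → ∑ (xs ++ ys) f ≡ ∑ xs f + ∑ ys f
∑-++ []       ys f = refl
∑-++ (x ∷ xs) ys f = trans (cong (f x +_) (∑-++ xs ys f)) (sym (+-assoc (f x) _ _))

∑-map : ∀ (h : Y → X) (ys : List Y) f → ∑ (map h ys) f ≡ ∑ ys (λ y → f (h y))
∑-map h []       f = refl
∑-map h (y ∷ ys) f = cong (f (h y) +_) (∑-map h ys f)

∑-concatMap : ∀ (h : Y → List X) (ys : List Y) f → ∑ (concatMap h ys) f ≡ ∑ ys (λ y → ∑ (h y) f)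
∑-concatMap h []       f = refl
∑-concatMap h (y ∷ ys) f = trans (∑-++ (h y) _ f) (cong (∑ (h y) f +_) (∑-concatMap h ys f))

∑-∈ : ∀ {xs : List X} {x} (f : X → ℕ) → x ∈ xs → f x ≤ ∑ xs f
∑-∈ f (here refl) = m≤m+n _ _
∑-∈ f (there i)   = ≤-trans (∑-∈ f i) (m≤n+m _ _)

∑-pos : ∀ (xs : List X) f → 0 < ∑ xs f → ∃ λ x → x ∈ xs × 0 < f x
∑-pos (x ∷ xs) f lt with f x in eq
... | suc m = x , here refl , subst (0 <_) (sym eq) z<s
... | zero  with ∑-pos xs f lt
...   | y , i , p = y , there i , p

search : ∀ (xs : List X) (P : X → Bool) →
         (∃ λ x → x ∈ xs × P x ≡ true) ⊎ (∀ {x} → x ∈ xs → P x ≡ false)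
search []       P = inj₂ (λ ())
search (x ∷ xs) P with P x in eq
... | true = inj₁ (x , here refl , eq)
... | false with search xs P
...   | inj₁ (y , i , p) = inj₁ (y , there i , p)
...   | inj₂ n = inj₂ λ { (here refl) → eq ; (there i) → n i }

-- If every entry fell short, each `length xs * f x` would miss `A` by at least one unit, and the
-- sum of these units contradicts `A ≤ ∑ xs f`.
pigeonhole : ∀ (xs : List X) (f : X → ℕ) {A} → 0 < A → A ≤ ∑ xs f → ∃ λ x → x ∈ xs × A ≤ length xs * f x
pigeonhole {X = X} xs f {A} pos le with search xs (λ x → A ≤ᵇ length xs * f x)
... | inj₁ (x , i , p) = x , i , ≤ᵇ⇒≤ A _ (subst Data.Bool.T (sym p) _)
... | inj₂ n = ⊥-elim (contra xs refl)
  where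
  small : ∀ {x} → x ∈ xs → 1 + length xs * f x ≤ A
  small {x} i with A ≤? length xs * f x
  ... | yes q = ⊥-elim (subst Data.Bool.T (n i) (≤⇒≤ᵇ q))
  ... | no q = ≰⇒> q
  contra : ∀ ys → ys ≡ xs → ⊥
  contra [] refl with n≤0⇒n≡0 le
  ... | refl = <-irrefl refl pos
  contra (y ∷ ys) refl = <-irrefl refl (begin-strict
    length xs * A ≤⟨ *-monoʳ-≤ (length xs) le ⟩
    length xs * ∑ xs f ≡⟨ sym (∑-*ˡ xs (length xs) f) ⟩
    ∑ xs (λ x → length xs * f x) <⟨ m<m+n _ {length xs} z<s ⟩
    ∑ xs (λ x → length xs * f x) + length xs ≡⟨ +-comm _ (length xs) ⟩
    length xs + ∑ xs (λ x → length xs * f x) ≡⟨ cong (_+ ∑ xs (λ x → length xs * f x)) (sym (trans (∑-const xs 1) (*-identityʳ (length xs)))) ⟩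
    ∑ xs (λ _ → 1) + ∑ xs (λ x → length xs * f x) ≡⟨ sym (∑-+ xs (λ _ → 1) _) ⟩
    ∑ xs (λ x → 1 + length xs * f x) ≤⟨ ∑-mono-∈ xs small ⟩
    ∑ xs (λ _ → A) ≡⟨ ∑-const xs A ⟩
    length xs * A ∎)
    where open ≤-Reasoning

-- Indicators

⟦_⟧ : Bool → ℕ
⟦ true ⟧  = 1
⟦ false ⟧ = 0

⟦⟧≤1 : ∀ b → ⟦ b ⟧ ≤ 1
⟦⟧≤1 true = ≤-refl
⟦⟧≤1 false = z≤n

⟦∧⟧ : ∀ a b → ⟦ a ∧ b ⟧ ≡ ⟦ a ⟧ * ⟦ b ⟧
⟦∧⟧ true b = sym (+-identityʳ _)
⟦∧⟧ false b = refl

⟦⟧-true : ∀ {b} → b ≡ true → ⟦ b ⟧ ≡ 1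
⟦⟧-true refl = refl

⟦⟧*≤ : ∀ b x → ⟦ b ⟧ * x ≤ x
⟦⟧*≤ true x = ≤-reflexive (+-identityʳ x)
⟦⟧*≤ false x = z≤n

⟦⟧-pos : ∀ b {x} → 0 < ⟦ b ⟧ * x → b ≡ true × 0 < x
⟦⟧-pos true {x} lt = refl , subst (0 <_) (+-identityʳ x) lt
⟦⟧-pos false ()

∧-true : ∀ {a b} → a ∧ b ≡ true → a ≡ true × b ≡ true
∧-true {true} {true} refl = refl , refl

true-∧ : ∀ {a b} → a ≡ true → b ≡ true → a ∧ b ≡ true
true-∧ refl refl = refl

not-true : ∀ {a} → not a ≡ true → a ≡ false
not-true {false} refl = refl

dichotomy : ∀ b → b ≡ true ⊎ b ≡ false
dichotomy true = inj₁ refl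
dichotomy false = inj₂ refl

bool-iff : ∀ {a b} → (a ≡ true → b ≡ true) → (b ≡ true → a ≡ true) → a ≡ b
bool-iff {true}  {true}  f g = refl
bool-iff {false} {false} f g = refl
bool-iff {true}  {false} f g = sym (f refl)
bool-iff {false} {true}  f g = g refl

not-false : ∀ {b} → not b ≡ false → b ≡ true
not-false {true} _ = refl

true≢false : true ≢ false
true≢false ()

pos-* : ∀ a {b} → 0 < a * b → 0 < a × 0 < b
pos-* (suc a) {suc b} lt = z<s , z<s
pos-* (suc a) {zero}  lt = ⊥-elim (<-irrefl (sym (*-zeroʳ a)) lt)

suc[m∸1+n]≡m∸n : ∀ m n → n < m → suc (m ∸ suc n) ≡ m ∸ n
suc[m∸1+n]≡m∸n (suc m) zero    lt = refl
suc[m∸1+n]≡m∸n (suc m) (suc n) (s≤s lt) = suc[m∸1+n]≡m∸n m n lt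

length-allFin : ∀ n → length (allFin n) ≡ n
length-allFin n = length-tabulate {n = n} (λ x → x)

≤ᵇ-true : ∀ {m n} → (m ≤ᵇ n) ≡ true → m ≤ n
≤ᵇ-true e = ≤ᵇ⇒≤ _ _ (subst Data.Bool.T (sym e) _)

true-≤ᵇ : ∀ {m n} → m ≤ n → (m ≤ᵇ n) ≡ true
true-≤ᵇ {m} {n} le with m ≤ᵇ n | ≤⇒≤ᵇ le
... | true | _ = refl

≤ᵇ-false : ∀ {m n} → (m ≤ᵇ n) ≡ false → n < m
≤ᵇ-false {m} {n} e with m ≤? n
... | no q = ≰⇒> q
... | yes q = ⊥-elim (subst Data.Bool.T e (≤⇒≤ᵇ q))

-- Equivalence classes and closed subsets

record Equivalence (X : Set) (_~_ : X → X → Bool) : Set where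
  field
    ~refl  : ∀ x → (x ~ x) ≡ true
    ~sym   : ∀ {x y} → (x ~ y) ≡ true → (y ~ x) ≡ true
    ~trans : ∀ {x y z} → (x ~ y) ≡ true → (y ~ z) ≡ true → (x ~ z) ≡ true

  ~congʳ : ∀ {x y} z → (x ~ y) ≡ true → (z ~ x) ≡ (z ~ y)
  ~congʳ {x} {y} z xy with z ~ x in p | z ~ y in q
  ... | true  | true  = refl
  ... | false | false = refl
  ... | true  | false = trans (sym (~trans p xy)) q
  ... | false | true  = trans (sym p) (~trans q (~sym xy))

  ~congˡ : ∀ {x y} z → (x ~ y) ≡ true → (x ~ z) ≡ (y ~ z)
  ~congˡ {x} {y} z xy with x ~ z in p | y ~ z in q
  ... | true  | true  = refl
  ... | false | false = refl
  ... | true  | false = trans (sym (~trans (~sym xy) p)) q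
  ... | false | true  = trans (sym p) (~trans xy q)

⟦⟧-split : ∀ p c → (c ≡ true → p ≡ true) → ⟦ p ⟧ ≡ ⟦ c ⟧ + ⟦ p ∧ not c ⟧
⟦⟧-split true  true  h = refl
⟦⟧-split true  false h = refl
⟦⟧-split false true  h with h refl
... | ()
⟦⟧-split false false h = refl

⟦⟧-split′ : ∀ p c → ⟦ p ⟧ ≡ ⟦ c ⟧ * ⟦ p ⟧ + ⟦ p ∧ not c ⟧
⟦⟧-split′ true  true  = refl
⟦⟧-split′ true  false = refl
⟦⟧-split′ false true  = refl
⟦⟧-split′ false false = refl

module _ {X : Set} (xs : List X) where

  count : (X → Bool) → ℕ
  count P = ∑ xs (λ x → ⟦ P x ⟧)

  count-remove : ∀ (P C : X → Bool) {x} → x ∈ xs → P x ≡ true → C x ≡ true →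
                 count (λ y → P y ∧ not (C y)) < count P
  count-remove P C {x} i Px Cx = begin-strict
    count (λ y → P y ∧ not (C y)) <⟨ m<n+m _ lt ⟩
    ∑ xs (λ y → ⟦ C y ⟧ * ⟦ P y ⟧) + count (λ y → P y ∧ not (C y)) ≡⟨ sym (∑-+ xs _ _) ⟩
    ∑ xs (λ y → ⟦ C y ⟧ * ⟦ P y ⟧ + ⟦ P y ∧ not (C y) ⟧) ≡⟨ ∑-cong xs (λ y → sym (⟦⟧-split′ (P y) (C y))) ⟩
    count P ∎
    where
    open ≤-Reasoning
    lt : 0 < ∑ xs (λ y → ⟦ C y ⟧ * ⟦ P y ⟧)
    lt = <-≤-trans (subst (0 <_) (sym (cong₂ (λ u v → ⟦ u ⟧ * ⟦ v ⟧) Cx Px)) z<s) (∑-∈ (λ y → ⟦ C y ⟧ * ⟦ P y ⟧) i)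

  module _ {_~_ : X → X → Bool} (E : Equivalence X _~_) where
    open Equivalence E

    -- Peels off one class at a time: saturation puts the class of a member of `P` entirely inside
    -- `P`, and what remains is again saturated and smaller.
    classwise-≤ : ∀ (P : X → Bool) (f g : X → ℕ) →
      (∀ {x y} → (x ~ y) ≡ true → P x ≡ true → P y ≡ true) →
      (∀ {x} → x ∈ xs → P x ≡ true → ∑ xs (λ y → ⟦ x ~ y ⟧ * f y) ≤ ∑ xs (λ y → ⟦ x ~ y ⟧ * g y)) →
      ∑ xs (λ y → ⟦ P y ⟧ * f y) ≤ ∑ xs (λ y → ⟦ P y ⟧ * g y)
    classwise-≤ P f g = go (suc (count P)) P ≤-refl
      where
      go : ∀ n (P : X → Bool) → count P < n →
        (∀ {x y} → (x ~ y) ≡ true → P x ≡ true → P y ≡ true) →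
        (∀ {x} → x ∈ xs → P x ≡ true → ∑ xs (λ y → ⟦ x ~ y ⟧ * f y) ≤ ∑ xs (λ y → ⟦ x ~ y ⟧ * g y)) →
        ∑ xs (λ y → ⟦ P y ⟧ * f y) ≤ ∑ xs (λ y → ⟦ P y ⟧ * g y)
      go (suc n) P (s≤s lt) sat cl with search xs P
      ... | inj₂ none = ∑-mono-∈ xs λ {x} i → subst (λ b → ⟦ b ⟧ * f x ≤ ⟦ b ⟧ * g x) (sym (none i)) z≤n
      ... | inj₁ (x , i , Px) = begin
        ∑ xs (λ y → ⟦ P y ⟧ * f y) ≡⟨ split f ⟩
        ∑ xs (λ y → ⟦ x ~ y ⟧ * f y) + ∑ xs (λ y → ⟦ P′ y ⟧ * f y) ≤⟨ +-mono-≤ (cl i Px) (go n P′ (<-≤-trans (count-remove P (x ~_) i Px (~refl x)) lt) sat′ (λ j q → cl j (proj₁ (∧-true q)))) ⟩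
        ∑ xs (λ y → ⟦ x ~ y ⟧ * g y) + ∑ xs (λ y → ⟦ P′ y ⟧ * g y) ≡⟨ sym (split g) ⟩
        ∑ xs (λ y → ⟦ P y ⟧ * g y) ∎
        where
        open ≤-Reasoning
        P′ : X → Bool
        P′ y = P y ∧ not (x ~ y)
        split : ∀ h → ∑ xs (λ y → ⟦ P y ⟧ * h y) ≡ ∑ xs (λ y → ⟦ x ~ y ⟧ * h y) + ∑ xs (λ y → ⟦ P′ y ⟧ * h y)
        split h = trans (∑-cong xs λ y → trans (cong (_* h y) (⟦⟧-split (P y) (x ~ y) (λ e → sat e Px))) (*-distribʳ-+ (h y) ⟦ x ~ y ⟧ _)) (∑-+ xs _ _)
        sat′ : ∀ {y z} → (y ~ z) ≡ true → P′ y ≡ true → P′ z ≡ true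
        sat′ {y} {z} yz q with ∧-true {P y} q
        ... | Py , ny = true-∧ (sat yz Py) (cong not (trans (~congʳ x (~sym yz)) (not-true ny)))

  any-true : ∀ {P : X → Bool} {x} → x ∈ xs → P x ≡ true → 1 ≤ ∑ xs (λ x → ⟦ P x ⟧)
  any-true {P} i e = ≤-trans (≤-reflexive (sym (⟦⟧-true e))) (∑-∈ (λ x → ⟦ P x ⟧) i)

  module _ {E : Set} (es : List E) (R : E → X → X → Bool) (eq : ∀ e → Equivalence X (R e)) (w ν : X → ℕ) where

    meets : (X → Bool) → E → X → Bool
    meets P e y = 1 ≤ᵇ ∑ xs (λ x → ⟦ P x ∧ R e x y ⟧)

    meets-intro : ∀ {P e x y} → x ∈ xs → P x ≡ true → R e x y ≡ true → meets P e y ≡ true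
    meets-intro {P} {e} {x} {y} i p r = true-≤ᵇ (any-true {λ x → P x ∧ R e x y} i (true-∧ p r))

    meets-elim : ∀ {P e y} → meets P e y ≡ true → ∃ λ x → x ∈ xs × P x ≡ true × R e x y ≡ true
    meets-elim {P} {e} {y} q with ∑-pos xs (λ x → ⟦ P x ∧ R e x y ⟧) (≤ᵇ-true q)
    ... | x , i , lt with dichotomy (P x ∧ R e x y)
    ...   | inj₁ t = x , i , ∧-true t
    ...   | inj₂ f with subst (λ b → 0 < ⟦ b ⟧) f lt
    ...     | ()

    -- The potential of the deletion process: the `ν`-mass of all classes of `R e` that still meet
    -- `P`.
    cost : (X → Bool) → E → ℕ
    cost P e = ∑ xs (λ y → ⟦ meets P e y ⟧ * ν y)

    -- With `w` equal to Q times `ν`, this says that each class met by `P` has at least the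
    -- proportion 1/Q of its mass in `P`.
    Closed : (X → Bool) → Set
    Closed P = ∀ {e x} → e ∈ es → x ∈ xs → P x ≡ true →
               ∑ xs (λ y → ⟦ R e x y ⟧ * ν y) ≤ ∑ xs (λ y → ⟦ R e x y ⟧ * (⟦ P y ⟧ * w y))

    private
      gap : ∀ {f g : E → ℕ} {c e} (es : List E) → e ∈ es → (∀ e → f e ≤ g e) → f e + c ≤ g e → ∑ es f + c ≤ ∑ es g
      gap {f} {g} {c} (e ∷ es) (here refl) le h = begin
        f e + ∑ es f + c ≡⟨ trans (+-assoc (f e) _ c) (trans (cong (f e +_) (+-comm _ c)) (sym (+-assoc (f e) c _))) ⟩
        f e + c + ∑ es f ≤⟨ +-mono-≤ h (∑-mono es le) ⟩
        g e + ∑ es g ∎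
        where open ≤-Reasoning
      gap {f} {g} {c} (e ∷ es) (there i) le h = begin
        f e + ∑ es f + c ≡⟨ +-assoc (f e) _ c ⟩
        f e + (∑ es f + c) ≤⟨ +-mono-≤ (le e) (gap es i le h) ⟩
        g e + ∑ es g ∎
        where open ≤-Reasoning

      viol : (X → Bool) → E → X → Bool
      viol P e x = P x ∧ not (∑ xs (λ y → ⟦ R e x y ⟧ * ν y) ≤ᵇ ∑ xs (λ y → ⟦ R e x y ⟧ * (⟦ P y ⟧ * w y)))

      -- Deletes from `P` a class in which closedness fails. The `w`-mass lost is smaller than the
      -- `ν`-mass of that class, and the class never meets `P` again, so the drop of the total
      -- `cost` pays for the loss.
      go : ∀ n (P : X → Bool) → count P < n →
           ∃ λ P′ → (∀ {x} → P′ x ≡ true → P x ≡ true) × Closed P′ ×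
             ∑ xs (λ x → ⟦ P x ⟧ * w x) + ∑ es (cost P′) ≤ ∑ xs (λ x → ⟦ P′ x ⟧ * w x) + ∑ es (cost P)
      go (suc n) P (s≤s lt) with search es (λ e → 1 ≤ᵇ ∑ xs (λ x → ⟦ viol P e x ⟧))
      ... | inj₂ none = P , (λ p → p) , closed , ≤-refl
        where
        closed : Closed P
        closed {e} {x} ie ix Px with dichotomy (∑ xs (λ y → ⟦ R e x y ⟧ * ν y) ≤ᵇ ∑ xs (λ y → ⟦ R e x y ⟧ * (⟦ P y ⟧ * w y)))
        ... | inj₁ t = ≤ᵇ-true t
        ... | inj₂ f with trans (sym (none ie)) (true-≤ᵇ (any-true {viol P e} ix (true-∧ Px (cong not f))))
        ... | ()
      ... | inj₁ (e , ie , some) with ∑-pos xs (λ x → ⟦ viol P e x ⟧) (≤ᵇ-true some)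
      ...   | x , ix , lt′ with dichotomy (viol P e x)
      ...     | inj₂ f with subst (λ b → 0 < ⟦ b ⟧) f lt′
      ...       | ()
      go (suc n) P (s≤s lt) | inj₁ (e , ie , some) | x , ix , lt′ | inj₁ t with ∧-true {P x} t
      ... | Px , bad = P″ , (λ q → proj₁ (∧-true (sub q))) , cl , (begin
          ∑ xs (λ x → ⟦ P x ⟧ * w x) + ∑ es (cost P″) ≡⟨ cong (_+ ∑ es (cost P″)) split ⟩
          C + ∑ xs (λ x → ⟦ P′ x ⟧ * w x) + ∑ es (cost P″) ≡⟨ +-assoc C _ _ ⟩
          C + (∑ xs (λ x → ⟦ P′ x ⟧ * w x) + ∑ es (cost P″)) ≤⟨ +-monoʳ-≤ C ih ⟩
          C + (∑ xs (λ x → ⟦ P″ x ⟧ * w x) + ∑ es (cost P′)) ≡⟨ trans (+-comm C _) (+-assoc (∑ xs (λ x → ⟦ P″ x ⟧ * w x)) _ C) ⟩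
          ∑ xs (λ x → ⟦ P″ x ⟧ * w x) + (∑ es (cost P′) + C) ≤⟨ +-monoʳ-≤ (∑ xs (λ x → ⟦ P″ x ⟧ * w x)) cost-drop ⟩
          ∑ xs (λ x → ⟦ P″ x ⟧ * w x) + ∑ es (cost P) ∎)
        where
        open ≤-Reasoning
        P′ : X → Bool
        P′ y = P y ∧ not (R e x y)
        rec = go n P′ (<-≤-trans (count-remove P (R e x) ix Px (Equivalence.~refl (eq e) x)) lt)
        P″ = proj₁ rec
        sub = proj₁ (proj₂ rec)
        cl : Closed P″
        cl = proj₁ (proj₂ (proj₂ rec))
        ih = proj₂ (proj₂ (proj₂ rec))
        C = ∑ xs (λ y → ⟦ R e x y ⟧ * (⟦ P y ⟧ * w y))
        split : ∑ xs (λ x → ⟦ P x ⟧ * w x) ≡ C + ∑ xs (λ x → ⟦ P′ x ⟧ * w x)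
        split = trans (∑-cong xs λ y → trans (cong (_* w y) (⟦⟧-split′ (P y) (R e x y)))
                  (trans (*-distribʳ-+ (w y) (⟦ R e x y ⟧ * ⟦ P y ⟧) _) (cong (_+ ⟦ P′ y ⟧ * w y) (*-assoc ⟦ R e x y ⟧ ⟦ P y ⟧ (w y))))) (∑-+ xs _ _)
        meets-mono : ∀ e′ y → ⟦ meets P′ e′ y ⟧ ≤ ⟦ meets P e′ y ⟧
        meets-mono e′ y with dichotomy (meets P′ e′ y)
        ... | inj₂ f rewrite f = z≤n
        ... | inj₁ m with meets-elim {P′} {e′} {y} m
        ...   | z , iz , P′z , r rewrite meets-intro {P} {e′} {z} {y} iz (proj₁ (∧-true P′z)) r = ⟦⟧≤1 _
        -- A class of `R e` that is still met after the deletion differs from the class of `x`, so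
        -- the two indicators on the left never overlap.
        meets-drop : ∀ y → ⟦ meets P′ e y ⟧ + ⟦ R e x y ⟧ ≤ ⟦ meets P e y ⟧
        meets-drop y with dichotomy (R e x y)
        ... | inj₂ f rewrite f | +-identityʳ ⟦ meets P′ e y ⟧ = meets-mono e y
        ... | inj₁ r with dichotomy (meets P′ e y)
        ...   | inj₂ f rewrite f | meets-intro {P} {e} {x} {y} ix Px r = ⟦⟧≤1 _
        ...   | inj₁ m with meets-elim {P′} {e} {y} m
        ...     | z , iz , P′z , rz with trans (sym (Equivalence.~trans (eq e) r (Equivalence.~sym (eq e) rz))) (not-true (proj₂ (∧-true {P z} P′z)))
        ...       | ()
        cost-mono : ∀ e′ → cost P′ e′ ≤ cost P e′
        cost-mono e′ = ∑-mono xs λ y → *-monoˡ-≤ (ν y) (meets-mono e′ y)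
        cost-drop : ∑ es (cost P′) + C ≤ ∑ es (cost P)
        cost-drop = gap es ie cost-mono (begin
          cost P′ e + C ≤⟨ +-monoʳ-≤ (cost P′ e) (<⇒≤ (≤ᵇ-false (not-true bad))) ⟩
          cost P′ e + ∑ xs (λ y → ⟦ R e x y ⟧ * ν y) ≡⟨ sym (∑-+ xs _ _) ⟩
          ∑ xs (λ y → ⟦ meets P′ e y ⟧ * ν y + ⟦ R e x y ⟧ * ν y) ≡⟨ ∑-cong xs (λ y → sym (*-distribʳ-+ (ν y) ⟦ meets P′ e y ⟧ ⟦ R e x y ⟧)) ⟩
          ∑ xs (λ y → (⟦ meets P′ e y ⟧ + ⟦ R e x y ⟧) * ν y) ≤⟨ ∑-mono xs (λ y → *-monoˡ-≤ (ν y) (meets-drop y)) ⟩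
          cost P e ∎)

    closure : ∀ (P : X → Bool) → ∃ λ P′ → (∀ {x} → P′ x ≡ true → P x ≡ true) × Closed P′ ×
              ∑ xs (λ x → ⟦ P x ⟧ * w x) ≤ ∑ xs (λ x → ⟦ P′ x ⟧ * w x) + length es * ∑ xs ν
    closure P with go (suc (count P)) P ≤-refl
    ... | P′ , sub , cl , le = P′ , sub , cl , ≤-trans (≤-trans (m≤m+n _ _) le) (+-monoʳ-≤ (∑ xs (λ x → ⟦ P′ x ⟧ * w x))
          (≤-trans (∑-mono es λ e → ∑-mono xs λ y → ⟦⟧*≤ (meets P e y) (ν y)) (≤-reflexive (∑-const es _))))

-- Random walks

x*yz≡y*xz : ∀ x y z → x * (y * z) ≡ y * (x * z)
x*yz≡y*xz x y z = trans (sym (*-assoc x y z)) (trans (cong (_* z) (*-comm x y)) (*-assoc y x z))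

^-distribʳ-* : ∀ k a b → (a * b) ^ k ≡ a ^ k * b ^ k
^-distribʳ-* zero    a b = refl
^-distribʳ-* (suc k) a b = trans (cong (a * b *_) (^-distribʳ-* k a b)) (solve 4 (λ a b x y → a :* b :* (x :* y) := a :* x :* (b :* y)) refl a b (a ^ k) (b ^ k))

tuples : ∀ {Y : Set} → List Y → ∀ n → List (Vec Y n)
tuples ys zero    = [] ∷ []
tuples ys (suc n) = concatMap (λ y → map (y ∷_) (tuples ys n)) ys

∑-tuples : ∀ {Y : Set} (ys : List Y) n f →
           ∑ (tuples ys (suc n)) f ≡ ∑ ys (λ y → ∑ (tuples ys n) (λ v → f (y ∷ v)))
∑-tuples ys n f = trans (∑-concatMap _ ys f) (∑-cong ys λ y → ∑-map (y ∷_) (tuples ys n) f)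

∈-tuples : ∀ {Y : Set} {ys : List Y} {n} (v : Vec Y n) → (∀ i → lookup v i ∈ ys) → v ∈ tuples ys n
∈-tuples []      h = here refl
∈-tuples {ys = ys} {suc n} (y ∷ v) h = ∈-concatMap⁺ (λ y → map (y ∷_) (tuples ys n)) (Any.map (λ { refl → ∈-map⁺ (y ∷_) (∈-tuples v (λ i → h (suc i))) }) (h zero))

-- The field `∑-δ` says, in the form used in sums, that `vs` lists every vertex exactly once. At a
-- vertex that is not isolated, `ω v / W` is the probability of each step out of `v`.
record WeightedGraph : Set₁ where
  field
    V       : Set
    vs      : List V
    _≟_     : DecidableEquality V
    ∈vs     : ∀ v → v ∈ vs
  _==_ : V → V → Bool
  u == v = does (u ≟ v)
  field
    ∑-δ     : ∀ u (g : V → ℕ) → ∑ vs (λ v → ⟦ v == u ⟧ * g v) ≡ g u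
    adj     : V → V → Bool
    adj-sym : ∀ u v → adj u v ≡ adj v u
  d : V → ℕ
  d v = ∑ vs (λ u → ⟦ adj v u ⟧)
  field
    W       : ℕ
    W-pos   : 0 < W
    ω       : V → ℕ
    d*ω     : ∀ v → 0 < d v → d v * ω v ≡ W

module Kernel (Γ : WeightedGraph) where
  open WeightedGraph Γ

  ==-true : ∀ {u v} → (u == v) ≡ true → u ≡ v
  ==-true {u} {v} e with u ≟ v
  ... | yes q = q

  ==-refl : ∀ u → (u == u) ≡ true
  ==-refl u with u ≟ u
  ... | yes _ = refl
  ... | no n = ⊥-elim (n refl)

  ==-sym : ∀ u v → (u == v) ≡ (v == u)
  ==-sym u v with u ≟ v | v ≟ u
  ... | yes _ | yes _ = refl
  ... | no _  | no _  = refl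
  ... | yes p | no q  = ⊥-elim (q (sym p))
  ... | no p  | yes q = ⊥-elim (p (sym q))

  ∑-δ′ : ∀ u (g : V → ℕ) → ∑ vs (λ v → ⟦ u == v ⟧ * g v) ≡ g u
  ∑-δ′ u g = trans (∑-cong vs λ v → cong (λ b → ⟦ b ⟧ * g v) (==-sym u v)) (∑-δ u g)

  adj⇒d>0 : ∀ {u v} → adj u v ≡ true → 0 < d u
  adj⇒d>0 {u} {v} e = <-≤-trans (subst (λ b → 0 < ⟦ b ⟧) (sym e) z<s) (∑-∈ (λ v → ⟦ adj u v ⟧) (∈vs v))

  p1 : V → V → ℕ
  p1 u v = ω u * ⟦ adj u v ⟧

  -- Detailed balance: the right-hand side is symmetric in `u` and `v`. Stationarity of `d` and
  -- every reversal of a walk below rest on it.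
  d*p1 : ∀ u v → d u * p1 u v ≡ W * ⟦ adj u v ⟧
  d*p1 u v with adj u v in e
  ... | false = trans (cong (d u *_) (*-zeroʳ (ω u))) (trans (*-zeroʳ (d u)) (sym (*-zeroʳ W)))
  ... | true  = trans (sym (*-assoc (d u) (ω u) 1)) (cong (_* 1) (d*ω u (adj⇒d>0 e)))

  p1-pos : ∀ {u v} → 0 < p1 u v → adj u v ≡ true
  p1-pos {u} {v} lt with adj u v
  ... | true  = refl
  ... | false = ⊥-elim (<-irrefl (sym (*-zeroʳ (ω u))) lt)

  p1-row : ∀ u → 0 < d u → ∑ vs (p1 u) ≡ W
  p1-row u q = trans (∑-*ˡ vs (ω u) _) (trans (*-comm (ω u) (d u)) (d*ω u q))

  p1-row≤ : ∀ u → ∑ vs (p1 u) ≤ W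
  p1-row≤ u with d u in e
  ... | zero  = ≤-trans (≤-reflexive (trans (∑-*ˡ vs (ω u) _) (trans (cong (ω u *_) e) (*-zeroʳ (ω u))))) z≤n
  ... | suc _ = ≤-reflexive (p1-row u (subst (0 <_) (sym e) z<s))

  p1-stat : ∀ v → ∑ vs (λ u → d u * p1 u v) ≡ W * d v
  p1-stat v = trans (∑-cong vs λ u → trans (d*p1 u v) (cong (λ b → W * ⟦ b ⟧) (adj-sym u v))) (∑-*ˡ vs W _)

  p : ℕ → V → V → ℕ
  p zero    u v = ⟦ u == v ⟧
  p (suc ℓ) u v = ∑ vs (λ w → p1 u w * p ℓ w v)

  p-one : ∀ u v → p 1 u v ≡ p1 u v
  p-one u v = trans (∑-cong vs λ w → *-comm (p1 u w) _) (∑-δ v (p1 u))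

  p-comp : ∀ a b u v → p (a + b) u v ≡ ∑ vs (λ w → p a u w * p b w v)
  p-comp zero    b u v = sym (∑-δ′ u (λ w → p b w v))
  p-comp (suc a) b u v = begin
    ∑ vs (λ x → p1 u x * p (a + b) x v) ≡⟨ ∑-cong vs (λ x → cong (p1 u x *_) (p-comp a b x v)) ⟩
    ∑ vs (λ x → p1 u x * ∑ vs (λ w → p a x w * p b w v)) ≡⟨ ∑-cong vs (λ x → sym (∑-*ˡ vs (p1 u x) _)) ⟩
    ∑ vs (λ x → ∑ vs (λ w → p1 u x * (p a x w * p b w v))) ≡⟨ ∑-swap vs vs _ ⟩
    ∑ vs (λ w → ∑ vs (λ x → p1 u x * (p a x w * p b w v))) ≡⟨ ∑-cong vs (λ w → trans (∑-cong vs (λ x → sym (*-assoc (p1 u x) _ _))) (∑-*ʳ vs (p b w v) _)) ⟩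
    ∑ vs (λ w → p (suc a) u w * p b w v) ∎
    where open ≡-Reasoning

  p-snoc : ∀ a u v → p (suc a) u v ≡ ∑ vs (λ w → p a u w * p1 w v)
  p-snoc a u v = trans (cong (λ ℓ → p ℓ u v) (+-comm 1 a))
    (trans (p-comp a 1 u v) (∑-cong vs λ w → cong (p a u w *_) (p-one w v)))

  p-row≤ : ∀ ℓ u → ∑ vs (p ℓ u) ≤ W ^ ℓ
  p-row≤ zero u = ≤-reflexive (trans (∑-cong vs λ v → sym (*-identityʳ ⟦ u == v ⟧)) (∑-δ′ u (λ _ → 1)))
  p-row≤ (suc ℓ) u = begin
    ∑ vs (λ v → ∑ vs (λ w → p1 u w * p ℓ w v)) ≡⟨ ∑-swap vs vs _ ⟩
    ∑ vs (λ w → ∑ vs (λ v → p1 u w * p ℓ w v)) ≡⟨ ∑-cong vs (λ w → ∑-*ˡ vs (p1 u w) (p ℓ w)) ⟩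
    ∑ vs (λ w → p1 u w * ∑ vs (p ℓ w)) ≤⟨ ∑-mono vs (λ w → *-monoʳ-≤ (p1 u w) (p-row≤ ℓ w)) ⟩
    ∑ vs (λ w → p1 u w * W ^ ℓ) ≡⟨ ∑-*ʳ vs (W ^ ℓ) (p1 u) ⟩
    ∑ vs (p1 u) * W ^ ℓ ≤⟨ *-monoˡ-≤ (W ^ ℓ) (p1-row≤ u) ⟩
    W * W ^ ℓ ∎
    where open ≤-Reasoning

  p-stat : ∀ ℓ v → ∑ vs (λ u → d u * p ℓ u v) ≡ W ^ ℓ * d v
  p-stat zero v = trans (∑-cong vs λ u → *-comm (d u) _) (trans (∑-δ v d) (sym (+-identityʳ (d v))))
  p-stat (suc ℓ) v = begin
    ∑ vs (λ u → d u * ∑ vs (λ w → p1 u w * p ℓ w v)) ≡⟨ ∑-cong vs (λ u → trans (sym (∑-*ˡ vs (d u) _)) (∑-cong vs λ w → sym (*-assoc (d u) _ _))) ⟩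
    ∑ vs (λ u → ∑ vs (λ w → d u * p1 u w * p ℓ w v)) ≡⟨ ∑-swap vs vs _ ⟩
    ∑ vs (λ w → ∑ vs (λ u → d u * p1 u w * p ℓ w v)) ≡⟨ ∑-cong vs (λ w → trans (∑-*ʳ vs (p ℓ w v) _) (trans (cong (_* p ℓ w v) (p1-stat w)) (*-assoc W _ _))) ⟩
    ∑ vs (λ w → W * (d w * p ℓ w v)) ≡⟨ ∑-*ˡ vs W _ ⟩
    W * ∑ vs (λ w → d w * p ℓ w v) ≡⟨ cong (W *_) (p-stat ℓ v) ⟩
    W * (W ^ ℓ * d v) ≡⟨ sym (*-assoc W _ _) ⟩
    W ^ suc ℓ * d v ∎
    where open ≡-Reasoning

  walks : ∀ n → List (Vec V n)
  walks = tuples vs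

  wt : ∀ {n} → V → Vec V n → ℕ
  wt u []      = 1
  wt u (v ∷ x) = p1 u v * wt v x

  Z : ℕ → V → ℕ
  Z n u = ∑ (walks n) (wt u)

  Z-suc : ∀ n u → Z (suc n) u ≡ ∑ vs (λ v → p1 u v * Z n v)
  Z-suc n u = trans (∑-tuples vs n (wt u)) (∑-cong vs λ v → ∑-*ˡ (walks n) (p1 u v) (wt v))

  mutual
    -- No mass is lost along a walk, since a vertex reached by a step has a neighbour, namely the
    -- one it was reached from.
    Z-alive : ∀ n u → 0 < d u → Z n u ≡ W ^ n
    Z-alive zero    u q = refl
    Z-alive (suc n) u q = trans (Z-suc n u) (trans (∑-cong vs (p1*Z n u)) (trans (∑-*ʳ vs (W ^ n) (p1 u)) (cong (_* W ^ n) (p1-row u q))))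

    p1*Z : ∀ n u v → p1 u v * Z n v ≡ p1 u v * W ^ n
    p1*Z n u v with adj u v in e
    ... | true  = cong (ω u * 1 *_) (Z-alive n v (adj⇒d>0 (trans (adj-sym v u) e)))
    ... | false = trans (cong (_* Z n v) (*-zeroʳ (ω u))) (sym (cong (_* W ^ n) (*-zeroʳ (ω u))))

  Z≤ : ∀ n u → Z n u ≤ W ^ n
  Z≤ zero u = ≤-refl
  Z≤ (suc n) u = begin
    Z (suc n) u ≡⟨ trans (Z-suc n u) (trans (∑-cong vs (p1*Z n u)) (∑-*ʳ vs (W ^ n) (p1 u))) ⟩
    ∑ vs (p1 u) * W ^ n ≤⟨ *-monoˡ-≤ (W ^ n) (p1-row≤ u) ⟩
    W ^ suc n ∎
    where open ≤-Reasoning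

  agreeIf : Bool → V → V → Bool
  agreeIf true  u v = u == v
  agreeIf false u v = true

  agreeLeg : ∀ {n} → (Fin n → Bool) → Vec V n → Vec V n → Bool
  agreeLeg m []      []      = true
  agreeLeg m (u ∷ x) (v ∷ y) = agreeIf (m zero) u v ∧ agreeLeg (λ j → m (suc j)) x y

  agreeLeg-sound : ∀ {n} {m : Fin n → Bool} {x y} → agreeLeg m x y ≡ true → ∀ j → m j ≡ true → lookup x j ≡ lookup y j
  agreeLeg-sound {m = m} {u ∷ x} {v ∷ y} e zero mj with m zero
  agreeLeg-sound {m = m} {u ∷ x} {v ∷ y} e zero refl | true = ==-true (proj₁ (∧-true e))
  agreeLeg-sound {m = m} {u ∷ x} {v ∷ y} e (suc j) mj = agreeLeg-sound {m = λ j → m (suc j)} {x} {y} (proj₂ (∧-true {agreeIf (m zero) u v} e)) j mj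

  agreeLeg-complete : ∀ {n} {m : Fin n → Bool} {x y} → (∀ j → m j ≡ true → lookup x j ≡ lookup y j) → agreeLeg m x y ≡ true
  agreeLeg-complete {x = []} {[]} h = refl
  agreeLeg-complete {m = m} {u ∷ x} {v ∷ y} h = true-∧ first (agreeLeg-complete {m = λ j → m (suc j)} {x} {y} (λ j → h (suc j)))
    where
    first : agreeIf (m zero) u v ≡ true
    first with m zero in e
    ... | false = refl
    ... | true rewrite h zero e = ==-refl v

  -- The mass of the walks x that follow a walk of length g from a and agree with y on the mask m
  -- factors over the segments cut out by m.
  segments : ∀ {n} → ℕ → V → (Fin n → Bool) → Vec V n → ℕ
  segments g a m []      = ∑ vs (p g a)
  segments g a m (r ∷ y) = if m zero then p (suc g) a r * segments 0 r (λ j → m (suc j)) y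
                                     else segments (suc g) a (λ j → m (suc j)) y

  legMass : ∀ {n} → V → (Fin n → Bool) → Vec V n → ℕ
  legMass {n} u m y = ∑ (walks n) (λ x → ⟦ agreeLeg m x y ⟧ * wt u x)

  legMass-cons : ∀ {n} u (m : Fin (suc n) → Bool) r (y : Vec V n) →
    legMass u m (r ∷ y) ≡ ∑ vs (λ v → ⟦ agreeIf (m zero) v r ⟧ * (p1 u v * legMass v (λ j → m (suc j)) y))
  legMass-cons {n} u m r y = trans (∑-tuples vs n _) (∑-cong vs λ v →
    trans (∑-cong (walks n) λ x → trans (cong (_* (p1 u v * wt v x)) (⟦∧⟧ (agreeIf (m zero) v r) _))
            (solve 4 (λ a b c d → a :* b :* (c :* d) := a :* c :* (b :* d)) refl ⟦ agreeIf (m zero) v r ⟧ _ (p1 u v) (wt v x)))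
      (trans (∑-*ˡ (walks n) (⟦ agreeIf (m zero) v r ⟧ * p1 u v) _) (*-assoc ⟦ agreeIf (m zero) v r ⟧ _ _)))

  -- The induction carries a pending free stretch of length `g` that starts at `a`: a vertex outside
  -- the mask lengthens the stretch, a vertex of the mask closes it, both by `p-snoc`.
  segments-mass : ∀ {n} g a (m : Fin n → Bool) y → ∑ vs (λ u → p g a u * legMass u m y) ≡ segments g a m y
  segments-mass g a m [] = ∑-cong vs λ u → *-identityʳ _
  segments-mass {suc n} g a m (r ∷ y) with m zero in e
  ... | true = begin
    ∑ vs (λ u → p g a u * legMass u m (r ∷ y)) ≡⟨ ∑-cong vs (λ u → cong (p g a u *_) (trans (legMass-cons u m r y) (pin u))) ⟩
    ∑ vs (λ u → p g a u * (p1 u r * legMass r m′ y)) ≡⟨ trans (∑-cong vs λ u → sym (*-assoc (p g a u) _ _)) (∑-*ʳ vs (legMass r m′ y) _) ⟩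
    ∑ vs (λ u → p g a u * p1 u r) * legMass r m′ y ≡⟨ cong₂ _*_ (sym (p-snoc g a r)) (sym (∑-δ′ r (λ u → legMass u m′ y))) ⟩
    p (suc g) a r * ∑ vs (λ u → p 0 r u * legMass u m′ y) ≡⟨ cong (p (suc g) a r *_) (segments-mass 0 r m′ y) ⟩
    p (suc g) a r * segments 0 r m′ y ∎
    where
    open ≡-Reasoning
    m′ : Fin n → Bool
    m′ j = m (suc j)
    pin : ∀ u → ∑ vs (λ v → ⟦ agreeIf (m zero) v r ⟧ * (p1 u v * legMass v m′ y)) ≡ p1 u r * legMass r m′ y
    pin u rewrite e = ∑-δ r (λ v → p1 u v * legMass v m′ y)
  ... | false = begin
    ∑ vs (λ u → p g a u * legMass u m (r ∷ y)) ≡⟨ ∑-cong vs (λ u → cong (p g a u *_) (trans (legMass-cons u m r y) (free u))) ⟩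
    ∑ vs (λ u → p g a u * ∑ vs (λ v → p1 u v * legMass v m′ y)) ≡⟨ ∑-cong vs (λ u → trans (sym (∑-*ˡ vs (p g a u) _)) (∑-cong vs λ v → sym (*-assoc (p g a u) _ _))) ⟩
    ∑ vs (λ u → ∑ vs (λ v → p g a u * p1 u v * legMass v m′ y)) ≡⟨ ∑-swap vs vs _ ⟩
    ∑ vs (λ v → ∑ vs (λ u → p g a u * p1 u v * legMass v m′ y)) ≡⟨ ∑-cong vs (λ v → trans (∑-*ʳ vs (legMass v m′ y) _) (cong (_* legMass v m′ y) (sym (p-snoc g a v)))) ⟩
    ∑ vs (λ v → p (suc g) a v * legMass v m′ y) ≡⟨ segments-mass (suc g) a m′ y ⟩
    segments (suc g) a m′ y ∎
    where
    open ≡-Reasoning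
    m′ : Fin n → Bool
    m′ j = m (suc j)
    free : ∀ u → ∑ vs (λ v → ⟦ agreeIf (m zero) v r ⟧ * (p1 u v * legMass v m′ y)) ≡ ∑ vs (λ v → p1 u v * legMass v m′ y)
    free u rewrite e = ∑-cong vs λ v → +-identityʳ _

  legMass≡segments : ∀ {n} u (m : Fin n → Bool) y → legMass u m y ≡ segments 0 u m y
  legMass≡segments u m y = trans (sym (∑-δ′ u (λ v → legMass v m y))) (segments-mass 0 u m y)

  walk-stat : ∀ n (g : Vec V (suc n) → ℕ) →
    ∑ vs (λ y → d y * ∑ (walks (suc n)) (λ x → wt y x * g x)) ≡ W * ∑ vs (λ v → d v * ∑ (walks n) (λ x → wt v x * g (v ∷ x)))
  walk-stat n g = begin
    ∑ vs (λ y → d y * ∑ (walks (suc n)) (λ x → wt y x * g x)) ≡⟨ ∑-cong vs (λ y → cong (d y *_) (trans (∑-tuples vs n _) (∑-cong vs λ v → trans (∑-cong (walks n) λ x → *-assoc (p1 y v) _ _) (∑-*ˡ (walks n) (p1 y v) _)))) ⟩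
    ∑ vs (λ y → d y * ∑ vs (λ v → p1 y v * M v)) ≡⟨ ∑-cong vs (λ y → trans (sym (∑-*ˡ vs (d y) _)) (∑-cong vs λ v → sym (*-assoc (d y) _ _))) ⟩
    ∑ vs (λ y → ∑ vs (λ v → d y * p1 y v * M v)) ≡⟨ ∑-swap vs vs _ ⟩
    ∑ vs (λ v → ∑ vs (λ y → d y * p1 y v * M v)) ≡⟨ ∑-cong vs (λ v → trans (∑-*ʳ vs (M v) _) (trans (cong (_* M v) (p1-stat v)) (*-assoc W _ _))) ⟩
    ∑ vs (λ v → W * (d v * M v)) ≡⟨ ∑-*ˡ vs W _ ⟩
    W * ∑ vs (λ v → d v * M v) ∎
    where
    open ≡-Reasoning
    M : V → ℕ
    M v = ∑ (walks n) (λ x → wt v x * g (v ∷ x))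

-- Heavy and rich pairs

splits : ℕ → List (ℕ × ℕ)
splits zero    = (0 , 0) ∷ []
splits (suc j) = (0 , suc j) ∷ map (λ ab → suc (proj₁ ab) , proj₂ ab) (splits j)

length-splits : ∀ j → length (splits j) ≡ suc j
length-splits zero    = refl
length-splits (suc j) = cong suc (trans (length-map _ (splits j)) (length-splits j))

∈-splits⁻ : ∀ j {ab} → ab ∈ splits j → proj₁ ab + proj₂ ab ≡ j
∈-splits⁻ zero    (here refl) = refl
∈-splits⁻ (suc j) (here refl) = refl
∈-splits⁻ (suc j) (there i) with ∈-map⁻ _ i
... | ab , i′ , refl = cong suc (∈-splits⁻ j i′)

∈-splits⁺ : ∀ a b → (a , b) ∈ splits (a + b)
∈-splits⁺ zero    zero    = here refl
∈-splits⁺ zero    (suc b) = here refl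
∈-splits⁺ (suc a) b = there (∈-map⁺ (λ ab → suc (proj₁ ab) , proj₂ ab) (∈-splits⁺ a b))

∑-uniform : ∀ {X : Set} (xs : List X) (f : X → ℕ) B → (∀ {x} → x ∈ xs → length xs * f x ≤ B) → ∑ xs f ≤ B
∑-uniform []         f B h = z≤n
∑-uniform xs@(_ ∷ _) f B h = *-cancelˡ-≤ (length xs) (begin
  length xs * ∑ xs f ≡⟨ sym (∑-*ˡ xs (length xs) f) ⟩
  ∑ xs (λ x → length xs * f x) ≤⟨ ∑-mono-∈ xs h ⟩
  ∑ xs (λ _ → B) ≡⟨ ∑-const xs B ⟩
  length xs * B ∎)
  where open ≤-Reasoning

record Bipartition (Γ : WeightedGraph) : Set where
  open WeightedGraph Γ
  field
    side     : V → Bool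
    adj-side : ∀ {u v} → adj u v ≡ true → side v ≡ not (side u)
    h        : Bool → ℕ
    ω≤h      : ∀ v → ω v ≤ h (side v)

module Paths (Γ : WeightedGraph) (Β : Bipartition Γ) where
  open WeightedGraph Γ
  open Kernel Γ
  open Bipartition Β

  flip : ℕ → Bool → Bool
  flip zero    b = b
  flip (suc n) b = flip n (not b)

  p-side : ∀ ℓ {u v} → 0 < p ℓ u v → side v ≡ flip ℓ (side u)
  p-side zero {u} {v} lt with u == v in e
  ... | true  = cong side (sym (==-true e))
  ... | false with lt
  ...   | ()
  p-side (suc ℓ) {u} {v} lt with ∑-pos vs _ lt
  ... | w , _ , q with adj u w in e
  ...   | true  = trans (p-side ℓ {w} {v} (proj₂ (pos-* (ω u * 1) q))) (cong (flip ℓ) (adj-side e))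
  ...   | false = ⊥-elim (<-irrefl (sym (cong (_* p ℓ w v) (*-zeroʳ (ω u)))) q)

  -- Bounds the product of ω over n consecutive vertices of a walk, the first of which lies on side b.
  walkBound : ℕ → Bool → ℕ
  walkBound zero    b = 1
  walkBound (suc n) b = h b * walkBound n (not b)

  walkBound-+ : ∀ a b s → walkBound (a + b) s ≡ walkBound a s * walkBound b (flip a s)
  walkBound-+ zero    b s = sym (+-identityʳ _)
  walkBound-+ (suc a) b s = trans (cong (h s *_) (walkBound-+ a b (not s))) (sym (*-assoc (h s) _ _))

  -- Walks are indexed by one less than their length, so that every index is meaningful.
  light : ℕ → V → ℕ
  light i u = ω u * walkBound i (not (side u))

  -- A single walk of length `suc i` from `u` weighs at most `light i u`, so a heavy pair is joined
  -- by more than `C ^ i` walks. With the exponent one below the length, the bounds for two light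
  -- pieces multiply to one factor `C` less than the threshold of the whole; this leaves room for
  -- the richness constant.
  heavy : ℕ → ℕ → V → V → Bool
  heavy C i u v = suc (C ^ i * light i u) ≤ᵇ p (suc i) u v

  heavy-false : ∀ {C i u v} → heavy C i u v ≡ false → p (suc i) u v ≤ C ^ i * light i u
  heavy-false e = s≤s⁻¹ (≤ᵇ-false e)

  obstruct : ℕ → ℕ → V → V → ℕ × ℕ → V → Bool
  obstruct c i u v (a , b) f = suc (p (suc i) u v) ≤ᵇ c * (p (suc a) u f * p (suc b) f v)

  -- The index `j` belongs to walks of length `suc (suc j)`, whose interior positions correspond to
  -- the splits of `j`. An obstruction is a vertex that carries more than the proportion `1 / c` of
  -- the walks at one position.
  rich : ℕ → ℕ → V → V → Bool
  rich c j u v = ∑ (splits j) (λ ab → ∑ vs (λ f → ⟦ obstruct c (suc j) u v ab f ⟧)) ≤ᵇ 0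

  rich-true : ∀ {c j u v} → rich c j u v ≡ true → ∀ {a b} → a + b ≡ j → ∀ f →
              c * (p (suc a) u f * p (suc b) f v) ≤ p (suc (suc j)) u v
  rich-true {c} {j} {u} {v} e {a} {b} refl f with dichotomy (obstruct c (suc j) u v (a , b) f)
  ... | inj₂ q = s≤s⁻¹ (≤ᵇ-false q)
  ... | inj₁ q = ⊥-elim (<-irrefl refl (≤-trans (begin
      1 ≡⟨ sym (⟦⟧-true q) ⟩
      ⟦ obstruct c (suc j) u v (a , b) f ⟧ ≤⟨ ∑-∈ (λ f → ⟦ obstruct c (suc j) u v (a , b) f ⟧) (∈vs f) ⟩
      ∑ vs (λ f → ⟦ obstruct c (suc j) u v (a , b) f ⟧) ≤⟨ ∑-∈ (λ ab → ∑ vs (λ f → ⟦ obstruct c (suc j) u v ab f ⟧)) (∈-splits⁺ a b) ⟩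
      ∑ (splits j) (λ ab → ∑ vs (λ f → ⟦ obstruct c (suc j) u v ab f ⟧)) ∎) (≤ᵇ-true e)))
    where open ≤-Reasoning

  rich-false : ∀ {c j u v} → rich c j u v ≡ false → ∃ λ ab → ab ∈ splits j × ∃ λ f →
               p (suc (suc j)) u v < c * (p (suc (proj₁ ab)) u f * p (suc (proj₂ ab)) f v)
  rich-false {c} {j} {u} {v} e with ∑-pos (splits j) _ (≤ᵇ-false e)
  ... | ab , i , q with ∑-pos vs _ q
  ...   | f , _ , q′ with dichotomy (obstruct c (suc j) u v ab f)
  ...     | inj₁ t = ab , i , f , ≤ᵇ-true t
  ...     | inj₂ n with subst (λ b → 0 < ⟦ b ⟧) n q′
  ...       | ()

  mass : (V → V → Bool) → ℕ → ℕ
  mass P i = ∑ vs (λ u → ∑ vs (λ v → d u * (⟦ P u v ⟧ * p (suc i) u v)))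

  total : ℕ → ℕ
  total i = W ^ suc i * ∑ vs d

  module _ (C : ℕ) where
    private
      H = heavy C

    light-mul : ∀ a b {u f} → side f ≡ flip a (not (side u)) → C ^ a * light a u * (C ^ b * light b f) ≤ C ^ (a + b) * light (suc (a + b)) u
    light-mul a b {u} {f} sf = begin
      C ^ a * light a u * (C ^ b * light b f) ≤⟨ *-monoʳ-≤ (C ^ a * light a u) (*-monoʳ-≤ (C ^ b) (*-monoˡ-≤ (walkBound b (not (side f))) (ω≤h f))) ⟩
      C ^ a * light a u * (C ^ b * walkBound (suc b) (side f)) ≡⟨ solve 5 (λ x y z q r → x :* (y :* z) :* (q :* r) := x :* q :* (y :* (z :* r))) refl (C ^ a) (ω u) (walkBound a (not (side u))) (C ^ b) (walkBound (suc b) (side f)) ⟩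
      C ^ a * C ^ b * (ω u * (walkBound a (not (side u)) * walkBound (suc b) (side f))) ≡⟨ cong₂ (λ x y → x * (ω u * y)) (sym (^-distribˡ-+-* C a b)) (trans (cong (λ s → walkBound a (not (side u)) * walkBound (suc b) s) sf) (sym (walkBound-+ a (suc b) (not (side u))))) ⟩
      C ^ (a + b) * (ω u * walkBound (a + suc b) (not (side u))) ≡⟨ cong (λ n → C ^ (a + b) * (ω u * walkBound n (not (side u)))) (+-suc a b) ⟩
      C ^ (a + b) * light (suc (a + b)) u ∎
      where open ≤-Reasoning

    light-split : ∀ a b {u f v} → 0 < p (suc a) u f → H a u f ≡ false → H b f v ≡ false →
      p (suc a) u f * p (suc b) f v ≤ C ^ (a + b) * light (suc (a + b)) u
    light-split a b {u} {f} {v} pos Ha Hb = ≤-trans (*-mono-≤ (heavy-false {C} {a} Ha) (heavy-false {C} {b} Hb)) (light-mul a b (p-side (suc a) pos))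

    -- A single edge weighs `ω u`, which is exactly the threshold at index 0. This is the base of
    -- the induction on the length.
    heavy-zero : ∀ u v → H 0 u v ≡ false
    heavy-zero u v with dichotomy (H 0 u v)
    ... | inj₂ q = q
    ... | inj₁ q = ⊥-elim (<-irrefl refl (begin-strict
      p 1 u v ≡⟨ p-one u v ⟩
      ω u * ⟦ adj u v ⟧ ≤⟨ *-monoʳ-≤ (ω u) (⟦⟧≤1 (adj u v)) ⟩
      ω u * 1 ≡⟨ sym (+-identityʳ (ω u * 1)) ⟩
      1 * light 0 u <⟨ ≤ᵇ-true q ⟩
      p 1 u v ∎))
      where open ≤-Reasoning

    -- If the pair is not rich, some vertex `f` obstructs it. Were both pieces at `f` light,
    -- `light-mul` and `c ≤ C` would make the whole pair light; so a heavy pair without richness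
    -- yields a shorter heavy pair, up to the factor `c`.
    heavy-pointwise : ∀ c j → c ≤ C → ∀ u v →
      ⟦ H (suc j) u v ⟧ * p (suc (suc j)) u v ≤
      ⟦ rich c j u v ⟧ * p (suc (suc j)) u v +
      ∑ (splits j) (λ ab → ∑ vs (λ f → c * (p (suc (proj₁ ab)) u f * p (suc (proj₂ ab)) f v * (⟦ H (proj₁ ab) u f ⟧ + ⟦ H (proj₂ ab) f v ⟧))))
    heavy-pointwise c j c≤C u v with dichotomy (H (suc j) u v)
    ... | inj₂ n rewrite n = z≤n
    ... | inj₁ q with dichotomy (rich c j u v)
    ...   | inj₁ r rewrite r = ≤-trans (⟦⟧*≤ (H (suc j) u v) _) (≤-trans (≤-reflexive (sym (+-identityʳ _))) (m≤m+n _ _))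
    ...   | inj₂ r with rich-false {c} {j} r
    ...     | (a , b) , i , f , lt with ∈-splits⁻ j i
    ...       | refl = begin
      ⟦ H (suc (a + b)) u v ⟧ * p (suc (suc (a + b))) u v ≤⟨ ⟦⟧*≤ (H (suc (a + b)) u v) _ ⟩
      p (suc (suc (a + b))) u v ≤⟨ <⇒≤ lt ⟩
      c * (p (suc a) u f * p (suc b) f v) ≡⟨ cong (c *_) (sym (*-identityʳ _)) ⟩
      c * (p (suc a) u f * p (suc b) f v * 1) ≤⟨ *-monoʳ-≤ c (*-monoʳ-≤ (p (suc a) u f * p (suc b) f v) one) ⟩
      c * (p (suc a) u f * p (suc b) f v * (⟦ H a u f ⟧ + ⟦ H b f v ⟧)) ≤⟨ ∑-∈ (λ f → c * (p (suc a) u f * p (suc b) f v * (⟦ H a u f ⟧ + ⟦ H b f v ⟧))) (∈vs f) ⟩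
      _ ≤⟨ ∑-∈ (λ ab → ∑ vs (λ f → c * (p (suc (proj₁ ab)) u f * p (suc (proj₂ ab)) f v * (⟦ H (proj₁ ab) u f ⟧ + ⟦ H (proj₂ ab) f v ⟧)))) i ⟩
      _ ≤⟨ m≤n+m _ _ ⟩
      _ ∎
      where
      open ≤-Reasoning
      pos : 0 < p (suc a) u f
      pos with p (suc a) u f
      ... | suc _ = z<s
      ... | zero with subst (p (suc (suc (a + b))) u v <_) (*-zeroʳ c) lt
      ...   | ()
      one : 1 ≤ ⟦ H a u f ⟧ + ⟦ H b f v ⟧
      one with dichotomy (H a u f) | dichotomy (H b f v)
      ... | inj₁ x | _      rewrite x = s≤s z≤n
      ... | inj₂ x | inj₁ y rewrite x | y = s≤s z≤n
      ... | inj₂ x | inj₂ y = ⊥-elim (<-irrefl refl (begin-strict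
        p (suc (suc (a + b))) u v <⟨ lt ⟩
        c * (p (suc a) u f * p (suc b) f v) ≤⟨ *-mono-≤ c≤C (light-split a b pos x y) ⟩
        C * (C ^ (a + b) * light (suc (a + b)) u) ≡⟨ sym (*-assoc C _ _) ⟩
        C ^ suc (a + b) * light (suc (a + b)) u <⟨ ≤ᵇ-true q ⟩
        p (suc (suc (a + b))) u v ∎))

    private
      -- The heavy piece is kept and the other one summed out: over the end vertex by the row bound,
      -- over the start vertex by stationarity of `d`.
      fubini : ∀ c a b →
        ∑ vs (λ u → ∑ vs (λ v → d u * ∑ vs (λ f → c * (p (suc a) u f * p (suc b) f v * (⟦ H a u f ⟧ + ⟦ H b f v ⟧)))))
        ≤ c * (mass (H a) a * W ^ suc b + W ^ suc a * mass (H b) b)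
      fubini c a b = begin
        ∑ vs (λ u → ∑ vs (λ v → d u * ∑ vs (λ f → c * (A u f * B f v * (⟦ H a u f ⟧ + ⟦ H b f v ⟧)))))
          ≡⟨ ∑-cong vs (λ u → ∑-cong vs λ v → trans (sym (∑-*ˡ vs (d u) _)) (trans (∑-cong vs λ f → rearr (d u) c (A u f) (B f v) ⟦ H a u f ⟧ ⟦ H b f v ⟧) (trans (∑-*ˡ vs c _) (cong (c *_) (∑-+ vs _ _))))) ⟩
        ∑ vs (λ u → ∑ vs (λ v → c * (∑ vs (λ f → S u f * B f v) + ∑ vs (λ f → d u * A u f * (⟦ H b f v ⟧ * B f v)))))
          ≡⟨ trans (∑-cong vs λ u → ∑-*ˡ vs c _) (∑-*ˡ vs c _) ⟩
        c * ∑ vs (λ u → ∑ vs (λ v → ∑ vs (λ f → S u f * B f v) + ∑ vs (λ f → d u * A u f * (⟦ H b f v ⟧ * B f v))))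
          ≡⟨ cong (c *_) (trans (∑-cong vs λ u → ∑-+ vs _ _) (∑-+ vs _ _)) ⟩
        c * (∑ vs (λ u → ∑ vs (λ v → ∑ vs (λ f → S u f * B f v))) + ∑ vs (λ u → ∑ vs (λ v → ∑ vs (λ f → d u * A u f * (⟦ H b f v ⟧ * B f v)))))
          ≤⟨ *-monoʳ-≤ c (+-mono-≤ first second) ⟩
        c * (mass (H a) a * W ^ suc b + W ^ suc a * mass (H b) b) ∎
        where
        open ≤-Reasoning
        A = p (suc a)
        B = p (suc b)
        S : V → V → ℕ
        S u f = d u * (⟦ H a u f ⟧ * A u f)
        rearr : ∀ x c A B g h → x * (c * (A * B * (g + h))) ≡ c * (x * (g * A) * B + x * A * (h * B))
        rearr = solve 6 (λ x c A B g h → x :* (c :* (A :* B :* (g :+ h))) := c :* (x :* (g :* A) :* B :+ x :* A :* (h :* B))) refl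
        first : ∑ vs (λ u → ∑ vs (λ v → ∑ vs (λ f → S u f * B f v))) ≤ mass (H a) a * W ^ suc b
        first = begin
          ∑ vs (λ u → ∑ vs (λ v → ∑ vs (λ f → S u f * B f v))) ≡⟨ ∑-cong vs (λ u → trans (∑-swap vs vs _) (∑-cong vs λ f → ∑-*ˡ vs (S u f) (B f))) ⟩
          ∑ vs (λ u → ∑ vs (λ f → S u f * ∑ vs (B f))) ≤⟨ ∑-mono vs (λ u → ∑-mono vs λ f → *-monoʳ-≤ (S u f) (p-row≤ (suc b) f)) ⟩
          ∑ vs (λ u → ∑ vs (λ f → S u f * W ^ suc b)) ≡⟨ trans (∑-cong vs λ u → ∑-*ʳ vs (W ^ suc b) _) (∑-*ʳ vs (W ^ suc b) _) ⟩
          mass (H a) a * W ^ suc b ∎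
        second : ∑ vs (λ u → ∑ vs (λ v → ∑ vs (λ f → d u * A u f * (⟦ H b f v ⟧ * B f v)))) ≤ W ^ suc a * mass (H b) b
        second = ≤-reflexive (begin-equality
          ∑ vs (λ u → ∑ vs (λ v → ∑ vs (λ f → d u * A u f * K f v))) ≡⟨ trans (∑-cong vs λ u → ∑-swap vs vs _) (∑-swap vs vs _) ⟩
          ∑ vs (λ f → ∑ vs (λ u → ∑ vs (λ v → d u * A u f * K f v))) ≡⟨ ∑-cong vs (λ f → trans (∑-cong vs λ u → ∑-*ˡ vs (d u * A u f) (K f)) (∑-*ʳ vs (∑ vs (K f)) _)) ⟩
          ∑ vs (λ f → ∑ vs (λ u → d u * A u f) * ∑ vs (K f)) ≡⟨ ∑-cong vs (λ f → trans (cong (_* ∑ vs (K f)) (p-stat (suc a) f)) (trans (*-assoc (W ^ suc a) (d f) _) (cong (W ^ suc a *_) (sym (∑-*ˡ vs (d f) (K f)))))) ⟩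
          ∑ vs (λ f → W ^ suc a * ∑ vs (λ v → d f * K f v)) ≡⟨ ∑-*ˡ vs (W ^ suc a) _ ⟩
          W ^ suc a * mass (H b) b ∎)
          where
          K : V → V → ℕ
          K f v = ⟦ H b f v ⟧ * B f v

    mass-heavy-step : ∀ c j → c ≤ C →
      mass (H (suc j)) (suc j) ≤ mass (rich c j) (suc j) +
        ∑ (splits j) (λ ab → c * (mass (H (proj₁ ab)) (proj₁ ab) * W ^ suc (proj₂ ab) + W ^ suc (proj₁ ab) * mass (H (proj₂ ab)) (proj₂ ab)))
    mass-heavy-step c j c≤C = begin
      mass (H (suc j)) (suc j)
        ≤⟨ ∑-mono vs (λ u → ∑-mono vs λ v → ≤-trans (*-monoʳ-≤ (d u) (heavy-pointwise c j c≤C u v)) (≤-reflexive (trans (*-distribˡ-+ (d u) (⟦ rich c j u v ⟧ * p (suc (suc j)) u v) _) (cong (d u * (⟦ rich c j u v ⟧ * p (suc (suc j)) u v) +_) (sym (∑-*ˡ (splits j) (d u) _)))))) ⟩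
      ∑ vs (λ u → ∑ vs (λ v → d u * (⟦ rich c j u v ⟧ * p (suc (suc j)) u v) + ∑ (splits j) (λ ab → d u * G ab u v)))
        ≡⟨ trans (∑-cong vs λ u → ∑-+ vs _ _) (∑-+ vs _ _) ⟩
      mass (rich c j) (suc j) + ∑ vs (λ u → ∑ vs (λ v → ∑ (splits j) (λ ab → d u * G ab u v)))
        ≡⟨ cong (mass (rich c j) (suc j) +_) (trans (∑-cong vs λ u → ∑-swap vs (splits j) _) (∑-swap vs (splits j) _)) ⟩
      mass (rich c j) (suc j) + ∑ (splits j) (λ ab → ∑ vs (λ u → ∑ vs (λ v → d u * G ab u v)))
        ≤⟨ +-monoʳ-≤ (mass (rich c j) (suc j)) (∑-mono (splits j) λ ab → fubini c (proj₁ ab) (proj₂ ab)) ⟩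
      _ ∎
      where
      open ≤-Reasoning
      G : ℕ × ℕ → V → V → ℕ
      G ab u v = ∑ vs (λ f → c * (p (suc (proj₁ ab)) u f * p (suc (proj₂ ab)) f v * (⟦ H (proj₁ ab) u f ⟧ + ⟦ H (proj₂ ab) f v ⟧)))

    -- Strong induction on the length. Half of the allowance goes to the rich pairs. The factor
    -- `4 * suc j * c j` keeps the rest within the other half: there are `suc j` splits, each with
    -- two pieces and with the loss `c j`.
    mass-heavy : ∀ n (c e : ℕ → ℕ) → (∀ j → j < n → c j ≤ C) →
      (∀ j → j < n → ∀ a → a ≤ j → 4 * suc j * c j * e (suc j) ≤ e a) →
      (∀ j → j < n → 2 * e (suc j) * mass (rich (c j) j) (suc j) ≤ total (suc j)) →
      ∀ i → i ≤ n → e i * mass (H i) i ≤ total i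
    mass-heavy n c e c≤ e≤ rich≤ i i≤ = go (suc i) i ≤-refl i≤
      where
      open ≤-Reasoning
      go : ∀ k i → i < k → i ≤ n → e i * mass (H i) i ≤ total i
      go (suc k) zero _ _ = ≤-trans (≤-reflexive (trans (cong (e 0 *_) none) (*-zeroʳ (e 0)))) z≤n
        where
        none : mass (H 0) 0 ≡ 0
        none = trans (∑-cong vs λ u → trans (∑-cong vs λ v → trans (cong (λ b → d u * (⟦ b ⟧ * p 1 u v)) (heavy-zero u v)) (*-zeroʳ (d u))) (∑-zero vs)) (∑-zero vs)
      go (suc k) (suc j) (s≤s lt) i≤n = *-cancelˡ-≤ 2 (begin
        2 * (E * mass (H (suc j)) (suc j)) ≡⟨ sym (*-assoc 2 E _) ⟩
        2 * E * mass (H (suc j)) (suc j) ≤⟨ *-monoʳ-≤ (2 * E) (mass-heavy-step (c j) j (c≤ j i≤n)) ⟩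
        2 * E * (mass (rich (c j) j) (suc j) + ∑ (splits j) F) ≡⟨ trans (*-distribˡ-+ (2 * E) _ _) (cong (2 * E * mass (rich (c j) j) (suc j) +_) (sym (∑-*ˡ (splits j) (2 * E) F))) ⟩
        2 * E * mass (rich (c j) j) (suc j) + ∑ (splits j) (λ ab → 2 * E * F ab) ≤⟨ +-mono-≤ (rich≤ j i≤n) (∑-uniform (splits j) _ (total (suc j)) term) ⟩
        total (suc j) + total (suc j) ≡⟨ cong (total (suc j) +_) (sym (+-identityʳ _)) ⟩
        2 * total (suc j) ∎)
        where
        E = e (suc j)
        F : ℕ × ℕ → ℕ
        F ab = c j * (mass (H (proj₁ ab)) (proj₁ ab) * W ^ suc (proj₂ ab) + W ^ suc (proj₁ ab) * mass (H (proj₂ ab)) (proj₂ ab))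
        term : ∀ {ab} → ab ∈ splits j → length (splits j) * (2 * E * F ab) ≤ total (suc j)
        term {a , b} i with ∈-splits⁻ j i
        ... | refl = *-cancelˡ-≤ 2 (begin
          2 * (length (splits (a + b)) * (2 * E * F (a , b))) ≡⟨ cong (λ l → 2 * (l * (2 * E * F (a , b)))) (length-splits (a + b)) ⟩
          2 * (suc (a + b) * (2 * E * F (a , b))) ≡⟨ solve 7 (λ l E c x y z q → con 2 :* (l :* (con 2 :* E :* (c :* (x :* y :+ z :* q)))) := con 4 :* l :* c :* E :* x :* y :+ z :* (con 4 :* l :* c :* E :* q)) refl (suc (a + b)) E (c (a + b)) (mass (H a) a) (W ^ suc b) (W ^ suc a) (mass (H b) b) ⟩
          4 * suc (a + b) * c (a + b) * E * mass (H a) a * W ^ suc b + W ^ suc a * (4 * suc (a + b) * c (a + b) * E * mass (H b) b)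
            ≤⟨ +-mono-≤ (*-monoˡ-≤ (W ^ suc b) (≤-trans (*-monoˡ-≤ (mass (H a) a) (e≤ _ i≤n a (m≤m+n a b))) (go k a (≤-trans (s≤s (m≤m+n a b)) lt) (≤-trans (m≤n⇒m≤1+n (m≤m+n a b)) i≤n))))
                        (*-monoʳ-≤ (W ^ suc a) (≤-trans (*-monoˡ-≤ (mass (H b) b) (e≤ _ i≤n b (m≤n+m b a))) (go k b (≤-trans (s≤s (m≤n+m b a)) lt) (≤-trans (m≤n⇒m≤1+n (m≤n+m b a)) i≤n)))) ⟩
          total a * W ^ suc b + W ^ suc a * total b ≡⟨ cong₂ _+_ t1 t2 ⟩
          total (suc (a + b)) + total (suc (a + b)) ≡⟨ cong (total (suc (a + b)) +_) (sym (+-identityʳ _)) ⟩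
          2 * total (suc (a + b)) ∎)
          where
          pw : W ^ suc (suc (a + b)) ≡ W ^ suc a * W ^ suc b
          pw = trans (cong (λ n → W ^ suc n) (sym (+-suc a b))) (^-distribˡ-+-* W (suc a) (suc b))
          t1 : total a * W ^ suc b ≡ total (suc (a + b))
          t1 = trans (solve 3 (λ x y z → x :* y :* z := x :* z :* y) refl (W ^ suc a) (∑ vs d) (W ^ suc b)) (cong (_* ∑ vs d) (sym pw))
          t2 : W ^ suc a * total b ≡ total (suc (a + b))
          t2 = trans (sym (*-assoc (W ^ suc a) _ _)) (cong (_* ∑ vs d) (sym pw))

-- Spiders

∏ : ∀ s → (Fin s → ℕ) → ℕ
∏ zero    f = 1
∏ (suc s) f = f zero * ∏ s (λ i → f (suc i))

∏-cong : ∀ s {f g : Fin s → ℕ} → (∀ i → f i ≡ g i) → ∏ s f ≡ ∏ s g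
∏-cong zero    e = refl
∏-cong (suc s) e = cong₂ _*_ (e zero) (∏-cong s (λ i → e (suc i)))

∏-mono : ∀ s {f g : Fin s → ℕ} → (∀ i → f i ≤ g i) → ∏ s f ≤ ∏ s g
∏-mono zero    e = ≤-refl
∏-mono (suc s) e = *-mono-≤ (e zero) (∏-mono s (λ i → e (suc i)))

∏-const : ∀ s c → ∏ s (λ _ → c) ≡ c ^ s
∏-const zero    c = refl
∏-const (suc s) c = cong (c *_) (∏-const s c)

∏-* : ∀ s (f g : Fin s → ℕ) → ∏ s (λ i → f i * g i) ≡ ∏ s f * ∏ s g
∏-* zero    f g = refl
∏-* (suc s) f g = trans (cong (f zero * g zero *_) (∏-* s _ _))
  (solve 4 (λ a b c d → a :* b :* (c :* d) := a :* c :* (b :* d)) refl (f zero) (g zero) _ _)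

∏-mono-at : ∀ s {f g : Fin s → ℕ} c i → (∀ i′ → i′ ≢ i → f i′ ≤ g i′) → c * f i ≤ g i → c * ∏ s f ≤ ∏ s g
∏-mono-at (suc s) {f} {g} c zero le h = ≤-trans (≤-reflexive (sym (*-assoc c (f zero) _))) (*-mono-≤ h (∏-mono s (λ i → le (suc i) (λ ()))))
∏-mono-at (suc s) {f} {g} c (suc i) le h = ≤-trans (≤-reflexive (x*yz≡y*xz c (f zero) _))
  (*-mono-≤ (le zero (λ ())) (∏-mono-at s c i (λ i′ n → le (suc i′) (λ { refl → n refl })) h))

∏-single : ∀ s (i : Fin s) (g : Fin s → ℕ) → ∏ s (λ i′ → if does (i′ Fin.≟ i) then g i′ else 1) ≡ g i
∏-single (suc s) zero    g = trans (cong (g zero *_) (trans (∏-const s 1) (^-zeroˡ s))) (*-identityʳ _)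
∏-single (suc s) (suc i) g = trans (+-identityʳ _) (trans (∏-cong s λ i′ → refl) (∏-single s i (λ i → g (suc i))))

∏-bound-at : ∀ s {f : Fin s → ℕ} B i → (∀ i′ → i′ ≢ i → f i′ ≤ B) → B * ∏ s f ≤ f i * B ^ s
∏-bound-at (suc s) {f} B zero le = ≤-trans (≤-reflexive (x*yz≡y*xz B (f zero) _)) (*-monoʳ-≤ (f zero) (*-monoʳ-≤ B
  (≤-trans (∏-mono s (λ i → le (suc i) (λ ()))) (≤-reflexive (∏-const s B)))))
∏-bound-at (suc s) {f} B (suc i) le = ≤-trans (≤-reflexive (x*yz≡y*xz B (f zero) _)) (≤-trans
  (*-mono-≤ (le zero (λ ())) (∏-bound-at s B i (λ i′ n → le (suc i′) (λ { refl → n refl })))) (≤-reflexive (x*yz≡y*xz B (f (suc i)) _)))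

∏-pos : ∀ s {f : Fin s → ℕ} → 0 < ∏ s f → ∀ i → 0 < f i
∏-pos (suc s) {f} lt i with f zero in e | ∏ s (λ i → f (suc i)) in e′
... | zero  | _     = ⊥-elim (<-irrefl refl lt)
... | suc a | zero  = ⊥-elim (<-irrefl (sym (*-zeroʳ a)) lt)
∏-pos (suc s) {f} lt zero    | suc a | suc b = subst (0 <_) (sym e) z<s
∏-pos (suc s) {f} lt (suc i) | suc a | suc b = ∏-pos s (subst (0 <_) (sym e′) z<s) i

∑-∏-tuples : ∀ {Y : Set} (ys : List Y) s (φ : Fin s → Y → ℕ) →
  ∑ (tuples ys s) (λ l → ∏ s (λ i → φ i (lookup l i))) ≡ ∏ s (λ i → ∑ ys (φ i))
∑-∏-tuples ys zero    φ = refl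
∑-∏-tuples ys (suc s) φ = begin
  ∑ (tuples ys (suc s)) (λ l → ∏ (suc s) (λ i → φ i (lookup l i))) ≡⟨ ∑-tuples ys s _ ⟩
  ∑ ys (λ y → ∑ (tuples ys s) (λ l → φ zero y * ∏ s (λ i → φ (suc i) (lookup l i)))) ≡⟨ ∑-cong ys (λ y → trans (∑-*ˡ (tuples ys s) (φ zero y) _) (cong (φ zero y *_) (∑-∏-tuples ys s (λ i → φ (suc i))))) ⟩
  ∑ ys (λ y → φ zero y * ∏ s (λ i → ∑ ys (φ (suc i)))) ≡⟨ ∑-*ʳ ys _ (φ zero) ⟩
  ∑ ys (φ zero) * ∏ s (λ i → ∑ ys (φ (suc i))) ∎
  where open ≡-Reasoning

⋀ : ∀ s → (Fin s → Bool) → Bool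
⋀ zero    f = true
⋀ (suc s) f = f zero ∧ ⋀ s (λ i → f (suc i))

⟦⋀⟧ : ∀ s f → ⟦ ⋀ s f ⟧ ≡ ∏ s (λ i → ⟦ f i ⟧)
⟦⋀⟧ zero    f = refl
⟦⋀⟧ (suc s) f = trans (⟦∧⟧ (f zero) _) (cong (⟦ f zero ⟧ *_) (⟦⋀⟧ s _))

⋀-sound : ∀ s {f} → ⋀ s f ≡ true → ∀ i → f i ≡ true
⋀-sound (suc s) {f} e zero    = proj₁ (∧-true e)
⋀-sound (suc s) {f} e (suc i) = ⋀-sound s (proj₂ (∧-true {f zero} e)) i

⋀-complete : ∀ s {f} → (∀ i → f i ≡ true) → ⋀ s f ≡ true
⋀-complete zero    h = refl
⋀-complete (suc s) h = true-∧ (h zero) (⋀-complete s (λ i → h (suc i)))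

below : ∀ {n} → ℕ → Fin n → Bool
below zero    j       = false
below (suc q) zero    = true
below (suc q) (suc j) = below q j

below-true : ∀ {n} q (j : Fin n) → toℕ j < q → below q j ≡ true
below-true (suc q) zero    lt = refl
below-true (suc q) (suc j) (s≤s lt) = below-true q j lt

below-false : ∀ {n} q (j : Fin n) → q ≤ toℕ j → below q j ≡ false
below-false zero    j       le = refl
below-false (suc q) (suc j) (s≤s le) = below-false q j le

∑-< : ∀ {X : Set} (xs : List X) (f g : X → ℕ) → ∑ xs f < ∑ xs g → ∃ λ x → x ∈ xs × f x < g x
∑-< (x ∷ xs) f g lt with f x <? g x
... | yes q = x , here refl , q
... | no q with ∑-< xs f g (+-cancelˡ-< (f x) _ _ (<-≤-trans lt (+-monoˡ-≤ (∑ xs g) (≮⇒≥ q))))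
...   | y , i , r = y , there i , r

-- Typical use: `m` is the mass of a class and `X` the mass of the hits on `N` forbidden vertices,
-- each of which is hit with proportion at most `1 / c`. Then the hits cannot exhaust a proportion
-- `1 / Q` of the class.
Q*X<m : ∀ {c Q N X m} → c * X ≤ N * m → Q * N < c → 0 < m → Q * X < m
Q*X<m {c} {Q} {N} {X} {m} le lt pos with Q * X <? m
... | yes q = q
... | no q = ⊥-elim (nope X refl)
  where
  open ≤-Reasoning
  m≤ : m ≤ Q * X
  m≤ = ≮⇒≥ q
  nope : ∀ X′ → X ≡ X′ → ⊥
  nope zero refl = <-irrefl refl (<-≤-trans pos (≤-trans m≤ (≤-reflexive (*-zeroʳ Q))))
  nope (suc x) refl = <-irrefl refl (begin-strict
    Q * N * X <⟨ *-monoˡ-< X lt ⟩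
    c * X ≤⟨ le ⟩
    N * m ≤⟨ *-monoʳ-≤ N m≤ ⟩
    N * (Q * X) ≡⟨ solve 3 (λ N Q X → N :* (Q :* X) := Q :* N :* X) refl N Q X ⟩
    Q * N * X ∎)

module Spiders (Γ : WeightedGraph) (s n : ℕ) (μ : WeightedGraph.V Γ → ℕ) where
  open WeightedGraph Γ
  open Kernel Γ

  Spider : Set
  Spider = V × Vec (Vec V n) s

  -- The position `at i j` lies at distance `suc (toℕ j)` from the centre. A spider may repeat
  -- vertices; distinctness is imposed later by `simple`.
  data Pos : Set where
    ctr : Pos
    at  : Fin s → Fin n → Pos

  val : Spider → Pos → V
  val (y , l) ctr      = y
  val (y , l) (at i j) = lookup (lookup l i) j

  spiders : List Spider
  spiders = concatMap (λ y → map (y ,_) (tuples (walks n) s)) vs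

  ∑-spiders : ∀ f → ∑ spiders f ≡ ∑ vs (λ y → ∑ (tuples (walks n) s) (λ l → f (y , l)))
  ∑-spiders f = trans (∑-concatMap _ vs f) (∑-cong vs λ y → ∑-map (y ,_) (tuples (walks n) s) f)

  ∈spiders : ∀ S → S ∈ spiders
  ∈spiders (y , l) = ∈-concatMap⁺ (λ y → map (y ,_) (tuples (walks n) s))
    (Any.map (λ { refl → ∈-map⁺ (y ,_) (∈-tuples l (λ i → ∈-tuples (lookup l i) (λ j → ∈vs _))) }) (∈vs y))

  weight : Spider → ℕ
  weight (y , l) = μ y * ∏ s (λ i → wt y (lookup l i))

  agree : (Pos → Bool) → Spider → Spider → Bool
  agree K (y , l) (y′ , l′) = agreeIf (K ctr) y y′ ∧ ⋀ s (λ i → agreeLeg (λ j → K (at i j)) (lookup l i) (lookup l′ i))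

  agree-sound : ∀ {K S S′} → agree K S S′ ≡ true → ∀ p → K p ≡ true → val S p ≡ val S′ p
  agree-sound {K} {y , l} {y′ , l′} e ctr k with K ctr | ∧-true {agreeIf (K ctr) y y′} e
  agree-sound {K} {y , l} {y′ , l′} e ctr refl | true | q , _ = ==-true q
  agree-sound {K} {y , l} {y′ , l′} e (at i j) k =
    agreeLeg-sound {m = λ j → K (at i j)} {lookup l i} {lookup l′ i} (⋀-sound s (proj₂ (∧-true {agreeIf (K ctr) y y′} e)) i) j k

  agree-complete : ∀ {K S S′} → (∀ p → K p ≡ true → val S p ≡ val S′ p) → agree K S S′ ≡ true
  agree-complete {K} {y , l} {y′ , l′} h = true-∧ first (⋀-complete s λ i →
    agreeLeg-complete {m = λ j → K (at i j)} {lookup l i} {lookup l′ i} (λ j → h (at i j)))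
    where
    first : agreeIf (K ctr) y y′ ≡ true
    first with K ctr in e
    ... | false = refl
    ... | true rewrite h ctr e = ==-refl y′

  agree-equivalence : ∀ K → Equivalence Spider (agree K)
  agree-equivalence K = record
    { ~refl  = λ S → agree-complete {K} {S} {S} (λ _ _ → refl)
    ; ~sym   = λ {S} {S′} e → agree-complete {K} {S′} {S} (λ p k → sym (agree-sound {K} {S} {S′} e p k))
    ; ~trans = λ {S} {S′} {S″} e e′ → agree-complete {K} {S} {S″} (λ p k → trans (agree-sound {K} {S} {S′} e p k) (agree-sound {K} {S′} {S″} e′ p k))
    }

  agree-mono : ∀ {K K′ S S′} → (∀ p → K p ≡ true → K′ p ≡ true) → agree K′ S S′ ≡ true → agree K S S′ ≡ true
  agree-mono {K} {K′} {S} {S′} h e = agree-complete {K} {S} {S′} (λ p k → agree-sound {K′} {S} {S′} e p (h p k))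

  class : (Pos → Bool) → Spider → (Spider → ℕ) → ℕ
  class K S f = ∑ spiders (λ S′ → ⟦ agree K S S′ ⟧ * f S′)

  totalMass : ℕ
  totalMass = ∑ spiders weight

  class-inner : ∀ K y l (φ : Fin s → Vec V n → ℕ) y′ →
    ∑ (tuples (walks n) s) (λ l′ → ⟦ agree K (y , l) (y′ , l′) ⟧ * (weight (y′ , l′) * ∏ s (λ i → φ i (lookup l′ i)))) ≡
    ⟦ agreeIf (K ctr) y y′ ⟧ * (μ y′ * ∏ s (λ i → ∑ (walks n) (λ x → ⟦ agreeLeg (λ j → K (at i j)) (lookup l i) x ⟧ * (wt y′ x * φ i x))))
  class-inner K y l φ y′ = begin
    ∑ (tuples (walks n) s) (λ l′ → ⟦ agreeIf (K ctr) y y′ ∧ ⋀ s (ag l′) ⟧ * (μ y′ * ∏ s (λ i → wt y′ (lookup l′ i)) * ∏ s (λ i → φ i (lookup l′ i))))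
      ≡⟨ ∑-cong (tuples (walks n) s) (λ l′ → trans (cong₂ _*_ (trans (⟦∧⟧ (agreeIf (K ctr) y y′) _) (cong (⟦ agreeIf (K ctr) y y′ ⟧ *_) (⟦⋀⟧ s (ag l′)))) (trans (*-assoc (μ y′) _ _) (cong (μ y′ *_) (sym (∏-* s _ _)))))
           (trans (solve 4 (λ a b c d → a :* b :* (c :* d) := a :* c :* (b :* d)) refl ⟦ agreeIf (K ctr) y y′ ⟧ _ (μ y′) _) (cong (⟦ agreeIf (K ctr) y y′ ⟧ * μ y′ *_) (sym (∏-* s _ _))))) ⟩
    ∑ (tuples (walks n) s) (λ l′ → ⟦ agreeIf (K ctr) y y′ ⟧ * μ y′ * ∏ s (λ i → ⟦ ag l′ i ⟧ * (wt y′ (lookup l′ i) * φ i (lookup l′ i))))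
      ≡⟨ trans (∑-*ˡ (tuples (walks n) s) (⟦ agreeIf (K ctr) y y′ ⟧ * μ y′) _) (trans (*-assoc ⟦ agreeIf (K ctr) y y′ ⟧ (μ y′) _) (cong (λ z → ⟦ agreeIf (K ctr) y y′ ⟧ * (μ y′ * z)) (∑-∏-tuples (walks n) s (λ i x → ⟦ agreeLeg (λ j → K (at i j)) (lookup l i) x ⟧ * (wt y′ x * φ i x))))) ⟩
    _ ∎
    where
    open ≡-Reasoning
    ag : Vec (Vec V n) s → Fin s → Bool
    ag l′ i = agreeLeg (λ j → K (at i j)) (lookup l i) (lookup l′ i)

  -- Given the centre, the legs are independent, so the mass of a class factors over them; `ψ` tests
  -- the centre and `φ` the single legs.
  class-product : ∀ K y l (ψ : V → ℕ) (φ : Fin s → Vec V n → ℕ) →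
    class K (y , l) (λ S′ → ψ (proj₁ S′) * (weight S′ * ∏ s (λ i → φ i (lookup (proj₂ S′) i)))) ≡
    ∑ vs (λ y′ → ψ y′ * (⟦ agreeIf (K ctr) y y′ ⟧ * (μ y′ * ∏ s (λ i → ∑ (walks n) (λ x → ⟦ agreeLeg (λ j → K (at i j)) (lookup l i) x ⟧ * (wt y′ x * φ i x))))))
  class-product K y l ψ φ = trans (∑-spiders _) (∑-cong vs λ y′ →
    trans (∑-cong (tuples (walks n) s) λ l′ → x*yz≡y*xz ⟦ agree K (y , l) (y′ , l′) ⟧ (ψ y′) _)
      (trans (∑-*ˡ (tuples (walks n) s) (ψ y′) _) (cong (ψ y′ *_) (class-inner K y l φ y′))))

  weight-one : ∀ S → 1 * (weight S * ∏ s (λ i → 1)) ≡ weight S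
  weight-one S = trans (+-identityʳ _) (trans (cong (weight S *_) (trans (∏-const s 1) (^-zeroˡ s))) (*-identityʳ (weight S)))

  -- The classes of this mask describe redrawing leg `i` from its entry `q` outwards, with
  -- everything else left in place.
  keep : Fin s → ℕ → Pos → Bool
  keep i q ctr       = true
  keep i q (at i′ j) = not (does (i′ Fin.≟ i)) ∨ below q j

  keep-other : ∀ {i i′} q j → i′ ≢ i → keep i q (at i′ j) ≡ true
  keep-other {i} {i′} q j ne with i′ Fin.≟ i
  ... | yes e = ⊥-elim (ne e)
  ... | no _  = refl

  keep-same : ∀ i q j → keep i q (at i j) ≡ below q j
  keep-same i q j with i Fin.≟ i
  ... | yes e = refl
  ... | no ne = ⊥-elim (ne refl)

  row : V → ℕ
  row u = ∑ vs (p1 u)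

  -- Given the vertices before it, an entry beyond the first `q` is a uniform neighbour of its
  -- predecessor, and the later entries contribute the same factor for each choice. The number `κ`
  -- plays the part of a minimum degree.
  legHit : ∀ {n} κ → (∀ u f → κ * p1 u f ≤ row u) → ∀ u q (ref : Vec V n) (j : Fin n) f → q ≤ toℕ j →
    κ * ∑ (walks n) (λ x → ⟦ agreeLeg (below q) ref x ⟧ * (wt u x * ⟦ lookup x j == f ⟧)) ≤
    ∑ (walks n) (λ x → ⟦ agreeLeg (below q) ref x ⟧ * wt u x)
  -- Only the degree of the start matters for the first entry. This allows `κ` to be the exact
  -- degree of the centre, which the second embedding needs.
  legHit-head : ∀ {n} κ u → (∀ f → κ * p1 u f ≤ row u) → ∀ (ref : Vec V (suc n)) f →
    κ * ∑ (walks (suc n)) (λ x → ⟦ agreeLeg (below 0) ref x ⟧ * (wt u x * ⟦ lookup x zero == f ⟧)) ≤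
    ∑ (walks (suc n)) (λ x → ⟦ agreeLeg (below 0) ref x ⟧ * wt u x)

  private
    agree-none : ∀ {n} (ref x : Vec V n) → agreeLeg (below 0) ref x ≡ true
    agree-none []      []      = refl
    agree-none (r ∷ y) (u ∷ x) = agree-none y x

    leg-step : ∀ {n} u q r (ref : Vec V n) (φ : Vec V (suc n) → ℕ) →
      ∑ (walks (suc n)) (λ x → ⟦ agreeLeg (below q) (r ∷ ref) x ⟧ * (wt u x * φ x)) ≡
      ∑ vs (λ v → ⟦ agreeIf (below q (zero {n})) r v ⟧ * p1 u v * ∑ (walks n) (λ x → ⟦ agreeLeg (λ j → below q (suc j)) ref x ⟧ * (wt v x * φ (v ∷ x))))
    leg-step {n} u q r ref φ = trans (∑-tuples vs n _) (∑-cong vs λ v → trans (∑-cong (walks n) λ x →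
      trans (cong₂ _*_ (⟦∧⟧ (agreeIf (below q (zero {n})) r v) _) (*-assoc (p1 u v) (wt v x) _))
        (solve 4 (λ a b c d → a :* b :* (c :* d) := a :* c :* (b :* d)) refl ⟦ agreeIf (below q (zero {n})) r v ⟧ _ (p1 u v) _)) (∑-*ˡ (walks n) (⟦ agreeIf (below q (zero {n})) r v ⟧ * p1 u v) _))

    leg-step′ : ∀ {n} u q r (ref : Vec V n) →
      ∑ (walks (suc n)) (λ x → ⟦ agreeLeg (below q) (r ∷ ref) x ⟧ * wt u x) ≡
      ∑ vs (λ v → ⟦ agreeIf (below q (zero {n})) r v ⟧ * p1 u v * ∑ (walks n) (λ x → ⟦ agreeLeg (λ j → below q (suc j)) ref x ⟧ * wt v x))
    leg-step′ {n} u q r ref = trans (∑-cong (walks (suc n)) λ x → cong (⟦ agreeLeg (below q) (r ∷ ref) x ⟧ *_) (sym (*-identityʳ (wt u x))))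
      (trans (leg-step u q r ref (λ _ → 1)) (∑-cong vs λ v → cong (⟦ agreeIf (below q (zero {n})) r v ⟧ * p1 u v *_) (∑-cong (walks n) λ x → cong (⟦ agreeLeg (λ j → below q (suc j)) ref x ⟧ *_) (*-identityʳ (wt v x)))))

  legHit-head {n} κ u hκ (r ∷ ref) f = begin
    κ * ∑ (walks (suc n)) (λ x → ⟦ agreeLeg (below 0) (r ∷ ref) x ⟧ * (wt u x * ⟦ lookup x zero == f ⟧))
      ≡⟨ cong (κ *_) (trans (leg-step u 0 r ref (λ x → ⟦ lookup x zero == f ⟧)) (∑-cong vs λ v → trans (cong₂ _*_ (+-identityʳ (p1 u v)) (trans (∑-cong (walks n) λ x → trans (cong (λ b → ⟦ b ⟧ * (wt v x * ⟦ v == f ⟧)) (agree-none ref x)) (+-identityʳ _)) (∑-*ʳ (walks n) ⟦ v == f ⟧ (wt v)))) (trans (sym (*-assoc (p1 u v) _ _)) (trans (cong (_* ⟦ v == f ⟧) (p1*Z n u v)) (*-comm _ ⟦ v == f ⟧))))) ⟩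
    κ * ∑ vs (λ v → ⟦ v == f ⟧ * (p1 u v * W ^ n)) ≡⟨ trans (cong (κ *_) (∑-δ f _)) (sym (*-assoc κ _ _)) ⟩
    κ * p1 u f * W ^ n ≤⟨ *-monoˡ-≤ (W ^ n) (hκ f) ⟩
    row u * W ^ n ≡⟨ sym (∑-*ʳ vs (W ^ n) (p1 u)) ⟩
    ∑ vs (λ v → p1 u v * W ^ n) ≡⟨ ∑-cong vs (λ v → trans (sym (p1*Z n u v)) (cong₂ _*_ (sym (+-identityʳ (p1 u v))) (∑-cong (walks n) λ x → trans (sym (+-identityʳ (wt v x))) (cong (λ b → ⟦ b ⟧ * wt v x) (sym (agree-none ref x)))))) ⟩
    ∑ vs (λ v → (p1 u v + 0) * ∑ (walks n) (λ x → ⟦ agreeLeg (below 0) ref x ⟧ * wt v x)) ≡⟨ sym (leg-step′ u 0 r ref) ⟩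
    ∑ (walks (suc n)) (λ x → ⟦ agreeLeg (below 0) (r ∷ ref) x ⟧ * wt u x) ∎
    where open ≤-Reasoning

  legHit κ hκ u zero ref@(_ ∷ _) zero f le = legHit-head κ u (hκ u) ref f
  legHit {suc n} κ hκ u q (r ∷ ref) (suc j) f le = begin
    κ * ∑ (walks (suc n)) (λ x → ⟦ agreeLeg (below q) (r ∷ ref) x ⟧ * (wt u x * ⟦ lookup x (suc j) == f ⟧)) ≡⟨ cong (κ *_) (leg-step u q r ref (λ x → ⟦ lookup x (suc j) == f ⟧)) ⟩
    κ * ∑ vs (λ v → c v * M v) ≡⟨ trans (sym (∑-*ˡ vs κ _)) (∑-cong vs λ v → x*yz≡y*xz κ (c v) (M v)) ⟩
    ∑ vs (λ v → c v * (κ * M v)) ≤⟨ ∑-mono vs (λ v → *-monoʳ-≤ (c v) (ih q le v)) ⟩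
    ∑ vs (λ v → c v * N v) ≡⟨ sym (leg-step′ u q r ref) ⟩
    ∑ (walks (suc n)) (λ x → ⟦ agreeLeg (below q) (r ∷ ref) x ⟧ * wt u x) ∎
    where
    open ≤-Reasoning
    c M N : V → ℕ
    c v = ⟦ agreeIf (below q (zero {n})) r v ⟧ * p1 u v
    M v = ∑ (walks n) (λ x → ⟦ agreeLeg (λ j → below q (suc j)) ref x ⟧ * (wt v x * ⟦ lookup x j == f ⟧))
    N v = ∑ (walks n) (λ x → ⟦ agreeLeg (λ j → below q (suc j)) ref x ⟧ * wt v x)
    ih : ∀ q → q ≤ suc (toℕ j) → ∀ v → κ * ∑ (walks n) (λ x → ⟦ agreeLeg (λ j → below q (suc j)) ref x ⟧ * (wt v x * ⟦ lookup x j == f ⟧)) ≤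
         ∑ (walks n) (λ x → ⟦ agreeLeg (λ j → below q (suc j)) ref x ⟧ * wt v x)
    ih zero    _        v = legHit κ hκ v 0 ref j f z≤n
    ih (suc q) (s≤s le) v = legHit κ hκ v q ref j f le

  d*p1≤row : ∀ u f → d u * p1 u f ≤ row u
  d*p1≤row u f with d u in e
  ... | zero  = z≤n
  ... | suc k = begin
    suc k * p1 u f ≡⟨ cong (_* p1 u f) (sym e) ⟩
    d u * p1 u f ≡⟨ d*p1 u f ⟩
    W * ⟦ adj u f ⟧ ≤⟨ *-monoʳ-≤ W (⟦⟧≤1 (adj u f)) ⟩
    W * 1 ≡⟨ *-identityʳ W ⟩
    W ≡⟨ sym (p1-row u (subst (0 <_) (sym e) z<s)) ⟩
    row u ∎
    where open ≤-Reasoning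

  private
    agreeLeg-cong : ∀ {n} {m m′ : Fin n → Bool} → (∀ j → m j ≡ m′ j) → ∀ x y → agreeLeg m x y ≡ agreeLeg m′ x y
    agreeLeg-cong e []      []      = refl
    agreeLeg-cong e (u ∷ x) (v ∷ y) = cong₂ (λ b b′ → agreeIf b u v ∧ b′) (e zero) (agreeLeg-cong (λ j → e (suc j)) x y)

  -- The centre and the other legs are pinned, so the inequality for leg `i` is multiplied by common
  -- factors.
  class-hit : ∀ κ S i q j f →
    κ * ∑ (walks n) (λ x → ⟦ agreeLeg (below q) (lookup (proj₂ S) i) x ⟧ * (wt (proj₁ S) x * ⟦ lookup x j == f ⟧)) ≤
        ∑ (walks n) (λ x → ⟦ agreeLeg (below q) (lookup (proj₂ S) i) x ⟧ * wt (proj₁ S) x) →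
    κ * class (keep i q) S (λ S′ → ⟦ val S′ (at i j) == f ⟧ * weight S′) ≤ class (keep i q) S weight
  class-hit κ (y , l) i q j f hyp = begin
    κ * class (keep i q) (y , l) (λ S′ → ⟦ val S′ (at i j) == f ⟧ * weight S′)
      ≡⟨ cong (κ *_) (trans (∑-cong spiders λ S′ → cong (⟦ agree (keep i q) (y , l) S′ ⟧ *_) (trans (*-comm _ (weight S′)) (trans (cong (weight S′ *_) (sym (one-factor S′))) (sym (+-identityʳ _))))) (trans (class-product (keep i q) y l (λ _ → 1) φ) (trans (∑-cong vs λ y′ → +-identityʳ _) (∑-δ′ y _)))) ⟩
    κ * (μ y * ∏ s A) ≡⟨ x*yz≡y*xz κ (μ y) _ ⟩
    μ y * (κ * ∏ s A) ≤⟨ *-monoʳ-≤ (μ y) (∏-mono-at s κ i other same) ⟩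
    μ y * ∏ s B ≡⟨ sym (trans (∑-cong spiders λ S′ → cong (⟦ agree (keep i q) (y , l) S′ ⟧ *_) (sym (weight-one S′))) (trans (class-product (keep i q) y l (λ _ → 1) (λ _ _ → 1)) (trans (∑-cong vs λ y′ → +-identityʳ _) (∑-δ′ y _)))) ⟩
    class (keep i q) (y , l) weight ∎
    where
    open ≤-Reasoning
    φ : Fin s → Vec V n → ℕ
    φ i′ x = if does (i′ Fin.≟ i) then ⟦ lookup x j == f ⟧ else 1
    m : Fin s → Fin n → Bool
    m i′ j′ = keep i q (at i′ j′)
    A B : Fin s → ℕ
    A i′ = ∑ (walks n) (λ x → ⟦ agreeLeg (m i′) (lookup l i′) x ⟧ * (wt y x * φ i′ x))
    B i′ = ∑ (walks n) (λ x → ⟦ agreeLeg (m i′) (lookup l i′) x ⟧ * (wt y x * 1))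
    one-factor : ∀ S′ → ∏ s (λ i′ → φ i′ (lookup (proj₂ S′) i′)) ≡ ⟦ val S′ (at i j) == f ⟧
    one-factor (y′ , l′) = ∏-single s i (λ i′ → ⟦ lookup (lookup l′ i′) j == f ⟧)
    other : ∀ i′ → i′ ≢ i → A i′ ≤ B i′
    other i′ ne with i′ Fin.≟ i
    ... | yes e = ⊥-elim (ne e)
    ... | no _  = ≤-refl
    same : κ * A i ≤ B i
    same = begin
      κ * A i ≡⟨ cong (κ *_) (∑-cong (walks n) λ x → cong₂ (λ b c → ⟦ b ⟧ * (wt y x * c)) (agreeLeg-cong (keep-same i q) (lookup l i) x) (φi x)) ⟩
      _ ≤⟨ hyp ⟩
      _ ≡⟨ ∑-cong (walks n) (λ x → cong₂ (λ b c → ⟦ b ⟧ * c) (sym (agreeLeg-cong (keep-same i q) (lookup l i) x)) (sym (*-identityʳ (wt y x)))) ⟩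
      B i ∎
      where
      φi : ∀ x → φ i x ≡ ⟦ lookup x j == f ⟧
      φi x with i Fin.≟ i
      ... | yes _ = refl
      ... | no ne = ⊥-elim (ne refl)

-- Closed systems of spiders

every : ∀ {X : Set} → List X → (X → Bool) → Bool
every xs P = ∑ xs (λ x → ⟦ not (P x) ⟧) ≤ᵇ 0

every-true : ∀ {X : Set} {xs : List X} {P x} → every xs P ≡ true → x ∈ xs → P x ≡ true
every-true {xs = xs} {P} {x} e i with dichotomy (P x)
... | inj₁ t = t
... | inj₂ f = ⊥-elim (<-irrefl refl (≤-trans (≤-reflexive (sym (⟦⟧-true (cong not f)))) (≤-trans (∑-∈ (λ x → ⟦ not (P x) ⟧) i) (≤ᵇ-true e))))

every-false : ∀ {X : Set} {xs : List X} {P} → every xs P ≡ false → ∃ λ x → x ∈ xs × P x ≡ false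
every-false {xs = xs} {P} e with ∑-pos xs _ (≤ᵇ-false e)
... | x , i , lt with dichotomy (P x)
...   | inj₂ f = x , i , f
...   | inj₁ t with subst (λ b → 0 < ⟦ not b ⟧) t lt
...     | ()

opaque
  -- Reciprocal of the proportion kept in each class of a closed system. The initial set has the
  -- proportion `1 / (2 * A)`, closing it costs at most the total mass once for each of the
  -- `1 + (s + s)` relations, and the outer `suc` leaves something over.
  loss : ℕ → ℕ → ℕ
  loss s A = suc ((1 + (s + s)) * (2 * A))

  loss-≡ : ∀ s A → loss s A ≡ suc ((1 + (s + s)) * (2 * A))
  loss-≡ s A = refl

0<t≤c*x : ∀ c {t x} → 0 < t → t ≤ c * x → 0 < x
0<t≤c*x c {x = suc x} pos le = z<s
0<t≤c*x c {x = zero}  pos le = ⊥-elim (<-irrefl refl (<-≤-trans pos (≤-trans le (≤-reflexive (*-zeroʳ c)))))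

MinDegree : WeightedGraph → ℕ → Set
MinDegree Γ δ = ∀ u → 0 < WeightedGraph.d Γ u → δ ≤ WeightedGraph.d Γ u

module Systems (Γ : WeightedGraph) (s n : ℕ) (μ : WeightedGraph.V Γ → ℕ) (δ : ℕ) (δ≤d : MinDegree Γ δ) where
  open WeightedGraph Γ
  open Kernel Γ
  open Spiders Γ s n μ

  δ*p1≤row : ∀ u f → δ * p1 u f ≤ row u
  δ*p1≤row u f with adj u f in e
  ... | false = ≤-trans (≤-reflexive (trans (cong (δ *_) (*-zeroʳ (ω u))) (*-zeroʳ δ))) z≤n
  ... | true  = ≤-trans (*-mono-≤ (δ≤d u (adj⇒d>0 e)) (≤-reflexive (cong (λ b → ω u * ⟦ b ⟧) (sym e)))) (d*p1≤row u f)

  poss : List Pos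
  poss = ctr ∷ concatMap (λ i → map (at i) (allFin n)) (allFin s)

  length-poss : length poss ≡ 1 + s * n
  length-poss = cong suc (trans (go (allFin s)) (cong (_* n) (length-allFin s)))
    where
    go : ∀ is → length (concatMap (λ i → map (at i) (allFin n)) is) ≡ length is * n
    go []       = refl
    go (i ∷ is) = trans (length-++ (map (at i) (allFin n))) (cong₂ _+_ (trans (length-map (at i) (allFin n)) (length-allFin n)) (go is))

  ∈poss : ∀ p → p ∈ poss
  ∈poss ctr      = here refl
  ∈poss (at i j) = there (∈-concatMap⁺ (λ i → map (at i) (allFin n)) (Any.map (λ { refl → ∈-map⁺ (at i) (∈-allFin j) }) (∈-allFin i)))

  class-mono : ∀ K S {f g : Spider → ℕ} → (∀ S′ → agree K S S′ ≡ true → f S′ ≤ g S′) → class K S f ≤ class K S g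
  class-mono K S {f} {g} h = ∑-mono spiders λ S′ → pt S′
    where
    pt : ∀ S′ → ⟦ agree K S S′ ⟧ * f S′ ≤ ⟦ agree K S S′ ⟧ * g S′
    pt S′ with agree K S S′ in e
    ... | true  = *-monoʳ-≤ 1 (h S′ e)
    ... | false = z≤n

  class-∑ : ∀ {X : Set} K S (xs : List X) (f : X → Spider → ℕ) → class K S (λ S′ → ∑ xs (λ x → f x S′)) ≡ ∑ xs (λ x → class K S (f x))
  class-∑ K S xs f = trans (∑-cong spiders λ S′ → sym (∑-*ˡ xs ⟦ agree K S S′ ⟧ _)) (∑-swap spiders xs _)

  class-*ˡ : ∀ K S c f → class K S (λ S′ → c * f S′) ≡ c * class K S f
  class-*ˡ K S c f = trans (∑-cong spiders λ S′ → x*yz≡y*xz ⟦ agree K S S′ ⟧ c (f S′)) (∑-*ˡ spiders c _)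

  class-self : ∀ K S f → f S ≤ class K S f
  class-self K S f = ≤-trans (≤-reflexive (sym (trans (cong (λ b → ⟦ b ⟧ * f S) (Equivalence.~refl (agree-equivalence K) S)) (+-identityʳ _))))
    (∑-∈ (λ S′ → ⟦ agree K S S′ ⟧ * f S′) (∈spiders S))

  class-cong : ∀ K {S S₁} f → agree K S S₁ ≡ true → class K S f ≡ class K S₁ f
  class-cong K {S} {S₁} f e = ∑-cong spiders λ S′ → cong (λ b → ⟦ b ⟧ * f S′) (Equivalence.~congˡ (agree-equivalence K) {S} {S₁} S′ e)

  keep-hit : ∀ S i q j f → q ≤ toℕ j →
    δ * class (keep i q) S (λ S′ → ⟦ val S′ (at i j) == f ⟧ * weight S′) ≤ class (keep i q) S weight
  keep-hit (y , l) i q j f le = class-hit δ (y , l) i q j f (legHit δ δ*p1≤row y q (lookup l i) j f le)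

  -- Asking that `p` be kept when leg `i` is redrawn from entry `j` makes `at i j` random given the
  -- value at `p`. Every pair of different positions is still covered: on a common leg the outer one
  -- is redrawn.
  clash : Fin s × Fin n × Pos → Spider → Bool
  clash (i , j , p) S = keep i (toℕ j) p ∧ (val S (at i j) == val S p)

  clashes : List (Fin s × Fin n × Pos)
  clashes = concatMap (λ i → concatMap (λ j → map (λ p → i , j , p) poss) (allFin n)) (allFin s)

  length-clashes : length clashes ≡ s * (n * (1 + s * n))
  length-clashes = trans (go (allFin s)) (cong (_* (n * (1 + s * n))) (length-allFin s))
    where
    go′ : ∀ i js → length (concatMap (λ j → map (λ p → i , j , p) poss) js) ≡ length js * (1 + s * n)
    go′ i []       = refl
    go′ i (j ∷ js) = trans (length-++ (map (λ p → i , j , p) poss)) (cong₂ _+_ (trans (length-map _ poss) length-poss) (go′ i js))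
    go : ∀ is → length (concatMap (λ i → concatMap (λ j → map (λ p → i , j , p) poss) (allFin n)) is) ≡ length is * (n * (1 + s * n))
    go []       = refl
    go (i ∷ is) = trans (length-++ (concatMap (λ j → map (λ p → i , j , p) poss) (allFin n)))
      (cong₂ _+_ (trans (go′ i (allFin n)) (cong (_* (1 + s * n)) (length-allFin n))) (go is))

  ∈clashes : ∀ i j p → (i , j , p) ∈ clashes
  ∈clashes i j p = ∈-concatMap⁺ (λ i → concatMap (λ j → map (λ p → i , j , p) poss) (allFin n)) (Any.map (λ { refl →
    ∈-concatMap⁺ (λ j → map (λ p → i , j , p) poss) (Any.map (λ { refl → ∈-map⁺ (λ p → i , j , p) (∈poss p) }) (∈-allFin j)) }) (∈-allFin i))

  simple : Spider → Bool
  simple S = every clashes (λ t → not (clash t S))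

  simple-distinct : ∀ {S} → simple S ≡ true → ∀ p p′ → val S p ≡ val S p′ → p ≡ p′
  simple-distinct {S} e = go
    where
    absurd : ∀ i j p → keep i (toℕ j) p ≡ true → val S (at i j) ≡ val S p → ⊥
    absurd i j p k q with trans (sym (not-true (every-true {xs = clashes} {λ t → not (clash t S)} e (∈clashes i j p))))
                                (true-∧ k (trans (cong (_== val S p) q) (==-refl (val S p))))
    ... | ()
    go : ∀ p p′ → val S p ≡ val S p′ → p ≡ p′
    go ctr ctr q = refl
    go ctr (at i j) q = ⊥-elim (absurd i j ctr refl (sym q))
    go (at i j) ctr q = ⊥-elim (absurd i j ctr refl q)
    go (at i j) (at i′ j′) q with i′ Fin.≟ i
    ... | no ne = ⊥-elim (absurd i j (at i′ j′) (keep-other (toℕ j) j′ ne) q)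
    ... | yes refl with <-cmp (toℕ j) (toℕ j′)
    ...   | tri≈ _ e _ = cong (at i) (toℕ-injective e)
    ...   | tri< lt _ _ = ⊥-elim (absurd i j′ (at i j) (trans (keep-same i (toℕ j′) j) (below-true (toℕ j′) j lt)) (sym q))
    ...   | tri> _ _ lt = ⊥-elim (absurd i j (at i j′) (trans (keep-same i (toℕ j) j′) (below-true (toℕ j) j′ lt)) q)

  clash-mass : ∀ t → δ * ∑ spiders (λ S → ⟦ clash t S ⟧ * weight S) ≤ totalMass
  clash-mass t@(i , j , p) = begin
    δ * ∑ spiders (λ S → ⟦ clash t S ⟧ * weight S) ≡⟨ trans (sym (∑-*ˡ spiders δ _)) (∑-cong spiders λ S → sym (+-identityʳ _)) ⟩
    ∑ spiders (λ S → 1 * (δ * (⟦ clash t S ⟧ * weight S))) ≤⟨ classwise-≤ spiders (agree-equivalence (keep i (toℕ j))) (λ _ → true) _ weight (λ _ _ → refl) (λ {S} _ _ → cls S) ⟩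
    ∑ spiders (λ S → 1 * weight S) ≡⟨ ∑-cong spiders (λ S → +-identityʳ _) ⟩
    totalMass ∎
    where
    open ≤-Reasoning
    cls : ∀ S → class (keep i (toℕ j)) S (λ S′ → δ * (⟦ clash t S′ ⟧ * weight S′)) ≤ class (keep i (toℕ j)) S weight
    cls S = ≤-trans (≤-reflexive (class-*ˡ (keep i (toℕ j)) S δ _)) (≤-trans (*-monoʳ-≤ δ (class-mono (keep i (toℕ j)) S pt)) (keep-hit S i (toℕ j) j (val S p) ≤-refl))
      where
      pt : ∀ S′ → agree (keep i (toℕ j)) S S′ ≡ true → ⟦ clash t S′ ⟧ * weight S′ ≤ ⟦ val S′ (at i j) == val S p ⟧ * weight S′
      pt S′ ag with keep i (toℕ j) p in k
      ... | false = z≤n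
      ... | true  rewrite agree-sound {keep i (toℕ j)} {S} {S′} ag p k = ≤-refl

  not-simple-mass : ∀ B → length clashes * B ≤ δ → B * ∑ spiders (λ S → ⟦ not (simple S) ⟧ * weight S) ≤ totalMass
  not-simple-mass B le = begin
    B * ∑ spiders (λ S → ⟦ not (simple S) ⟧ * weight S) ≤⟨ *-monoʳ-≤ B (∑-mono spiders pt) ⟩
    B * ∑ spiders (λ S → ∑ clashes (λ t → ⟦ clash t S ⟧ * weight S)) ≡⟨ trans (cong (B *_) (∑-swap spiders clashes _)) (sym (∑-*ˡ clashes B _)) ⟩
    ∑ clashes (λ t → B * M t) ≤⟨ ∑-uniform clashes (λ t → B * M t) totalMass (λ {t} _ → ≤-trans (≤-reflexive (sym (*-assoc (length clashes) B (M t)))) (≤-trans (*-monoˡ-≤ (M t) le) (clash-mass t))) ⟩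
    totalMass ∎
    where
    open ≤-Reasoning
    M : Fin s × Fin n × Pos → ℕ
    M t = ∑ spiders (λ S → ⟦ clash t S ⟧ * weight S)
    pt : ∀ S → ⟦ not (simple S) ⟧ * weight S ≤ ∑ clashes (λ t → ⟦ clash t S ⟧ * weight S)
    pt S with dichotomy (simple S)
    ... | inj₁ e rewrite e = z≤n
    ... | inj₂ e with every-false {xs = clashes} {λ t → not (clash t S)} e
    ...   | t , i , q rewrite e = ≤-trans (≤-reflexive (cong (λ b → ⟦ b ⟧ * weight S) (sym (not-false q)))) (∑-∈ (λ t → ⟦ clash t S ⟧ * weight S) i)

  hits : (Pos → Bool) → V → Spider → ℕ
  hits K f S = ∑ poss (λ p → ⟦ not (K p) ⟧ * ⟦ val S p == f ⟧)

  -- The analogue of `rich` for spiders: given the values on `K`, the expected number of free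
  -- positions occupied by `f` is at most `1 / c`. It depends on `S` only through its class.
  richAt : (Pos → Bool) → ℕ → Spider → V → Bool
  richAt K c S f = c * class K S (λ S′ → hits K f S′ * weight S′) ≤ᵇ class K S weight

  richSpider : (Pos → Bool) → ℕ → Spider → Bool
  richSpider K c S = every vs (richAt K c S)

  record KernelShape (K : Pos → Bool) : Set where
    field
      tip   : Fin s → Fin n
      K-ctr : K ctr ≡ false
      K-tip : ∀ i → K (at i (tip i)) ≡ true
      K-pre : ∀ i j → toℕ j < toℕ (tip i) → K (at i j) ≡ false

  -- `moveA` redraws everything off the kernel and rests on richness; `moveB` redraws leg `i` from
  -- its tip outwards and rests on the minimum degree; `dense` is for redrawing a whole leg. A move
  -- returns a good spider, so moves can be iterated; `N` bounds the number of vertices that can be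
  -- avoided.
  record ClosedSystem (K : Pos → Bool) (κ : KernelShape K) (N Q : ℕ) : Set where
    open KernelShape κ
    field
      good     : Spider → Bool
      S₀       : Spider
      good-S₀  : good S₀ ≡ true
      distinct : ∀ {S} → good S ≡ true → ∀ p p′ → val S p ≡ val S p′ → p ≡ p′
      positive : ∀ {S} → good S ≡ true → 0 < weight S
      moveA    : ∀ {S} → good S ≡ true → ∀ F → length F ≤ N → ∃ λ S′ → good S′ ≡ true × agree K S S′ ≡ true ×
                 (∀ p → K p ≡ false → val S′ p ∉ F)
      moveB    : ∀ {S} → good S ≡ true → ∀ i F → length F ≤ N → ∃ λ S′ → good S′ ≡ true × agree (keep i (toℕ (tip i))) S S′ ≡ true ×
                 (∀ j → toℕ (tip i) ≤ toℕ j → val S′ (at i j) ∉ F)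
      dense    : ∀ {S} → good S ≡ true → ∀ i → class (keep i 0) S weight ≤ Q * class (keep i 0) S (λ S′ → ⟦ good S′ ⟧ * weight S′)

  ∑⟦∉⟧ : ∀ (F : List V) v → ∑ F (λ f → ⟦ v == f ⟧) ≡ 0 → v ∉ F
  ∑⟦∉⟧ F v e i = <-irrefl (sym e) (<-≤-trans (subst (λ b → 0 < ⟦ b ⟧) (sym (==-refl v)) z<s) (∑-∈ (λ f → ⟦ v == f ⟧) i))

  avoid-mass : ∀ S i q F →
    δ * class (keep i q) S (λ S′ → ∑ F (λ f → ∑ (allFin n) (λ j → ⟦ not (below q j) ⟧ * ⟦ val S′ (at i j) == f ⟧)) * weight S′) ≤ length F * n * class (keep i q) S weight
  avoid-mass S i q F = begin
    δ * class Kq S (λ S′ → ∑ F (λ f → ∑ (allFin n) (λ j → ⟦ not (below q j) ⟧ * ⟦ val S′ (at i j) == f ⟧)) * weight S′)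
      ≡⟨ cong (δ *_) (trans (∑-cong spiders λ S′ → cong (⟦ agree Kq S S′ ⟧ *_) (trans (sym (∑-*ʳ F (weight S′) _)) (∑-cong F λ f → trans (sym (∑-*ʳ (allFin n) (weight S′) _)) (∑-cong (allFin n) λ j → *-assoc ⟦ not (below q j) ⟧ _ _)))) (trans (class-∑ Kq S F _) (∑-cong F λ f → class-∑ Kq S (allFin n) _))) ⟩
    δ * ∑ F (λ f → ∑ (allFin n) (λ j → class Kq S (λ S′ → ⟦ not (below q j) ⟧ * (⟦ val S′ (at i j) == f ⟧ * weight S′))))
      ≡⟨ trans (sym (∑-*ˡ F δ _)) (∑-cong F λ f → sym (∑-*ˡ (allFin n) δ _)) ⟩
    ∑ F (λ f → ∑ (allFin n) (λ j → δ * class Kq S (λ S′ → ⟦ not (below q j) ⟧ * (⟦ val S′ (at i j) == f ⟧ * weight S′))))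
      ≤⟨ ∑-mono F (λ f → ∑-mono (allFin n) (λ j → each f j)) ⟩
    ∑ F (λ f → ∑ (allFin n) (λ j → class Kq S weight))
      ≡⟨ trans (∑-cong F λ f → trans (∑-const (allFin n) _) (cong (_* class Kq S weight) (length-allFin n))) (trans (∑-const F _) (sym (*-assoc (length F) n _))) ⟩
    length F * n * class Kq S weight ∎
    where
    open ≤-Reasoning
    Kq = keep i q
    each : ∀ f j → δ * class Kq S (λ S′ → ⟦ not (below q j) ⟧ * (⟦ val S′ (at i j) == f ⟧ * weight S′)) ≤ class Kq S weight
    each f j with q ≤? toℕ j
    ... | yes le rewrite below-false q j le = ≤-trans (*-monoʳ-≤ δ (class-mono Kq S λ S′ _ → ≤-reflexive (+-identityʳ _))) (keep-hit S i q j f le)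
    ... | no gt  rewrite below-true q j (≰⇒> gt) = ≤-trans (≤-reflexive (trans (cong (δ *_) (trans (∑-cong spiders λ S′ → *-zeroʳ ⟦ agree Kq S S′ ⟧) (∑-zero spiders))) (*-zeroʳ δ))) z≤n

  avoid-sound : ∀ S i q F → ∑ F (λ f → ∑ (allFin n) (λ j → ⟦ not (below q j) ⟧ * ⟦ val S (at i j) == f ⟧)) ≡ 0 → ∀ j → q ≤ toℕ j → val S (at i j) ∉ F
  avoid-sound S i q F e j le = ∑⟦∉⟧ F _ (n≤0⇒n≡0 (≤-trans (∑-mono F λ f → ≤-trans (≤-reflexive (sym (trans (cong (λ b → ⟦ not b ⟧ * ⟦ val S (at i j) == f ⟧) (below-false q j le)) (+-identityʳ _)))) (∑-∈ (λ j → ⟦ not (below q j) ⟧ * ⟦ val S (at i j) == f ⟧) (∈-allFin j))) (≤-reflexive e)))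

  relations : ∀ {K} → KernelShape K → List (Pos → Bool)
  relations {K} κ = K ∷ map (λ i → keep i (toℕ (KernelShape.tip κ i))) (allFin s) ++ map (λ i → keep i 0) (allFin s)

  length-relations : ∀ {K} (κ : KernelShape K) → length (relations κ) ≡ 1 + (s + s)
  length-relations κ = cong suc (trans (length-++ (map (λ i → keep i (toℕ (KernelShape.tip κ i))) (allFin s)))
    (cong₂ _+_ (trans (length-map _ (allFin s)) (length-allFin s)) (trans (length-map _ (allFin s)) (length-allFin s))))

  module _ {K} (κ : KernelShape K) (A c N : ℕ) (tot>0 : 0 < totalMass)
    (rich≥ : totalMass ≤ A * ∑ spiders (λ S → ⟦ richSpider K c S ⟧ * weight S))
    (clash≤ : length clashes * (2 * A) ≤ δ) (N<c : loss s A * N < c) (N<δ : loss s A * (N * n) < δ) where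

    P₀ : Spider → Bool
    P₀ S = richSpider K c S ∧ (simple S ∧ (1 ≤ᵇ weight S))

    closed-from : ∀ P → (∀ {S} → P S ≡ true → P₀ S ≡ true) →
      Closed spiders (relations κ) agree agree-equivalence (λ S → loss s A * weight S) weight P →
      ∑ spiders (λ S → ⟦ P₀ S ⟧ * (loss s A * weight S)) ≤ ∑ spiders (λ S → ⟦ P S ⟧ * (loss s A * weight S)) + length (relations κ) * totalMass →
      ClosedSystem K κ N (loss s A)
    closed-from P sub closed le₀ = record
      { good = P ; S₀ = proj₁ origin ; good-S₀ = proj₁ (proj₂ origin)
      ; distinct = λ g → simple-distinct (proj₁ (proj₂ (base g)))
      ; positive = λ g → proj₂ (proj₂ (base g))
      ; moveA = mA ; moveB = mB
      ; dense = λ g i → cl-class (there (∈-++⁺ʳ (map (λ i → keep i (toℕ (tip i))) (allFin s)) (∈-map⁺ (λ i → keep i 0) (∈-allFin i)))) g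
      }
      where
      open ≤-Reasoning
      open KernelShape κ
      Q = loss s A
      es = relations κ
      m : (Spider → Bool) → ℕ
      m R = ∑ spiders (λ S → ⟦ R S ⟧ * weight S)
      base : ∀ {S} → P S ≡ true → richSpider K c S ≡ true × simple S ≡ true × 0 < weight S
      base {S} g with ∧-true {richSpider K c S} (sub g)
      ... | r , q with ∧-true {simple S} q
      ...   | sm , w = r , sm , ≤ᵇ-true w
      cl-class : ∀ {e S} → e ∈ es → P S ≡ true → class e S weight ≤ Q * class e S (λ S′ → ⟦ P S′ ⟧ * weight S′)
      cl-class {e} {S} i g = ≤-trans (closed i (∈spiders S) g) (≤-reflexive (trans
        (∑-cong spiders λ S′ → cong (⟦ agree e S S′ ⟧ *_) (x*yz≡y*xz ⟦ P S′ ⟧ Q (weight S′))) (class-*ˡ e S Q _)))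
      split : m (richSpider K c) ≤ m P₀ + m (λ S → not (simple S))
      split = ≤-trans (∑-mono spiders pt) (≤-reflexive (∑-+ spiders _ _))
        where
        pt : ∀ S → ⟦ richSpider K c S ⟧ * weight S ≤ ⟦ P₀ S ⟧ * weight S + ⟦ not (simple S) ⟧ * weight S
        pt S with richSpider K c S | simple S | weight S
        ... | false | _     | _     = z≤n
        ... | true  | false | w     = ≤-refl
        ... | true  | true  | zero  = z≤n
        ... | true  | true  | suc w = m≤m+n _ _
      -- Rich spiders have the proportion `1 / A` of the mass, and by `clash≤` those that are not
      -- simple take at most half of it.
      P₀-large : totalMass ≤ 2 * A * m P₀
      P₀-large = +-cancelʳ-≤ totalMass totalMass (2 * A * m P₀) (begin
        totalMass + totalMass ≤⟨ +-mono-≤ rich≥ rich≥ ⟩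
        A * m (richSpider K c) + A * m (richSpider K c) ≡⟨ solve 2 (λ A x → A :* x :+ A :* x := con 2 :* A :* x) refl A (m (richSpider K c)) ⟩
        2 * A * m (richSpider K c) ≤⟨ *-monoʳ-≤ (2 * A) split ⟩
        2 * A * (m P₀ + m (λ S → not (simple S))) ≡⟨ *-distribˡ-+ (2 * A) (m P₀) _ ⟩
        2 * A * m P₀ + 2 * A * m (λ S → not (simple S)) ≤⟨ +-monoʳ-≤ (2 * A * m P₀) (not-simple-mass (2 * A) clash≤) ⟩
        2 * A * m P₀ + totalMass ∎)
      P₀>0 : 0 < m P₀
      P₀>0 = 0<t≤c*x (2 * A) tot>0 P₀-large
      -- If nothing survived the closure, the mass of `P₀` times `loss s A` would be at most
      -- `1 + (s + s)` times the total mass, against the choice of `loss`.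
      P>0 : 0 < ∑ spiders (λ S → ⟦ P S ⟧ * (Q * weight S))
      P>0 = pos _ le₀
        where
        pos : ∀ x → ∑ spiders (λ S → ⟦ P₀ S ⟧ * (Q * weight S)) ≤ x + length es * totalMass → 0 < x
        pos (suc _) _ = z<s
        pos zero le = ⊥-elim (<-irrefl refl (begin-strict
            length es * totalMass ≡⟨ cong (_* totalMass) (length-relations κ) ⟩
            (1 + (s + s)) * totalMass ≤⟨ *-monoʳ-≤ (1 + (s + s)) P₀-large ⟩
            (1 + (s + s)) * (2 * A * m P₀) ≡⟨ sym (*-assoc (1 + (s + s)) (2 * A) (m P₀)) ⟩
            (1 + (s + s)) * (2 * A) * m P₀ <⟨ <-≤-trans (m<n+m _ P₀>0) (≤-reflexive (cong (_* m P₀) (sym (loss-≡ s A)))) ⟩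
            Q * m P₀ ≡⟨ sym (trans (∑-cong spiders λ S → x*yz≡y*xz ⟦ P₀ S ⟧ Q (weight S)) (∑-*ˡ spiders Q _)) ⟩
            ∑ spiders (λ S → ⟦ P₀ S ⟧ * (Q * weight S)) ≤⟨ le ⟩
            length es * totalMass ∎))
      origin : ∃ λ S → P S ≡ true × 0 < Q * weight S
      origin with ∑-pos spiders _ P>0
      ... | S , _ , lt = S , ⟦⟧-pos (P S) lt
      -- Good spiders fill the proportion `1 / Q` of the class. If the `bad` mass, counted with
      -- multiplicity, is smaller than that, some good spider has the value 0.
      move : ∀ {e S} → e ∈ es → P S ≡ true → ∀ (bad : Spider → ℕ) → Q * class e S (λ S′ → bad S′ * weight S′) < class e S weight →
             ∃ λ S′ → P S′ ≡ true × agree e S S′ ≡ true × bad S′ ≡ 0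
      move {e} {S} i g bad lt with ∑-< spiders _ _ (*-cancelˡ-< Q _ _ (<-≤-trans lt (cl-class i g)))
      ... | S′ , _ , lt′ with agree e S S′ in ag | P S′ in g′
      ...   | false | _ = ⊥-elim (<-irrefl refl lt′)
      ...   | true | false = ⊥-elim (n≮0 lt′)
      ...   | true | true with bad S′ in b
      ...     | zero = S′ , g′ , ag , b
      ...     | suc k = ⊥-elim (<-irrefl refl (<-≤-trans lt′ (≤-trans (≤-reflexive (trans (+-identityʳ _) (+-identityʳ _))) (≤-trans (m≤m+n (weight S′) _) (≤-reflexive (sym (+-identityʳ _)))))))
      class>0 : ∀ {S} e → P S ≡ true → 0 < class e S weight
      class>0 {S} e g = <-≤-trans (proj₂ (proj₂ (base g))) (class-self e S weight)
      mA : ∀ {S} → P S ≡ true → ∀ F → length F ≤ N → ∃ λ S′ → P S′ ≡ true × agree K S S′ ≡ true × (∀ p → K p ≡ false → val S′ p ∉ F)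
      mA {S} g F F≤ with move (here refl) g (λ S′ → ∑ F (λ f → hits K f S′)) (Q*X<m {c} {Q} {N} (begin
          c * class K S (λ S′ → ∑ F (λ f → hits K f S′) * weight S′) ≡⟨ cong (c *_) (trans (∑-cong spiders λ S′ → cong (⟦ agree K S S′ ⟧ *_) (sym (∑-*ʳ F (weight S′) _))) (class-∑ K S F _)) ⟩
          c * ∑ F (λ f → class K S (λ S′ → hits K f S′ * weight S′)) ≡⟨ sym (∑-*ˡ F c _) ⟩
          ∑ F (λ f → c * class K S (λ S′ → hits K f S′ * weight S′)) ≤⟨ ∑-mono F (λ f → ≤ᵇ-true (every-true {xs = vs} {richAt K c S} (proj₁ (base g)) (∈vs f))) ⟩
          ∑ F (λ f → class K S weight) ≡⟨ ∑-const F _ ⟩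
          length F * class K S weight ≤⟨ *-monoˡ-≤ (class K S weight) F≤ ⟩
          N * class K S weight ∎) N<c (class>0 K g))
      ... | S′ , g′ , ag , none = S′ , g′ , ag , λ p k → ∑⟦∉⟧ F _ (n≤0⇒n≡0 (≤-trans (∑-mono F λ f →
            ≤-trans (≤-reflexive (sym (trans (cong (λ b → ⟦ not b ⟧ * ⟦ val S′ p == f ⟧) k) (+-identityʳ _)))) (∑-∈ (λ p → ⟦ not (K p) ⟧ * ⟦ val S′ p == f ⟧) (∈poss p))) (≤-reflexive none)))
      mB : ∀ {S} → P S ≡ true → ∀ i F → length F ≤ N → ∃ λ S′ → P S′ ≡ true × agree (keep i (toℕ (tip i))) S S′ ≡ true × (∀ j → toℕ (tip i) ≤ toℕ j → val S′ (at i j) ∉ F)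
      mB {S} g i F F≤ with move (there (∈-++⁺ˡ (∈-map⁺ (λ i → keep i (toℕ (tip i))) (∈-allFin i)))) g
          (λ S′ → ∑ F (λ f → ∑ (allFin n) (λ j → ⟦ not (below (toℕ (tip i)) j) ⟧ * ⟦ val S′ (at i j) == f ⟧)))
          (Q*X<m {δ} {Q} {N * n} (≤-trans (avoid-mass S i (toℕ (tip i)) F) (*-monoˡ-≤ (class (keep i (toℕ (tip i))) S weight) (*-monoˡ-≤ n F≤))) N<δ (class>0 (keep i (toℕ (tip i))) g))
      ... | S′ , g′ , ag , none = S′ , g′ , ag , avoid-sound S′ i (toℕ (tip i)) F none

  closed-system : ∀ {K} (κ : KernelShape K) (A c N : ℕ) → 0 < totalMass →
    totalMass ≤ A * ∑ spiders (λ S → ⟦ richSpider K c S ⟧ * weight S) →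
    length clashes * (2 * A) ≤ δ → loss s A * N < c → loss s A * (N * n) < δ →
    ClosedSystem K κ N (loss s A)
  closed-system κ A c N tot>0 rich≥ clash≤ N<c N<δ =
    let P , sub , cl , le = closure spiders (relations κ) agree agree-equivalence (λ S → loss s A * weight S) weight (P₀ κ A c N tot>0 rich≥ clash≤ N<c N<δ)
    in closed-from κ A c N tot>0 rich≥ clash≤ N<c N<δ P sub cl le

-- Subdivisions

∉-++ : ∀ {X : Set} {x : X} {xs ys} → x ∉ xs → x ∉ ys → x ∉ xs ++ ys
∉-++ {xs = xs} p q i with ∈-++⁻ xs i
... | inj₁ a = p a
... | inj₂ b = q b

unique-++ : ∀ {X : Set} {xs ys : List X} → Unique xs → Unique ys → (∀ {x} → x ∈ xs → x ∉ ys) → Unique (xs ++ ys)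
unique-++ ux uy dis = Uniqueₚ.++⁺ ux uy (λ { (i , j) → dis i j })

unique-∷ : ∀ {X : Set} {x : X} {xs} → x ∉ xs → Unique xs → Unique (x ∷ xs)
unique-∷ {x = x} {xs} nx u = All.tabulate (λ { i refl → nx i }) ∷ u

module Trails (Γ : WeightedGraph) where
  open WeightedGraph Γ

  infixr 5 _∷_
  -- The list omits the start and contains the end, so that concatenation repeats no vertex.
  data Trail : V → List V → V → Set where
    []  : ∀ {u} → Trail u [] u
    _∷_ : ∀ {u w T v} → adj u w ≡ true → Trail w T v → Trail u (w ∷ T) v

  _++ᵗ_ : ∀ {u v w S T} → Trail u S v → Trail v T w → Trail u (S ++ T) w
  []      ++ᵗ t = t
  (e ∷ s) ++ᵗ t = e ∷ (s ++ᵗ t)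

  -- P lists the interior vertices only.
  data Walk : V → List V → V → Set where
    [_] : ∀ {u v} → adj u v ≡ true → Walk u [] v
    _∷_ : ∀ {u w P v} → adj u w ≡ true → Walk w P v → Walk u (w ∷ P) v

  _++ʷ_ : ∀ {u v w S P} → Trail u S v → Walk v P w → Walk u (S ++ P) w
  []      ++ʷ t = t
  (e ∷ s) ++ʷ t = e ∷ (s ++ʷ t)

  snoc : ∀ {u P v w} → Walk u P v → adj v w ≡ true → Walk u (P ++ v ∷ []) w
  snoc [ e ]   e′ = e ∷ [ e′ ]
  snoc (e ∷ x) e′ = e ∷ snoc x e′

  -- The lists `path` hold interior vertices only, so `m` is one less than the length of the
  -- subdividing paths.
  record Subdivision (s t r m : ℕ) : Set where
    field
      left       : Fin s → V
      right      : Fin t → V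
      path       : Fin s → Fin t → Fin r → List V
      walk       : ∀ a b ρ → Walk (left a) (path a b ρ) (right b)
      length≡    : ∀ a b ρ → length (path a b ρ) ≡ m
      left-inj   : ∀ {a a′} → left a ≡ left a′ → a ≡ a′
      right-inj  : ∀ {b b′} → right b ≡ right b′ → b ≡ b′
      left≢right : ∀ {a b} → left a ≢ right b
      path≢left  : ∀ {a b ρ a′} → left a′ ∉ path a b ρ
      path≢right : ∀ {a b ρ b′} → right b′ ∉ path a b ρ
      unique     : ∀ a b ρ → Unique (path a b ρ)
      disjoint   : ∀ {a b ρ a′ b′ ρ′ x} → x ∈ path a b ρ → x ∈ path a′ b′ ρ′ → a ≡ a′ × b ≡ b′ × ρ ≡ ρ′

  -- The forbidden set absorbs each chosen item, at most `v` vertices at a time, and stays within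
  -- the bound `N` under which `pick` works.
  greedy : ∀ {Item : Set} (verts : Item → List V) (N v : ℕ) n (Good : Fin n → Item → Set) →
    (∀ e F → length F ≤ N → ∃ λ it → Good e it × length (verts it) ≤ v × (∀ {x} → x ∈ verts it → x ∉ F)) →
    ∀ F → length F + n * v ≤ N →
    ∃ λ (f : Fin n → Item) → (∀ e → Good e (f e)) × (∀ e {x} → x ∈ verts (f e) → x ∉ F) ×
      (∀ e e′ {x} → x ∈ verts (f e) → x ∈ verts (f e′) → e ≡ e′)
  greedy verts N v zero    Good pick F le = (λ ()) , (λ ()) , (λ ()) , (λ ())
  greedy {Item} verts N v (suc n) Good pick F le with pick zero F (≤-trans (m≤m+n _ _) le)
  ... | it , good , len , av with greedy verts N v n (λ e → Good (suc e)) (λ e → pick (suc e)) (verts it ++ F) (begin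
      length (verts it ++ F) + n * v ≡⟨ cong (_+ n * v) (length-++ (verts it)) ⟩
      length (verts it) + length F + n * v ≤⟨ +-monoˡ-≤ (n * v) (+-monoˡ-≤ (length F) len) ⟩
      v + length F + n * v ≡⟨ solve 3 (λ v f x → v :+ f :+ x := f :+ (v :+ x)) refl v (length F) (n * v) ⟩
      length F + (v + n * v) ≤⟨ le ⟩
      N ∎)
    where open ≤-Reasoning
  ...   | f , goods , avs , dis = g , gg , ga , gd
    where
    g : Fin (suc n) → Item
    g zero    = it
    g (suc e) = f e
    gg : ∀ e → Good e (g e)
    gg zero    = good
    gg (suc e) = goods e
    ga : ∀ e {x} → x ∈ verts (g e) → x ∉ F
    ga zero    i = av i
    ga (suc e) i j = avs e i (∈-++⁺ʳ (verts it) j)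
    gd : ∀ e e′ {x} → x ∈ verts (g e) → x ∈ verts (g e′) → e ≡ e′
    gd zero    zero     i j = refl
    gd zero    (suc e′) i j = ⊥-elim (avs e′ j (∈-++⁺ˡ i))
    gd (suc e) zero     i j = ⊥-elim (avs e i (∈-++⁺ˡ j))
    gd (suc e) (suc e′) i j = cong suc (dis e e′ i j)

  -- The branch vertices lie in `B`, which is forbidden to all interiors; the paths are then picked
  -- greedily, with the triple `(a , b , ρ)` coded as one index.
  linked-subdivision : ∀ s t r m N (left : Fin s → V) (right : Fin t → V) (B : List V) →
    (∀ {a a′} → left a ≡ left a′ → a ≡ a′) → (∀ {b b′} → right b ≡ right b′ → b ≡ b′) → (∀ {a b} → left a ≢ right b) →
    (∀ a → left a ∈ B) → (∀ b → right b ∈ B) → length B + s * (t * r) * m ≤ N →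
    (∀ a b F → length F ≤ N → (∀ {x} → x ∈ B → x ∈ F) → ∃ λ P → Walk (left a) P (right b) × length P ≡ m × Unique P × (∀ {x} → x ∈ P → x ∉ F)) →
    Subdivision s t r m
  linked-subdivision s t r m N left right B li ri lr lB rB le link = record
    { left = left ; right = right ; path = λ a b ρ → f (idx a b ρ)
    ; walk = λ a b ρ → subst (λ e → Walk (left (proj₁ e)) (f (idx a b ρ)) (right (proj₂ e))) (decode a b ρ) (proj₁ (good (idx a b ρ)))
    ; length≡ = λ a b ρ → proj₁ (proj₂ (good (idx a b ρ)))
    ; left-inj = li ; right-inj = ri ; left≢right = lr
    ; path≢left = λ i → proj₂ (proj₂ (proj₂ (good _))) i (lB _)
    ; path≢right = λ i → proj₂ (proj₂ (proj₂ (good _))) i (rB _)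
    ; unique = λ a b ρ → proj₁ (proj₂ (proj₂ (good (idx a b ρ))))
    ; disjoint = dis
    }
    where
    idx : Fin s → Fin t → Fin r → Fin (s * (t * r))
    idx a b ρ = combine a (combine b ρ)
    ends : Fin (s * (t * r)) → Fin s × Fin t
    ends e = proj₁ (remQuot {s} (t * r) e) , proj₁ (remQuot {t} r (proj₂ (remQuot {s} (t * r) e)))
    decode : ∀ a b ρ → ends (idx a b ρ) ≡ (a , b)
    decode a b ρ = trans (cong (λ q → proj₁ q , proj₁ (remQuot {t} r (proj₂ q))) (remQuot-combine {s} {t * r} a (combine b ρ)))
                         (cong (λ q → a , proj₁ q) (remQuot-combine {t} {r} b ρ))
    Good : Fin (s * (t * r)) → List V → Set
    Good e P = Walk (left (proj₁ (ends e))) P (right (proj₂ (ends e))) × length P ≡ m × Unique P × (∀ {x} → x ∈ P → x ∉ B)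
    pick : ∀ e F → length F ≤ N ∸ length B → ∃ λ P → Good e P × length P ≤ m × (∀ {x} → x ∈ P → x ∉ F)
    pick e F F≤ with link (proj₁ (ends e)) (proj₂ (ends e)) (B ++ F) (≤-trans (≤-reflexive (length-++ B)) (≤-trans (+-monoʳ-≤ (length B) F≤) (≤-reflexive (m+[n∸m]≡n {length B} {N} (≤-trans (m≤m+n (length B) _) le))))) ∈-++⁺ˡ
    ... | P , w , len , u , av = P , (w , len , u , λ i j → av i (∈-++⁺ˡ j)) , ≤-reflexive len , λ i j → av i (∈-++⁺ʳ B j)
    all = greedy (λ P → P) (N ∸ length B) m (s * (t * r)) Good pick [] (cancel (length B) le)
      where
      cancel : ∀ a {x o} → a + x ≤ o → x ≤ o ∸ a
      cancel a {x} q = ≤-trans (≤-reflexive (sym (m+n∸m≡n a x))) (∸-monoˡ-≤ a q)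
    f = proj₁ all
    good = proj₁ (proj₂ all)
    dis : ∀ {a b ρ a′ b′ ρ′ x} → x ∈ f (idx a b ρ) → x ∈ f (idx a′ b′ ρ′) → a ≡ a′ × b ≡ b′ × ρ ≡ ρ′
    dis {a} {b} {ρ} {a′} {b′} {ρ′} i j with combine-injective a (combine b ρ) a′ (combine b′ ρ′) (proj₂ (proj₂ (proj₂ all)) _ _ i j)
    ... | refl , e with combine-injective b ρ b′ ρ′ e
    ...   | refl , refl = refl , refl , refl

-- Moving the tips of a spider

-- The order is descending because the interior of a leg is read from its tip towards the centre.
desc : ∀ {n} → Fin n → List (Fin n)
desc zero    = []
desc (suc j) = map suc (desc j) ++ zero ∷ []

length-desc : ∀ {n} (j : Fin n) → length (desc j) ≡ toℕ j
length-desc zero    = refl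
length-desc (suc j) = trans (length-++ (map suc (desc j))) (trans (+-comm _ 1) (cong suc (trans (length-map suc (desc j)) (length-desc j))))

∈-desc : ∀ {n} (j : Fin n) {i} → i ∈ desc j → toℕ i < toℕ j
∈-desc (suc j) i∈ with ∈-++⁻ (map suc (desc j)) i∈
... | inj₂ (here refl) = z<s
... | inj₁ k with ∈-map⁻ suc k
...   | i , k′ , refl = s<s (∈-desc j k′)

unique-desc : ∀ {n} (j : Fin n) → Unique (desc j)
unique-desc zero    = []
unique-desc (suc j) = unique-++ (Uniqueₚ.map⁺ (λ { refl → refl }) (unique-desc j)) ([] ∷ []) zero∉
  where
  zero∉ : ∀ {x} → x ∈ map suc (desc j) → x ∉ zero ∷ []
  zero∉ i (here refl) with ∈-map⁻ suc i
  ... | _ , _ , ()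

∑-δ-Fin : ∀ s (i : Fin s) (g : Fin s → ℕ) → ∑ (allFin s) (λ j → ⟦ does (j Fin.≟ i) ⟧ * g j) ≡ g i
∑-δ-Fin s i g = trans (∑-tabulate s (λ j → ⟦ does (j Fin.≟ i) ⟧ * g j)) (go s i g)
  where
  ∑F : ∀ s → (Fin s → ℕ) → ℕ
  ∑F zero    f = 0
  ∑F (suc s) f = f zero + ∑F s (λ i → f (suc i))
  ∑-tab : ∀ {X : Set} s (h : Fin s → X) (f : X → ℕ) → ∑ (Data.List.tabulate h) f ≡ ∑F s (λ i → f (h i))
  ∑-tab zero    h f = refl
  ∑-tab (suc s) h f = cong (f (h zero) +_) (∑-tab s (λ i → h (suc i)) f)
  ∑-tabulate : ∀ s (f : Fin s → ℕ) → ∑ (allFin s) f ≡ ∑F s f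
  ∑-tabulate s f = ∑-tab s (λ x → x) f
  zeros : ∀ s → ∑F s (λ _ → 0) ≡ 0
  zeros zero    = refl
  zeros (suc s) = zeros s
  go : ∀ s (i : Fin s) g → ∑F s (λ j → ⟦ does (j Fin.≟ i) ⟧ * g j) ≡ g i
  go (suc s) zero    g = trans (cong₂ _+_ (+-identityʳ (g zero)) (zeros s)) (+-identityʳ _)
  go (suc s) (suc i) g = go s i (λ j → g (suc j))

module Growth (Γ : WeightedGraph) (s n : ℕ) (μ : WeightedGraph.V Γ → ℕ) (δ : ℕ) (δ≤d : MinDegree Γ δ) where
  open WeightedGraph Γ
  open Kernel Γ
  open Spiders Γ s n μ
  open Systems Γ s n μ δ δ≤d
  open Trails Γ

  before : ∀ {n} → V → Vec V n → Fin n → V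
  before u x zero    = u
  before u x (suc j) = lookup x (inject₁ j)

  leg-adj : ∀ {n} {u} (x : Vec V n) → 0 < wt u x → ∀ j → adj (before u x j) (lookup x j) ≡ true
  leg-adj {u = u} (v ∷ x) lt zero    = p1-pos (proj₁ (pos-* (p1 u v) lt))
  leg-adj {u = u} (v ∷ x) lt (suc j) = subst (λ z → adj z (lookup x j) ≡ true) (same j) (leg-adj x (proj₂ (pos-* (p1 u v) lt)) j)
    where
    same : ∀ j → before v x j ≡ lookup (v ∷ x) (inject₁ j)
    same zero    = refl
    same (suc j) = refl

  leg-walk : ∀ {n} {u} (x : Vec V n) → 0 < wt u x → ∀ j → Walk (lookup x j) (map (lookup x) (desc j)) u
  leg-walk {u = u} (v ∷ x) lt zero    = [ trans (adj-sym v u) (p1-pos (proj₁ (pos-* (p1 u v) lt))) ]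
  leg-walk {u = u} (v ∷ x) lt (suc j) = subst (λ P → Walk (lookup x j) P u) (sym (trans (map-++ (lookup (v ∷ x)) (map suc (desc j)) (zero ∷ [])) (cong (_++ v ∷ []) (sym (map-∘ (desc j))))))
    (snoc (leg-walk x (proj₂ (pos-* (p1 u v) lt)) j) (trans (adj-sym v u) (p1-pos (proj₁ (pos-* (p1 u v) lt)))))

  leg-positive : ∀ {S} → 0 < weight S → ∀ i → 0 < wt (proj₁ S) (lookup (proj₂ S) i)
  leg-positive {y , l} lt i = ∏-pos s (proj₂ (pos-* (μ y) lt)) i

  module Moves {K : Pos → Bool} (κ : KernelShape K) {N Q : ℕ} (C : ClosedSystem K κ N Q) where
    open KernelShape κ
    open ClosedSystem C

    tipOf : Spider → Fin s → V
    tipOf S i = val S (at i (tip i))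

    preAt : Fin s → Fin n → Pos
    preAt i zero    = ctr
    preAt i (suc j) = at i (inject₁ j)

    pre : Fin s → Pos
    pre i = preAt i (tip i)

    preAt-K : ∀ i j → (∀ j′ → toℕ j′ < toℕ j → K (at i j′) ≡ false) → K (preAt i j) ≡ false
    preAt-K i zero    h = K-ctr
    preAt-K i (suc j) h = h (inject₁ j) (subst (_< suc (toℕ j)) (sym (toℕ-inject₁ j)) ≤-refl)

    pre-K : ∀ i → K (pre i) ≡ false
    pre-K i = preAt-K i (tip i) (K-pre i)

    keep-pre : ∀ i → keep i (toℕ (tip i)) (pre i) ≡ true
    keep-pre i = go (tip i)
      where
      go : ∀ j → keep i (toℕ j) (preAt i j) ≡ true
      go zero    = refl
      go (suc j) = trans (keep-same i (suc (toℕ j)) (inject₁ j)) (below-true (suc (toℕ j)) (inject₁ j) (subst (_< suc (toℕ j)) (sym (toℕ-inject₁ j)) ≤-refl))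

    adj-pre : ∀ {S} → good S ≡ true → ∀ i → adj (val S (pre i)) (tipOf S i) ≡ true
    adj-pre {S} g i = subst (λ z → adj z (tipOf S i) ≡ true) (same (tip i)) (leg-adj (lookup (proj₂ S) i) (leg-positive {S} (positive g) i) (tip i))
      where
      same : ∀ j → before (proj₁ S) (lookup (proj₂ S) i) j ≡ val S (preAt i j)
      same zero    = refl
      same (suc j) = refl

    interior : Spider → Fin s → List V
    interior S i = map (lookup (lookup (proj₂ S) i)) (desc (tip i))

    interior-walk : ∀ {S} → good S ≡ true → ∀ i → Walk (tipOf S i) (interior S i) (val S ctr)
    interior-walk {S} g i = leg-walk (lookup (proj₂ S) i) (leg-positive {S} (positive g) i) (tip i)

    length-interior : ∀ S i → length (interior S i) ≡ toℕ (tip i)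
    length-interior S i = trans (length-map _ (desc (tip i))) (length-desc (tip i))

    ∈-interior : ∀ {S i x} → x ∈ interior S i → ∃ λ j → toℕ j < toℕ (tip i) × x ≡ val S (at i j)
    ∈-interior {S} {i} x∈ with ∈-map⁻ _ x∈
    ... | j , k , e = j , ∈-desc (tip i) k , e

    unique-interior : ∀ {S} → good S ≡ true → ∀ i → Unique (interior S i)
    unique-interior {S} g i = Uniqueₚ.map⁺ (λ {j} {j′} e → at-inj (distinct g (at i j) (at i j′) e)) (unique-desc (tip i))
      where
      at-inj : ∀ {j j′} → at i j ≡ at i j′ → j ≡ j′
      at-inj refl = refl

    Fresh : Spider → List V → Set
    Fresh S F = ∀ p → K p ≡ false → val S p ∉ F

    interior-fresh : ∀ {S F} → Fresh S F → ∀ i {x} → x ∈ interior S i → x ∉ F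
    interior-fresh {S} fr i x∈ with ∈-interior {S} {i} x∈
    ... | j , lt , refl = fr (at i j) (K-pre i j lt)

    -- Each step leaves the tip of leg i through its predecessor on the leg, returns to a new tip,
    -- and then replaces the whole body of the spider.
    extend : ∀ m {S} i F → good S ≡ true → Fresh S F → length F + 2 * m ≤ N →
      ∃ λ S′ → good S′ ≡ true × (∀ i′ → i′ ≢ i → tipOf S′ i′ ≡ tipOf S i′) × ∃ λ T → length T ≡ 2 * m ×
        Trail (tipOf S i) T (tipOf S′ i) × Unique T × (∀ {x} → x ∈ T → x ∉ F) × Fresh S′ (T ++ F)
    extend zero {S} i F g fr le = S , g , (λ _ _ → refl) , [] , refl , [] , [] , (λ ()) , fr
    extend (suc m) {S} i F g fr le with moveB g i (val S (pre i) ∷ F) (≤-trans (≤-trans (≤-reflexive (+-comm 1 (length F))) (+-monoʳ-≤ (length F) {1} (s≤s z≤n))) le)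
    ... | S₁ , g₁ , ag₁ , new with moveA g₁ (tipOf S₁ i ∷ val S (pre i) ∷ F) (≤-trans (≤-trans (≤-reflexive (+-comm 2 (length F))) (+-monoʳ-≤ (length F) {2} (*-monoʳ-≤ 2 {1} {suc m} (s≤s z≤n)))) le)
    ... | S₂ , g₂ , ag₂ , fr₂ with extend m i (tipOf S₁ i ∷ val S (pre i) ∷ F) g₂ fr₂ (≤-trans (≤-reflexive (solve 2 (λ f m → con 2 :+ f :+ con 2 :* m := f :+ con 2 :* (con 1 :+ m)) refl (length F) m)) le)
    ... | S₃ , g₃ , other , T , len , tr , u , av , fr₃ =
      S₃ , g₃ , other′ , val S (pre i) ∷ tipOf S₁ i ∷ T , trans (cong (2 +_) len) (sym (*-suc 2 m)) ,
      trans (adj-sym (tipOf S i) (val S (pre i))) (adj-pre {S} g i) ∷ adj₁ ∷ subst (λ v → Trail v T (tipOf S₃ i)) (sym (same-tip i)) tr ,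
      unique-∷ (λ { (here e) → new′ (here (sym e)) ; (there k) → av k (there (here refl)) }) (unique-∷ (λ k → av k (here refl)) u) ,
      (λ { (here refl) → fr (pre i) (pre-K i) ; (there (here refl)) k → new′ (there k) ; (there (there k)) k′ → av k (there (there k′)) }) ,
      λ p k → reorder p (fr₃ p k)
      where
      new′ : tipOf S₁ i ∉ val S (pre i) ∷ F
      new′ = new (tip i) ≤-refl
      same-tip : ∀ i′ → tipOf S₁ i′ ≡ tipOf S₂ i′
      same-tip i′ = agree-sound {K} {S₁} {S₂} ag₂ (at i′ (tip i′)) (K-tip i′)
      adj₁ : adj (val S (pre i)) (tipOf S₁ i) ≡ true
      adj₁ = subst (λ v → adj v (tipOf S₁ i) ≡ true) (sym (agree-sound {keep i (toℕ (tip i))} {S} {S₁} ag₁ (pre i) (keep-pre i))) (adj-pre {S₁} g₁ i)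
      other′ : ∀ i′ → i′ ≢ i → tipOf S₃ i′ ≡ tipOf S i′
      other′ i′ ne = trans (other i′ ne) (trans (sym (same-tip i′)) (sym (agree-sound {keep i (toℕ (tip i))} {S} {S₁} ag₁ (at i′ (tip i′)) (keep-other (toℕ (tip i)) (tip i′) ne))))
      reorder : ∀ p → val S₃ p ∉ T ++ tipOf S₁ i ∷ val S (pre i) ∷ F → val S₃ p ∉ val S (pre i) ∷ tipOf S₁ i ∷ T ++ F
      reorder p h (here e)          = h (∈-++⁺ʳ T (there (here e)))
      reorder p h (there (here e))  = h (∈-++⁺ʳ T (here e))
      reorder p h (there (there k)) with ∈-++⁻ T k
      ... | inj₁ a = h (∈-++⁺ˡ a)
      ... | inj₂ b = h (∈-++⁺ʳ T (there (there b)))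

    -- Extending one leg leaves the other tips in place and keeps the body off all vertices used so
    -- far, so the legs can be treated in turn. A leg is extended once for each occurrence in `is`,
    -- whence the sum in the length of `T i`.
    extendAll : ∀ (m : Fin s → ℕ) (is : List (Fin s)) {S} F → good S ≡ true → Fresh S F → length F + ∑ is (λ i → 2 * m i) ≤ N →
      ∃ λ S′ → good S′ ≡ true × ∃ λ (T : Fin s → List V) → (∀ i → length (T i) ≡ ∑ is (λ i′ → ⟦ does (i′ Fin.≟ i) ⟧ * (2 * m i′))) ×
        (∀ i → Trail (tipOf S i) (T i) (tipOf S′ i)) × (∀ i → Unique (T i)) × (∀ i {x} → x ∈ T i → x ∉ F) ×
        (∀ i i′ {x} → x ∈ T i → x ∈ T i′ → i ≡ i′) × Fresh S′ F × (∀ i → Fresh S′ (T i))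
    extendAll m [] {S} F g fr le = S , g , (λ _ → []) , (λ _ → refl) , (λ _ → []) , (λ _ → []) , (λ _ ()) , (λ _ _ ()) , fr , λ _ _ _ ()
    extendAll m (i ∷ is) {S} F g fr le with extend (m i) i F g fr (≤-trans (+-monoʳ-≤ (length F) (m≤m+n _ _)) le)
    ... | S₁ , g₁ , other , T₁ , len₁ , tr₁ , u₁ , av₁ , fr₁ with extendAll m is (T₁ ++ F) g₁ fr₁ (begin
        length (T₁ ++ F) + ∑ is (λ i → 2 * m i) ≡⟨ cong (_+ ∑ is (λ i → 2 * m i)) (trans (length-++ T₁) (cong (_+ length F) len₁)) ⟩
        2 * m i + length F + ∑ is (λ i → 2 * m i) ≡⟨ solve 3 (λ a b c → a :+ b :+ c := b :+ (a :+ c)) refl (2 * m i) (length F) _ ⟩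
        length F + (2 * m i + ∑ is (λ i → 2 * m i)) ≤⟨ le ⟩
        N ∎)
      where open ≤-Reasoning
    ... | S₂ , g₂ , T₂ , len₂ , tr₂ , u₂ , av₂ , dis₂ , fr₂ , frT₂ = S₂ , g₂ , T , lens , trs , us , avs , dis , (λ p k q → fr₂ p k (∈-++⁺ʳ T₁ q)) , frs
      where
      T : Fin s → List V
      T i′ with i Fin.≟ i′
      ... | yes _ = T₁ ++ T₂ i′
      ... | no _  = T₂ i′
      lens : ∀ i′ → length (T i′) ≡ ⟦ does (i Fin.≟ i′) ⟧ * (2 * m i) + ∑ is (λ j → ⟦ does (j Fin.≟ i′) ⟧ * (2 * m j))
      lens i′ with i Fin.≟ i′
      ... | yes _ = trans (length-++ T₁) (cong₂ _+_ (trans len₁ (sym (+-identityʳ _))) (len₂ i′))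
      ... | no _  = len₂ i′
      trs : ∀ i′ → Trail (tipOf S i′) (T i′) (tipOf S₂ i′)
      trs i′ with i Fin.≟ i′
      ... | yes refl = tr₁ ++ᵗ tr₂ i′
      ... | no ne    = subst (λ v → Trail v (T₂ i′) (tipOf S₂ i′)) (other i′ (λ e → ne (sym e))) (tr₂ i′)
      us : ∀ i′ → Unique (T i′)
      us i′ with i Fin.≟ i′
      ... | yes _ = unique-++ u₁ (u₂ i′) (λ a b → av₂ i′ b (∈-++⁺ˡ a))
      ... | no _  = u₂ i′
      T-cases : ∀ i′ {x} → x ∈ T i′ → (i ≡ i′ × x ∈ T₁) ⊎ x ∈ T₂ i′
      T-cases i′ k with i Fin.≟ i′
      ... | no _  = inj₂ k
      ... | yes e with ∈-++⁻ T₁ k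
      ...   | inj₁ a = inj₁ (e , a)
      ...   | inj₂ b = inj₂ b
      avs : ∀ i′ {x} → x ∈ T i′ → x ∉ F
      avs i′ k with T-cases i′ k
      ... | inj₁ (_ , a) = av₁ a
      ... | inj₂ b = λ q → av₂ i′ b (∈-++⁺ʳ T₁ q)
      dis : ∀ i′ i″ {x} → x ∈ T i′ → x ∈ T i″ → i′ ≡ i″
      dis i′ i″ k k′ with T-cases i′ k | T-cases i″ k′
      ... | inj₁ (refl , _) | inj₁ (refl , _) = refl
      ... | inj₁ (_ , a)    | inj₂ b          = ⊥-elim (av₂ i″ b (∈-++⁺ˡ a))
      ... | inj₂ b          | inj₁ (_ , a)    = ⊥-elim (av₂ i′ b (∈-++⁺ˡ a))
      ... | inj₂ b          | inj₂ b′         = dis₂ i′ i″ b b′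
      frs : ∀ i′ → Fresh S₂ (T i′)
      frs i′ p k q with T-cases i′ q
      ... | inj₁ (_ , a) = fr₂ p k (∈-++⁺ˡ a)
      ... | inj₂ b = frT₂ i′ p k b

half : ∀ d → (∃ λ m → 2 * m ≡ d) ⊎ (∃ λ m → 1 + 2 * m ≡ d)
half zero = inj₁ (0 , refl)
half (suc d) with half d
... | inj₁ (m , e) = inj₂ (m , cong suc e)
... | inj₂ (m , e) = inj₁ (suc m , trans (*-suc 2 m) (cong suc e))

-- `M ∸ τ` is the number of interior vertices missing when the final leg contributes `τ` of them.
-- Trails supply an even number, so the parity decides where the path starts.
parity-gap : ∀ {τ M} → τ ≤ M → (∃ λ m → 2 * m + τ ≡ M) ⊎ (∃ λ m → 1 + 2 * m + τ ≡ M)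
parity-gap {τ} {M} le with half (M ∸ τ)
... | inj₁ (m , e) = inj₁ (m , trans (cong (_+ τ) e) (m∸n+n≡m le))
... | inj₂ (m , e) = inj₂ (m , trans (cong (_+ τ) e) (m∸n+n≡m le))

-- Disjoint stars with common leaves

module Spread (Γ : WeightedGraph) (s n : ℕ) (μ : WeightedGraph.V Γ → ℕ) (δ : ℕ) (δ≤d : MinDegree Γ δ) where
  open WeightedGraph Γ
  open Kernel Γ
  open Spiders Γ s n μ
  open Systems Γ s n μ δ δ≤d
  open Trails Γ
  open Growth Γ s n μ δ δ≤d

  module _ {K : Pos → Bool} (κ : KernelShape K) {N Q : ℕ} (C : ClosedSystem K κ N Q) where
    open KernelShape κ
    open ClosedSystem C
    open Moves κ C

    -- For an odd gap the path starts at the predecessor of the tip, which must stay, and the tip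
    -- becomes an interior vertex that has to be renewed for every copy. The remaining tips are
    -- branch vertices and must not move.
    retip : ∀ (odd : Fin s → Bool) (is : List (Fin s)) {S} F → good S ≡ true → length F ≤ N →
      ∃ λ S′ → good S′ ≡ true × (∀ i j → toℕ j < toℕ (tip i) → val S′ (at i j) ≡ val S (at i j)) × val S′ ctr ≡ val S ctr ×
        (∀ i → odd i ≡ false → tipOf S′ i ≡ tipOf S i) × (∀ i → tipOf S i ∉ F → tipOf S′ i ∉ F) ×
        (∀ {i} → i ∈ is → odd i ≡ true → tipOf S′ i ∉ F)
    retip odd [] {S} F g le = S , g , (λ _ _ _ → refl) , refl , (λ _ _ → refl) , (λ _ h → h) , (λ ())
    retip odd (i ∷ is) {S} F g le with dichotomy (odd i)
    ... | inj₂ no-odd with retip odd is F g le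
    ...   | S′ , g′ , body , c , even , stay , out = S′ , g′ , body , c , even , stay , out′
      where
      out′ : ∀ {i′} → i′ ∈ i ∷ is → odd i′ ≡ true → tipOf S′ i′ ∉ F
      out′ (there k) o = out k o
      out′ (here refl) o with trans (sym o) no-odd
      ... | ()
    retip odd (i ∷ is) {S} F g le | inj₁ is-odd with moveB g i F le
    ... | S₁ , g₁ , ag , new with retip odd is F g₁ le
    ...   | S′ , g′ , body , c , even , stay , out =
      S′ , g′ , (λ i′ j lt → trans (body i′ j lt) (sym (agree-sound {keep i (toℕ (tip i))} {S} {S₁} ag (at i′ j) (kept i′ j lt)))) ,
      trans c (sym (agree-sound {keep i (toℕ (tip i))} {S} {S₁} ag ctr refl)) , even′ , stay′ , out′
      where
      kept : ∀ i′ j → toℕ j < toℕ (tip i′) → keep i (toℕ (tip i)) (at i′ j) ≡ true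
      kept i′ j lt with i′ Fin.≟ i
      ... | no _     = refl
      ... | yes refl = below-true (toℕ (tip i)) j lt
      tips : ∀ i′ → i′ ≢ i → tipOf S i′ ≡ tipOf S₁ i′
      tips i′ ne = agree-sound {keep i (toℕ (tip i))} {S} {S₁} ag (at i′ (tip i′)) (keep-other (toℕ (tip i)) (tip i′) ne)
      even′ : ∀ i′ → odd i′ ≡ false → tipOf S′ i′ ≡ tipOf S i′
      even′ i′ ev = trans (even i′ ev) (sym (tips i′ λ { refl → true≢false (trans (sym is-odd) ev) }))
      stay′ : ∀ i′ → tipOf S i′ ∉ F → tipOf S′ i′ ∉ F
      stay′ i′ h with i′ Fin.≟ i
      ... | yes refl = stay i′ (new (tip i′) ≤-refl)
      ... | no ne    = stay i′ (subst (_∉ F) (tips i′ ne) h)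
      out′ : ∀ {i′} → i′ ∈ i ∷ is → odd i′ ≡ true → tipOf S′ i′ ∉ F
      out′ (here refl) o = stay i (new (tip i) ≤-refl)
      out′ (there k)   o = out k o

    pre-cases : ∀ i → (toℕ (tip i) ≡ 0 × pre i ≡ ctr) ⊎ ∃ λ j → toℕ j < toℕ (tip i) × pre i ≡ at i j
    pre-cases i with tip i
    ... | zero  = inj₁ (refl , refl)
    ... | suc j = inj₂ (inject₁ j , s≤s (≤-reflexive (Data.Fin.Properties.toℕ-inject₁ j)) , refl)

    -- The boolean is the parity of the gap; the vertices of `S₀` at these positions become the left
    -- branch vertices.
    xpos : Bool → Fin s → Pos
    xpos true  i = pre i
    xpos false i = at i (tip i)

    at-leg : ∀ {i i′ j j′} → at i j ≡ at i′ j′ → i ≡ i′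
    at-leg refl = refl

    ctr≢at : ∀ {i j} → ctr ≢ at i j
    ctr≢at ()

    -- The predecessors of the tips of two legs can be the same position only if it is the centre;
    -- `one-short` excludes this.
    xpos-inj : (∀ i i′ → toℕ (tip i) ≡ 0 → toℕ (tip i′) ≡ 0 → i ≡ i′) → ∀ b b′ i i′ → xpos b i ≡ xpos b′ i′ → i ≡ i′
    xpos-inj one-short b b′ i i′ = go b b′ (pre-cases i) (pre-cases i′)
      where
      Cases : Fin s → Set
      Cases i = (toℕ (tip i) ≡ 0 × pre i ≡ ctr) ⊎ ∃ λ j → toℕ j < toℕ (tip i) × pre i ≡ at i j
      go : ∀ b b′ → Cases i → Cases i′ → xpos b i ≡ xpos b′ i′ → i ≡ i′
      go false false _ _ q = at-leg q
      go false true  _ (inj₁ (_ , r)) q = ⊥-elim (ctr≢at (trans (sym r) (sym q)))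
      go false true  _ (inj₂ (_ , _ , r)) q = at-leg (trans q r)
      go true  false (inj₁ (_ , r)) _ q = ⊥-elim (ctr≢at (trans (sym r) q))
      go true  false (inj₂ (_ , _ , r)) _ q = at-leg (trans (sym r) q)
      go true  true  (inj₁ (z , r)) (inj₁ (z′ , r′)) q = one-short i i′ z z′
      go true  true  (inj₂ (_ , _ , r)) (inj₂ (_ , _ , r′)) q = at-leg (trans (sym r) (trans q r′))
      go true  true  (inj₁ (_ , r)) (inj₂ (_ , _ , r′)) q = ⊥-elim (ctr≢at (trans (sym r) (trans q r′)))
      go true  true  (inj₂ (_ , _ , r)) (inj₁ (_ , r′)) q = ⊥-elim (ctr≢at (sym (trans (sym r) (trans q r′))))

    first : Bool → V → List V
    first true  v = v ∷ []
    first false v = []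

    ∈first : ∀ b {v z} → z ∈ first b v → b ≡ true × z ≡ v
    ∈first true (here e) = refl , e

    length-first : ∀ b v → length (first b v) ≡ ⟦ b ⟧
    length-first true  v = refl
    length-first false v = refl

    unique-first : ∀ b v → Unique (first b v)
    unique-first true  v = [] ∷ []
    unique-first false v = []

    Copy : Set
    Copy = V × (Fin s → List V)

    verts : Copy → List V
    verts (y , P) = y ∷ concatMap P (allFin s)

    record GoodCopy (x : Fin s → V) (M : ℕ) (F : List V) (c : Copy) : Set where
      field
        walk-to   : ∀ i → Walk (x i) (proj₂ c i) (proj₁ c)
        length-to : ∀ i → length (proj₂ c i) ≡ M
        unique-to : ∀ i → Unique (proj₂ c i)
        centre∉   : ∀ i → proj₁ c ∉ proj₂ c i
        legs-disj : ∀ i i′ {z} → z ∈ proj₂ c i → z ∈ proj₂ c i′ → i ≡ i′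
        avoids    : ∀ {z} → z ∈ verts c → z ∉ F

    -- An interior consists of the renewed tip (for an odd gap), the trail and the interior of the
    -- final leg; `par` counts these vertices. All tips of `S₂` lie in `G`, so the trails and the
    -- final spider avoid the renewed tips too.
    module Assemble (x : Fin s → V) (M : ℕ) (odd : Fin s → Bool) (m : Fin s → ℕ) (par : ∀ i → ⟦ odd i ⟧ + (2 * m i + toℕ (tip i)) ≡ M)
      (F G : List V) (F⊆G : ∀ {z} → z ∈ F → z ∈ G) (S₂ S₃ : Spider) (g₂ : good S₂ ≡ true) (g₃ : good S₃ ≡ true)
      (tip∈G : ∀ i → tipOf S₂ i ∈ G) (out : ∀ i → odd i ≡ true → tipOf S₂ i ∉ F)
      (head-trail : ∀ i → Trail (x i) (first (odd i) (tipOf S₂ i)) (tipOf S₂ i))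
      (T : Fin s → List V) (lenT : ∀ i → length (T i) ≡ 2 * m i) (trT : ∀ i → Trail (tipOf S₂ i) (T i) (tipOf S₃ i))
      (uT : ∀ i → Unique (T i)) (avT : ∀ i {z} → z ∈ T i → z ∉ G) (disT : ∀ i i′ {z} → z ∈ T i → z ∈ T i′ → i ≡ i′)
      (fr₃ : Fresh S₃ G) (frT : ∀ i → Fresh S₃ (T i)) where

      P : Fin s → List V
      P i = first (odd i) (tipOf S₂ i) ++ (T i ++ interior S₃ i)

      lens : ∀ i → length (P i) ≡ M
      lens i = trans (length-++ (first (odd i) (tipOf S₂ i))) (trans (cong₂ _+_ (length-first (odd i) _) (trans (length-++ (T i)) (cong₂ _+_ (lenT i) (length-interior S₃ i)))) (par i))

      first∈G : ∀ {i z} → z ∈ first (odd i) (tipOf S₂ i) → z ∈ G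
      first∈G {i} k = subst (_∈ G) (sym (proj₂ (∈first (odd i) k))) (tip∈G i)

      T-int : ∀ {i i′ z} → z ∈ T i → z ∉ interior S₃ i′
      T-int {i} {i′} k k′ = interior-fresh (frT i) i′ k′ k

      uniq : ∀ i → Unique (P i)
      uniq i = unique-++ (unique-first (odd i) _) (unique-++ (uT i) (unique-interior {S₃} g₃ i) (T-int {i} {i}))
        (λ {z} k → ∉-++ (λ k′ → avT i k′ (first∈G {i} k)) (λ k′ → interior-fresh fr₃ i k′ (first∈G {i} k)))

      Cases : Fin s → V → Set
      Cases i z = z ∈ first (odd i) (tipOf S₂ i) ⊎ z ∈ T i ⊎ z ∈ interior S₃ i

      cases : ∀ {i z} → z ∈ P i → Cases i z
      cases {i} k with ∈-++⁻ (first (odd i) (tipOf S₂ i)) k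
      ... | inj₁ a = inj₁ a
      ... | inj₂ b = inj₂ (∈-++⁻ (T i) b)

      ctr∉ : ∀ i → val S₃ ctr ∉ P i
      ctr∉ i k = go (cases {i} k)
        where
        go : Cases i (val S₃ ctr) → ⊥
        go (inj₁ a) = fr₃ ctr K-ctr (first∈G {i} a)
        go (inj₂ (inj₁ b)) = frT i ctr K-ctr b
        go (inj₂ (inj₂ c)) = let j , _ , e = ∈-interior {S₃} {i} c in ctr≢at (distinct g₃ ctr (at i j) e)

      dis : ∀ i i′ {z} → z ∈ P i → z ∈ P i′ → i ≡ i′
      dis i i′ {z} k k′ = go (cases {i} k) (cases {i′} k′)
        where
        go : Cases i z → Cases i′ z → i ≡ i′
        go (inj₁ a) (inj₁ a′) = at-leg (distinct g₂ (at i (tip i)) (at i′ (tip i′)) (trans (sym (proj₂ (∈first (odd i) a))) (proj₂ (∈first (odd i′) a′))))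
        go (inj₁ a) (inj₂ (inj₁ b)) = ⊥-elim (avT i′ b (first∈G {i} a))
        go (inj₁ a) (inj₂ (inj₂ c)) = ⊥-elim (interior-fresh fr₃ i′ c (first∈G {i} a))
        go (inj₂ (inj₁ b)) (inj₁ a) = ⊥-elim (avT i b (first∈G {i′} a))
        go (inj₂ (inj₂ c)) (inj₁ a) = ⊥-elim (interior-fresh fr₃ i c (first∈G {i′} a))
        go (inj₂ (inj₁ b)) (inj₂ (inj₁ b′)) = disT i i′ b b′
        go (inj₂ (inj₁ b)) (inj₂ (inj₂ c)) = ⊥-elim (T-int {i} {i′} b c)
        go (inj₂ (inj₂ c)) (inj₂ (inj₁ b)) = ⊥-elim (T-int {i′} {i} b c)
        go (inj₂ (inj₂ c)) (inj₂ (inj₂ c′)) =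
          let j , _ , e = ∈-interior {S₃} {i} c
              j′ , _ , e′ = ∈-interior {S₃} {i′} c′
          in at-leg (distinct g₃ (at i j) (at i′ j′) (trans (sym e) e′))

      P-avoid : ∀ i {z} → z ∈ P i → z ∉ F
      P-avoid i {z} k = go (cases {i} k)
        where
        go : Cases i z → z ∉ F
        go (inj₂ (inj₁ b)) q = avT i b (F⊆G q)
        go (inj₂ (inj₂ c)) q = interior-fresh fr₃ i c (F⊆G q)
        go (inj₁ a) q = out i (proj₁ (∈first (odd i) a)) (subst (_∈ F) (proj₂ (∈first (odd i) a)) q)

      avoid : ∀ {z} → z ∈ verts (val S₃ ctr , P) → z ∉ F
      avoid (here refl) q = fr₃ ctr K-ctr (F⊆G q)
      avoid (there k) q = let i , k′ = Any.satisfied (∈-concatMap⁻ P {xs = allFin s} k) in P-avoid i k′ q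

      goodCopy : GoodCopy x M F (val S₃ ctr , P)
      goodCopy = record
        { walk-to = λ i → head-trail i ++ʷ (trT i ++ʷ interior-walk {S₃} g₃ i)
        ; length-to = lens ; unique-to = uniq ; centre∉ = ctr∉ ; legs-disj = dis ; avoids = avoid }

    head-trail : ∀ b {S₁ S₂} → good S₁ ≡ true → val S₁ (pre b) ≡ val S₀ (pre b) → tipOf S₁ b ≡ tipOf S₂ b →
      ∀ o → (o ≡ false → tipOf S₁ b ≡ tipOf S₀ b) → Trail (val S₀ (xpos o b)) (first o (tipOf S₂ b)) (tipOf S₂ b)
    head-trail i {S₁} {S₂} g₁ pre-same same-tip true  even = subst₂ (λ u v → adj u v ≡ true) pre-same same-tip (adj-pre {S₁} g₁ i) ∷ []
    head-trail i {S₁} {S₂} g₁ pre-same same-tip false even = subst (λ v → Trail v [] (tipOf S₂ i)) (trans (sym same-tip) (even refl)) []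

    module _ (M : ℕ) (odd : Fin s → Bool) (m : Fin s → ℕ) (par : ∀ i → ⟦ odd i ⟧ + (2 * m i + toℕ (tip i)) ≡ M)
             (one-short : ∀ i i′ → toℕ (tip i) ≡ 0 → toℕ (tip i′) ≡ 0 → i ≡ i′) where

      private
        x : Fin s → V
        x i = val S₀ (xpos (odd i) i)

        2m≤M : ∀ i → 2 * m i ≤ M
        2m≤M i = ≤-trans (≤-trans (m≤m+n (2 * m i) (toℕ (tip i))) (m≤n+m _ ⟦ odd i ⟧)) (≤-reflexive (par i))

        length-tips : ∀ S F → length (map (tipOf S) (allFin s) ++ F) ≡ length F + s
        length-tips S F = trans (length-++ (map (tipOf S) (allFin s))) (trans (cong (_+ length F) (trans (length-map _ (allFin s)) (length-allFin s))) (+-comm s _))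

        -- Each copy starts again from `S₀`, hence all copies share the left branch vertices. The
        -- centre of the final spider is the right branch vertex of the copy.
        copy : ∀ F → length F + (s + s * M) ≤ N → ∃ λ c → GoodCopy x M F c
        copy F le =
          let S₁ , g₁ , body , c₁ , even , _ , out = retip odd (allFin s) F good-S₀ (≤-trans (m≤m+n (length F) _) le)
              G = map (tipOf S₁) (allFin s) ++ F
              S₂ , g₂ , ag₂ , fr₂ = moveA g₁ G (≤-trans (≤-reflexive (length-tips S₁ F)) (≤-trans (+-monoʳ-≤ (length F) (m≤m+n s _)) le))
              S₃ , g₃ , T , lenT , trT , uT , avT , disT , fr₃ , frT = extendAll m (allFin s) G g₂ fr₂
                (≤-trans (+-mono-≤ (≤-reflexive (length-tips S₁ F)) (≤-trans (∑-mono (allFin s) 2m≤M) (≤-reflexive (trans (∑-const (allFin s) M) (cong (_* M) (length-allFin s))))))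
                         (≤-trans (≤-reflexive (+-assoc (length F) s _)) le))
              same-tip = λ i → agree-sound {K} {S₁} {S₂} ag₂ (at i (tip i)) (K-tip i)
          in _ , Assemble.goodCopy x M odd m par F G (∈-++⁺ʳ (map (tipOf S₁) (allFin s))) S₂ S₃ g₂ g₃
               (λ i → ∈-++⁺ˡ (subst (_∈ map (tipOf S₁) (allFin s)) (same-tip i) (∈-map⁺ (tipOf S₁) (∈-allFin i))))
               (λ i o → subst (_∉ F) (same-tip i) (out (∈-allFin i) o))
               (λ i → head-trail i {S₁} {S₂} g₁ (pre-same S₁ body c₁ i (pre-cases i)) (same-tip i) (odd i) (even i))
               T (λ i → trans (lenT i) (∑-δ-Fin s i (λ i → 2 * m i))) trT uT avT disT fr₃ frT
          where
          pre-same : ∀ S₁ → (∀ i j → toℕ j < toℕ (tip i) → val S₁ (at i j) ≡ val S₀ (at i j)) → val S₁ ctr ≡ val S₀ ctr →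
            ∀ i → (toℕ (tip i) ≡ 0 × pre i ≡ ctr) ⊎ (∃ λ j → toℕ j < toℕ (tip i) × pre i ≡ at i j) → val S₁ (pre i) ≡ val S₀ (pre i)
          pre-same S₁ body c₁ i (inj₁ (_ , r)) = trans (cong (val S₁) r) (trans c₁ (cong (val S₀) (sym r)))
          pre-same S₁ body c₁ i (inj₂ (j , lt , r)) = trans (cong (val S₁) r) (trans (body i j lt) (cong (val S₀) (sym r)))

        length-verts : ∀ c {F} → GoodCopy x M F c → length (verts c) ≤ 1 + s * M
        length-verts (y , P) gc = s≤s (≤-trans (≤-reflexive (go (allFin s))) (*-monoˡ-≤ M (≤-reflexive (length-allFin s))))
          where
          go : ∀ is → length (concatMap P is) ≡ length is * M
          go []       = refl
          go (i ∷ is) = trans (length-++ (P i)) (cong₂ _+_ (GoodCopy.length-to gc i) (go is))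

        ∈verts : ∀ c i {z} → z ∈ proj₂ c i → z ∈ verts c
        ∈verts c i k = there (∈-concatMap⁺ (proj₂ c) (Any.map (λ { refl → k }) (∈-allFin i)))

        assemble : ∀ t (F : List V) → (∀ a → x a ∈ F) → (f : Fin t → Copy) → (∀ b → GoodCopy x M [] (f b)) → (∀ b {z} → z ∈ verts (f b) → z ∉ F) →
          (∀ b b′ {z} → z ∈ verts (f b) → z ∈ verts (f b′) → b ≡ b′) → Subdivision s t 1 M
        assemble t F x∈ f gd av dis = record
          { left = x ; right = λ b → proj₁ (f b) ; path = λ a b _ → proj₂ (f b) a
          ; walk = λ a b _ → GoodCopy.walk-to (gd b) a
          ; length≡ = λ a b _ → GoodCopy.length-to (gd b) a
          ; left-inj = λ {a} {a′} e → xpos-inj one-short (odd a) (odd a′) a a′ (distinct good-S₀ (xpos (odd a) a) (xpos (odd a′) a′) e)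
          ; right-inj = λ {b} {b′} e → dis b b′ (here refl) (here e)
          ; left≢right = λ {a} {b} e → av b (here e) (x∈ a)
          ; path≢left = λ {a} {b} {_} {a′} k → av b (∈verts (f b) a k) (x∈ a′)
          ; path≢right = λ {a} {b} {_} {b′} k → p≢r a b b′ (dis b b′ (∈verts (f b) a k) (here refl)) k
          ; unique = λ a b _ → GoodCopy.unique-to (gd b) a
          ; disjoint = λ {a} {b} {ρ} {a′} {b′} {ρ′} k k′ → dj a b ρ a′ b′ ρ′ (dis b b′ (∈verts (f b) a k) (∈verts (f b′) a′ k′)) k k′
          }
          where
          p≢r : ∀ a b b′ → b ≡ b′ → proj₁ (f b′) ∉ proj₂ (f b) a
          p≢r a b b refl k = GoodCopy.centre∉ (gd b) a k
          dj : ∀ a b (ρ : Fin 1) a′ b′ (ρ′ : Fin 1) {z} → b ≡ b′ → z ∈ proj₂ (f b) a → z ∈ proj₂ (f b′) a′ → a ≡ a′ × b ≡ b′ × ρ ≡ ρ′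
          dj a b zero a′ b zero refl k k′ = GoodCopy.legs-disj (gd b) a a′ k k′ , refl , refl

      -- The summands of the budget are the left branch vertices, the `t` copies, and the room
      -- needed while one copy is built.
      spread-subdivision : ∀ t → s + t * (1 + s * M) + (s + s * M) ≤ N → Subdivision s t 1 M
      spread-subdivision t le =
        let f , gd , av , dis = greedy verts (N ∸ (s + s * M)) (1 + s * M) t (λ _ → GoodCopy x M []) pick (map x (allFin s)) fits
        in assemble t (map x (allFin s)) (λ a → ∈-map⁺ x (∈-allFin a)) f gd av dis
        where
        pick : ∀ (e : Fin t) F → length F ≤ N ∸ (s + s * M) → ∃ λ c → GoodCopy x M [] c × length (verts c) ≤ 1 + s * M × (∀ {z} → z ∈ verts c → z ∉ F)
        pick e F F≤ =
          let c , gc = copy F (≤-trans (+-monoˡ-≤ (s + s * M) F≤) (≤-reflexive (m∸n+n≡m (≤-trans (m≤n+m (s + s * M) (s + t * (1 + s * M))) le))))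
          in c , record { walk-to = GoodCopy.walk-to gc ; length-to = GoodCopy.length-to gc ; unique-to = GoodCopy.unique-to gc
                        ; centre∉ = GoodCopy.centre∉ gc ; legs-disj = GoodCopy.legs-disj gc ; avoids = λ _ () } , length-verts c gc , GoodCopy.avoids gc
        fits : length (map x (allFin s)) + t * (1 + s * M) ≤ N ∸ (s + s * M)
        fits = begin
          length (map x (allFin s)) + t * (1 + s * M) ≡⟨ cong (_+ t * (1 + s * M)) (trans (length-map x (allFin s)) (length-allFin s)) ⟩
          s + t * (1 + s * M) ≡⟨ sym (m+n∸n≡m _ (s + s * M)) ⟩
          s + t * (1 + s * M) + (s + s * M) ∸ (s + s * M) ≤⟨ ∸-monoˡ-≤ (s + s * M) le ⟩
          N ∸ (s + s * M) ∎
          where open ≤-Reasoning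

-- Many spiders with a common leg

module Pairing (Γ : WeightedGraph) (s n : ℕ) (μ : WeightedGraph.V Γ → ℕ) (δ : ℕ) (δ≤d : MinDegree Γ δ) where
  open WeightedGraph Γ
  open Kernel Γ
  open Spiders Γ s n μ
  open Systems Γ s n μ δ δ≤d
  open Trails Γ
  open Growth Γ s n μ δ δ≤d
  open Spread Γ s n μ δ δ≤d

  -- The first vertex of a leg is uniform among the neighbours of the centre. The exact degree is
  -- needed, because the number of possible tips is later compared with the number of neighbours.
  first-hit : ∀ S i (j : Fin n) f → toℕ j ≡ 0 →
    d (val S ctr) * class (keep i 0) S (λ S′ → ⟦ val S′ (at i j) == f ⟧ * weight S′) ≤ class (keep i 0) S weight
  first-hit (y , l) i j f e = class-hit (d y) (y , l) i 0 j f (go j e (lookup l i))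
    where
    go : ∀ {n} (j : Fin n) → toℕ j ≡ 0 → (ref : Vec V n) →
      d y * ∑ (walks n) (λ x → ⟦ agreeLeg (below 0) ref x ⟧ * (wt y x * ⟦ lookup x j == f ⟧)) ≤ ∑ (walks n) (λ x → ⟦ agreeLeg (below 0) ref x ⟧ * wt y x)
    go zero _ ref = legHit-head d-y y (d*p1≤row y) ref f
      where d-y = d y

  module _ {K : Pos → Bool} (κ : KernelShape K) {N Q : ℕ} (C : ClosedSystem K κ N Q)
           (i₁ i₂ : Fin s) (i₁≢i₂ : i₁ ≢ i₂) (short : toℕ (KernelShape.tip κ i₁) ≡ 0) where
    open KernelShape κ
    open ClosedSystem C
    open Moves κ C

    private
      corner = xpos κ C

    adj-ctr : ∀ {S} → good S ≡ true → adj (val S ctr) (tipOf S i₁) ≡ true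
    adj-ctr {S} g = go (pre-cases κ C i₁)
      where
      go : (toℕ (tip i₁) ≡ 0 × pre i₁ ≡ ctr) ⊎ (∃ λ j → toℕ j < toℕ (tip i₁) × pre i₁ ≡ at i₁ j) → adj (val S ctr) (tipOf S i₁) ≡ true
      go (inj₁ (_ , r)) = subst (λ p → adj (val S p) (tipOf S i₁) ≡ true) r (adj-pre {S} g i₁)
      go (inj₂ (_ , lt , _)) = ⊥-elim (n≮0 (subst (_ <_) short lt))

    Link : ℕ → V → V → List V → Set
    Link M u v F = ∃ λ P → Walk u P v × length P ≡ M × Unique P × (∀ {x} → x ∈ P → x ∉ F)

    -- The path follows the trail of leg `i₂`, descends that leg to the centre (the `1` in the
    -- count) and takes one edge to the tip of leg `i₁`, which stays in place during all moves.
    link-from : ∀ M o m → ⟦ o ⟧ + (2 * m + (toℕ (tip i₂) + 1)) ≡ M → ∀ {S₁} u F → good S₁ ≡ true →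
      Trail u (first κ C o (tipOf S₁ i₂)) (tipOf S₁ i₂) → (o ≡ true → tipOf S₁ i₂ ∉ F) → length F + (1 + M) ≤ N → Link M u (tipOf S₁ i₁) F
    link-from M o m eq {S₁} u F g₁ head-tr new le with moveA g₁ (tipOf S₁ i₂ ∷ F) (≤-trans (≤-reflexive (+-comm 1 (length F))) (≤-trans (+-monoʳ-≤ (length F) (m≤m+n 1 M)) le))
    ... | S₂ , g₂ , ag₂ , fr₂ with extend m i₂ (tipOf S₁ i₂ ∷ F) g₂ fr₂ (≤-trans (≤-reflexive (sym (+-suc (length F) (2 * m)))) (≤-trans (+-monoʳ-≤ (length F) (s≤s 2m≤M)) le))
      where
      2m≤M : 2 * m ≤ M
      2m≤M = ≤-trans (≤-trans (m≤m+n (2 * m) _) (m≤n+m _ ⟦ o ⟧)) (≤-reflexive eq)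
    ... | S₃ , g₃ , other , T , lenT , trT , uT , avT , fr₃ = P , walk , len , uniq , avoid
      where
      same-tip : ∀ i → tipOf S₁ i ≡ tipOf S₂ i
      same-tip i = agree-sound {K} {S₁} {S₂} ag₂ (at i (tip i)) (K-tip i)
      first′ = first κ C o (tipOf S₁ i₂)
      rest = interior S₃ i₂ ++ val S₃ ctr ∷ []
      P = first′ ++ (T ++ rest)
      walk : Walk u P (tipOf S₁ i₁)
      walk = head-tr ++ʷ (subst (λ v → Trail v T (tipOf S₃ i₂)) (sym (same-tip i₂)) trT ++ʷ
               snoc (interior-walk {S₃} g₃ i₂) (subst (λ v → adj (val S₃ ctr) v ≡ true) (trans (other i₁ i₁≢i₂) (sym (same-tip i₁))) (adj-ctr {S₃} g₃)))
      len : length P ≡ M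
      len = trans (length-++ first′) (trans (cong₂ _+_ (length-first κ C o _) (trans (length-++ T) (cong₂ _+_ lenT (trans (length-++ (interior S₃ i₂)) (cong (_+ 1) (length-interior S₃ i₂)))))) eq)
      rest-fresh : ∀ {z} → z ∈ rest → z ∉ T ++ tipOf S₁ i₂ ∷ F
      rest-fresh k with ∈-++⁻ (interior S₃ i₂) k
      ... | inj₁ a = interior-fresh fr₃ i₂ a
      ... | inj₂ (here refl) = fr₃ ctr K-ctr
      uniq-rest : Unique rest
      uniq-rest = unique-++ (unique-interior {S₃} g₃ i₂) ([] ∷ []) λ { a (here refl) →
        let j , _ , e = ∈-interior {S₃} {i₂} a in ctr≢at κ C (distinct g₃ ctr (at i₂ j) e) }
      uniq : Unique P
      uniq = unique-++ (unique-first κ C o _) (unique-++ uT uniq-rest (λ a b → rest-fresh b (∈-++⁺ˡ a)))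
        (λ {z} a → ∉-++ (λ b → avT b (here (proj₂ (∈first κ C o a)))) (λ b → rest-fresh b (∈-++⁺ʳ T (here (proj₂ (∈first κ C o a))))))
      avoid : ∀ {z} → z ∈ P → z ∉ F
      avoid k q with ∈-++⁻ first′ k
      ... | inj₁ a = new (proj₁ (∈first κ C o a)) (subst (_∈ F) (proj₂ (∈first κ C o a)) q)
      ... | inj₂ b with ∈-++⁻ T b
      ...   | inj₁ c = avT c (there q)
      ...   | inj₂ c = rest-fresh c (∈-++⁺ʳ T (there q))

    link : ∀ M o m → ⟦ o ⟧ + (2 * m + (toℕ (tip i₂) + 1)) ≡ M → ∀ {S} F → good S ≡ true → length F + (1 + M) ≤ N → Link M (val S (corner o i₂)) (tipOf S i₁) F
    link M false m eq {S} F g le = link-from M false m eq (tipOf S i₂) F g [] (λ ()) le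
    link M true  m eq {S} F g le =
      let S₁ , g₁ , ag , new = moveB g i₂ F (≤-trans (m≤m+n (length F) _) le)
      in subst (λ v → Link M (val S (pre i₂)) v F) (sym (agree-sound {keep i₂ (toℕ (tip i₂))} {S} {S₁} ag (at i₁ (tip i₁)) (keep-other (toℕ (tip i₂)) (tip i₁) i₁≢i₂)))
           (link-from M true m eq (val S (pre i₂)) F g₁
             (subst (λ v → adj v (tipOf S₁ i₂) ≡ true) (sym (agree-sound {keep i₂ (toℕ (tip i₂))} {S} {S₁} ag (pre i₂) (keep-pre i₂))) (adj-pre {S₁} g₁ i₂) ∷ [])
             (λ _ → new (tip i₂) ≤-refl) le)

    private
      k₁ k₂ : Pos → Bool
      k₁ = keep i₁ 0
      k₂ = keep i₂ 0
      y = val S₀ ctr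

    -- x joins S when leg i₁ of S can be replaced so that the result is good and its tip is x.
    joins : V → Spider → Bool
    joins x S = 1 ≤ᵇ class k₁ S (λ S′ → ⟦ good S′ ⟧ * ⟦ tipOf S′ i₁ == x ⟧)

    joins-elim : ∀ {x S} → joins x S ≡ true → ∃ λ S′ → good S′ ≡ true × agree k₁ S S′ ≡ true × tipOf S′ i₁ ≡ x
    joins-elim {x} {S} e with ∑-pos spiders (λ S′ → ⟦ agree k₁ S S′ ⟧ * (⟦ good S′ ⟧ * ⟦ tipOf S′ i₁ == x ⟧)) (≤ᵇ-true e)
    ... | S′ , _ , lt with ⟦⟧-pos (agree k₁ S S′) lt
    ...   | ag , lt′ with ⟦⟧-pos (good S′) lt′
    ...     | g , lt″ = S′ , g , ag , ==-true (proj₁ (⟦⟧-pos (tipOf S′ i₁ == x) {1} (subst (0 <_) (sym (*-identityʳ _)) lt″)))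

    joins-intro : ∀ {x S S′} → good S′ ≡ true → agree k₁ S S′ ≡ true → (tipOf S′ i₁ == x) ≡ true → joins x S ≡ true
    joins-intro {x} {S} {S′} g ag e = true-≤ᵇ (≤-trans (≤-reflexive (sym (trans (cong (λ b → ⟦ b ⟧ * _) ag) (cong₂ (λ b c → ⟦ b ⟧ * ⟦ c ⟧ + 0) g e))))
      (∑-∈ (λ S′ → ⟦ agree k₁ S S′ ⟧ * (⟦ good S′ ⟧ * ⟦ tipOf S′ i₁ == x ⟧)) (∈spiders S′)))

    -- Good spiders fill the proportion `1 / Q` of the class, while a single tip takes at most
    -- `1 / d` of it; so at least `d / Q` tips occur.
    joins-many : ∀ {x S} → joins x S ≡ true → d (val S ctr) ≤ Q * ∑ vs (λ x → ⟦ joins x S ⟧)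
    joins-many {x} {S} e =
      let S′ , g , ag , _ = joins-elim {x} {S} e
          cS = class k₁ S weight
          pos : 0 < class k₁ S′ weight
          pos = <-≤-trans (positive g) (class-self k₁ S′ weight)
      in *-cancelʳ-≤ _ _ cS {{>-nonZero (subst (0 <_) (sym (class-cong k₁ {S} {S′} weight ag)) pos)}} (begin
        d (val S ctr) * cS
          ≤⟨ *-monoʳ-≤ (d (val S ctr)) (≤-trans (≤-reflexive (class-cong k₁ {S} {S′} weight ag)) (≤-trans (dense g i₁) (*-monoʳ-≤ Q (≤-reflexive (sym (class-cong k₁ {S} {S′} _ ag)))))) ⟩
        d (val S ctr) * (Q * class k₁ S (λ S′ → ⟦ good S′ ⟧ * weight S′))
          ≤⟨ *-monoʳ-≤ (d (val S ctr)) (*-monoʳ-≤ Q (∑-mono spiders pt)) ⟩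
        d (val S ctr) * (Q * class k₁ S (λ S′ → ∑ vs (λ x → ⟦ joins x S ⟧ * (⟦ tipOf S′ i₁ == x ⟧ * weight S′))))
          ≡⟨ trans (x*yz≡y*xz (d (val S ctr)) Q _) (cong (λ z → Q * (d (val S ctr) * z)) (trans (class-∑ k₁ S vs _) (∑-cong vs λ x → class-*ˡ k₁ S ⟦ joins x S ⟧ _))) ⟩
        Q * (d (val S ctr) * ∑ vs (λ x → ⟦ joins x S ⟧ * class k₁ S (λ S′ → ⟦ tipOf S′ i₁ == x ⟧ * weight S′)))
          ≡⟨ cong (Q *_) (trans (sym (∑-*ˡ vs (d (val S ctr)) _)) (∑-cong vs λ x → x*yz≡y*xz (d (val S ctr)) ⟦ joins x S ⟧ _)) ⟩
        Q * ∑ vs (λ x → ⟦ joins x S ⟧ * (d (val S ctr) * class k₁ S (λ S′ → ⟦ tipOf S′ i₁ == x ⟧ * weight S′)))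
          ≤⟨ *-monoʳ-≤ Q (∑-mono vs λ x → *-monoʳ-≤ ⟦ joins x S ⟧ (first-hit S i₁ (tip i₁) x short)) ⟩
        Q * ∑ vs (λ x → ⟦ joins x S ⟧ * cS)
          ≡⟨ trans (cong (Q *_) (∑-*ʳ vs cS _)) (sym (*-assoc Q _ cS)) ⟩
        Q * ∑ vs (λ x → ⟦ joins x S ⟧) * cS ∎)
      where
      open ≤-Reasoning
      pt : ∀ S′ → ⟦ agree k₁ S S′ ⟧ * (⟦ good S′ ⟧ * weight S′) ≤ ⟦ agree k₁ S S′ ⟧ * ∑ vs (λ x → ⟦ joins x S ⟧ * (⟦ tipOf S′ i₁ == x ⟧ * weight S′))
      pt S′ with agree k₁ S S′ in ag
      ... | false = z≤n
      ... | true with good S′ in g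
      ...   | false = z≤n
      ...   | true  = *-monoʳ-≤ 1 (≤-trans (≤-reflexive (trans (sym (+-identityʳ (1 * weight S′))) (sym (cong₂ (λ b c → ⟦ b ⟧ * (⟦ c ⟧ * weight S′)) (joins-intro {tipOf S′ i₁} {S} {S′} g ag (==-refl (tipOf S′ i₁))) (==-refl (tipOf S′ i₁))))))
                         (∑-∈ (λ x → ⟦ joins x S ⟧ * (⟦ tipOf S′ i₁ == x ⟧ * weight S′)) (∈vs (tipOf S′ i₁))))

    avoids : List V → V → Bool
    avoids U x = ∑ U (λ f → ⟦ x == f ⟧) ≤ᵇ 0

    avoids-sound : ∀ U x → avoids U x ≡ true → x ∉ U
    avoids-sound U x e = ∑⟦∉⟧ U x (n≤0⇒n≡0 (≤ᵇ-true e))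

    -- The hypothesis on `U` makes its removal cost at most half of the bound in `joins-many`, hence
    -- the factor 2.
    joins-new : ∀ U {x S} → joins x S ≡ true → 2 * Q * length U ≤ d (val S ctr) →
      d (val S ctr) ≤ 2 * Q * ∑ vs (λ x → ⟦ joins x S ⟧ * ⟦ avoids U x ⟧)
    joins-new U {x} {S} e le = +-cancelʳ-≤ D D _ (begin
      D + D ≤⟨ +-mono-≤ (joins-many {x} {S} e) (joins-many {x} {S} e) ⟩
      Q * cnt + Q * cnt ≡⟨ solve 2 (λ q j → q :* j :+ q :* j := con 2 :* q :* j) refl Q cnt ⟩
      2 * Q * cnt ≤⟨ *-monoʳ-≤ (2 * Q) cnt≤ ⟩
      2 * Q * (cnt′ + length U) ≡⟨ *-distribˡ-+ (2 * Q) cnt′ (length U) ⟩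
      2 * Q * cnt′ + 2 * Q * length U ≤⟨ +-monoʳ-≤ (2 * Q * cnt′) le ⟩
      2 * Q * cnt′ + D ∎)
      where
      open ≤-Reasoning
      D = d (val S ctr)
      cnt = ∑ vs (λ x → ⟦ joins x S ⟧)
      cnt′ = ∑ vs (λ x → ⟦ joins x S ⟧ * ⟦ avoids U x ⟧)
      one : ∀ a m → ⟦ a ⟧ ≤ ⟦ a ⟧ * ⟦ m ≤ᵇ 0 ⟧ + m
      one false m    = z≤n
      one true  zero = s≤s z≤n
      one true  (suc m) = s≤s z≤n
      cnt≤ : cnt ≤ cnt′ + length U
      cnt≤ = begin
        cnt ≤⟨ ∑-mono vs (λ x → one (joins x S) (∑ U (λ f → ⟦ x == f ⟧))) ⟩
        ∑ vs (λ x → ⟦ joins x S ⟧ * ⟦ avoids U x ⟧ + ∑ U (λ f → ⟦ x == f ⟧)) ≡⟨ ∑-+ vs _ _ ⟩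
        cnt′ + ∑ vs (λ x → ∑ U (λ f → ⟦ x == f ⟧)) ≡⟨ cong (cnt′ +_) (trans (∑-swap vs U _) (trans (∑-cong U λ f → trans (∑-cong vs λ x → sym (*-identityʳ ⟦ x == f ⟧)) (∑-δ f (λ _ → 1))) (trans (∑-const U 1) (*-identityʳ (length U))))) ⟩
        cnt′ + length U ∎

    mass₂ : (Spider → Bool) → ℕ
    mass₂ P = class k₂ S₀ (λ S → ⟦ P S ⟧ * weight S)

    Joined : Spider → Set
    Joined S = ∃ λ x → joins x S ≡ true

    select-one : ∀ U (P : Spider → Bool) → (∀ {S} → P S ≡ true → Joined S) → 2 * Q * length U ≤ d y → 0 < d y → 0 < mass₂ P →
      ∃ λ x → x ∉ U × mass₂ P ≤ 2 * Q * mass₂ (λ S → P S ∧ joins x S)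
    select-one U P P-joined le d>0 m>0 =
      -- Averages over the `d y` neighbours of `y`. Passing to the predecessor of the mass makes the
      -- comparison strict; positivity of the larger term then forces `x` to be a neighbour of `y`
      -- outside `U`.
      let x , _ , lt = ∑-< vs (λ x → ⟦ adj y x ⟧ * pred (mass₂ P)) f (begin-strict
            ∑ vs (λ x → ⟦ adj y x ⟧ * pred (mass₂ P)) ≡⟨ ∑-*ʳ vs (pred (mass₂ P)) _ ⟩
            d y * pred (mass₂ P) <⟨ *-monoʳ-< (d y) {{>-nonZero d>0}} (≤-reflexive (suc-pred (mass₂ P) {{>-nonZero m>0}})) ⟩
            d y * mass₂ P ≤⟨ average ⟩
            ∑ vs f ∎)
          av , adj-yx = f-pos x (≤-<-trans z≤n lt)
      in x , av , ≤-trans (≤-reflexive (trans (sym (suc-pred (mass₂ P) {{>-nonZero m>0}})) (cong suc (sym (trans (cong (λ b → ⟦ b ⟧ * pred (mass₂ P)) adj-yx) (+-identityʳ _))))))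
           (≤-trans lt (*-monoʳ-≤ (2 * Q) (⟦⟧*≤ (avoids U x) _)))
      where
      open ≤-Reasoning
      f : V → ℕ
      f x = 2 * Q * (⟦ avoids U x ⟧ * mass₂ (λ S → P S ∧ joins x S))
      f-pos : ∀ x → 0 < f x → x ∉ U × adj y x ≡ true
      f-pos x lt with ⟦⟧-pos (avoids U x) (0<t≤c*x (2 * Q) lt ≤-refl)
      ... | a , lt′ with ∑-pos spiders (λ S → ⟦ agree k₂ S₀ S ⟧ * (⟦ P S ∧ joins x S ⟧ * weight S)) lt′
      ...   | S , _ , lt″ with ⟦⟧-pos (agree k₂ S₀ S) lt″
      ...     | ag , lt‴ with joins-elim {x} {S} (proj₂ (∧-true {P S} (proj₁ (⟦⟧-pos (P S ∧ joins x S) lt‴))))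
      ...       | S′ , g , ag′ , refl = avoids-sound U x a , subst (λ v → adj v (tipOf S′ i₁) ≡ true)
                    (trans (sym (agree-sound {k₁} {S} {S′} ag′ ctr refl)) (sym (agree-sound {k₂} {S₀} {S} ag ctr refl))) (adj-ctr {S′} g)
      pt : ∀ S → d y * (⟦ agree k₂ S₀ S ⟧ * (⟦ P S ⟧ * weight S)) ≤ 2 * Q * ∑ vs (λ x → ⟦ avoids U x ⟧ * (⟦ agree k₂ S₀ S ⟧ * (⟦ P S ∧ joins x S ⟧ * weight S)))
      pt S with agree k₂ S₀ S in ag
      ... | false = ≤-trans (≤-reflexive (*-zeroʳ (d y))) z≤n
      ... | true with P S in e
      ...   | false = ≤-trans (≤-reflexive (*-zeroʳ (d y))) z≤n
      ...   | true  = begin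
        d y * (1 * (1 * weight S)) ≡⟨ cong (d y *_) (trans (+-identityʳ _) (+-identityʳ _)) ⟩
        d y * weight S ≡⟨ cong (λ v → d v * weight S) y≡ ⟩
        d (val S ctr) * weight S ≤⟨ *-monoˡ-≤ (weight S) (joins-new U {proj₁ (P-joined e)} {S} (proj₂ (P-joined e)) (subst (λ v → 2 * Q * length U ≤ d v) y≡ le)) ⟩
        2 * Q * ∑ vs (λ x → ⟦ joins x S ⟧ * ⟦ avoids U x ⟧) * weight S ≡⟨ trans (*-assoc (2 * Q) _ _) (cong (2 * Q *_) (trans (sym (∑-*ʳ vs (weight S) _)) (∑-cong vs λ x → trans (cong (_* weight S) (*-comm ⟦ joins x S ⟧ _)) (trans (*-assoc ⟦ avoids U x ⟧ _ _) (cong (⟦ avoids U x ⟧ *_) (sym (+-identityʳ _))))))) ⟩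
        2 * Q * ∑ vs (λ x → ⟦ avoids U x ⟧ * (1 * (⟦ joins x S ⟧ * weight S))) ∎
        where
        y≡ : y ≡ val S ctr
        y≡ = agree-sound {k₂} {S₀} {S} ag ctr refl
      average : d y * mass₂ P ≤ ∑ vs f
      average = begin
        d y * mass₂ P ≡⟨ sym (∑-*ˡ spiders (d y) _) ⟩
        ∑ spiders (λ S → d y * (⟦ agree k₂ S₀ S ⟧ * (⟦ P S ⟧ * weight S))) ≤⟨ ∑-mono spiders pt ⟩
        ∑ spiders (λ S → 2 * Q * ∑ vs (λ x → ⟦ avoids U x ⟧ * (⟦ agree k₂ S₀ S ⟧ * (⟦ P S ∧ joins x S ⟧ * weight S)))) ≡⟨ trans (∑-*ˡ spiders (2 * Q) _) (cong (2 * Q *_) (trans (∑-swap spiders vs _) (∑-cong vs λ x → ∑-*ˡ spiders ⟦ avoids U x ⟧ _))) ⟩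
        2 * Q * ∑ vs (λ x → ⟦ avoids U x ⟧ * mass₂ (λ S → P S ∧ joins x S)) ≡⟨ sym (∑-*ˡ vs (2 * Q) _) ⟩
        ∑ vs f ∎

    -- The vertices `R b` are the right branch vertices. A positive proportion of the ways to redraw
    -- leg `i₂` of `S₀` joins all of them at once, and the left branch vertices are then taken from
    -- different such redrawings.
    record Selection (t : ℕ) (P : Spider → Bool) (U : List V) : Set where
      field
        R       : Fin t → V
        R∉      : ∀ b → R b ∉ U
        R-inj   : ∀ b b′ → R b ≡ R b′ → b ≡ b′
        P′      : Spider → Bool
        P′⊆     : ∀ {S} → P′ S ≡ true → P S ≡ true
        P′-join : ∀ {S} → P′ S ≡ true → ∀ b → joins (R b) S ≡ true
        mass≤   : mass₂ P ≤ (2 * Q) ^ t * mass₂ P′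

    select : ∀ t (P : Spider → Bool) U → (∀ {S} → P S ≡ true → Joined S) → 2 * Q * (length U + t) ≤ d y → 0 < d y → 0 < mass₂ P → Selection t P U
    select zero P U Pj le d>0 m>0 = record
      { R = λ () ; R∉ = λ () ; R-inj = λ () ; P′ = P ; P′⊆ = λ e → e ; P′-join = λ _ () ; mass≤ = ≤-reflexive (sym (+-identityʳ _)) }
    select (suc t) P U Pj le d>0 m>0 =
      let x , x∉ , m≤ = select-one U P Pj (≤-trans (*-monoʳ-≤ (2 * Q) (m≤m+n (length U) (suc t))) le) d>0 m>0
      in finish x x∉ m≤ (select t (λ S → P S ∧ joins x S) (x ∷ U) (λ {S} q → Pj (proj₁ (∧-true {P S} q)))
            (≤-trans (≤-reflexive (cong (2 * Q *_) (sym (+-suc (length U) t)))) le) d>0 (0<t≤c*x (2 * Q) m>0 m≤))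
      where
      finish : ∀ x → x ∉ U → mass₂ P ≤ 2 * Q * mass₂ (λ S → P S ∧ joins x S) → Selection t (λ S → P S ∧ joins x S) (x ∷ U) → Selection (suc t) P U
      finish x x∉ m≤ sel = record
        { R = R ; R∉ = R∉ ; R-inj = R-inj ; P′ = sel.P′ ; P′⊆ = λ {S} e → proj₁ (∧-true {P S} (sel.P′⊆ e)) ; P′-join = join
        ; mass≤ = ≤-trans m≤ (≤-trans (*-monoʳ-≤ (2 * Q) sel.mass≤) (≤-reflexive (sym (*-assoc (2 * Q) _ _)))) }
        where
        module sel = Selection sel
        R : Fin (suc t) → V
        R zero    = x
        R (suc b) = sel.R b
        R∉ : ∀ b → R b ∉ U
        R∉ zero    = x∉
        R∉ (suc b) k = sel.R∉ b (there k)
        R-inj : ∀ b b′ → R b ≡ R b′ → b ≡ b′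
        R-inj zero    zero     e = refl
        R-inj zero    (suc b′) e = ⊥-elim (sel.R∉ b′ (here (sym e)))
        R-inj (suc b) zero     e = ⊥-elim (sel.R∉ b (here e))
        R-inj (suc b) (suc b′) e = cong suc (sel.R-inj b b′ e)
        join : ∀ {S} → sel.P′ S ≡ true → ∀ b → joins (R b) S ≡ true
        join {S} e zero    = proj₂ (∧-true {P S} (sel.P′⊆ e))
        join {S} e (suc b) = sel.P′-join e b

    joined : Spider → Bool
    joined S = 1 ≤ᵇ ∑ vs (λ x → ⟦ joins x S ⟧)

    joined-true : ∀ {S} → joined S ≡ true → Joined S
    joined-true {S} e with ∑-pos vs (λ x → ⟦ joins x S ⟧) (≤ᵇ-true e)
    ... | x , _ , lt = x , proj₁ (⟦⟧-pos (joins x S) {1} (subst (0 <_) (sym (*-identityʳ _)) lt))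

    -- A good spider is joined by its own tip, so `dense` supplies the mass with which the selection
    -- starts.
    start-mass : class k₂ S₀ weight ≤ Q * mass₂ joined
    start-mass = ≤-trans (dense good-S₀ i₂) (*-monoʳ-≤ Q (class-mono k₂ S₀ λ S _ → *-monoˡ-≤ (weight S) (good⇒joined S)))
      where
      good⇒joined : ∀ S → ⟦ good S ⟧ ≤ ⟦ joined S ⟧
      good⇒joined S with good S in g
      ... | false = z≤n
      ... | true = ≤-reflexive (sym (⟦⟧-true (true-≤ᵇ (any-true vs {λ x → joins x S} (∈vs (tipOf S i₁)) (joins-intro {tipOf S i₁} {S} {S} g (Equivalence.~refl (agree-equivalence k₁) S) (==-refl (tipOf S i₁)))))))

    module _ (s′ t r M : ℕ) (o : Bool) (m : ℕ) (par : ⟦ o ⟧ + (2 * m + (toℕ (tip i₂) + 1)) ≡ M) (long : o ≡ true → 0 < toℕ (tip i₂)) where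

      private
        Qₜ = Q * (2 * Q) ^ t

        -- The position on leg i₂ whose vertices become the left branch vertices.
        xleg : ∀ o → (o ≡ true → 0 < toℕ (tip i₂)) → ∃ λ j → corner o i₂ ≡ at i₂ j
        xleg false _ = tip i₂ , refl
        xleg true  h with pre-cases κ C i₂
        ... | inj₁ (z , _) = ⊥-elim (<-irrefl (sym z) (h refl))
        ... | inj₂ (j , _ , e) = j , e

        lookup-left : ∀ F P′ → class k₂ S₀ weight ≤ Qₜ * mass₂ P′ → Qₜ * (length F * n) < δ →
          ∃ λ S → P′ S ≡ true × (∀ j → val S (at i₂ j) ∉ F)
        lookup-left F P′ m≤ lt with ∑-< spiders _ _ (*-cancelˡ-< Qₜ _ _ (<-≤-trans (Q*X<m {δ} {Qₜ} {length F * n} (avoid-mass S₀ i₂ 0 F) lt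
                 (<-≤-trans (positive good-S₀) (class-self k₂ S₀ weight))) m≤))
        ... | S , _ , lt′ with agree k₂ S₀ S
        ...   | false = ⊥-elim (n≮0 lt′)
        ...   | true with P′ S in e
        ...     | false = ⊥-elim (n≮0 lt′)
        ...     | true = S , e , λ j → avoid-sound S i₂ 0 F (none _ lt′) j z≤n
          where
          none : ∀ b → 1 * (b * weight S) < 1 * (1 * weight S) → b ≡ 0
          none zero    _  = refl
          none (suc b) lt = ⊥-elim (<-irrefl refl (<-≤-trans lt (*-monoʳ-≤ 1 (*-monoˡ-≤ (weight S) {1} {suc b} (s≤s z≤n)))))

      -- The number `s′` of left branch vertices is independent of the number of legs: spiders with
      -- two legs suffice for every `s′`. The bound by `d y` lets `t` right vertices be selected,
      -- the bound by `δ` keeps the left vertices distinct from each other and from these.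
      paired-subdivision : 2 * Q * t ≤ d y → 0 < d y → Qₜ * ((t + s′) * n) < δ → (s′ + t) + s′ * (t * r) * M + (1 + M) ≤ N → Subdivision s′ t r M
      paired-subdivision Qt≤ d>0 Q<δ le = build (select t joined [] (λ {S} → joined-true {S}) Qt≤ d>0 (0<t≤c*x Q (<-≤-trans (positive good-S₀) (class-self k₂ S₀ weight)) start-mass))
        where
        build : Selection t joined [] → Subdivision s′ t r M
        build sel = with-lefts (greedy (λ S → val S (corner o i₂) ∷ []) (t + s′) 1 s′ (λ _ S → sel.P′ S ≡ true) pick Rs (≤-reflexive (cong₂ _+_ len-Rs (*-identityʳ s′))))
          where
          module sel = Selection sel
          Rs = map sel.R (allFin t)
          len-Rs : length Rs ≡ t
          len-Rs = trans (length-map sel.R (allFin t)) (length-allFin t)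
          m≤ : class k₂ S₀ weight ≤ Qₜ * mass₂ sel.P′
          m≤ = ≤-trans start-mass (≤-trans (*-monoʳ-≤ Q sel.mass≤) (≤-reflexive (sym (*-assoc Q _ _))))
          pick : ∀ (e : Fin s′) F → length F ≤ t + s′ → ∃ λ S → sel.P′ S ≡ true × 1 ≤ 1 × (∀ {x} → x ∈ val S (corner o i₂) ∷ [] → x ∉ F)
          pick e F F≤ =
            let S , q , av = lookup-left F sel.P′ m≤ (≤-<-trans (*-monoʳ-≤ Qₜ (*-monoˡ-≤ n F≤)) Q<δ)
                j , ex = xleg o long
            in S , q , ≤-refl , λ { (here refl) → subst (λ p → val S p ∉ F) (sym ex) (av j) }
          with-lefts : (∃ λ (f : Fin s′ → Spider) → (∀ e → sel.P′ (f e) ≡ true) × (∀ e {x} → x ∈ val (f e) (corner o i₂) ∷ [] → x ∉ Rs) ×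
              (∀ e e′ {x} → x ∈ val (f e) (corner o i₂) ∷ [] → x ∈ val (f e′) (corner o i₂) ∷ [] → e ≡ e′)) → Subdivision s′ t r M
          with-lefts (f , fP , f∉ , f-inj) = linked-subdivision s′ t r M (N ∸ (1 + M)) (λ a → val (f a) (corner o i₂)) sel.R B
              (λ {a} {a′} e → f-inj a a′ (here refl) (here e)) (λ {b} {b′} e → sel.R-inj b b′ e) (λ {a} {b} e → f∉ a (here refl) (subst (_∈ Rs) (sym e) (R∈ b)))
              (λ a → ∈-++⁺ˡ (∈-map⁺ (λ a → val (f a) (corner o i₂)) (∈-allFin a))) (λ b → ∈-++⁺ʳ Ls (R∈ b))
              (≤-trans (≤-reflexive (cong (_+ s′ * (t * r) * M) (trans (length-++ Ls) (cong₂ _+_ (trans (length-map _ (allFin s′)) (length-allFin s′)) len-Rs))))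
                (≤-trans (≤-reflexive (sym (m+n∸n≡m _ (1 + M)))) (∸-monoˡ-≤ (1 + M) le)))
              connect
            where
            Ls = map (λ a → val (f a) (corner o i₂)) (allFin s′)
            B = Ls ++ Rs
            R∈ : ∀ b → sel.R b ∈ Rs
            R∈ b = ∈-map⁺ sel.R (∈-allFin b)
            connect : ∀ a b F → length F ≤ N ∸ (1 + M) → (∀ {x} → x ∈ B → x ∈ F) → Link M (val (f a) (corner o i₂)) (sel.R b) F
            connect a b F F≤ _ =
              let S′ , g , ag , e = joins-elim {sel.R b} {f a} (sel.P′-join (fP a) b)
                  j , ex = xleg o long
                  same : val (f a) (corner o i₂) ≡ val S′ (corner o i₂)
                  same = subst (λ p → val (f a) p ≡ val S′ p) (sym ex) (agree-sound {k₁} {f a} {S′} ag (at i₂ j) (keep-other 0 j (λ q → i₁≢i₂ (sym q))))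
              in subst₂ (λ u v → Link M u v F) (sym same) e (link M o m par {S′} F g
                   (≤-trans (+-monoˡ-≤ (1 + M) F≤) (≤-reflexive (m∸n+n≡m (≤-trans (m≤n+m (1 + M) ((s′ + t) + s′ * (t * r) * M)) le)))))

-- Rich pairs force a subdivision

does-refl : ∀ {n} (i : Fin n) → does (i Fin.≟ i) ≡ true
does-refl i with i Fin.≟ i
... | yes _ = refl
... | no ne = ⊥-elim (ne refl)

does-≢ : ∀ {n} {i j : Fin n} → i ≢ j → does (i Fin.≟ j) ≡ false
does-≢ {i = i} {j} ne with i Fin.≟ j
... | yes e = ⊥-elim (ne e)
... | no _ = refl

does-≡ : ∀ {n} {i j : Fin n} → does (i Fin.≟ j) ≡ true → i ≡ j
does-≡ {i = i} {j} e with i Fin.≟ j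
... | yes q = q

opaque
  -- Bounds the vertices to be avoided at any time: the branch vertices, all finished paths, and the
  -- path under construction.
  budget : ℕ → ℕ → ℕ → ℕ → ℕ
  budget s t r M = (s + t) + s * (t * r) * M + (1 + M)

  budget-pair : ∀ s t r M → (s + t) + s * (t * r) * M + (1 + M) ≤ budget s t r M
  budget-pair s t r M = ≤-refl

  -- Sufficient minimum degree for closing a system of mass 1/A in the space of s₀ legs of length n.
  degreeNeeded : (s₀ n A N s t : ℕ) → ℕ
  degreeNeeded s₀ n A N s t =
    s₀ * (n * (1 + s₀ * n)) * (2 * A) + suc (loss s₀ A * (N * n)) + 2 * loss s₀ A * t + suc (loss s₀ A * (2 * loss s₀ A) ^ t * ((t + s) * n))

  four-parts : ∀ a b c e → (a ≤ a + b + c + e) × (b ≤ a + b + c + e) × (c ≤ a + b + c + e) × (e ≤ a + b + c + e)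
  four-parts a b c e = ≤-trans (m≤m+n a b) (≤-trans (m≤m+n (a + b) c) (m≤m+n (a + b + c) e)) ,
    ≤-trans (m≤n+m b a) (≤-trans (m≤m+n (a + b) c) (m≤m+n (a + b + c) e)) ,
    ≤-trans (m≤n+m c (a + b)) (m≤m+n (a + b + c) e) , m≤n+m e (a + b + c)

  degreeNeeded-parts : ∀ s₀ n A N s t → let D = degreeNeeded s₀ n A N s t in
    (s₀ * (n * (1 + s₀ * n)) * (2 * A) ≤ D) × (suc (loss s₀ A * (N * n)) ≤ D) × (2 * loss s₀ A * t ≤ D) × (suc (loss s₀ A * (2 * loss s₀ A) ^ t * ((t + s) * n)) ≤ D)
  degreeNeeded-parts s₀ n A N s t = four-parts (s₀ * (n * (1 + s₀ * n)) * (2 * A)) (suc (loss s₀ A * (N * n))) (2 * loss s₀ A * t) (suc (loss s₀ A * (2 * loss s₀ A) ^ t * ((t + s) * n)))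

-- Sums over walks with prescribed vertices

module PathSums (Γ : WeightedGraph) where
  open WeightedGraph Γ
  open Kernel Γ

  p-step : ∀ k u (φ : V → ℕ) → ∑ vs (λ v → p1 u v * ∑ vs (λ w → p k v w * φ w)) ≡ ∑ vs (λ w → p (suc k) u w * φ w)
  p-step k u φ = trans (∑-cong vs λ v → sym (∑-*ˡ vs (p1 u v) _)) (trans (∑-swap vs vs _)
            (∑-cong vs λ w → trans (∑-cong vs λ v → sym (*-assoc (p1 u v) _ _)) (∑-*ʳ vs (φ w) _)))

  cons-sum : ∀ n u (g : Vec V (suc n) → ℕ) → ∑ (walks (suc n)) (λ x → wt u x * g x) ≡ ∑ vs (λ v → p1 u v * ∑ (walks n) (λ x → wt v x * g (v ∷ x)))
  cons-sum n u g = trans (∑-tuples vs n _) (∑-cong vs λ v → trans (∑-cong (walks n) λ x → *-assoc (p1 u v) _ _) (∑-*ˡ (walks n) (p1 u v) _))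

  last-sum : ∀ j u (φ : V → ℕ) → ∑ (walks (suc j)) (λ x → wt u x * φ (lookup x (fromℕ j))) ≡ ∑ vs (λ v → p (suc j) u v * φ v)
  last-sum zero    u φ = trans (cons-sum 0 u (λ x → φ (lookup x zero))) (∑-cong vs λ v → cong₂ _*_ (sym (p-one u v)) (trans (+-identityʳ _) (+-identityʳ _)))
  last-sum (suc j) u φ = trans (cons-sum (suc j) u (λ x → φ (lookup x (fromℕ (suc j))))) (trans (∑-cong vs λ v → cong (p1 u v *_) (last-sum j v φ)) (p-step (suc j) u φ))

  mid-sum : ∀ j (i : Fin (suc j)) → toℕ i < j → ∀ u (φ ψ : V → ℕ) →
    ∑ (walks (suc j)) (λ x → wt u x * (φ (lookup x i) * ψ (lookup x (fromℕ j)))) ≡ ∑ vs (λ f → p (suc (toℕ i)) u f * (φ f * ∑ vs (λ v → p (j ∸ toℕ i) f v * ψ v)))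
  mid-sum (suc j) zero lt u φ ψ = trans (cons-sum (suc j) u (λ x → φ (lookup x zero) * ψ (lookup x (fromℕ (suc j))))) (∑-cong vs λ v → cong₂ _*_ (sym (p-one u v))
    (trans (∑-cong (walks (suc j)) λ x → x*yz≡y*xz (wt v x) (φ v) _) (trans (∑-*ˡ (walks (suc j)) (φ v) _) (cong (φ v *_) (last-sum j v ψ)))))
  mid-sum (suc j) (suc i) (s≤s lt) u φ ψ = trans (cons-sum (suc j) u (λ x → φ (lookup x (suc i)) * ψ (lookup x (fromℕ (suc j)))))
    (trans (∑-cong vs λ v → cong (p1 u v *_) (mid-sum j i lt v φ ψ)) (p-step (suc (toℕ i)) u _))

  pinned : ∀ {n} u (ref : Vec V n) → ∑ (walks n) (λ x → ⟦ agreeLeg (λ _ → true) ref x ⟧ * wt u x) ≡ wt u ref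
  pinned u []        = refl
  pinned {suc n} u (r ∷ ref) = begin
    ∑ (walks (suc n)) (λ x → ⟦ agreeLeg (λ _ → true) (r ∷ ref) x ⟧ * wt u x)
      ≡⟨ trans (∑-tuples vs n _) (∑-cong vs λ v → trans (∑-cong (walks n) λ x → trans (cong (_* (p1 u v * wt v x)) (⟦∧⟧ (r == v) _)) (solve 4 (λ a b c d → a :* b :* (c :* d) := a :* c :* (b :* d)) refl ⟦ r == v ⟧ _ (p1 u v) (wt v x))) (trans (∑-*ˡ (walks n) (⟦ r == v ⟧ * p1 u v) _) (*-assoc ⟦ r == v ⟧ _ _))) ⟩
    ∑ vs (λ v → ⟦ r == v ⟧ * (p1 u v * ∑ (walks n) (λ x → ⟦ agreeLeg (λ _ → true) ref x ⟧ * wt v x))) ≡⟨ ∑-δ′ r _ ⟩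
    p1 u r * ∑ (walks n) (λ x → ⟦ agreeLeg (λ _ → true) ref x ⟧ * wt r x) ≡⟨ cong (p1 u r *_) (pinned r ref) ⟩
    p1 u r * wt r ref ∎
    where open ≡-Reasoning

  d-rev : ∀ u v → d u * p1 u v ≡ d v * p1 v u
  d-rev u v = trans (d*p1 u v) (trans (cong (λ b → W * ⟦ b ⟧) (adj-sym u v)) (sym (d*p1 v u)))

  agree-last : ∀ j (ref x : Vec V (suc j)) → agreeLeg (λ i → does (i Fin.≟ fromℕ j)) ref x ≡ (lookup x (fromℕ j) == lookup ref (fromℕ j))
  agree-last j ref x = bool-iff
    (λ e → trans (cong (lookup x (fromℕ j) ==_) (agreeLeg-sound {m = λ i → does (i Fin.≟ fromℕ j)} {ref} {x} e (fromℕ j) (does-refl (fromℕ j)))) (==-refl _))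
    (λ e → agreeLeg-complete {m = λ i → does (i Fin.≟ fromℕ j)} {ref} {x} λ i q → subst (λ i → lookup ref i ≡ lookup x i) (sym (does-≡ {i = i} {fromℕ j} q)) (sym (==-true e)))

module RichPaths (Γ : WeightedGraph) (Β : Bipartition Γ) (δ : ℕ) (δ≤d : MinDegree Γ δ) (j : ℕ) where
  open WeightedGraph Γ
  open Kernel Γ
  open PathSums Γ
  open Paths Γ Β using (rich; rich-true; mass; total)
  open Spiders Γ 2 (suc j) d
  open Systems Γ 2 (suc j) d δ δ≤d
  open Trails Γ
  open Pairing Γ 2 (suc j) d δ δ≤d using (paired-subdivision)

  -- A walk of length `suc (suc j)` between two vertices is viewed as part of a spider: its second
  -- vertex is the centre, its start is the first vertex of leg 0, its end is the last vertex of leg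
  -- 1. Pinning all of leg 0 and the end of leg 1 leaves exactly the interior of the walk free.
  K : Pos → Bool
  K ctr               = false
  K (at zero _)       = true
  K (at (suc zero) i) = does (i Fin.≟ fromℕ j)

  κ : KernelShape K
  κ = record
    { tip = λ { zero → zero ; (suc zero) → fromℕ j } ; K-ctr = refl
    ; K-tip = λ { zero → refl ; (suc zero) → does-refl (fromℕ j) }
    ; K-pre = λ { zero i () ; (suc zero) i lt → does-≢ {i = i} {fromℕ j} λ { refl → <-irrefl refl lt } } }

  module _ (c : ℕ) (x : V) (l₀ : Vec V j) (y : V) (l₁ : Vec V (suc j)) where
    private
      S : Spider
      S = y , (x ∷ l₀) ∷ l₁ ∷ []
      v = lookup l₁ (fromℕ j)
      κ₀ = wt x l₀ * d x

    -- Reversibility turns `d y′ * p1 y′ x` into `d x * p1 x y′`, so the sum over centres becomes a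
    -- sum over walks from `x`. The pinned rest of leg 0 enters only through the constant `κ₀`.
    class-value : ∀ (ψ : V → ℕ) (φ : Vec V (suc j) → ℕ) (B : V → ℕ) →
      (∀ y′ → ∑ (walks (suc j)) (λ z → wt y′ z * (φ z * ⟦ lookup z (fromℕ j) == v ⟧)) ≡ B y′) →
      class K S (λ S′ → ψ (proj₁ S′) * (weight S′ * φ (lookup (proj₂ S′) (suc zero)))) ≡ κ₀ * ∑ vs (λ y′ → p1 x y′ * (ψ y′ * B y′))
    class-value ψ φ B hB = begin
      class K S (λ S′ → ψ (proj₁ S′) * (weight S′ * φ (lookup (proj₂ S′) (suc zero))))
        ≡⟨ ∑-cong spiders (λ S′ → cong (λ z → ⟦ agree K S S′ ⟧ * (ψ (proj₁ S′) * (weight S′ * z))) (sym (trans (+-identityʳ _) (*-identityʳ _)))) ⟩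
      class K S (λ S′ → ψ (proj₁ S′) * (weight S′ * ∏ 2 (λ i → φ′ i (lookup (proj₂ S′) i))))
        ≡⟨ class-product K y ((x ∷ l₀) ∷ l₁ ∷ []) ψ φ′ ⟩
      ∑ vs (λ y′ → ψ y′ * (1 * (d y′ * (∑ (walks (suc j)) (λ z → ⟦ agreeLeg (λ _ → true) (x ∷ l₀) z ⟧ * (wt y′ z * 1)) * (∑ (walks (suc j)) (λ z → ⟦ agreeLeg (λ i → does (i Fin.≟ fromℕ j)) l₁ z ⟧ * (wt y′ z * φ z)) * 1)))))
        ≡⟨ ∑-cong vs (λ y′ → cong (λ z → ψ y′ * (1 * z)) (trans (cong₂ (λ a b → d y′ * (a * (b * 1))) (leg₀ y′) (leg₁ y′)) (rev y′))) ⟩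
      ∑ vs (λ y′ → ψ y′ * (1 * (κ₀ * (p1 x y′ * B y′))))
        ≡⟨ ∑-cong vs (λ y′ → solve 4 (λ s k q b → s :* (con 1 :* (k :* (q :* b))) := k :* (q :* (s :* b))) refl (ψ y′) κ₀ (p1 x y′) (B y′)) ⟩
      ∑ vs (λ y′ → κ₀ * (p1 x y′ * (ψ y′ * B y′)))
        ≡⟨ ∑-*ˡ vs κ₀ _ ⟩
      κ₀ * ∑ vs (λ y′ → p1 x y′ * (ψ y′ * B y′)) ∎
      where
      open ≡-Reasoning
      φ′ : Fin 2 → Vec V (suc j) → ℕ
      φ′ zero       z = 1
      φ′ (suc zero) z = φ z
      leg₀ : ∀ y′ → ∑ (walks (suc j)) (λ z → ⟦ agreeLeg (λ _ → true) (x ∷ l₀) z ⟧ * (wt y′ z * 1)) ≡ p1 y′ x * wt x l₀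
      leg₀ y′ = trans (∑-cong (walks (suc j)) λ z → cong (⟦ agreeLeg (λ _ → true) (x ∷ l₀) z ⟧ *_) (*-identityʳ (wt y′ z))) (pinned y′ (x ∷ l₀))
      leg₁ : ∀ y′ → ∑ (walks (suc j)) (λ z → ⟦ agreeLeg (λ i → does (i Fin.≟ fromℕ j)) l₁ z ⟧ * (wt y′ z * φ z)) ≡ B y′
      leg₁ y′ = trans (∑-cong (walks (suc j)) λ z → trans (cong (λ b → ⟦ b ⟧ * (wt y′ z * φ z)) (agree-last j l₁ z)) (solve 3 (λ a b c → a :* (b :* c) := b :* (c :* a)) refl ⟦ lookup z (fromℕ j) == v ⟧ (wt y′ z) (φ z))) (hB y′)
      rev : ∀ y′ → d y′ * (p1 y′ x * wt x l₀ * (B y′ * 1)) ≡ κ₀ * (p1 x y′ * B y′)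
      rev y′ = trans (solve 4 (λ a b w z → a :* (b :* w :* (z :* con 1)) := a :* b :* (w :* z)) refl (d y′) (p1 y′ x) (wt x l₀) (B y′))
        (trans (cong (_* (wt x l₀ * B y′)) (d-rev y′ x)) (solve 4 (λ a b w z → a :* b :* (w :* z) := w :* a :* (b :* z)) refl (d x) (p1 x y′) (wt x l₀) (B y′)))

    class-weight : class K S weight ≡ κ₀ * p (suc (suc j)) x v
    class-weight = trans (∑-cong spiders λ S′ → cong (⟦ agree K S S′ ⟧ *_) (sym (trans (+-identityʳ _) (*-identityʳ _))))
      (trans (class-value (λ _ → 1) (λ _ → 1) (λ y′ → p (suc j) y′ v) (λ y′ → trans (∑-cong (walks (suc j)) λ z → cong (wt y′ z *_) (+-identityʳ _)) (trans (last-sum j y′ (λ u → ⟦ u == v ⟧)) (trans (∑-cong vs λ u → *-comm (p (suc j) y′ u) _) (∑-δ v (p (suc j) y′))))))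
        (cong (κ₀ *_) (∑-cong vs λ y′ → cong (p1 x y′ *_) (+-identityʳ _))))

    module _ (R : rich c j x v ≡ true) where

      hit-value : ∀ f q → c * (⟦ not (K q) ⟧ * class K S (λ S′ → ⟦ val S′ q == f ⟧ * weight S′)) ≤ class K S weight
      hit-value f (at zero i) = ≤-trans (≤-reflexive (*-zeroʳ c)) z≤n
      hit-value f ctr = begin
        c * (1 * class K S (λ S′ → ⟦ proj₁ S′ == f ⟧ * weight S′))
          ≡⟨ cong (c *_) (trans (+-identityʳ _) (trans (∑-cong spiders λ S′ → cong (λ z → ⟦ agree K S S′ ⟧ * (⟦ proj₁ S′ == f ⟧ * z)) (sym (*-identityʳ (weight S′))))
               (class-value (λ u → ⟦ u == f ⟧) (λ _ → 1) (λ y′ → p (suc j) y′ v) (λ y′ → trans (∑-cong (walks (suc j)) λ z → cong (wt y′ z *_) (+-identityʳ _)) (trans (last-sum j y′ (λ u → ⟦ u == v ⟧)) (trans (∑-cong vs λ u → *-comm (p (suc j) y′ u) _) (∑-δ v (p (suc j) y′)))))))) ⟩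
        c * (κ₀ * ∑ vs (λ y′ → p1 x y′ * (⟦ y′ == f ⟧ * p (suc j) y′ v)))
          ≡⟨ cong (λ z → c * (κ₀ * z)) (trans (∑-cong vs λ y′ → x*yz≡y*xz (p1 x y′) ⟦ y′ == f ⟧ _) (trans (∑-δ f _) (cong (_* p (suc j) f v) (sym (p-one x f))))) ⟩
        c * (κ₀ * (p 1 x f * p (suc j) f v)) ≡⟨ x*yz≡y*xz c κ₀ _ ⟩
        κ₀ * (c * (p 1 x f * p (suc j) f v)) ≤⟨ *-monoʳ-≤ κ₀ (rich-true {c} {j} {x} {v} R {0} {j} refl f) ⟩
        κ₀ * p (suc (suc j)) x v ≡⟨ sym class-weight ⟩
        class K S weight ∎
        where open ≤-Reasoning
      hit-value f (at (suc zero) i) with toℕ i <? j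
      ... | no ge = ≤-trans (≤-reflexive (trans (cong (λ b → c * (⟦ not b ⟧ * class K S (λ S′ → ⟦ val S′ (at (suc zero) i) == f ⟧ * weight S′))) is-last) (*-zeroʳ c))) z≤n
        where
        is-last : does (i Fin.≟ fromℕ j) ≡ true
        is-last = trans (cong (λ i → does (i Fin.≟ fromℕ j)) (toℕ-injective (trans (≤-antisym (s≤s⁻¹ (toℕ<n i)) (≮⇒≥ ge)) (sym (toℕ-fromℕ j))))) (does-refl (fromℕ j))
      ... | yes lt = begin
        c * (⟦ not (K (at (suc zero) i)) ⟧ * class K S (λ S′ → ⟦ val S′ (at (suc zero) i) == f ⟧ * weight S′))
          ≤⟨ *-monoʳ-≤ c (⟦⟧*≤ (not (K (at (suc zero) i))) _) ⟩
        c * class K S (λ S′ → ⟦ val S′ (at (suc zero) i) == f ⟧ * weight S′)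
          ≡⟨ cong (c *_) (trans (∑-cong spiders λ S′ → cong (⟦ agree K S S′ ⟧ *_) (trans (*-comm _ (weight S′)) (sym (+-identityʳ _))))
               (class-value (λ _ → 1) (λ z → ⟦ lookup z i == f ⟧) (λ y′ → p (suc (toℕ i)) y′ f * p (j ∸ toℕ i) f v) two-points)) ⟩
        c * (κ₀ * ∑ vs (λ y′ → p1 x y′ * (1 * (p (suc (toℕ i)) y′ f * p (j ∸ toℕ i) f v))))
          ≡⟨ cong (λ z → c * (κ₀ * z)) (trans (∑-cong vs λ y′ → trans (cong (p1 x y′ *_) (+-identityʳ _)) (sym (*-assoc (p1 x y′) _ _))) (∑-*ʳ vs (p (j ∸ toℕ i) f v) _)) ⟩
        c * (κ₀ * (p (suc (suc (toℕ i))) x f * p (j ∸ toℕ i) f v)) ≡⟨ x*yz≡y*xz c κ₀ _ ⟩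
        κ₀ * (c * (p (suc (suc (toℕ i))) x f * p (j ∸ toℕ i) f v)) ≡⟨ cong (λ b → κ₀ * (c * (p (suc (suc (toℕ i))) x f * p b f v))) (sym (suc[m∸1+n]≡m∸n j (toℕ i) lt)) ⟩
        κ₀ * (c * (p (suc (suc (toℕ i))) x f * p (suc (j ∸ suc (toℕ i))) f v)) ≤⟨ *-monoʳ-≤ κ₀ (rich-true {c} {j} {x} {v} R {suc (toℕ i)} {j ∸ suc (toℕ i)} (m+[n∸m]≡n lt) f) ⟩
        κ₀ * p (suc (suc j)) x v ≡⟨ sym class-weight ⟩
        class K S weight ∎
        where
        open ≤-Reasoning
        two-points : ∀ y′ → ∑ (walks (suc j)) (λ z → wt y′ z * (⟦ lookup z i == f ⟧ * ⟦ lookup z (fromℕ j) == v ⟧)) ≡ p (suc (toℕ i)) y′ f * p (j ∸ toℕ i) f v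
        two-points y′ = trans (mid-sum j i lt y′ (λ u → ⟦ u == f ⟧) (λ u → ⟦ u == v ⟧))
          (trans (∑-cong vs λ u → x*yz≡y*xz (p (suc (toℕ i)) y′ u) ⟦ u == f ⟧ _) (trans (∑-δ f _) (cong (p (suc (toℕ i)) y′ f *_) (trans (∑-cong vs λ u → *-comm (p (j ∸ toℕ i) f u) _) (∑-δ v (p (j ∸ toℕ i) f))))))

      -- A union bound over all positions; this is the origin of the factor `1 + 2 * suc j` in the
      -- required richness.
      rich-spider : ∀ c′ → (1 + 2 * suc j) * c′ ≤ c → richSpider K c′ S ≡ true
      rich-spider c′ le = true-≤ᵇ (≤-reflexive (trans (∑-cong vs λ f → cong (λ b → ⟦ not b ⟧) (true-≤ᵇ (at-f f))) (∑-zero vs)))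
        where
        open ≤-Reasoning
        term : V → Pos → ℕ
        term f q = ⟦ not (K q) ⟧ * class K S (λ S′ → ⟦ val S′ q == f ⟧ * weight S′)
        at-f : ∀ f → c′ * class K S (λ S′ → hits K f S′ * weight S′) ≤ class K S weight
        at-f f = begin
          c′ * class K S (λ S′ → hits K f S′ * weight S′)
            ≡⟨ cong (c′ *_) (trans (∑-cong spiders λ S′ → cong (⟦ agree K S S′ ⟧ *_) (trans (sym (∑-*ʳ poss (weight S′) (λ q → ⟦ not (K q) ⟧ * ⟦ val S′ q == f ⟧))) (∑-cong poss λ q → *-assoc ⟦ not (K q) ⟧ ⟦ val S′ q == f ⟧ (weight S′)))) (trans (class-∑ K S poss _) (∑-cong poss λ q → class-*ˡ K S ⟦ not (K q) ⟧ _))) ⟩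
          c′ * ∑ poss (term f) ≡⟨ sym (∑-*ˡ poss c′ _) ⟩
          ∑ poss (λ q → c′ * term f q) ≤⟨ ∑-uniform poss (λ q → c′ * term f q) (class K S weight) (λ {q} _ → each q) ⟩
          class K S weight ∎
          where
          each : ∀ q → length poss * (c′ * term f q) ≤ class K S weight
          each q = begin
            length poss * (c′ * term f q) ≡⟨ sym (*-assoc (length poss) c′ _) ⟩
            length poss * c′ * term f q ≤⟨ *-monoˡ-≤ (term f q) (≤-trans (≤-reflexive (cong (_* c′) length-poss)) le) ⟩
            c * term f q ≤⟨ hit-value f q ⟩
            class K S weight ∎

  private
    richEnds : ℕ → Spider → Bool
    richEnds c S = rich c j (val S (at zero zero)) (val S (at (suc zero) (fromℕ j)))

  -- The vertices of leg 0 after the first sum out to `W ^ j`; reversing the edge at the centre then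
  -- makes the walk start at `x`.
  mass-transfer : ∀ c → ∑ spiders (λ S → ⟦ richEnds c S ⟧ * weight S) ≡ W ^ j * mass (rich c j) (suc j)
  mass-transfer c = begin
    ∑ spiders (λ S → ⟦ richEnds c S ⟧ * weight S)
      ≡⟨ trans (∑-spiders _) (∑-cong vs λ y → trans (∑-tuples (walks (suc j)) 1 _) (∑-cong (walks (suc j)) λ l₀ → trans (∑-tuples (walks (suc j)) 0 _) (∑-cong (walks (suc j)) λ l₁ → trans (+-identityʳ _) (solve 4 (λ r m a b → r :* (m :* (a :* (b :* con 1))) := m :* a :* (b :* r)) refl ⟦ rich c j (lookup l₀ zero) (lookup l₁ (fromℕ j)) ⟧ (d y) (wt y l₀) (wt y l₁))))) ⟩
    ∑ vs (λ y → ∑ (walks (suc j)) (λ l₀ → ∑ (walks (suc j)) (λ l₁ → d y * wt y l₀ * (wt y l₁ * ⟦ rich c j (lookup l₀ zero) (lookup l₁ (fromℕ j)) ⟧))))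
      ≡⟨ ∑-cong vs (λ y → trans (∑-cong (walks (suc j)) λ l₀ → trans (∑-*ˡ (walks (suc j)) (d y * wt y l₀) _) (trans (cong (d y * wt y l₀ *_) (last-sum j y _)) (*-assoc (d y) _ _))) (∑-*ˡ (walks (suc j)) (d y) _)) ⟩
    ∑ vs (λ y → d y * ∑ (walks (suc j)) (λ l₀ → wt y l₀ * G y (lookup l₀ zero)))
      ≡⟨ ∑-cong vs (λ y → cong (d y *_) (trans (cons-sum j y (λ l₀ → G y (lookup l₀ zero))) (∑-cong vs λ x → trans (cong (p1 y x *_) (∑-*ʳ (walks j) (G y x) (wt x))) (trans (sym (*-assoc (p1 y x) _ _)) (trans (cong (_* G y x) (trans (p1*Z j y x) (*-comm (p1 y x) _))) (*-assoc (W ^ j) _ _)))))) ⟩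
    ∑ vs (λ y → d y * ∑ vs (λ x → W ^ j * (p1 y x * G y x)))
      ≡⟨ ∑-cong vs (λ y → trans (sym (∑-*ˡ vs (d y) _)) (∑-cong vs λ x → trans (x*yz≡y*xz (d y) (W ^ j) _) (cong (W ^ j *_) (trans (sym (*-assoc (d y) _ _)) (trans (cong (_* G y x) (d-rev y x)) (*-assoc (d x) _ _)))))) ⟩
    ∑ vs (λ y → ∑ vs (λ x → W ^ j * (d x * (p1 x y * G y x))))
      ≡⟨ trans (∑-swap vs vs _) (trans (∑-cong vs λ x → trans (∑-*ˡ vs (W ^ j) _) (cong (W ^ j *_) (∑-*ˡ vs (d x) _))) (∑-*ˡ vs (W ^ j) _)) ⟩
    W ^ j * ∑ vs (λ x → d x * ∑ vs (λ y → p1 x y * G y x))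
      ≡⟨ cong (W ^ j *_) (∑-cong vs λ x → trans (cong (d x *_) (trans (p-step (suc j) x (λ v → ⟦ rich c j x v ⟧)) (∑-cong vs λ v → *-comm (p (suc (suc j)) x v) _))) (sym (∑-*ˡ vs (d x) _))) ⟩
    W ^ j * mass (rich c j) (suc j) ∎
    where
    open ≡-Reasoning
    G : V → V → ℕ
    G y x = ∑ vs (λ v → p (suc j) y v * ⟦ rich c j x v ⟧)

  totalMass≤ : totalMass ≤ W ^ j * total (suc j)
  totalMass≤ = begin
    totalMass ≡⟨ trans (∑-spiders _) (∑-cong vs λ y → trans (∑-*ˡ (tuples (walks (suc j)) 2) (d y) _) (cong (d y *_) (∑-∏-tuples (walks (suc j)) 2 (λ _ → wt y)))) ⟩
    ∑ vs (λ y → d y * (Z (suc j) y * (Z (suc j) y * 1))) ≤⟨ ∑-mono vs (λ y → *-monoʳ-≤ (d y) (*-mono-≤ (Z≤ (suc j) y) (*-monoˡ-≤ 1 (Z≤ (suc j) y)))) ⟩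
    ∑ vs (λ y → d y * (W ^ suc j * (W ^ suc j * 1))) ≡⟨ ∑-*ʳ vs _ d ⟩
    ∑ vs d * (W * W ^ j * (W * W ^ j * 1)) ≡⟨ solve 3 (λ D w x → D :* (w :* x :* (w :* x :* con 1)) := x :* (w :* (w :* x) :* D)) refl (∑ vs d) W (W ^ j) ⟩
    W ^ j * total (suc j) ∎
    where open ≤-Reasoning

  totalMass>0 : 0 < ∑ vs d → 0 < totalMass
  totalMass>0 lt with ∑-pos vs d lt
  ... | y , _ , d>0 = <-≤-trans (subst (0 <_) (sym e) pos) (≤-trans (∑-∈ (λ y → d y * (Z (suc j) y * (Z (suc j) y * 1))) (∈vs y))
        (≤-reflexive (sym (trans (∑-spiders _) (∑-cong vs λ y → trans (∑-*ˡ (tuples (walks (suc j)) 2) (d y) _) (cong (d y *_) (∑-∏-tuples (walks (suc j)) 2 (λ _ → wt y))))))))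
    where
    e : d y * (Z (suc j) y * (Z (suc j) y * 1)) ≡ d y * (W ^ suc j * (W ^ suc j * 1))
    e rewrite Z-alive (suc j) y d>0 = refl
    pos : 0 < d y * (W ^ suc j * (W ^ suc j * 1))
    pos = *-mono-≤ d>0 (*-mono-≤ wp (*-mono-≤ wp (s≤s z≤n)))
      where
      wp : 0 < W ^ suc j
      wp = m^n>0 W {{>-nonZero W-pos}} (suc j)

  rich-subdivision : ∀ A c s t r k → 0 < ∑ vs d → j ≤ 2 * k → total (suc j) ≤ A * mass (rich c j) (suc j) →
    (1 + 2 * suc j) * suc (loss 2 A * budget s t r (1 + 2 * k)) ≤ c →
    degreeNeeded 2 (suc j) A (budget s t r (1 + 2 * k)) s t ≤ δ → Subdivision s t r (1 + 2 * k)
  rich-subdivision A c s t r k d>0 j≤ rich≥ c≥ δ≥ =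
    let o , m , par , long = choose
        sys = closed-system κ A (suc (loss 2 A * N)) N (totalMass>0 d>0) spiders≥
                (≤-trans (≤-reflexive (cong (_* (2 * A)) length-clashes)) (≤-trans (proj₁ needed) δ≥))
                ≤-refl (≤-trans (proj₁ (proj₂ needed)) δ≥)
        y>0 = centre>0 sys
    in paired-subdivision κ sys zero (suc zero) (λ ()) refl s t r (1 + 2 * k) o m par long
         (≤-trans (proj₁ (proj₂ (proj₂ needed))) (≤-trans δ≥ (δ≤d _ y>0))) y>0 (≤-trans (proj₂ (proj₂ (proj₂ needed))) δ≥) (budget-pair s t r (1 + 2 * k))
    where
    N = budget s t r (1 + 2 * k)
    needed = degreeNeeded-parts 2 (suc j) A N s t
    centre>0 : (sys : ClosedSystem K κ N (loss 2 A)) → 0 < d (val (ClosedSystem.S₀ sys) ctr)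
    centre>0 sys with d (proj₁ (ClosedSystem.S₀ sys)) | ClosedSystem.positive sys (ClosedSystem.good-S₀ sys)
    ... | suc _ | _ = z<s
    ... | zero  | ()
    -- For `j` equal to 0 the predecessor of the tip would be the centre, but then the centre is
    -- already one interior vertex and the remaining `2 * k` need no shift.
    choose : ∃ λ o → ∃ λ m → ⟦ o ⟧ + (2 * m + (toℕ (fromℕ j) + 1)) ≡ 1 + 2 * k × (o ≡ true → 0 < toℕ (fromℕ j))
    choose rewrite toℕ-fromℕ j = go j j≤
      where
      go : ∀ j → j ≤ 2 * k → ∃ λ o → ∃ λ m → ⟦ o ⟧ + (2 * m + (j + 1)) ≡ 1 + 2 * k × (o ≡ true → 0 < j)
      go zero    _  = false , k , +-comm (2 * k) 1 , λ ()
      go (suc j) le with parity-gap {suc j + 1} {1 + 2 * k} (≤-trans (≤-reflexive (+-comm (suc j) 1)) (s≤s le))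
      ... | inj₁ (m , e) = false , m , e , λ ()
      ... | inj₂ (m , e) = true , m , e , λ _ → z<s
    transfer : ∀ S → ⟦ richEnds c S ⟧ * weight S ≤ ⟦ richSpider K (suc (loss 2 A * N)) S ⟧ * weight S
    transfer S@(y , (x ∷ l₀) ∷ l₁ ∷ []) with rich c j x (lookup l₁ (fromℕ j)) in e
    ... | false = z≤n
    ... | true  = ≤-reflexive (cong (λ b → ⟦ b ⟧ * weight S) (sym (rich-spider c x l₀ y l₁ e (suc (loss 2 A * N)) c≥)))
    spiders≥ : totalMass ≤ A * ∑ spiders (λ S → ⟦ richSpider K (suc (loss 2 A * N)) S ⟧ * weight S)
    spiders≥ = begin
      totalMass ≤⟨ totalMass≤ ⟩
      W ^ j * total (suc j) ≤⟨ *-monoʳ-≤ (W ^ j) rich≥ ⟩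
      W ^ j * (A * mass (rich c j) (suc j)) ≡⟨ x*yz≡y*xz (W ^ j) A _ ⟩
      A * (W ^ j * mass (rich c j) (suc j)) ≡⟨ cong (A *_) (sym (mass-transfer c)) ⟩
      A * ∑ spiders (λ S → ⟦ richEnds c S ⟧ * weight S) ≤⟨ *-monoʳ-≤ A (∑-mono spiders transfer) ⟩
      _ ∎
      where open ≤-Reasoning

-- Determination by a kernel

∨-true : ∀ {a b} → a ∨ b ≡ true → a ≡ true ⊎ b ≡ true
∨-true {true}  e = inj₁ refl
∨-true {false} e = inj₂ e

true-∨ˡ : ∀ {a b} → a ≡ true → a ∨ b ≡ true
true-∨ˡ refl = refl

true-∨ʳ : ∀ {a b} → b ≡ true → a ∨ b ≡ true
true-∨ʳ {true}  e = refl
true-∨ʳ {false} e = e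

module Determination (Γ : WeightedGraph) (s n : ℕ) (μ : WeightedGraph.V Γ → ℕ) (δ : ℕ) (δ≤d : MinDegree Γ δ) where
  open WeightedGraph Γ
  open Kernel Γ
  open Spiders Γ s n μ
  open Systems Γ s n μ δ δ≤d

  eqPos : Pos → Pos → Bool
  eqPos ctr      ctr        = true
  eqPos ctr      (at _ _)   = false
  eqPos (at _ _) ctr        = false
  eqPos (at i j) (at i′ j′) = does (i Fin.≟ i′) ∧ does (j Fin.≟ j′)

  eqPos-sound : ∀ p q → eqPos p q ≡ true → p ≡ q
  eqPos-sound ctr      ctr        e = refl
  eqPos-sound (at i j) (at i′ j′) e with i Fin.≟ i′ | j Fin.≟ j′
  ... | yes refl | yes refl = refl

  eqPos-refl : ∀ p → eqPos p p ≡ true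
  eqPos-refl ctr = refl
  eqPos-refl (at i j) with i Fin.≟ i | j Fin.≟ j
  ... | yes _ | yes _ = refl
  ... | no ne | _     = ⊥-elim (ne refl)
  ... | yes _ | no ne = ⊥-elim (ne refl)

  infixl 6 _∪_
  _∪_ : (Pos → Bool) → Pos → (Pos → Bool)
  (K ∪ p) q = K q ∨ eqPos p q

  ∪-⊆ : ∀ K p q → K q ≡ true → (K ∪ p) q ≡ true
  ∪-⊆ K p q e = true-∨ˡ e

  agree-∪ : ∀ K p S S′ → agree (K ∪ p) S S′ ≡ (agree K S S′ ∧ (val S′ p == val S p))
  agree-∪ K p S S′ = bool-iff fwd bwd
    where
    fwd : agree (K ∪ p) S S′ ≡ true → (agree K S S′ ∧ (val S′ p == val S p)) ≡ true
    fwd e = true-∧ (agree-mono {K} {K ∪ p} {S} {S′} (∪-⊆ K p) e)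
      (trans (cong (_== val S p) (sym (agree-sound {K ∪ p} {S} {S′} e p (true-∨ʳ {K p} (eqPos-refl p))))) (==-refl (val S p)))
    bwd : (agree K S S′ ∧ (val S′ p == val S p)) ≡ true → agree (K ∪ p) S S′ ≡ true
    bwd e = let a , b = ∧-true {agree K S S′} e in agree-complete {K ∪ p} {S} {S′} λ q h → go a b q (∨-true h)
      where
      go : agree K S S′ ≡ true → (val S′ p == val S p) ≡ true → ∀ q → K q ≡ true ⊎ eqPos p q ≡ true → val S q ≡ val S′ q
      go a b q (inj₁ k) = agree-sound {K} {S} {S′} a q k
      go a b q (inj₂ k) = subst (λ q → val S q ≡ val S′ q) (eqPos-sound p q k) (sym (==-true b))

  class-∪ : ∀ K p S → class (K ∪ p) S weight ≡ class K S (λ S′ → ⟦ val S′ p == val S p ⟧ * weight S′)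
  class-∪ K p S = ∑-cong spiders λ S′ → trans (cong (λ b → ⟦ b ⟧ * weight S′) (agree-∪ K p S S′))
    (trans (cong (_* weight S′) (⟦∧⟧ (agree K S S′) _)) (*-assoc ⟦ agree K S S′ ⟧ _ _))

  massOf : (Spider → Bool) → ℕ
  massOf P = ∑ spiders (λ S → ⟦ P S ⟧ * weight S)

  free : (Pos → Bool) → ℕ
  free K = ∑ poss (λ p → ⟦ not (K p) ⟧)

  free-∪ : ∀ K p → K p ≡ false → free (K ∪ p) < free K
  free-∪ K p Kp = begin-strict
    free (K ∪ p) ≤⟨ ∑-mono poss (λ q → le (K q) (eqPos p q)) ⟩
    count poss (λ q → not (K q) ∧ not (eqPos p q)) <⟨ count-remove poss (λ q → not (K q)) (eqPos p) (∈poss p) (cong not Kp) (eqPos-refl p) ⟩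
    free K ∎
    where
    open ≤-Reasoning
    le : ∀ a b → ⟦ not (a ∨ b) ⟧ ≤ ⟦ not a ∧ not b ⟧
    le true  b = z≤n
    le false b = ≤-refl

  rich-invariant : ∀ K c {S S′} → agree K S S′ ≡ true → richSpider K c S ≡ richSpider K c S′
  rich-invariant K c {S} {S′} ag = cong (_≤ᵇ 0) (∑-cong vs λ f → cong (λ b → ⟦ not b ⟧)
    (cong₂ (λ a b → c * a ≤ᵇ b) (class-cong K {S} {S′} _ ag) (class-cong K {S} {S′} _ ag)))

  private
    Mp = 1 + s * n

  -- The value of `S` at the free position `p` is shared by at least the proportion `1 / (c * Mp)`
  -- of its class, so pinning `p` shrinks the class by no more than that.
  frequent : (Pos → Bool) → ℕ → Pos → Spider → Bool
  frequent K c p S = not (K p) ∧ (class K S weight ≤ᵇ c * Mp * class (K ∪ p) S weight)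

  frequent-invariant : ∀ K c p {S S′} → agree (K ∪ p) S S′ ≡ true → frequent K c p S ≡ frequent K c p S′
  frequent-invariant K c p {S} {S′} ag = cong₂ (λ a b → not (K p) ∧ (a ≤ᵇ c * Mp * b))
    (class-cong K {S} {S′} weight (agree-mono {K} {K ∪ p} {S} {S′} (∪-⊆ K p) ag)) (class-cong (K ∪ p) {S} {S′} weight ag)

  -- A class that is not rich has a vertex `f` hit too often. Some position carries the share
  -- `1 / Mp` of these hits, and all spiders of the class with `f` there are frequent at that
  -- position.
  frequent-mass : ∀ K c S → richSpider K c S ≡ false →
    class K S weight ≤ c * Mp * class K S (λ S′ → ∑ poss (λ p → ⟦ frequent K c p S′ ⟧ * weight S′))
  frequent-mass K c S nr = go (class K S weight) refl
    where
    open ≤-Reasoning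
    hitMass : V → Pos → ℕ
    hitMass f p = class K S (λ S′ → ⟦ val S′ p == f ⟧ * weight S′)
    Goal : ℕ → Set
    Goal x = x ≤ c * Mp * class K S (λ S′ → ∑ poss (λ p → ⟦ frequent K c p S′ ⟧ * weight S′))
    final : ∀ w → class K S weight ≡ suc w → ∀ f p b → K p ≡ b → suc w ≤ length poss * (c * (⟦ not b ⟧ * hitMass f p)) → Goal (suc w)
    final w eq f p true  Kp le = ⊥-elim (n≮0 (≤-trans le (≤-reflexive (trans (cong (length poss *_) (*-zeroʳ c)) (*-zeroʳ (length poss))))))
    final w eq f p false Kp le = begin
      suc w ≤⟨ le′ ⟩
      c * Mp * hitMass f p ≤⟨ *-monoʳ-≤ (c * Mp) (class-mono K S pt) ⟩
      c * Mp * class K S (λ S′ → ∑ poss (λ p → ⟦ frequent K c p S′ ⟧ * weight S′)) ∎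
      where
      le′ : suc w ≤ c * Mp * hitMass f p
      le′ = ≤-trans le (≤-reflexive (trans (cong₂ (λ a b → a * (c * b)) length-poss (+-identityʳ _)) (trans (sym (*-assoc Mp c _)) (cong (_* hitMass f p) (*-comm Mp c)))))
      pt : ∀ S′ → agree K S S′ ≡ true → ⟦ val S′ p == f ⟧ * weight S′ ≤ ∑ poss (λ p → ⟦ frequent K c p S′ ⟧ * weight S′)
      pt S′ ag with val S′ p == f in e
      ... | false = z≤n
      ... | true  = ≤-trans (≤-reflexive (cong (λ b → ⟦ b ⟧ * weight S′) (sym (true-∧ (cong not Kp) (true-≤ᵇ (begin
              class K S′ weight ≡⟨ sym (class-cong K {S} {S′} weight ag) ⟩
              class K S weight ≡⟨ eq ⟩
              suc w ≤⟨ le′ ⟩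
              c * Mp * hitMass f p ≡⟨ cong (c * Mp *_) (trans (class-cong K {S} {S′} _ ag) (trans (∑-cong spiders λ S″ → cong (λ u → ⟦ agree K S′ S″ ⟧ * (⟦ val S″ p == u ⟧ * weight S″)) (sym (==-true e))) (sym (class-∪ K p S′)))) ⟩
              c * Mp * class (K ∪ p) S′ weight ∎))))))
            (∑-∈ (λ p → ⟦ frequent K c p S′ ⟧ * weight S′) (∈poss p))
    bound : ∀ w → class K S weight ≡ suc w → ∀ f → richAt K c S f ≡ false → suc w ≤ ∑ poss (λ p → c * (⟦ not (K p) ⟧ * hitMass f p))
    bound w eq f bad = begin
      suc w ≡⟨ sym eq ⟩
      class K S weight ≤⟨ <⇒≤ (≤ᵇ-false bad) ⟩
      c * class K S (λ S′ → hits K f S′ * weight S′) ≡⟨ cong (c *_) (trans (∑-cong spiders λ S′ → cong (⟦ agree K S S′ ⟧ *_) (trans (sym (∑-*ʳ poss (weight S′) (λ p → ⟦ not (K p) ⟧ * ⟦ val S′ p == f ⟧))) (∑-cong poss λ p → *-assoc ⟦ not (K p) ⟧ ⟦ val S′ p == f ⟧ (weight S′)))) (trans (class-∑ K S poss _) (∑-cong poss λ p → class-*ˡ K S ⟦ not (K p) ⟧ _))) ⟩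
      c * ∑ poss (λ p → ⟦ not (K p) ⟧ * hitMass f p) ≡⟨ sym (∑-*ˡ poss c _) ⟩
      ∑ poss (λ p → c * (⟦ not (K p) ⟧ * hitMass f p)) ∎
    go : ∀ x → class K S weight ≡ x → Goal x
    go zero    eq = z≤n
    go (suc w) eq =
      let f , _ , bad = every-false {xs = vs} {richAt K c S} nr
          p , _ , le = pigeonhole poss (λ p → c * (⟦ not (K p) ⟧ * hitMass f p)) (z<s {w}) (bound w eq f bad)
      in final w eq f p (K p) refl le

  module _ (A c β : ℕ → ℕ) (A-step : ∀ j → A (suc j) ≡ 2 * A j * (c j * Mp) * Mp) (β-step : ∀ j → β (suc j) ≡ β j * (c j * Mp))
           (K₀ : Pos → Bool) (Ω₀ : Spider → Bool) (tot>0 : 0 < totalMass) where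

    -- The situation after `j` positions have been pinned: `1 / A j` is the proportion of spiders
    -- still considered, and `β j` bounds the shrinking of their classes since the start. Saturation
    -- allows estimates class by class.
    record Stage (j : ℕ) (K : Pos → Bool) (Ω : Spider → Bool) : Set where
      field
        K-ctr     : K ctr ≡ false
        K₀⊆K      : ∀ p → K₀ p ≡ true → K p ≡ true
        saturated : ∀ {S S′} → agree K S S′ ≡ true → Ω S ≡ true → Ω S′ ≡ true
        Ω⊆Ω₀      : ∀ {S} → Ω S ≡ true → Ω₀ S ≡ true
        large     : totalMass ≤ A j * massOf Ω
        pinned-by : ∀ {S} → Ω S ≡ true → class K₀ S weight ≤ β j * class K S weight

    record RichKernel (j : ℕ) : Set where
      field
        K     : Pos → Bool
        K-ctr : K ctr ≡ false
        K₀⊆K  : ∀ p → K₀ p ≡ true → K p ≡ true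
        large : totalMass ≤ 2 * A j * massOf (richSpider K (c j))

    record PinnedCentre (j : ℕ) : Set where
      field
        K         : Pos → Bool
        K-ctr     : K ctr ≡ true
        K₀⊆K      : ∀ p → K₀ p ≡ true → K p ≡ true
        Ω         : Spider → Bool
        Ω⊆Ω₀      : ∀ {S} → Ω S ≡ true → Ω₀ S ≡ true
        large     : totalMass ≤ A j * massOf Ω
        pinned-by : ∀ {S} → Ω S ≡ true → class K₀ S weight ≤ β j * class K S weight

    Outcome : ℕ → Set
    Outcome J = ∃ λ j → j ≤ J × (RichKernel j ⊎ PinnedCentre j)

    private
      module Next {j K Ω} (st : Stage j K Ω) (poor : 2 * A j * massOf (richSpider K (c j)) < totalMass) where
        open Stage st
        open ≤-Reasoning
        Ω′ : Spider → Bool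
        Ω′ S = Ω S ∧ not (richSpider K (c j) S)

        Ω′-large : totalMass ≤ 2 * A j * massOf Ω′
        Ω′-large = +-cancelʳ-≤ totalMass totalMass _ (begin
          totalMass + totalMass ≤⟨ +-mono-≤ large large ⟩
          A j * massOf Ω + A j * massOf Ω ≡⟨ solve 2 (λ a x → a :* x :+ a :* x := con 2 :* a :* x) refl (A j) (massOf Ω) ⟩
          2 * A j * massOf Ω ≤⟨ *-monoʳ-≤ (2 * A j) (≤-trans (∑-mono spiders pt) (≤-reflexive (∑-+ spiders _ _))) ⟩
          2 * A j * (massOf Ω′ + massOf (richSpider K (c j))) ≡⟨ *-distribˡ-+ (2 * A j) (massOf Ω′) _ ⟩
          2 * A j * massOf Ω′ + 2 * A j * massOf (richSpider K (c j)) ≤⟨ +-monoʳ-≤ (2 * A j * massOf Ω′) (<⇒≤ poor) ⟩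
          2 * A j * massOf Ω′ + totalMass ∎)
          where
          pt : ∀ S → ⟦ Ω S ⟧ * weight S ≤ ⟦ Ω′ S ⟧ * weight S + ⟦ richSpider K (c j) S ⟧ * weight S
          pt S with Ω S | richSpider K (c j) S
          ... | false | _     = z≤n
          ... | true  | true  = ≤-refl
          ... | true  | false = m≤m+n _ _

        Ω′-sat : ∀ {S S′} → agree K S S′ ≡ true → Ω′ S ≡ true → Ω′ S′ ≡ true
        Ω′-sat {S} {S′} ag e = let a , b = ∧-true {Ω S} e in true-∧ (saturated {S} {S′} ag a) (trans (cong not (sym (rich-invariant K (c j) {S} {S′} ag))) b)

        spread : massOf Ω′ ≤ ∑ poss (λ p → c j * Mp * massOf (λ S → Ω′ S ∧ frequent K (c j) p S))
        spread = begin
          massOf Ω′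
            ≤⟨ classwise-≤ spiders (agree-equivalence K) Ω′ weight (λ S → c j * Mp * ∑ poss (λ p → ⟦ frequent K (c j) p S ⟧ * weight S)) (λ {S} {S′} → Ω′-sat {S} {S′})
                 (λ {S} _ e → ≤-trans (frequent-mass K (c j) S (not-true (proj₂ (∧-true {Ω S} e)))) (≤-reflexive (sym (class-*ˡ K S (c j * Mp) _)))) ⟩
          ∑ spiders (λ S → ⟦ Ω′ S ⟧ * (c j * Mp * ∑ poss (λ p → ⟦ frequent K (c j) p S ⟧ * weight S)))
            ≡⟨ ∑-cong spiders (λ S → trans (x*yz≡y*xz ⟦ Ω′ S ⟧ (c j * Mp) _) (trans (cong (c j * Mp *_) (trans (sym (∑-*ˡ poss ⟦ Ω′ S ⟧ _)) (∑-cong poss λ p → trans (sym (*-assoc ⟦ Ω′ S ⟧ ⟦ frequent K (c j) p S ⟧ (weight S))) (cong (_* weight S) (sym (⟦∧⟧ (Ω′ S) (frequent K (c j) p S))))))) (sym (∑-*ˡ poss (c j * Mp) _)))) ⟩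
          ∑ spiders (λ S → ∑ poss (λ p → c j * Mp * (⟦ Ω′ S ∧ frequent K (c j) p S ⟧ * weight S)))
            ≡⟨ trans (∑-swap spiders poss _) (∑-cong poss λ p → ∑-*ˡ spiders (c j * Mp) _) ⟩
          ∑ poss (λ p → c j * Mp * massOf (λ S → Ω′ S ∧ frequent K (c j) p S)) ∎

        -- The factors of `A-step`: 2 for discarding the rich classes, `c j * Mp` for frequency, and
        -- `Mp` for agreeing on one position for all spiders.
        chosen : ∃ λ p → totalMass ≤ A (suc j) * massOf (λ S → Ω′ S ∧ frequent K (c j) p S)
        chosen =
          let p , _ , le = pigeonhole poss (λ p → 2 * A j * (c j * Mp * massOf (λ S → Ω′ S ∧ frequent K (c j) p S))) tot>0
                (≤-trans Ω′-large (≤-trans (*-monoʳ-≤ (2 * A j) spread) (≤-reflexive (sym (∑-*ˡ poss (2 * A j) _)))))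
          in p , ≤-trans le (≤-reflexive (trans (cong (_* (2 * A j * (c j * Mp * massOf (λ S → Ω′ S ∧ frequent K (c j) p S)))) length-poss)
               (trans (solve 4 (λ m a x z → m :* (a :* (x :* z)) := a :* x :* m :* z) refl Mp (2 * A j) (c j * Mp) _) (cong (_* massOf (λ S → Ω′ S ∧ frequent K (c j) p S)) (sym (A-step j))))))

        module _ (p : Pos) (le : totalMass ≤ A (suc j) * massOf (λ S → Ω′ S ∧ frequent K (c j) p S)) where
          Ω″ : Spider → Bool
          Ω″ S = Ω′ S ∧ frequent K (c j) p S

          split : ∀ {S} → Ω″ S ≡ true → Ω S ≡ true × K p ≡ false × class K S weight ≤ c j * Mp * class (K ∪ p) S weight
          split {S} e =
            let a , b = ∧-true {Ω′ S} e
                c₁ , c₂ = ∧-true {not (K p)} b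
            in proj₁ (∧-true {Ω S} a) , not-true c₁ , ≤ᵇ-true c₂

          K-p : K p ≡ false
          K-p =
            let S , _ , lt = ∑-pos spiders (λ S → ⟦ Ω″ S ⟧ * weight S) (0<t≤c*x (A (suc j)) tot>0 le)
            in proj₁ (proj₂ (split {S} (proj₁ (⟦⟧-pos (Ω″ S) lt))))

          pinned″ : ∀ {S} → Ω″ S ≡ true → class K₀ S weight ≤ β (suc j) * class (K ∪ p) S weight
          pinned″ {S} e = ≤-trans (pinned-by (proj₁ (split {S} e))) (≤-trans (*-monoʳ-≤ (β j) (proj₂ (proj₂ (split {S} e))))
            (≤-reflexive (trans (sym (*-assoc (β j) (c j * Mp) _)) (cong (_* class (K ∪ p) S weight) (sym (β-step j))))))

          sat″ : ∀ {S S′} → agree (K ∪ p) S S′ ≡ true → Ω″ S ≡ true → Ω″ S′ ≡ true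
          sat″ {S} {S′} ag e = let a , b = ∧-true {Ω′ S} e in
            true-∧ (Ω′-sat {S} {S′} (agree-mono {K} {K ∪ p} {S} {S′} (∪-⊆ K p) ag) a) (trans (sym (frequent-invariant K (c j) p {S} {S′} ag)) b)

          ⊆″ : ∀ {S} → Ω″ S ≡ true → Ω₀ S ≡ true
          ⊆″ {S} e = Ω⊆Ω₀ (proj₁ (split {S} e))

        pinnedCentre : totalMass ≤ A (suc j) * massOf (λ S → Ω′ S ∧ frequent K (c j) ctr S) → PinnedCentre (suc j)
        pinnedCentre le = record
          { K = K ∪ ctr ; K-ctr = true-∨ʳ {K ctr} refl ; K₀⊆K = λ p k → ∪-⊆ K ctr p (K₀⊆K p k)
          ; Ω = Ω″ ctr le ; Ω⊆Ω₀ = λ {S} → ⊆″ ctr le {S} ; large = le ; pinned-by = λ {S} → pinned″ ctr le {S} }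

        nextStage : ∀ i l (le : totalMass ≤ A (suc j) * massOf (λ S → Ω′ S ∧ frequent K (c j) (at i l) S)) → Stage (suc j) (K ∪ at i l) (Ω″ (at i l) le)
        nextStage i l le = record
          { K-ctr = cong (_∨ false) K-ctr ; K₀⊆K = λ p k → ∪-⊆ K (at i l) p (K₀⊆K p k)
          ; saturated = λ {S} {S′} → sat″ (at i l) le {S} {S′} ; Ω⊆Ω₀ = λ {S} → ⊆″ (at i l) le {S} ; large = le ; pinned-by = λ {S} → pinned″ (at i l) le {S} }

      run : ∀ fuel j {K Ω} → Stage j K Ω → free K ≤ fuel → Outcome (j + fuel)
      step : ∀ fuel j {K Ω} (st : Stage j K Ω) → free K ≤ fuel → ∀ b → (totalMass ≤ᵇ 2 * A j * massOf (richSpider K (c j))) ≡ b → Outcome (j + fuel)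
      choose : ∀ fuel j {K Ω} (st : Stage j K Ω) (poor : 2 * A j * massOf (richSpider K (c j)) < totalMass) → free K ≤ suc fuel → ∀ p →
        totalMass ≤ A (suc j) * massOf (λ S → Next.Ω′ st poor S ∧ frequent K (c j) p S) → Outcome (j + suc fuel)

      run fuel j st le = step fuel j st le _ refl

      step fuel j {K} st le true e = j , m≤m+n j fuel , inj₁ (record { K = K ; K-ctr = Stage.K-ctr st ; K₀⊆K = Stage.K₀⊆K st ; large = ≤ᵇ-true e })
      -- The fuel bounds the number of free positions, and the centre is still free.
      step zero j {K} st le false e = ⊥-elim (n≮0 (≤-trans (≤-trans (≤-reflexive (sym (⟦⟧-true (cong not (Stage.K-ctr st))))) (∑-∈ (λ p → ⟦ not (K p) ⟧) (∈poss ctr))) le))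
      step (suc fuel) j {K} st le false e = let p , le′ = Next.chosen st (≤ᵇ-false e) in choose fuel j st (≤ᵇ-false e) le p le′

      choose fuel j st poor le ctr le′ = suc j , ≤-trans (m≤m+n (suc j) fuel) (≤-reflexive (sym (+-suc j fuel))) , inj₂ (Next.pinnedCentre st poor le′)
      choose fuel j {K} st poor le (at i l) le′ =
        let j′ , j≤ , out = run fuel (suc j) (Next.nextStage st poor i l le′) (s≤s⁻¹ (<-≤-trans (free-∪ K (at i l) (Next.K-p st poor (at i l) le′)) le))
        in j′ , ≤-trans j≤ (≤-reflexive (sym (+-suc j fuel))) , out

    determination : Stage 0 K₀ Ω₀ → Outcome Mp
    determination st = run Mp 0 st (≤-trans (∑-mono poss λ p → ⟦⟧≤1 (not (K₀ p))) (≤-reflexive (trans (∑-const poss 1) (trans (*-identityʳ _) length-poss))))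

-- Light walks

⟦not-∧⟧ : ∀ a b → ⟦ not (a ∧ b) ⟧ ≤ ⟦ not a ⟧ + ⟦ not b ⟧
⟦not-∧⟧ true  b = ≤-refl
⟦not-∧⟧ false b = s≤s z≤n

⟦not-⋀⟧ : ∀ s f → ⟦ not (⋀ s f) ⟧ ≤ ∑ (allFin s) (λ i → ⟦ not (f i) ⟧)
⟦not-⋀⟧ s f with dichotomy (⋀ s f)
... | inj₁ e rewrite e = z≤n
... | inj₂ e with search (allFin s) (λ i → not (f i))
...   | inj₁ (i , k , q) = ≤-trans (⟦⟧≤1 _) (any-true (allFin s) {λ i → not (f i)} k q)
...   | inj₂ h with trans (sym e) (⋀-complete s (λ i → not-false (h (∈-allFin i))))
...     | ()

module LightLegs (Γ : WeightedGraph) (Β : Bipartition Γ) (C : ℕ) where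
  open WeightedGraph Γ
  open Kernel Γ
  open Bipartition Β
  open Paths Γ Β

  -- The head of the list is at distance `suc g` from `a`, which has index `g` in `heavy`.
  lightFrom : ∀ {n} → ℕ → V → Vec V n → Bool
  lightFrom g a []      = true
  lightFrom g a (r ∷ x) = not (heavy C g a r) ∧ lightFrom (suc g) a x

  -- allLight a x: no two vertices of the walk a ∷ x are joined by a heavy number of walks.
  allLight : ∀ {n} → V → Vec V n → Bool
  allLight a []      = true
  allLight a (r ∷ x) = lightFrom 0 a (r ∷ x) ∧ allLight r x

  Alternates : ∀ {n} → Bool → Vec V n → Set
  Alternates b []      = ⊤
  Alternates b (r ∷ x) = side r ≡ b × Alternates (not b) x

  walk-alternates : ∀ {n} u (x : Vec V n) → 0 < wt u x → Alternates (not (side u)) x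
  walk-alternates u []      lt = tt
  walk-alternates u (r ∷ x) lt with adj u r in e
  ... | false = ⊥-elim (<-irrefl (sym (cong (_* wt r x) (*-zeroʳ (ω u)))) lt)
  ... | true  = adj-side e , subst (λ b → Alternates (not b) x) (adj-side e) (walk-alternates r x (proj₂ (pos-* (ω u * 1) lt)))

  flip-not : ∀ g b → flip g (not b) ≡ not (flip g b)
  flip-not zero    b = refl
  flip-not (suc g) b = flip-not g (not b)

  alternates-last : ∀ {n} {b} (x : Vec V (suc n)) → Alternates b x → side (lookup x (fromℕ n)) ≡ flip n b
  alternates-last {zero}  (r ∷ []) (e , _) = e
  alternates-last {suc n} (r ∷ x)  (_ , al) = alternates-last x al

  -- Each segment cut out by the mask is light, and `light-mul` combines it with the bound for the
  -- rest; the product falls one factor `C` below the claim, whence `1 ≤ C`. The mask has to contain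
  -- the last vertex, as nothing bounds an open final stretch.
  segments-light : 1 ≤ C → ∀ {n} g a (m : Fin (suc n) → Bool) (x : Vec V (suc n)) → m (fromℕ n) ≡ true →
    lightFrom g a x ≡ true → (∀ {r y} → x ≡ r ∷ y → allLight r y ≡ true) → Alternates (flip g (not (side a))) x →
    segments g a m x ≤ C ^ (g + n) * light (g + n) a
  segments-light 1≤C {zero} g a m (r ∷ []) ml lf al alt rewrite ml = begin
    p (suc g) a r * ∑ vs (p 0 r) ≤⟨ *-mono-≤ (heavy-false {C} {g} (not-true (proj₁ (∧-true {not (heavy C g a r)} lf)))) (p-row≤ 0 r) ⟩
    C ^ g * light g a * 1 ≡⟨ trans (*-identityʳ _) (cong (λ k → C ^ k * light k a) (sym (+-identityʳ g))) ⟩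
    C ^ (g + 0) * light (g + 0) a ∎
    where open ≤-Reasoning
  segments-light 1≤C {suc n} g a m (r ∷ y@(_ ∷ _)) ml lf al (sr , alt) with m zero
  ... | true = begin
    p (suc g) a r * segments 0 r (λ j → m (suc j)) y
      ≤⟨ *-mono-≤ (heavy-false {C} {g} (not-true (proj₁ (∧-true {not (heavy C g a r)} lf))))
           (segments-light 1≤C 0 r (λ j → m (suc j)) y ml (proj₁ (∧-true {lightFrom 0 r y} (al refl))) (λ { refl → proj₂ (∧-true {lightFrom 0 r y} (al refl)) })
             (subst (λ b → Alternates (not b) y) (sym sr) alt)) ⟩
    C ^ g * light g a * (C ^ n * light n r) ≤⟨ light-mul C g n sr ⟩
    C ^ (g + n) * light (suc (g + n)) a ≤⟨ *-monoˡ-≤ (light (suc (g + n)) a) (≤-trans (≤-reflexive (sym (+-identityʳ _))) (*-monoˡ-≤ (C ^ (g + n)) 1≤C)) ⟩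
    C ^ suc (g + n) * light (suc (g + n)) a ≡⟨ cong (λ k → C ^ k * light k a) (sym (+-suc g n)) ⟩
    C ^ (g + suc n) * light (g + suc n) a ∎
    where open ≤-Reasoning
  ... | false = ≤-trans (segments-light 1≤C (suc g) a (λ j → m (suc j)) y ml (proj₂ (∧-true {not (heavy C g a r)} lf))
                  (λ { refl → proj₂ (∧-true {lightFrom 0 r y} (al refl)) }) (subst (λ b → Alternates b y) (sym (flip-not g (not (side a)))) alt))
                  (≤-reflexive (cong (λ k → C ^ k * light k a) (sym (+-suc g n))))

  leg-light : 1 ≤ C → ∀ {n} a (m : Fin (suc n) → Bool) (x : Vec V (suc n)) → m (fromℕ n) ≡ true → allLight a x ≡ true → 0 < wt a x →
    legMass a m x ≤ C ^ n * light n a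
  leg-light 1≤C a m x@(r ∷ y) ml al lt = ≤-trans (≤-reflexive (legMass≡segments a m x))
    (segments-light 1≤C 0 a m x ml (proj₁ (∧-true {lightFrom 0 a x} al)) (λ { refl → proj₂ (∧-true {lightFrom 0 a x} al) }) (walk-alternates a x lt))

  heavyCount : ∀ {n} → ℕ → V → Vec V n → ℕ
  heavyCount g a []      = 0
  heavyCount g a (r ∷ x) = ⟦ heavy C g a r ⟧ + heavyCount (suc g) a x

  not-lightFrom : ∀ {n} g a (x : Vec V n) → ⟦ not (lightFrom g a x) ⟧ ≤ heavyCount g a x
  not-lightFrom g a []      = z≤n
  not-lightFrom g a (r ∷ x) = ≤-trans (⟦not-∧⟧ (not (heavy C g a r)) _) (+-mono-≤ (not-not (heavy C g a r)) (not-lightFrom (suc g) a x))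
    where
    not-not : ∀ b → ⟦ not (not b) ⟧ ≤ ⟦ b ⟧
    not-not true  = ≤-refl
    not-not false = z≤n

  module _ (e n₀ : ℕ) (heavy≤ : ∀ i → i < n₀ → e * mass (heavy C i) i ≤ total i) where

    private
      S = ∑ vs d
      -- Counts, over walks of length `g + n` with weight, the heavy pairs formed by the start and
      -- one of the last `n` vertices.
      M : ℕ → ℕ → ℕ
      M g n = ∑ vs (λ u → d u * ∑ vs (λ v → p g u v * ∑ (walks n) (λ x → wt v x * heavyCount g u x)))

      M-step : ∀ g n → M g (suc n) ≤ mass (heavy C g) g * W ^ n + M (suc g) n
      M-step g n = begin
        M g (suc n) ≡⟨ ∑-cong vs (λ u → cong (d u *_) (inner u)) ⟩
        ∑ vs (λ u → d u * ∑ vs (λ r → p (suc g) u r * (⟦ heavy C g u r ⟧ * Z n r + N u r)))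
          ≤⟨ ∑-mono vs (λ u → *-monoʳ-≤ (d u) (∑-mono vs λ r → *-monoʳ-≤ (p (suc g) u r) (+-monoˡ-≤ (N u r) (*-monoʳ-≤ ⟦ heavy C g u r ⟧ (Z≤ n r))))) ⟩
        ∑ vs (λ u → d u * ∑ vs (λ r → p (suc g) u r * (⟦ heavy C g u r ⟧ * W ^ n + N u r)))
          ≡⟨ ∑-cong vs (λ u → trans (sym (∑-*ˡ vs (d u) _)) (trans (∑-cong vs λ r → solve 5 (λ d p h w n → d :* (p :* (h :* w :+ n)) := d :* (h :* p) :* w :+ d :* (p :* n)) refl (d u) (p (suc g) u r) ⟦ heavy C g u r ⟧ (W ^ n) (N u r)) (trans (∑-+ vs _ _) (cong₂ _+_ (∑-*ʳ vs (W ^ n) _) (∑-*ˡ vs (d u) _))))) ⟩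
        ∑ vs (λ u → ∑ vs (λ r → d u * (⟦ heavy C g u r ⟧ * p (suc g) u r)) * W ^ n + d u * ∑ vs (λ r → p (suc g) u r * N u r))
          ≡⟨ trans (∑-+ vs _ _) (cong (_+ M (suc g) n) (∑-*ʳ vs (W ^ n) _)) ⟩
        mass (heavy C g) g * W ^ n + M (suc g) n ∎
        where
        open ≤-Reasoning
        N : V → V → ℕ
        N u r = ∑ (walks n) (λ x → wt r x * heavyCount (suc g) u x)
        G : V → V → ℕ
        G u r = ⟦ heavy C g u r ⟧ * Z n r + N u r
        cons : ∀ u v → ∑ (walks (suc n)) (λ x → wt v x * heavyCount g u x) ≡ ∑ vs (λ r → p1 v r * G u r)
        cons u v = trans (∑-tuples vs n _) (∑-cong vs λ r → trans (∑-cong (walks n) λ x → trans (*-assoc (p1 v r) (wt r x) _) (cong (p1 v r *_) (trans (*-distribˡ-+ (wt r x) ⟦ heavy C g u r ⟧ _) (cong (_+ wt r x * heavyCount (suc g) u x) (*-comm (wt r x) _)))))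
          (trans (∑-*ˡ (walks n) (p1 v r) _) (cong (p1 v r *_) (trans (∑-+ (walks n) _ _) (cong (_+ N u r) (∑-*ˡ (walks n) ⟦ heavy C g u r ⟧ (wt r)))))))
        inner : ∀ u → ∑ vs (λ v → p g u v * ∑ (walks (suc n)) (λ x → wt v x * heavyCount g u x)) ≡ ∑ vs (λ r → p (suc g) u r * G u r)
        inner u = trans (∑-cong vs λ v → trans (cong (p g u v *_) (cons u v)) (trans (sym (∑-*ˡ vs (p g u v) _)) (∑-cong vs λ r → sym (*-assoc (p g u v) (p1 v r) (G u r)))))
          (trans (∑-swap vs vs _) (∑-cong vs λ r → trans (∑-*ʳ vs (G u r) _) (cong (_* G u r) (sym (p-snoc g u r)))))

      M-bound : ∀ g n → g + n ≤ n₀ → e * M g n ≤ n * (W ^ (g + n) * S)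
      M-bound g zero    le = ≤-reflexive (trans (cong (e *_) (trans (∑-cong vs λ u → trans (cong (d u *_) (trans (∑-cong vs λ v → *-zeroʳ (p g u v)) (∑-zero vs))) (*-zeroʳ (d u))) (∑-zero vs))) (*-zeroʳ e))
      M-bound g (suc n) le = begin
        e * M g (suc n) ≤⟨ *-monoʳ-≤ e (M-step g n) ⟩
        e * (mass (heavy C g) g * W ^ n + M (suc g) n) ≡⟨ trans (*-distribˡ-+ e _ _) (cong (_+ e * M (suc g) n) (sym (*-assoc e _ _))) ⟩
        e * mass (heavy C g) g * W ^ n + e * M (suc g) n ≤⟨ +-mono-≤ (*-monoˡ-≤ (W ^ n) (heavy≤ g (≤-trans (≤-trans (s≤s (m≤m+n g n)) (≤-reflexive (sym (+-suc g n)))) le))) (M-bound (suc g) n (≤-trans (≤-reflexive (sym (+-suc g n))) le)) ⟩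
        W ^ suc g * S * W ^ n + n * (W ^ (suc g + n) * S) ≡⟨ cong₂ _+_ (trans (solve 3 (λ a b c → a :* b :* c := a :* c :* b) refl (W ^ suc g) S (W ^ n)) (cong (_* S) (sym (^-distribˡ-+-* W (suc g) n)))) refl ⟩
        W ^ (suc g + n) * S + n * (W ^ (suc g + n) * S) ≡⟨ cong (λ k → suc n * (W ^ k * S)) (sym (+-suc g n)) ⟩
        suc n * (W ^ (g + suc n) * S) ∎
        where open ≤-Reasoning

    darkMass : ℕ → ℕ
    darkMass n = ∑ vs (λ u → d u * ∑ (walks n) (λ x → wt u x * ⟦ not (allLight u x) ⟧))

    -- A walk that is not light has a heavy pair at its start or is not light after its start;
    -- stationarity reduces the second case to shorter walks. The factor `n * n` bounds the number
    -- of pairs.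
    dark-bound : ∀ n → n ≤ n₀ → e * darkMass n ≤ n * n * (W ^ n * S)
    dark-bound zero le = ≤-reflexive (trans (cong (e *_) (trans (∑-cong vs λ u → *-zeroʳ (d u)) (∑-zero vs))) (*-zeroʳ e))
    dark-bound (suc n) le = begin
      e * darkMass (suc n) ≤⟨ *-monoʳ-≤ e step ⟩
      e * (M 0 (suc n) + W * darkMass n) ≡⟨ trans (*-distribˡ-+ e _ _) (cong (e * M 0 (suc n) +_) (x*yz≡y*xz e W _)) ⟩
      e * M 0 (suc n) + W * (e * darkMass n) ≤⟨ +-mono-≤ (M-bound 0 (suc n) le) (*-monoʳ-≤ W (dark-bound n (≤-trans (n≤1+n n) le))) ⟩
      suc n * (W ^ suc n * S) + W * (n * n * (W ^ n * S)) ≡⟨ solve 4 (λ n w x s → (con 1 :+ n) :* (w :* x :* s) :+ w :* (n :* n :* (x :* s)) := (con 1 :+ n :+ n :* n) :* (w :* x :* s)) refl n W (W ^ n) S ⟩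
      (1 + n + n * n) * (W ^ suc n * S) ≤⟨ *-monoˡ-≤ (W ^ suc n * S) (s≤s (+-monoʳ-≤ n (*-monoʳ-≤ n (n≤1+n n)))) ⟩
      suc n * suc n * (W ^ suc n * S) ∎
      where
      open ≤-Reasoning
      pt : ∀ u (x : Vec V (suc n)) → ⟦ not (allLight u x) ⟧ ≤ heavyCount 0 u x + ⟦ not (allLight (Data.Vec.head x) (Data.Vec.tail x)) ⟧
      pt u x@(r ∷ y) = ≤-trans (⟦not-∧⟧ (lightFrom 0 u x) _) (+-monoˡ-≤ _ (not-lightFrom 0 u x))
      step : darkMass (suc n) ≤ M 0 (suc n) + W * darkMass n
      step = begin
        darkMass (suc n)
          ≤⟨ ∑-mono vs (λ u → *-monoʳ-≤ (d u) (∑-mono (walks (suc n)) λ x → *-monoʳ-≤ (wt u x) (pt u x))) ⟩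
        ∑ vs (λ u → d u * ∑ (walks (suc n)) (λ x → wt u x * (heavyCount 0 u x + ⟦ not (allLight (Data.Vec.head x) (Data.Vec.tail x)) ⟧)))
          ≡⟨ trans (∑-cong vs λ u → trans (cong (d u *_) (trans (∑-cong (walks (suc n)) λ x → *-distribˡ-+ (wt u x) _ _) (∑-+ (walks (suc n)) _ _))) (*-distribˡ-+ (d u) _ _)) (∑-+ vs _ _) ⟩
        ∑ vs (λ u → d u * ∑ (walks (suc n)) (λ x → wt u x * heavyCount 0 u x)) + ∑ vs (λ u → d u * ∑ (walks (suc n)) (λ x → wt u x * ⟦ not (allLight (Data.Vec.head x) (Data.Vec.tail x)) ⟧))
          ≡⟨ cong₂ _+_ (∑-cong vs λ u → cong (d u *_) (sym (∑-δ′ u (λ v → ∑ (walks (suc n)) (λ x → wt v x * heavyCount 0 u x))))) (walk-stat n (λ x → ⟦ not (allLight (Data.Vec.head x) (Data.Vec.tail x)) ⟧)) ⟩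
        M 0 (suc n) + W * darkMass n ∎

-- Spiders with long legs

firstTrue : ∀ {n} (m : Fin (suc n) → Bool) → m (fromℕ n) ≡ true → ∃ λ j → m j ≡ true × (∀ j′ → toℕ j′ < toℕ j → m j′ ≡ false)
firstTrue {zero}  m e = zero , e , λ _ ()
firstTrue {suc n} m e with m zero in z
... | true  = zero , z , λ _ ()
... | false =
  let j , ej , before = firstTrue (λ j → m (suc j)) e
  in suc j , ej , λ { zero _ → z ; (suc j′) (s≤s lt) → before j′ lt }

module TopSpiders (Γ : WeightedGraph) (Β : Bipartition Γ) (δ : ℕ) (δ≤d : MinDegree Γ δ) (s′ n′ : ℕ) where
  open WeightedGraph Γ
  open Kernel Γ
  open Bipartition Β
  open Paths Γ Β

  s = suc s′
  n = suc n′

  -- Centres are restricted to one side, in the application the part of size m. For legs of even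
  -- length the leaves lie there too, which limits the number of tuples of leaves to `m ^ s`.
  μ : V → ℕ
  μ y = ⟦ side y ⟧ * d y

  open Spiders Γ s n μ
  open Systems Γ s n μ δ δ≤d
  open Trails Γ
  open Determination Γ s n μ δ δ≤d

  μ≤d : ∀ y → μ y ≤ d y
  μ≤d y = ⟦⟧*≤ (side y) (d y)

  totalMass-value : totalMass ≡ ∑ vs μ * (W ^ n) ^ s
  totalMass-value = trans (∑-spiders _) (trans (∑-cong vs λ y → trans (∑-*ˡ (tuples (walks n) s) (μ y) _) (trans (cong (μ y *_) (∑-∏-tuples (walks n) s (λ _ → wt y))) (value y))) (∑-*ʳ vs ((W ^ n) ^ s) μ))
    where
    value : ∀ y → μ y * ∏ s (λ _ → Z n y) ≡ μ y * (W ^ n) ^ s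
    value y with d y in e
    ... | zero  = trans (cong (_* ∏ s (λ _ → Z n y)) (*-zeroʳ ⟦ side y ⟧)) (sym (cong (_* (W ^ n) ^ s) (*-zeroʳ ⟦ side y ⟧)))
    ... | suc k = cong (⟦ side y ⟧ * suc k *_) (trans (∏-const s (Z n y)) (cong (_^ s) (Z-alive n y (subst (0 <_) (sym e) z<s))))

  weight-pos : ∀ {S} → 0 < weight S → side (proj₁ S) ≡ true × 0 < d (proj₁ S) × (∀ i → 0 < wt (proj₁ S) (lookup (proj₂ S) i))
  weight-pos {y , l} lt =
    let a , b = pos-* (μ y) lt
        sy , dy = ⟦⟧-pos (side y) a
    in sy , dy , ∏-pos s b

  K₀ : Pos → Bool
  K₀ ctr      = false
  K₀ (at i j) = does (j Fin.≟ fromℕ n′)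

  tipsEq : Vec V s → Spider → Bool
  tipsEq t S = ⋀ s (λ i → val S (at i (fromℕ n′)) == lookup t i)

  tipsEq-agree : ∀ {t S S′} → tipsEq t S ≡ true → tipsEq t S′ ≡ true → agree K₀ S S′ ≡ true
  tipsEq-agree {t} {S} {S′} e e′ = agree-complete {K₀} {S} {S′} λ { ctr () ; (at i j) k → go i j (does-≡ {i = j} {fromℕ n′} k) }
    where
    go : ∀ i j → j ≡ fromℕ n′ → val S (at i j) ≡ val S′ (at i j)
    go i _ refl = trans (==-true (⋀-sound s {λ i → val S (at i (fromℕ n′)) == lookup t i} e i)) (sym (==-true (⋀-sound s {λ i → val S′ (at i (fromℕ n′)) == lookup t i} e′ i)))

  heavyTop : ℕ → Spider → Bool
  heavyTop B S = suc B ≤ᵇ class K₀ S weight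

  module _ (C : ℕ) where
    open LightLegs Γ Β C

    lightSpider : Spider → Bool
    lightSpider (y , l) = ⋀ s (λ i → allLight y (lookup l i))

    -- A union bound over the legs, in which the other legs contribute at most `W ^ n` each. The
    -- factor 2 is the passage from all degrees to those counted by `μ`.
    dark-spiders : ∀ e → (∀ i → i < n → e * mass (heavy C i) i ≤ total i) → ∑ vs d ≤ 2 * ∑ vs μ →
      e * massOf (λ S → not (lightSpider S)) ≤ s * (n * n * 2) * totalMass
    dark-spiders e heavy≤ dbl = begin
      e * massOf (λ S → not (lightSpider S))
        ≤⟨ *-monoʳ-≤ e (∑-mono spiders λ S → ≤-trans (*-monoˡ-≤ (weight S) (⟦not-⋀⟧ s (λ i → allLight (proj₁ S) (lookup (proj₂ S) i)))) (≤-reflexive (sym (∑-*ʳ (allFin s) (weight S) (λ i → ⟦ dark i S ⟧))))) ⟩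
      e * ∑ spiders (λ S → ∑ (allFin s) (λ i → ⟦ dark i S ⟧ * weight S)) ≡⟨ trans (cong (e *_) (∑-swap spiders (allFin s) _)) (sym (∑-*ˡ (allFin s) e _)) ⟩
      ∑ (allFin s) (λ i → e * massOf (dark i)) ≤⟨ ∑-mono (allFin s) one-leg ⟩
      ∑ (allFin s) (λ i → n * n * 2 * totalMass) ≡⟨ trans (∑-const (allFin s) _) (trans (cong (_* (n * n * 2 * totalMass)) (length-allFin s)) (sym (*-assoc s (n * n * 2) totalMass))) ⟩
      s * (n * n * 2) * totalMass ∎
      where
      open ≤-Reasoning
      dark : Fin s → Spider → Bool
      dark i (y , l) = not (allLight y (lookup l i))
      one-leg : ∀ i → e * massOf (dark i) ≤ n * n * 2 * totalMass
      one-leg i = *-cancelˡ-≤ (W ^ n) {{m^n≢0 W n {{>-nonZero W-pos}}}} (begin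
        W ^ n * (e * massOf (dark i)) ≡⟨ trans (x*yz≡y*xz (W ^ n) e _) (cong (e *_) (trans (cong (W ^ n *_) value) (sym (∑-*ˡ vs (W ^ n) _)))) ⟩
        e * ∑ vs (λ y → W ^ n * (μ y * ∏ s (F y))) ≤⟨ *-monoʳ-≤ e (∑-mono vs bound) ⟩
        e * ∑ vs (λ y → d y * G y * (W ^ n) ^ s) ≡⟨ trans (cong (e *_) (∑-*ʳ vs ((W ^ n) ^ s) _)) (sym (*-assoc e _ _)) ⟩
        e * darkMass e n heavy≤ n * (W ^ n) ^ s ≤⟨ *-monoˡ-≤ ((W ^ n) ^ s) (dark-bound e n heavy≤ n ≤-refl) ⟩
        n * n * (W ^ n * ∑ vs d) * (W ^ n) ^ s ≤⟨ *-monoˡ-≤ ((W ^ n) ^ s) (*-monoʳ-≤ (n * n) (*-monoʳ-≤ (W ^ n) dbl)) ⟩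
        n * n * (W ^ n * (2 * ∑ vs μ)) * (W ^ n) ^ s ≡⟨ solve 4 (λ n w m x → n :* (w :* (con 2 :* m)) :* x := w :* (n :* con 2 :* (m :* x))) refl (n * n) (W ^ n) (∑ vs μ) ((W ^ n) ^ s) ⟩
        W ^ n * (n * n * 2 * (∑ vs μ * (W ^ n) ^ s)) ≡⟨ cong (λ z → W ^ n * (n * n * 2 * z)) (sym totalMass-value) ⟩
        W ^ n * (n * n * 2 * totalMass) ∎)
        where
        G : V → ℕ
        G y = ∑ (walks n) (λ x → wt y x * ⟦ not (allLight y x) ⟧)
        φ : V → Fin s → Vec V n → ℕ
        φ y i′ x = if does (i′ Fin.≟ i) then ⟦ not (allLight y x) ⟧ else 1
        F : V → Fin s → ℕ
        F y i′ = ∑ (walks n) (λ x → wt y x * φ y i′ x)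
        value : massOf (dark i) ≡ ∑ vs (λ y → μ y * ∏ s (F y))
        value = trans (∑-spiders _) (∑-cong vs λ y → trans (∑-cong (tuples (walks n) s) λ l → trans (x*yz≡y*xz ⟦ dark i (y , l) ⟧ (μ y) _) (cong (μ y *_) (trans (*-comm ⟦ dark i (y , l) ⟧ _)
            (trans (cong (∏ s (λ i → wt y (lookup l i)) *_) (sym (∏-single s i (λ i′ → ⟦ not (allLight y (lookup l i′)) ⟧)))) (sym (∏-* s (λ i′ → wt y (lookup l i′)) (λ i′ → φ y i′ (lookup l i′))))))))
          (trans (∑-*ˡ (tuples (walks n) s) (μ y) _) (cong (μ y *_) (∑-∏-tuples (walks n) s (λ i′ x → wt y x * φ y i′ x)))))
        F-other : ∀ y i′ → i′ ≢ i → F y i′ ≤ W ^ n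
        F-other y i′ ne rewrite does-≢ {i = i′} {i} ne = ≤-trans (≤-reflexive (∑-cong (walks n) λ x → *-identityʳ (wt y x))) (Z≤ n y)
        F-same : ∀ y → F y i ≡ G y
        F-same y rewrite does-refl i = refl
        bound : ∀ y → W ^ n * (μ y * ∏ s (F y)) ≤ d y * G y * (W ^ n) ^ s
        bound y = begin
          W ^ n * (μ y * ∏ s (F y)) ≡⟨ x*yz≡y*xz (W ^ n) (μ y) _ ⟩
          μ y * (W ^ n * ∏ s (F y)) ≤⟨ *-mono-≤ (μ≤d y) (∏-bound-at s (W ^ n) i (F-other y)) ⟩
          d y * (F y i * (W ^ n) ^ s) ≡⟨ trans (cong (λ z → d y * (z * (W ^ n) ^ s)) (F-same y)) (sym (*-assoc (d y) _ _)) ⟩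
          d y * G y * (W ^ n) ^ s ∎

    -- Every leg brings a factor `ω y` of the centre. One of them cancels against the degree in
    -- `μ y` and gives `W`, the other `s′` are bounded by `h true`.
    maxWeight : ℕ
    maxWeight = W * (h true ^ s′ * (C ^ n′ * walkBound n′ false) ^ s)

    -- Once the centre is pinned the class mass is a product over the legs, and `leg-light` bounds
    -- each factor, whatever else `K` pins.
    pinned-light : 1 ≤ C → ∀ K S → K ctr ≡ true → (∀ p → K₀ p ≡ true → K p ≡ true) → lightSpider S ≡ true → 0 < weight S → class K S weight ≤ maxWeight
    pinned-light 1≤C K S@(y , l) kc k₀ ls lt = begin
      class K S weight
        ≡⟨ trans (∑-cong spiders λ S′ → cong (⟦ agree K S S′ ⟧ *_) (sym (weight-one S′))) (class-product K y l (λ _ → 1) (λ _ _ → 1)) ⟩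
      ∑ vs (λ y′ → 1 * (⟦ agreeIf (K ctr) y y′ ⟧ * (μ y′ * ∏ s (L y′))))
        ≡⟨ trans (∑-cong vs λ y′ → trans (+-identityʳ _) (cong (λ b → ⟦ agreeIf b y y′ ⟧ * (μ y′ * ∏ s (L y′))) kc)) (∑-δ′ y _) ⟩
      μ y * ∏ s (L y) ≤⟨ *-mono-≤ (μ≤d y) (≤-trans (∏-mono s leg) (≤-reflexive (∏-const s (C ^ n′ * light n′ y)))) ⟩
      d y * (C ^ n′ * light n′ y) ^ s ≡⟨ cong (λ z → d y * z ^ s) (trans (cong (λ b → C ^ n′ * (ω y * walkBound n′ (not b))) sy) (x*yz≡y*xz (C ^ n′) (ω y) _)) ⟩
      d y * (ω y * CT) ^ s ≡⟨ cong (d y *_) (^-distribʳ-* s (ω y) CT) ⟩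
      d y * (ω y * ω y ^ s′ * CT ^ s) ≡⟨ solve 4 (λ d w x z → d :* (w :* x :* z) := d :* w :* (x :* z)) refl (d y) (ω y) (ω y ^ s′) (CT ^ s) ⟩
      d y * ω y * (ω y ^ s′ * CT ^ s) ≤⟨ *-mono-≤ (≤-reflexive (d*ω y (proj₁ (proj₂ wp)))) (*-monoˡ-≤ (CT ^ s) (^-monoˡ-≤ s′ (≤-trans (ω≤h y) (≤-reflexive (cong h sy))))) ⟩
      maxWeight ∎
      where
      open ≤-Reasoning
      wp = weight-pos {S} lt
      sy = proj₁ wp
      CT = C ^ n′ * walkBound n′ false
      L : V → Fin s → ℕ
      L y′ i = ∑ (walks n) (λ x → ⟦ agreeLeg (λ j → K (at i j)) (lookup l i) x ⟧ * (wt y′ x * 1))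
      swap : ∀ m (x z : Vec V n) → agreeLeg m x z ≡ agreeLeg m z x
      swap m x z = bool-iff (λ e → agreeLeg-complete {m = m} {z} {x} λ j q → sym (agreeLeg-sound {m = m} {x} {z} e j q))
                            (λ e → agreeLeg-complete {m = m} {x} {z} λ j q → sym (agreeLeg-sound {m = m} {z} {x} e j q))
      leg : ∀ i → L y i ≤ C ^ n′ * light n′ y
      leg i = ≤-trans (≤-reflexive (∑-cong (walks n) λ x → cong₂ (λ b w → ⟦ b ⟧ * w) (swap (λ j → K (at i j)) (lookup l i) x) (*-identityʳ (wt y x))))
        (leg-light 1≤C y (λ j → K (at i j)) (lookup l i) (k₀ (at i (fromℕ n′)) (does-refl (fromℕ n′))) (⋀-sound s {λ i → allLight y (lookup l i)} ls i) (proj₂ (proj₂ wp) i))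

    tip-side : flip n true ≡ true → ∀ {S} → 0 < weight S → ∀ i → side (val S (at i (fromℕ n′))) ≡ true
    tip-side even {S} lt i =
      let sy , _ , legs = weight-pos {S} lt
      in trans (alternates-last (lookup (proj₂ S) i) (walk-alternates (proj₁ S) (lookup (proj₂ S) i) (legs i))) (trans (cong (λ b → flip n′ (not b)) sy) even)

    -- Spiders are grouped by their leaves. A tuple of leaves contributes either nothing or at most
    -- the mass of one class of `K₀` that stays below the threshold `B`.
    few-light-tops : flip n true ≡ true → ∀ B → massOf (λ S → not (heavyTop B S)) ≤ (∑ vs (λ v → ⟦ side v ⟧)) ^ s * B
    few-light-tops even B = begin
      massOf (λ S → not (heavyTop B S)) ≤⟨ ∑-mono spiders pt ⟩
      ∑ spiders (λ S → ∑ (tuples vs s) (λ t → sides t * (⟦ tipsEq t S ⟧ * f S))) ≡⟨ trans (∑-swap spiders (tuples vs s) _) (∑-cong (tuples vs s) λ t → ∑-*ˡ spiders (sides t) _) ⟩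
      ∑ (tuples vs s) (λ t → sides t * ∑ spiders (λ S → ⟦ tipsEq t S ⟧ * f S)) ≤⟨ ∑-mono (tuples vs s) (λ t → *-monoʳ-≤ (sides t) (class≤ t)) ⟩
      ∑ (tuples vs s) (λ t → sides t * B) ≡⟨ ∑-*ʳ (tuples vs s) B _ ⟩
      ∑ (tuples vs s) sides * B ≡⟨ cong (_* B) (trans (∑-∏-tuples vs s (λ _ v → ⟦ side v ⟧)) (∏-const s (∑ vs (λ v → ⟦ side v ⟧)))) ⟩
      (∑ vs (λ v → ⟦ side v ⟧)) ^ s * B ∎
      where
      open ≤-Reasoning
      f : Spider → ℕ
      f S = ⟦ not (heavyTop B S) ⟧ * weight S
      sides : Vec V s → ℕ
      sides t = ∏ s (λ i → ⟦ side (lookup t i) ⟧)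
      tips : Spider → Vec V s
      tips S = Data.Vec.tabulate (λ i → val S (at i (fromℕ n′)))
      tips-at : ∀ S i → lookup (tips S) i ≡ val S (at i (fromℕ n′))
      tips-at S i = Data.Vec.Properties.lookup∘tabulate (λ i → val S (at i (fromℕ n′))) i
      pt : ∀ S → f S ≤ ∑ (tuples vs s) (λ t → sides t * (⟦ tipsEq t S ⟧ * f S))
      pt S with weight S in w
      ... | zero  = ≤-trans (≤-reflexive (*-zeroʳ ⟦ not (heavyTop B S) ⟧)) z≤n
      ... | suc k = ≤-trans (≤-reflexive (sym (trans (cong₂ (λ a b → a * (⟦ b ⟧ * (⟦ not (heavyTop B S) ⟧ * suc k))) sides-one tips-eq) (trans (+-identityʳ _) (+-identityʳ _)))))
              (∑-∈ (λ t → sides t * (⟦ tipsEq t S ⟧ * (⟦ not (heavyTop B S) ⟧ * suc k))) (∈-tuples (tips S) (λ i → ∈vs _)))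
        where
        sides-one : sides (tips S) ≡ 1
        sides-one = trans (∏-cong s λ i → trans (cong (λ v → ⟦ side v ⟧) (tips-at S i)) (⟦⟧-true (tip-side even {S} (subst (0 <_) (sym w) z<s) i))) (trans (∏-const s 1) (^-zeroˡ s))
        tips-eq : tipsEq (tips S) S ≡ true
        tips-eq = ⋀-complete s λ i → trans (cong (val S (at i (fromℕ n′)) ==_) (tips-at S i)) (==-refl _)
      class≤ : ∀ t → ∑ spiders (λ S → ⟦ tipsEq t S ⟧ * f S) ≤ B
      class≤ t with search spiders (λ S → tipsEq t S ∧ not (heavyTop B S))
      ... | inj₂ none = ≤-trans (∑-mono-∈ spiders (λ {S} i → ≤-reflexive (zero-term S (none i)))) (≤-trans (≤-reflexive (∑-zero spiders)) z≤n)
        where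
        zero-term : ∀ S → (tipsEq t S ∧ not (heavyTop B S)) ≡ false → ⟦ tipsEq t S ⟧ * f S ≡ 0
        zero-term S e = trans (sym (*-assoc ⟦ tipsEq t S ⟧ ⟦ not (heavyTop B S) ⟧ (weight S))) (cong (_* weight S) (trans (sym (⟦∧⟧ (tipsEq t S) _)) (cong ⟦_⟧ e)))
      ... | inj₁ (S₁ , _ , e) = let a , b = ∧-true {tipsEq t S₁} e in ≤-trans (∑-mono spiders (λ S → *-mono-≤ (le S a) (⟦⟧*≤ (not (heavyTop B S)) (weight S)))) (s≤s⁻¹ (≤ᵇ-false (not-true b)))
        where
        le : ∀ S → tipsEq t S₁ ≡ true → ⟦ tipsEq t S ⟧ ≤ ⟦ agree K₀ S₁ S ⟧
        le S a with tipsEq t S in q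
        ... | false = z≤n
        ... | true  = ≤-reflexive (sym (⟦⟧-true (tipsEq-agree {t} {S₁} {S} a q)))

  kernel : ∀ K → K ctr ≡ false → (∀ p → K₀ p ≡ true → K p ≡ true) → KernelShape K
  kernel K kc k₀ = record
    { tip = λ i → proj₁ (ft i) ; K-ctr = kc ; K-tip = λ i → proj₁ (proj₂ (ft i)) ; K-pre = λ i → proj₂ (proj₂ (ft i)) }
    where
    ft : ∀ i → ∃ λ j → K (at i j) ≡ true × (∀ j′ → toℕ j′ < toℕ j → K (at i j′) ≡ false)
    ft i = firstTrue (λ j → K (at i j)) (k₀ (at i (fromℕ n′)) (does-refl (fromℕ n′)))

  module _ (t k′ : ℕ) (n′≡ : n′ ≡ 1 + 2 * k′) where

    -- Since `n′` is odd, two legs whose tips are adjacent to the centre both have an odd gap and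
    -- would both get the centre as branch vertex. Such legs are handed to `Pairing`; without them
    -- `Spread` applies.
    rich-kernel-subdivision : ∀ {K} (κ : KernelShape K) A c N → 0 < totalMass → totalMass ≤ A * massOf (richSpider K c) → loss s A * N < c →
      degreeNeeded s n A N s t ≤ δ → (s + t) + s * (t * 1) * n′ + (1 + n′) ≤ N → s + t * (1 + s * n′) + (s + s * n′) ≤ N → Subdivision s t 1 n′
    rich-kernel-subdivision {K} κ A c N tot>0 rich≥ c> δ≥ N≥ N≥′ = decide (search (allFin s) twin)
      where
      open KernelShape κ
      needed = degreeNeeded-parts s n A N s t
      sys : ClosedSystem K κ N (loss s A)
      sys = closed-system κ A c N tot>0 rich≥ (≤-trans (≤-reflexive (cong (_* (2 * A)) length-clashes)) (≤-trans (proj₁ needed) δ≥)) c>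
              (≤-trans (proj₁ (proj₂ needed)) δ≥)
      short : Fin s → Bool
      short i = toℕ (tip i) ≤ᵇ 0
      other : Fin s → Fin s → Bool
      other i i′ = not (does (i Fin.≟ i′)) ∧ (short i ∧ short i′)
      twin : Fin s → Bool
      twin i = 1 ≤ᵇ ∑ (allFin s) (λ i′ → ⟦ other i i′ ⟧)
      zeros : ∀ {i} → short i ≡ true → toℕ (tip i) ≡ 0
      zeros e = n≤0⇒n≡0 (≤ᵇ-true e)
      y>0 : 0 < d (val (ClosedSystem.S₀ sys) ctr)
      y>0 = proj₁ (proj₂ (weight-pos {ClosedSystem.S₀ sys} (ClosedSystem.positive sys (ClosedSystem.good-S₀ sys))))
      decide : (∃ λ i → i ∈ allFin s × twin i ≡ true) ⊎ (∀ {i} → i ∈ allFin s → twin i ≡ false) → Subdivision s t 1 n′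
      decide (inj₁ (i , _ , tw)) =
        let i′ , _ , lt = ∑-pos (allFin s) (λ i′ → ⟦ other i i′ ⟧) (≤ᵇ-true tw)
            o , _ = ⟦⟧-pos (other i i′) {1} (subst (0 <_) (sym (*-identityʳ _)) lt)
            ne , sh = ∧-true {not (does (i Fin.≟ i′))} o
            sh₁ , sh₂ = ∧-true {short i} sh
        in Pairing.paired-subdivision Γ s n μ δ δ≤d κ sys i i′ (λ e → true≢false (trans (sym (does-refl i)) (trans (cong (λ z → does (i Fin.≟ z)) e) (not-true ne)))) (zeros {i} sh₁) s t 1 n′ false k′
             (trans (cong (λ z → 2 * k′ + (z + 1)) (zeros {i′} sh₂)) (trans (+-comm (2 * k′) 1) (sym n′≡))) (λ ())
             (≤-trans (proj₁ (proj₂ (proj₂ needed))) (≤-trans δ≥ (δ≤d _ y>0))) y>0 (≤-trans (proj₂ (proj₂ (proj₂ needed))) δ≥) N≥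
      decide (inj₂ none) = Spread.spread-subdivision Γ s n μ δ δ≤d κ sys n′ odd half′ par one-short t N≥′
        where
        pg : ∀ i → (∃ λ m → 2 * m + toℕ (tip i) ≡ n′) ⊎ (∃ λ m → 1 + 2 * m + toℕ (tip i) ≡ n′)
        pg i = parity-gap {toℕ (tip i)} {n′} (s≤s⁻¹ (toℕ<n (tip i)))
        odd-of : ∀ {τ} → (∃ λ m → 2 * m + τ ≡ n′) ⊎ (∃ λ m → 1 + 2 * m + τ ≡ n′) → Bool
        odd-of (inj₁ _) = false
        odd-of (inj₂ _) = true
        half-of : ∀ {τ} → (∃ λ m → 2 * m + τ ≡ n′) ⊎ (∃ λ m → 1 + 2 * m + τ ≡ n′) → ℕ
        half-of (inj₁ (m , _)) = m
        half-of (inj₂ (m , _)) = m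
        par-of : ∀ {τ} (c : (∃ λ m → 2 * m + τ ≡ n′) ⊎ (∃ λ m → 1 + 2 * m + τ ≡ n′)) → ⟦ odd-of c ⟧ + (2 * half-of c + τ) ≡ n′
        par-of (inj₁ (m , e)) = e
        par-of (inj₂ (m , e)) = e
        odd : Fin s → Bool
        odd i = odd-of (pg i)
        half′ : Fin s → ℕ
        half′ i = half-of (pg i)
        par : ∀ i → ⟦ odd i ⟧ + (2 * half′ i + toℕ (tip i)) ≡ n′
        par i = par-of (pg i)
        one-short : ∀ i i′ → toℕ (tip i) ≡ 0 → toℕ (tip i′) ≡ 0 → i ≡ i′
        one-short i i′ z z′ with i Fin.≟ i′
        ... | yes e = e
        ... | no ne = ⊥-elim (true≢false (sym (trans (sym (none (∈-allFin i))) (true-≤ᵇ (any-true (allFin s) {other i} (∈-allFin i′)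
                (true-∧ (cong not (does-≢ ne)) (true-∧ (true-≤ᵇ (≤-reflexive z)) (true-≤ᵇ (≤-reflexive z′)))))))))

    -- If the first alternative fails, at least half of the mass lies on leaves of class mass above
    -- `βm * maxWeight C`, whence the start value 2 of `A`. Pinning then cannot reach the centre:
    -- too few spiders fail to be light to fill the surviving set, and a light one would have class
    -- mass at most that threshold.
    spider-dichotomy : ∀ (A c β : ℕ → ℕ) N C e βm → (∀ j → A (suc j) ≡ 2 * A j * (c j * (1 + s * n)) * (1 + s * n)) → (∀ j → β (suc j) ≡ β j * (c j * (1 + s * n))) →
      A 0 ≡ 2 → β 0 ≡ 1 → (∀ j → loss s (2 * A j) * N < c j) → (∀ j → j ≤ 1 + s * n → β j ≤ βm) → (∀ j → j ≤ 1 + s * n → A j * (s * (n * n * 2)) < e) →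
      (∀ j → j ≤ 1 + s * n → degreeNeeded s n (2 * A j) N s t ≤ δ) → (s + t) + s * (t * 1) * n′ + (1 + n′) ≤ N → s + t * (1 + s * n′) + (s + s * n′) ≤ N →
      1 ≤ C → (∀ i → i < n → e * mass (heavy C i) i ≤ total i) → flip n true ≡ true → ∑ vs d ≤ 2 * ∑ vs μ → 0 < totalMass →
      totalMass ≤ 2 * ((∑ vs (λ v → ⟦ side v ⟧)) ^ s * (βm * maxWeight C)) ⊎ Subdivision s t 1 n′
    spider-dichotomy A c β N C e βm A-step β-step A0 β0 c> β≤ e> δ≥ N≥ N≥′ 1≤C heavy≤ even dbl tot>0 =
      decide (totalMass ≤? 2 * ((∑ vs (λ v → ⟦ side v ⟧)) ^ s * B))
      where
      open ≤-Reasoning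
      B = βm * maxWeight C
      Ω₀ = heavyTop B
      module D = Determination Γ s n μ δ δ≤d
      stage₀ : 2 * ((∑ vs (λ v → ⟦ side v ⟧)) ^ s * B) < totalMass → D.Stage A c β A-step β-step K₀ Ω₀ tot>0 0 K₀ Ω₀
      stage₀ lt = record
        { K-ctr = refl ; K₀⊆K = λ _ k → k
        ; saturated = λ {S} {S′} ag q → trans (cong (suc B ≤ᵇ_) (sym (class-cong K₀ {S} {S′} weight ag))) q
        ; Ω⊆Ω₀ = λ q → q
        ; large = ≤-trans (+-cancelʳ-≤ totalMass totalMass (2 * massOf Ω₀) (begin
            totalMass + totalMass ≡⟨ cong₂ _+_ all all ⟩
            massOf Ω₀ + massOf (λ S → not (Ω₀ S)) + (massOf Ω₀ + massOf (λ S → not (Ω₀ S))) ≡⟨ solve 2 (λ x y → x :+ y :+ (x :+ y) := con 2 :* x :+ con 2 :* y) refl (massOf Ω₀) (massOf (λ S → not (Ω₀ S))) ⟩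
            2 * massOf Ω₀ + 2 * massOf (λ S → not (Ω₀ S)) ≤⟨ +-monoʳ-≤ (2 * massOf Ω₀) (≤-trans (*-monoʳ-≤ 2 (few-light-tops C even B)) (<⇒≤ lt)) ⟩
            2 * massOf Ω₀ + totalMass ∎)) (≤-reflexive (cong (_* massOf Ω₀) (sym A0)))
        ; pinned-by = λ {S} _ → ≤-reflexive (sym (trans (cong (_* class K₀ S weight) β0) (+-identityʳ _))) }
        where
        all : totalMass ≡ massOf Ω₀ + massOf (λ S → not (Ω₀ S))
        all = trans (∑-cong spiders λ S → pt (Ω₀ S) (weight S)) (∑-+ spiders _ _)
          where
          pt : ∀ b w → w ≡ ⟦ b ⟧ * w + ⟦ not b ⟧ * w
          pt true  w = sym (trans (+-identityʳ _) (+-identityʳ w))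
          pt false w = sym (+-identityʳ w)
      finish : D.Outcome A c β A-step β-step K₀ Ω₀ tot>0 (1 + s * n) → Subdivision s t 1 n′
      finish (j , j≤ , inj₁ rk) = rich-kernel-subdivision (kernel RK.K RK.K-ctr RK.K₀⊆K) (2 * A j) (c j) N tot>0 RK.large (c> j) (δ≥ j j≤) N≥ N≥′
        where module RK = D.RichKernel rk
      finish (j , j≤ , inj₂ pc) = ⊥-elim (absurd (massOf (λ S → PC.Ω S ∧ lightSpider C S)) refl)
        where
        module PC = D.PinnedCentre pc
        absurd : ∀ x → massOf (λ S → PC.Ω S ∧ lightSpider C S) ≡ x → ⊥
        absurd zero z = <-irrefl refl (<-≤-trans (e> j j≤) (*-cancelʳ-≤ e (A j * (s * (n * n * 2))) totalMass {{>-nonZero tot>0}} (begin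
          e * totalMass ≤⟨ *-monoʳ-≤ e PC.large ⟩
          e * (A j * massOf PC.Ω) ≤⟨ *-monoʳ-≤ e (*-monoʳ-≤ (A j) (≤-trans (∑-mono spiders pt) (≤-reflexive (trans (∑-+ spiders _ _) (cong (_+ massOf (λ S → not (lightSpider C S))) z))))) ⟩
          e * (A j * massOf (λ S → not (lightSpider C S))) ≡⟨ x*yz≡y*xz e (A j) _ ⟩
          A j * (e * massOf (λ S → not (lightSpider C S))) ≤⟨ *-monoʳ-≤ (A j) (dark-spiders C e heavy≤ dbl) ⟩
          A j * (s * (n * n * 2) * totalMass) ≡⟨ sym (*-assoc (A j) _ _) ⟩
          A j * (s * (n * n * 2)) * totalMass ∎)))
          where
          pt : ∀ S → ⟦ PC.Ω S ⟧ * weight S ≤ ⟦ PC.Ω S ∧ lightSpider C S ⟧ * weight S + ⟦ not (lightSpider C S) ⟧ * weight S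
          pt S with PC.Ω S | lightSpider C S
          ... | false | _     = z≤n
          ... | true  | true  = m≤m+n _ _
          ... | true  | false = ≤-refl
        absurd (suc x) e′ =
          let S , _ , lt = ∑-pos spiders (λ S → ⟦ PC.Ω S ∧ lightSpider C S ⟧ * weight S) (subst (0 <_) (sym e′) z<s)
              q , w>0 = ⟦⟧-pos (PC.Ω S ∧ lightSpider C S) lt
              inΩ , ls = ∧-true {PC.Ω S} q
          in <-irrefl refl (begin-strict
               B <⟨ ≤ᵇ-true (PC.Ω⊆Ω₀ inΩ) ⟩
               class K₀ S weight ≤⟨ PC.pinned-by inΩ ⟩
               β j * class PC.K S weight ≤⟨ *-mono-≤ (β≤ j j≤) (pinned-light C 1≤C PC.K S PC.K-ctr PC.K₀⊆K ls w>0) ⟩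
               B ∎)
      decide : Dec (totalMass ≤ 2 * ((∑ vs (λ v → ⟦ side v ⟧)) ^ s * B)) → totalMass ≤ 2 * ((∑ vs (λ v → ⟦ side v ⟧)) ^ s * B) ⊎ Subdivision s t 1 n′
      decide (yes le) = inj₁ le
      decide (no gt) = inj₂ (finish (D.determination A c β A-step β-step K₀ Ω₀ tot>0 (stage₀ (≰⇒> gt))))

-- Constants for walks

module PathConstants (s t r k′ E₀ : ℕ) (E₀-pos : 0 < E₀) where

  private
    n = 2 + 2 * k′
    n′ = 1 + 2 * k′
    Bg = budget s t r n′

  opaque
    -- The richness with which pairs of density `1 / (2 * x)` produce a closed system able to avoid
    -- `Bg` vertices; the first factor is for the union bound over positions.
    richness : ℕ → ℕ
    richness x = (1 + 2 * n) * suc (loss 2 (2 * x) * Bg)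

    -- The constants are fixed from the longest walks downwards: the density tolerated at index
    -- `suc j` determines `c j`, and this in turn the smaller density tolerated at the indices up to
    -- `j`. Hence the reversed index in `e`.
    level : ℕ → ℕ
    level zero    = E₀
    level (suc i) = 4 * n * richness (level i) * level i

    level-zero : level 0 ≡ E₀
    level-zero = refl

    level-suc : ∀ i → level (suc i) ≡ 4 * n * richness (level i) * level i
    level-suc i = refl

    richness-≡ : ∀ x → richness x ≡ (1 + 2 * n) * suc (loss 2 (2 * x) * Bg)
    richness-≡ x = refl

  richness-pos : ∀ x → 0 < richness x
  richness-pos x = subst (0 <_) (sym (richness-≡ x)) (*-mono-≤ {1} {1 + 2 * n} {1} {suc (loss 2 (2 * x) * Bg)} (s≤s z≤n) (s≤s z≤n))

  private
    ≤-level : ∀ a b c → 0 < a → 0 < c → b ≤ a * b * c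
    ≤-level (suc a) b (suc c) _ _ = ≤-trans (m≤m+n b (a * b)) (m≤m*n (suc a * b) (suc c))

  level-pos : ∀ i → 0 < level i
  level-pos zero    = subst (0 <_) (sym level-zero) E₀-pos
  level-pos (suc i) = <-≤-trans (richness-pos (level i)) (≤-trans (≤-level (4 * n) (richness (level i)) (level i) z<s (level-pos i)) (≤-reflexive (sym (level-suc i))))

  level-step : ∀ i → level i ≤ level (suc i)
  level-step i = ≤-trans (≤-trans (≤-reflexive (sym (+-identityʳ (level i)))) (*-monoˡ-≤ (level i) {1} {4 * n * richness (level i)} (*-mono-≤ {1} {4 * n} (s≤s z≤n) (richness-pos (level i))))) (≤-reflexive (sym (level-suc i)))

  level-mono : ∀ {i j} → i ≤ j → level i ≤ level j
  level-mono {i} {j} le = subst (λ j → level i ≤ level j) (m∸n+n≡m le) (go (j ∸ i))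
    where
    go : ∀ k → level i ≤ level (k + i)
    go zero    = ≤-refl
    go (suc k) = ≤-trans (go k) (level-step (k + i))

  e c : ℕ → ℕ
  e i = level (n′ ∸ i)
  c j = richness (e (suc j))

  -- One threshold for all lengths: each level is at least the richness of the level before it.
  C : ℕ
  C = level n

  C-pos : 1 ≤ C
  C-pos = level-pos n

  private
    n′∸j : ∀ {j} → j < n′ → n′ ∸ j ≡ suc (n′ ∸ suc j)
    n′∸j {j} lt = sym (suc[m∸1+n]≡m∸n n′ j lt)

  c≤C : ∀ j → j < n′ → c j ≤ C
  c≤C j lt = ≤-trans (≤-trans (≤-level (4 * n) (c j) (e (suc j)) z<s (level-pos (n′ ∸ suc j))) (≤-reflexive (sym (level-suc (n′ ∸ suc j)))))
    (level-mono {suc (n′ ∸ suc j)} {n} (≤-trans (≤-reflexive (sym (n′∸j lt))) (≤-trans (m∸n≤m n′ j) (n≤1+n n′))))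

  e-step : ∀ j → j < n′ → ∀ a → a ≤ j → 4 * suc j * c j * e (suc j) ≤ e a
  e-step j lt a a≤j = begin
    4 * suc j * c j * e (suc j) ≤⟨ *-monoˡ-≤ (e (suc j)) (*-monoˡ-≤ (c j) (*-monoʳ-≤ 4 (≤-trans lt (n≤1+n n′)))) ⟩
    4 * n * c j * e (suc j) ≡⟨ sym (level-suc (n′ ∸ suc j)) ⟩
    level (suc (n′ ∸ suc j)) ≡⟨ cong level (sym (n′∸j lt)) ⟩
    level (n′ ∸ j) ≤⟨ level-mono {n′ ∸ j} {n′ ∸ a} (∸-monoʳ-≤ n′ a≤j) ⟩
    e a ∎
    where open ≤-Reasoning

  E₀≤e : ∀ i → E₀ ≤ e i
  E₀≤e i = ≤-trans (≤-reflexive (sym level-zero)) (level-mono {0} {n′ ∸ i} z≤n)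

  Δ : ℕ
  Δ = ∑ (upTo n′) (λ j → degreeNeeded 2 (suc j) (2 * e (suc j)) Bg s t)

  module _ (Γ : WeightedGraph) (Β : Bipartition Γ) (δ : ℕ) (δ≤d : MinDegree Γ δ) (Δ≤δ : Δ ≤ δ) where
    open WeightedGraph Γ
    open Paths Γ Β
    open Trails Γ

    path-dichotomy : 0 < ∑ vs d → Subdivision s t r n′ ⊎ (∀ i → i < n → E₀ * mass (heavy C i) i ≤ total i)
    path-dichotomy d>0 = decide (search (upTo n′) (λ j → not (2 * e (suc j) * mass (rich (c j) j) (suc j) ≤ᵇ total (suc j))))
      where
      open ≤-Reasoning
      decide : (∃ λ j → j ∈ upTo n′ × not (2 * e (suc j) * mass (rich (c j) j) (suc j) ≤ᵇ total (suc j)) ≡ true) ⊎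
               (∀ {j} → j ∈ upTo n′ → not (2 * e (suc j) * mass (rich (c j) j) (suc j) ≤ᵇ total (suc j)) ≡ false) →
               Subdivision s t r n′ ⊎ (∀ i → i < n → E₀ * mass (heavy C i) i ≤ total i)
      decide (inj₁ (j , j∈ , bad)) = inj₁ (RichPaths.rich-subdivision Γ Β δ δ≤d j (2 * e (suc j)) (c j) s t r k′ d>0 (s≤s⁻¹ (∈-upTo⁻ j∈))
        (<⇒≤ (≤ᵇ-false (not-true bad)))
        (≤-trans (*-monoˡ-≤ (suc (loss 2 (2 * e (suc j)) * Bg)) (s≤s (*-monoʳ-≤ 2 (≤-trans (∈-upTo⁻ j∈) (n≤1+n n′))))) (≤-reflexive (sym (richness-≡ (e (suc j))))))
        (≤-trans (∑-∈ (λ j → degreeNeeded 2 (suc j) (2 * e (suc j)) Bg s t) j∈) Δ≤δ))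
      decide (inj₂ ok) = inj₂ λ i lt → ≤-trans (*-monoˡ-≤ (mass (heavy C i) i) (E₀≤e i))
        (mass-heavy C n′ c e c≤C e-step (λ j j< → rich≤ j (ok (∈-upTo⁺ j<))) i (s≤s⁻¹ lt))
        where
        rich≤ : ∀ j → not (2 * e (suc j) * mass (rich (c j) j) (suc j) ≤ᵇ total (suc j)) ≡ false → 2 * e (suc j) * mass (rich (c j) j) (suc j) ≤ total (suc j)
        rich≤ j q = ≤ᵇ-true (not-false q)

-- Counting light pairs

module FirstBound (Γ : WeightedGraph) (Β : Bipartition Γ) where
  open WeightedGraph Γ
  open Kernel Γ
  open Bipartition Β
  open Paths Γ Β
  open PathSums Γ

  -- By `dbl` and the factor 4, heavy pairs take at most half of the mass on the left. In a light
  -- pair `d u * ω u` gives `W`, and even length puts both ends on the same side.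
  few-light-pairs : ∀ C j → flip (suc j) true ≡ true → 4 * mass (heavy C j) j ≤ total j → ∑ vs d ≤ 2 * ∑ vs (λ y → ⟦ side y ⟧ * d y) →
    ∑ vs (λ y → ⟦ side y ⟧ * d y) * W ^ suc j ≤ 2 * (∑ vs (λ v → ⟦ side v ⟧) * ∑ vs (λ v → ⟦ side v ⟧) * (C ^ j * (W * walkBound j false)))
  few-light-pairs C j even heavy≤ dbl = *-cancelˡ-≤ 2 (+-cancelˡ-≤ (2 * (E * W ^ suc j)) _ _ (begin
    2 * (E * W ^ suc j) + 2 * (E * W ^ suc j) ≡⟨ solve 1 (λ x → con 2 :* x :+ con 2 :* x := con 4 :* x) refl (E * W ^ suc j) ⟩
    4 * (E * W ^ suc j) ≤⟨ *-monoʳ-≤ 4 split ⟩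
    4 * (mass (heavy C j) j + R) ≡⟨ *-distribˡ-+ 4 (mass (heavy C j) j) R ⟩
    4 * mass (heavy C j) j + 4 * R ≤⟨ +-monoˡ-≤ (4 * R) (≤-trans heavy≤ (*-monoʳ-≤ (W ^ suc j) dbl)) ⟩
    W ^ suc j * (2 * E) + 4 * R ≡⟨ solve 3 (λ w e r → w :* (con 2 :* e) :+ con 4 :* r := con 2 :* (e :* w) :+ con 2 :* (con 2 :* r)) refl (W ^ suc j) E R ⟩
    2 * (E * W ^ suc j) + 2 * (2 * R) ∎))
    where
    open ≤-Reasoning
    μ : V → ℕ
    μ y = ⟦ side y ⟧ * d y
    E = ∑ vs μ
    m = ∑ vs (λ v → ⟦ side v ⟧)
    L = C ^ j * (W * walkBound j false)
    R = m * m * L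
    row-value : ∀ u → μ u * W ^ suc j ≡ ∑ vs (λ v → μ u * p (suc j) u v)
    row-value u with d u in e
    ... | zero  = trans (cong (_* W ^ suc j) (*-zeroʳ ⟦ side u ⟧)) (sym (trans (∑-cong vs λ v → cong (_* p (suc j) u v) (*-zeroʳ ⟦ side u ⟧)) (∑-zero vs)))
    ... | suc k = sym (trans (∑-*ˡ vs (⟦ side u ⟧ * suc k) _) (cong (⟦ side u ⟧ * suc k *_)
      (trans (∑-cong vs λ v → sym (*-identityʳ (p (suc j) u v))) (trans (sym (last-sum j u (λ _ → 1))) (trans (∑-cong (walks (suc j)) λ x → *-identityʳ (wt u x)) (Z-alive (suc j) u (subst (0 <_) (sym e) z<s)))))))
    pt : ∀ u v → μ u * p (suc j) u v ≤ d u * (⟦ heavy C j u v ⟧ * p (suc j) u v) + ⟦ side u ⟧ * (⟦ side v ⟧ * L)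
    pt u v with heavy C j u v in hv
    ... | true  = ≤-trans (≤-trans (*-monoˡ-≤ (p (suc j) u v) (⟦⟧*≤ (side u) (d u))) (≤-reflexive (cong (d u *_) (sym (+-identityʳ _))))) (m≤m+n _ _)
    ... | false = go (p (suc j) u v) refl (d u) refl (side u) refl
      where
      go : ∀ q → p (suc j) u v ≡ q → ∀ du → d u ≡ du → ∀ b → side u ≡ b → ⟦ b ⟧ * du * q ≤ du * 0 + ⟦ b ⟧ * (⟦ side v ⟧ * L)
      go q eq du ed false es = z≤n
      go zero eq du ed true es = ≤-trans (≤-reflexive (*-zeroʳ (1 * du))) z≤n
      go (suc q) eq zero ed true es = z≤n
      go (suc q) eq (suc k) ed true es = ≤-trans (begin
        1 * suc k * suc q ≡⟨ cong₂ _*_ (trans (+-identityʳ _) (sym ed)) (sym eq) ⟩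
        d u * p (suc j) u v ≤⟨ *-monoʳ-≤ (d u) (heavy-false {C} {j} hv) ⟩
        d u * (C ^ j * (ω u * walkBound j (not (side u)))) ≡⟨ cong (λ b → d u * (C ^ j * (ω u * walkBound j (not b)))) es ⟩
        d u * (C ^ j * (ω u * walkBound j false)) ≡⟨ solve 4 (λ d c w t → d :* (c :* (w :* t)) := c :* (d :* w :* t)) refl (d u) (C ^ j) (ω u) (walkBound j false) ⟩
        C ^ j * (d u * ω u * walkBound j false) ≡⟨ cong (λ w → C ^ j * (w * walkBound j false)) (d*ω u (subst (0 <_) (sym ed) z<s)) ⟩
        L ≡⟨ sym (trans (cong (λ b → 1 * (⟦ b ⟧ * L)) (trans (p-side (suc j) (subst (0 <_) (sym eq) z<s)) (trans (cong (flip (suc j)) es) even))) (trans (+-identityʳ _) (+-identityʳ L))) ⟩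
        1 * (⟦ side v ⟧ * L) ∎) (m≤n+m _ (suc k * 0))
    split : E * W ^ suc j ≤ mass (heavy C j) j + R
    split = begin
      E * W ^ suc j ≡⟨ trans (sym (∑-*ʳ vs (W ^ suc j) μ)) (∑-cong vs row-value) ⟩
      ∑ vs (λ u → ∑ vs (λ v → μ u * p (suc j) u v)) ≤⟨ ∑-mono vs (λ u → ∑-mono vs (pt u)) ⟩
      ∑ vs (λ u → ∑ vs (λ v → d u * (⟦ heavy C j u v ⟧ * p (suc j) u v) + ⟦ side u ⟧ * (⟦ side v ⟧ * L))) ≡⟨ trans (∑-cong vs λ u → ∑-+ vs _ _) (∑-+ vs _ _) ⟩
      mass (heavy C j) j + ∑ vs (λ u → ∑ vs (λ v → ⟦ side u ⟧ * (⟦ side v ⟧ * L))) ≡⟨ cong (mass (heavy C j) j +_) (trans (∑-cong vs λ u → trans (∑-*ˡ vs ⟦ side u ⟧ _) (cong (⟦ side u ⟧ *_) (∑-*ʳ vs L _))) (trans (∑-*ʳ vs (m * L) _) (sym (*-assoc m m L)))) ⟩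
      mass (heavy C j) j + R ∎

-- From bipartite graphs to weighted graphs

maxOver : ∀ {X : Set} → List X → (X → ℕ) → ℕ
maxOver []       f = 0
maxOver (x ∷ xs) f = f x ⊔ maxOver xs f

≤-maxOver : ∀ {X : Set} {xs : List X} (f : X → ℕ) {x} → x ∈ xs → f x ≤ maxOver xs f
≤-maxOver f (here refl) = m≤m⊔n _ _
≤-maxOver f (there i)   = ≤-trans (≤-maxOver f i) (m≤n⊔m _ _)

maxOver-* : ∀ {X : Set} (xs : List X) (f : X → ℕ) e R → (∀ x → e * f x ≤ R) → e * maxOver xs f ≤ R
maxOver-* []       f e R h = ≤-trans (≤-reflexive (*-zeroʳ e)) z≤n
maxOver-* (x ∷ xs) f e R h with ⊔-sel (f x) (maxOver xs f)
... | inj₁ q = ≤-trans (≤-reflexive (cong (e *_) q)) (h x)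
... | inj₂ q = ≤-trans (≤-reflexive (cong (e *_) q)) (maxOver-* xs f e R h)

∑≡sum : ∀ {X : Set} (xs : List X) f → ∑ xs f ≡ sum (map f xs)
∑≡sum []       f = refl
∑≡sum (x ∷ xs) f = cong (f x +_) (∑≡sum xs f)

edgeCount : ∀ {m n} → BipGraph m n → ℕ
edgeCount {m} {n} G = ∑ (allFin m) (λ i → ∑ (allFin n) (λ j → ⟦ G i j ⟧))

edges≡edgeCount : ∀ {m n} (G : BipGraph m n) → Defs.edges G ≡ edgeCount G
edges≡edgeCount {m} {n} G = trans (sym (∑≡sum (allFin m) _)) (∑-cong (allFin m) λ i → trans (sym (∑≡sum (allFin n) _)) (∑-cong (allFin n) λ j → ind (G i j)))
  where
  ind : ∀ b → (if b then 1 else 0) ≡ ⟦ b ⟧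
  ind true  = refl
  ind false = refl

module _ (m n : ℕ) where

  Vertex : Set
  Vertex = Fin m ⊎ Fin n

  vertices : List Vertex
  vertices = map inj₁ (allFin m) ++ map inj₂ (allFin n)

  ∑-vertices : ∀ f → ∑ vertices f ≡ ∑ (allFin m) (λ i → f (inj₁ i)) + ∑ (allFin n) (λ j → f (inj₂ j))
  ∑-vertices f = trans (∑-++ (map inj₁ (allFin m)) _ f) (cong₂ _+_ (∑-map inj₁ (allFin m) f) (∑-map inj₂ (allFin n) f))

  _≟ᵥ_ : (u v : Vertex) → Dec (u ≡ v)
  inj₁ i ≟ᵥ inj₁ j with i Fin.≟ j
  ... | yes e = yes (cong inj₁ e)
  ... | no ne = no λ { refl → ne refl }
  inj₂ i ≟ᵥ inj₂ j with i Fin.≟ j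
  ... | yes e = yes (cong inj₂ e)
  ... | no ne = no λ { refl → ne refl }
  inj₁ _ ≟ᵥ inj₂ _ = no λ ()
  inj₂ _ ≟ᵥ inj₁ _ = no λ ()

  does₁ : ∀ i j → does (inj₁ i ≟ᵥ inj₁ j) ≡ does (i Fin.≟ j)
  does₁ i j with i Fin.≟ j
  ... | yes _ = refl
  ... | no _  = refl

  does₂ : ∀ i j → does (inj₂ i ≟ᵥ inj₂ j) ≡ does (i Fin.≟ j)
  does₂ i j with i Fin.≟ j
  ... | yes _ = refl
  ... | no _  = refl

  ∑-δᵥ : ∀ u (g : Vertex → ℕ) → ∑ vertices (λ v → ⟦ does (v ≟ᵥ u) ⟧ * g v) ≡ g u
  ∑-δᵥ (inj₁ i) g = trans (∑-vertices _) (trans (cong₂ _+_ (trans (∑-cong (allFin m) λ j → cong (λ b → ⟦ b ⟧ * g (inj₁ j)) (does₁ j i)) (∑-δ-Fin m i (λ i → g (inj₁ i)))) (∑-zero (allFin n))) (+-identityʳ _))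
  ∑-δᵥ (inj₂ i) g = trans (∑-vertices _) (trans (cong₂ _+_ (∑-zero (allFin m)) (trans (∑-cong (allFin n) λ j → cong (λ b → ⟦ b ⟧ * g (inj₂ j)) (does₂ j i)) (∑-δ-Fin n i (λ i → g (inj₂ i))))) refl)

  ∈vertices : ∀ v → v ∈ vertices
  ∈vertices (inj₁ i) = ∈-++⁺ˡ (∈-map⁺ inj₁ (∈-allFin i))
  ∈vertices (inj₂ j) = ∈-++⁺ʳ (map inj₁ (allFin m)) (∈-map⁺ inj₂ (∈-allFin j))

  sideOf : Vertex → Bool
  sideOf (inj₁ _) = true
  sideOf (inj₂ _) = false

  module _ (P : BipGraph m n) where

    adjacent : Vertex → Vertex → Bool
    adjacent (inj₁ i) (inj₂ j) = P i j
    adjacent (inj₂ j) (inj₁ i) = P i j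
    adjacent (inj₁ _) (inj₁ _) = false
    adjacent (inj₂ _) (inj₂ _) = false

    adjacent-sym : ∀ u v → adjacent u v ≡ adjacent v u
    adjacent-sym (inj₁ _) (inj₁ _) = refl
    adjacent-sym (inj₁ _) (inj₂ _) = refl
    adjacent-sym (inj₂ _) (inj₁ _) = refl
    adjacent-sym (inj₂ _) (inj₂ _) = refl

    adjacent-side : ∀ {u v} → adjacent u v ≡ true → sideOf v ≡ not (sideOf u)
    adjacent-side {inj₁ _} {inj₂ _} e = refl
    adjacent-side {inj₂ _} {inj₁ _} e = refl

    degree : Vertex → ℕ
    degree v = ∑ vertices (λ u → ⟦ adjacent v u ⟧)

    private
      -- With `L` the number of vertices, `L !` is a multiple of every positive degree. The value 0
      -- at degree 0 matters, since `sideMax` ranges over isolated vertices as well.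
      invOf : ∀ L d → d ≤ L → ℕ
      invOf L zero    le = 0
      invOf L (suc d) le with ∣-trans (m∣m*n {suc d} (d !)) (m≤n⇒m!∣n! le)
      ... | divides q _ = q

      invOf-* : ∀ L d (le : d ≤ L) → 0 < d → d * invOf L d le ≡ L !
      invOf-* L (suc d) le _ with ∣-trans (m∣m*n {suc d} (d !)) (m≤n⇒m!∣n! le)
      ... | divides q e = trans (*-comm (suc d) q) (sym e)

      invOf-zero : ∀ L d (le : d ≤ L) → d ≡ 0 → invOf L d le ≡ 0
      invOf-zero L zero le refl = refl

      degree≤ : ∀ v → degree v ≤ length vertices
      degree≤ v = ≤-trans (∑-mono vertices λ u → ⟦⟧≤1 (adjacent v u)) (≤-reflexive (trans (∑-const vertices 1) (*-identityʳ _)))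

      inv : Vertex → ℕ
      inv v = invOf (length vertices) (degree v) (degree≤ v)

    graph : WeightedGraph
    graph = record
      { V = Vertex ; vs = vertices ; _≟_ = _≟ᵥ_ ; ∈vs = ∈vertices ; ∑-δ = ∑-δᵥ
      ; adj = adjacent ; adj-sym = adjacent-sym
      ; W = (length vertices) ! ; W-pos = >-nonZero⁻¹ ((length vertices) !) {{(length vertices) !≢0}}
      ; ω = inv ; d*ω = λ v → invOf-* (length vertices) (degree v) (degree≤ v) }

    open WeightedGraph graph using (ω; W; d)

    sideMax : Bool → ℕ
    sideMax true  = maxOver vertices (λ v → ⟦ sideOf v ⟧ * ω v)
    sideMax false = maxOver vertices (λ v → ⟦ not (sideOf v) ⟧ * ω v)

    bipartition : Bipartition graph
    bipartition = record { side = sideOf ; adj-side = λ {u} {v} → adjacent-side {u} {v} ; h = sideMax ; ω≤h = ω≤ }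
      where
      ω≤ : ∀ v → ω v ≤ sideMax (sideOf v)
      ω≤ (inj₁ i) = ≤-trans (≤-reflexive (sym (+-identityʳ _))) (≤-maxOver (λ v → ⟦ sideOf v ⟧ * ω v) (∈vertices (inj₁ i)))
      ω≤ (inj₂ j) = ≤-trans (≤-reflexive (sym (+-identityʳ _))) (≤-maxOver (λ v → ⟦ not (sideOf v) ⟧ * ω v) (∈vertices (inj₂ j)))

    sideMax-bound : ∀ e a b → (∀ i → 0 < d (inj₁ i) → e ≤ a * d (inj₁ i)) → (∀ j → 0 < d (inj₂ j) → e ≤ b * d (inj₂ j)) →
      e * sideMax true ≤ a * W × e * sideMax false ≤ b * W
    sideMax-bound e a b rows cols = maxOver-* vertices _ e (a * W) one , maxOver-* vertices _ e (b * W) two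
      where
      open ≤-Reasoning
      general : ∀ x v → (0 < d v → e ≤ x * d v) → e * ω v ≤ x * W
      general x v h = go (d v) refl
        where
        go : ∀ k → d v ≡ k → e * ω v ≤ x * W
        go zero    dv = ≤-trans (≤-reflexive (trans (cong (e *_) (invOf-zero (length vertices) (degree v) (degree≤ v) dv)) (*-zeroʳ e))) z≤n
        go (suc k) dv = begin
          e * ω v ≤⟨ *-monoˡ-≤ (ω v) (h (subst (0 <_) (sym dv) z<s)) ⟩
          x * d v * ω v ≡⟨ *-assoc x (d v) (ω v) ⟩
          x * (d v * ω v) ≡⟨ cong (x *_) (WeightedGraph.d*ω graph v (subst (0 <_) (sym dv) z<s)) ⟩
          x * W ∎
      one : ∀ v → e * (⟦ sideOf v ⟧ * ω v) ≤ a * W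
      one (inj₁ i) = ≤-trans (≤-reflexive (cong (e *_) (+-identityʳ _))) (general a (inj₁ i) (rows i))
      one (inj₂ j) = ≤-trans (≤-reflexive (*-zeroʳ e)) z≤n
      two : ∀ v → e * (⟦ not (sideOf v) ⟧ * ω v) ≤ b * W
      two (inj₁ i) = ≤-trans (≤-reflexive (*-zeroʳ e)) z≤n
      two (inj₂ j) = ≤-trans (≤-reflexive (cong (e *_) (+-identityʳ _))) (general b (inj₂ j) (cols j))

    d-row : ∀ i → d (inj₁ i) ≡ ∑ (allFin n) (λ j → ⟦ P i j ⟧)
    d-row i = trans (∑-vertices _) (cong (_+ ∑ (allFin n) (λ j → ⟦ P i j ⟧)) (∑-zero (allFin m)))

    d-col : ∀ j → d (inj₂ j) ≡ ∑ (allFin m) (λ i → ⟦ P i j ⟧)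
    d-col j = trans (∑-vertices _) (trans (cong (∑ (allFin m) (λ i → ⟦ P i j ⟧) +_) (∑-zero (allFin n))) (+-identityʳ _))

    ∑-left : ∑ vertices (λ v → ⟦ sideOf v ⟧ * d v) ≡ edgeCount P
    ∑-left = trans (∑-vertices _) (trans (cong₂ _+_ (∑-cong (allFin m) λ i → trans (+-identityʳ _) (d-row i)) (∑-zero (allFin n))) (+-identityʳ _))

    ∑-degrees : ∑ vertices d ≡ 2 * ∑ vertices (λ v → ⟦ sideOf v ⟧ * d v)
    ∑-degrees = trans (∑-vertices d) (trans (cong₂ _+_ (∑-cong (allFin m) d-row) (trans (∑-cong (allFin n) d-col) (∑-swap (allFin n) (allFin m) _)))
      (trans (cong (edgeCount P +_) (sym (+-identityʳ (edgeCount P)))) (cong (2 *_) (sym ∑-left))))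

    ∑-side : ∑ vertices (λ v → ⟦ sideOf v ⟧) ≡ m
    ∑-side = trans (∑-vertices _) (trans (cong₂ _+_ (trans (∑-const (allFin m) 1) (trans (*-identityʳ _) (length-allFin m))) (∑-zero (allFin n))) (+-identityʳ m))

  record Core (G : BipGraph m n) : Set where
    field
      P    : BipGraph m n
      P⊆G  : ∀ {i j} → P i j ≡ true → G i j ≡ true
      rows : ∀ i → 0 < ∑ (allFin n) (λ j → ⟦ P i j ⟧) → edgeCount G ≤ 4 * m * ∑ (allFin n) (λ j → ⟦ P i j ⟧)
      cols : ∀ j → 0 < ∑ (allFin m) (λ i → ⟦ P i j ⟧) → edgeCount G ≤ 4 * n * ∑ (allFin m) (λ i → ⟦ P i j ⟧)
      half-kept : edgeCount G ≤ 2 * edgeCount P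

  -- Rows and columns are the classes for `closure`. The weights `4 * (m * n)` and `e` translate
  -- closedness into degrees of at least `e / (4 * m)` in rows and `e / (4 * n)` in columns, and the
  -- loss `2 * (m * n) * e` is half of the initial mass.
  core : 0 < m → 0 < n → ∀ G → Core G
  core m>0 n>0 G =
    let P , sub , cl , le = closure pairs (true ∷ false ∷ []) R R-eq (λ _ → 4 * (m * n)) (λ _ → e) (λ x → G (proj₁ x) (proj₂ x))
    in record
      { P = λ i j → P (i , j) ; P⊆G = sub
      ; rows = λ i lt → row P i (cl {true}) lt ; cols = λ j lt → col P j (cl {false}) lt ; half-kept = half′ P le }
    where
    open ≤-Reasoning
    e = edgeCount G
    pairs : List (Fin m × Fin n)
    pairs = concatMap (λ i → map (i ,_) (allFin n)) (allFin m)
    ∑-pairs : ∀ f → ∑ pairs f ≡ ∑ (allFin m) (λ i → ∑ (allFin n) (λ j → f (i , j)))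
    ∑-pairs f = trans (∑-concatMap _ (allFin m) f) (∑-cong (allFin m) λ i → ∑-map (i ,_) (allFin n) f)
    ∈pairs : ∀ i j → (i , j) ∈ pairs
    ∈pairs i j = ∈-concatMap⁺ (λ i → map (i ,_) (allFin n)) (Any.map (λ { refl → ∈-map⁺ (i ,_) (∈-allFin j) }) (∈-allFin i))
    same : ∀ {k} → Fin k → Fin k → Bool
    same i i′ = does (i′ Fin.≟ i)
    same-refl : ∀ {k} (i : Fin k) → same i i ≡ true
    same-refl i with i Fin.≟ i
    ... | yes _ = refl
    ... | no ne = ⊥-elim (ne refl)
    same-sound : ∀ {k} {i i′ : Fin k} → same i i′ ≡ true → i ≡ i′
    same-sound {i = i} {i′} q with i′ Fin.≟ i
    ... | yes r = sym r
    R : Bool → Fin m × Fin n → Fin m × Fin n → Bool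
    R true  x y = same (proj₁ x) (proj₁ y)
    R false x y = same (proj₂ x) (proj₂ y)
    same-eq : ∀ {X : Set} {k} (f : X → Fin k) → Equivalence X (λ x y → same (f x) (f y))
    same-eq f = record
      { ~refl = λ x → same-refl (f x)
      ; ~sym = λ {x} {y} q → subst (λ z → same z (f x) ≡ true) (same-sound q) (same-refl (f x))
      ; ~trans = λ {x} {y} {z} q q′ → subst (λ w → same w (f z) ≡ true) (sym (same-sound {i = f x} {f y} q)) q′ }
    R-eq : ∀ b → Equivalence (Fin m × Fin n) (R b)
    R-eq true  = same-eq proj₁
    R-eq false = same-eq proj₂
    lenF : ∀ k → length (allFin k) ≡ k
    lenF k = length-allFin k
    some : ∀ {k} (f : Fin k → Bool) → 0 < ∑ (allFin k) (λ j → ⟦ f j ⟧) → ∃ λ j → f j ≡ true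
    some f lt = let j , _ , q = ∑-pos (allFin _) _ lt in j , proj₁ (⟦⟧-pos (f j) {1} (subst (0 <_) (sym (*-identityʳ _)) q))
    row : ∀ (P : Fin m × Fin n → Bool) i →
      (∀ {x} → true ∈ true ∷ false ∷ [] → x ∈ pairs → P x ≡ true → ∑ pairs (λ y → ⟦ R true x y ⟧ * e) ≤ ∑ pairs (λ y → ⟦ R true x y ⟧ * (⟦ P y ⟧ * (4 * (m * n))))) →
      0 < ∑ (allFin n) (λ j → ⟦ P (i , j) ⟧) → e ≤ 4 * m * ∑ (allFin n) (λ j → ⟦ P (i , j) ⟧)
    row P i cl lt = *-cancelˡ-≤ n {{>-nonZero n>0}} (begin
      n * e ≡⟨ sym (trans (∑-pairs _) (trans (∑-cong (allFin m) λ i′ → ∑-*ˡ (allFin n) ⟦ same i i′ ⟧ _) (trans (∑-δ-Fin m i (λ _ → ∑ (allFin n) (λ _ → e))) (trans (∑-const (allFin n) e) (cong (_* e) (lenF n)))))) ⟩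
      ∑ pairs (λ y → ⟦ R true (i , proj₁ q) y ⟧ * e) ≤⟨ cl (here refl) (∈pairs i (proj₁ q)) (proj₂ q) ⟩
      ∑ pairs (λ y → ⟦ R true (i , proj₁ q) y ⟧ * (⟦ P y ⟧ * (4 * (m * n)))) ≡⟨ trans (∑-pairs _) (trans (∑-cong (allFin m) λ i′ → ∑-*ˡ (allFin n) ⟦ same i i′ ⟧ _) (trans (∑-δ-Fin m i (λ i′ → ∑ (allFin n) (λ j → ⟦ P (i′ , j) ⟧ * (4 * (m * n))))) (∑-*ʳ (allFin n) (4 * (m * n)) _))) ⟩
      D * (4 * (m * n)) ≡⟨ solve 3 (λ d m n → d :* (con 4 :* (m :* n)) := n :* (con 4 :* m :* d)) refl D m n ⟩
      n * (4 * m * D) ∎)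
      where
      D = ∑ (allFin n) (λ j → ⟦ P (i , j) ⟧)
      q = some (λ j → P (i , j)) lt
    col : ∀ (P : Fin m × Fin n → Bool) j →
      (∀ {x} → false ∈ true ∷ false ∷ [] → x ∈ pairs → P x ≡ true → ∑ pairs (λ y → ⟦ R false x y ⟧ * e) ≤ ∑ pairs (λ y → ⟦ R false x y ⟧ * (⟦ P y ⟧ * (4 * (m * n))))) →
      0 < ∑ (allFin m) (λ i → ⟦ P (i , j) ⟧) → e ≤ 4 * n * ∑ (allFin m) (λ i → ⟦ P (i , j) ⟧)
    col P j cl lt = *-cancelˡ-≤ m {{>-nonZero m>0}} (begin
      m * e ≡⟨ sym (trans (∑-pairs _) (trans (∑-cong (allFin m) λ i → ∑-δ-Fin n j (λ _ → e)) (trans (∑-const (allFin m) e) (cong (_* e) (lenF m))))) ⟩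
      ∑ pairs (λ y → ⟦ R false (proj₁ q , j) y ⟧ * e) ≤⟨ cl (there (here refl)) (∈pairs (proj₁ q) j) (proj₂ q) ⟩
      ∑ pairs (λ y → ⟦ R false (proj₁ q , j) y ⟧ * (⟦ P y ⟧ * (4 * (m * n)))) ≡⟨ trans (∑-pairs _) (trans (∑-cong (allFin m) λ i → ∑-δ-Fin n j (λ j → ⟦ P (i , j) ⟧ * (4 * (m * n)))) (∑-*ʳ (allFin m) (4 * (m * n)) _)) ⟩
      D * (4 * (m * n)) ≡⟨ solve 3 (λ d m n → d :* (con 4 :* (m :* n)) := m :* (con 4 :* n :* d)) refl D m n ⟩
      m * (4 * n * D) ∎)
      where
      D = ∑ (allFin m) (λ i → ⟦ P (i , j) ⟧)
      q = some (λ i → P (i , j)) lt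
    half′ : ∀ (P : Fin m × Fin n → Bool) → ∑ pairs (λ x → ⟦ G (proj₁ x) (proj₂ x) ⟧ * (4 * (m * n))) ≤ ∑ pairs (λ x → ⟦ P x ⟧ * (4 * (m * n))) + 2 * ∑ pairs (λ _ → e) →
      e ≤ 2 * edgeCount (λ i j → P (i , j))
    half′ P le = *-cancelˡ-≤ (2 * (m * n)) {{m*n≢0 2 (m * n) {{_}} {{m*n≢0 m n {{>-nonZero m>0}} {{>-nonZero n>0}}}}}} (+-cancelʳ-≤ (2 * (m * n) * e) _ _ (begin
      2 * (m * n) * e + 2 * (m * n) * e ≡⟨ solve 2 (λ x e → con 2 :* x :* e :+ con 2 :* x :* e := e :* (con 4 :* x)) refl (m * n) e ⟩
      e * (4 * (m * n)) ≡⟨ sym (trans (∑-pairs _) (trans (∑-cong (allFin m) λ i → ∑-*ʳ (allFin n) (4 * (m * n)) _) (∑-*ʳ (allFin m) (4 * (m * n)) _))) ⟩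
      ∑ pairs (λ x → ⟦ G (proj₁ x) (proj₂ x) ⟧ * (4 * (m * n))) ≤⟨ le ⟩
      ∑ pairs (λ x → ⟦ P x ⟧ * (4 * (m * n))) + 2 * ∑ pairs (λ _ → e) ≡⟨ cong₂ _+_ (trans (∑-pairs _) (trans (∑-cong (allFin m) λ i → ∑-*ʳ (allFin n) (4 * (m * n)) _) (∑-*ʳ (allFin m) (4 * (m * n)) _)))
                                                                              (cong (2 *_) (trans (∑-pairs _) (trans (∑-cong (allFin m) λ i → trans (∑-const (allFin n) e) (cong (_* e) (lenF n))) (trans (∑-const (allFin m) (n * e)) (cong (_* (n * e)) (lenF m)))))) ⟩
      e′ * (4 * (m * n)) + 2 * (m * (n * e)) ≡⟨ solve 4 (λ x m n e → x :* (con 4 :* (m :* n)) :+ con 2 :* (m :* (n :* e)) := con 2 :* (m :* n) :* (con 2 :* x) :+ con 2 :* (m :* n) :* e) refl e′ m n e ⟩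
      2 * (m * n) * (2 * e′) + 2 * (m * n) * e ∎))
      where e′ = edgeCount (λ i j → P (i , j))

module Embed {m n : ℕ} (G P : BipGraph m n) (P⊆G : ∀ {i j} → P i j ≡ true → G i j ≡ true) where
  open Trails (graph m n P)
  open SVert
  open SEdge
  private
    V = Vertex m n

  adj⇒Adj : ∀ u v → adjacent m n P u v ≡ true → Adj G u v
  adj⇒Adj (inj₁ _) (inj₂ _) e = P⊆G e
  adj⇒Adj (inj₂ _) (inj₁ _) e = P⊆G e

  at-index : (xs : List V) → Fin (length xs) → V
  at-index = Data.List.lookup

  walk-start : ∀ {u L v} → Walk u L v → ∀ i → toℕ i ≡ 0 → adjacent m n P u (at-index L i) ≡ true
  walk-start (e ∷ w) zero _ = e

  walk-step : ∀ {u L v} → Walk u L v → ∀ i j → suc (toℕ i) ≡ toℕ j → adjacent m n P (at-index L i) (at-index L j) ≡ true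
  walk-step (e ∷ w) zero    (suc j) q = walk-start w j (sym (suc-injective q))
  walk-step (e ∷ w) (suc i) (suc j) q = walk-step w i j (suc-injective q)

  walk-end : ∀ {u L v} → Walk u L v → ∀ i → suc (toℕ i) ≡ length L → adjacent m n P (at-index L i) v ≡ true
  walk-end (e ∷ [ e′ ])  zero    q = e′
  walk-end (e ∷ e′ ∷ w)  zero    ()
  walk-end (e ∷ w@(_ ∷ _)) (suc i) q = walk-end w i (suc-injective q)

  index-injective : ∀ {xs : List V} → Unique xs → ∀ i j → at-index xs i ≡ at-index xs j → i ≡ j
  index-injective (x ∷ u) zero    zero    e = refl
  index-injective (x ∷ u) (suc i) (suc j) e = cong suc (index-injective u i j e)
  index-injective (x ∷ u) zero    (suc j) e = ⊥-elim (All.lookup x (∈-lookup j) e)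
  index-injective (x ∷ u) (suc i) zero    e = ⊥-elim (All.lookup x (∈-lookup i) (sym e))

  contains : ∀ {s t r M ℓ} → ℓ ∸ 1 ≡ M → Subdivision s t r M → Contains (SVert s t r ℓ) (SEdge s t r ℓ) G
  contains {s} {t} {r} {M} {ℓ} ℓ≡ D = f , inj , edge
    where
    open Subdivision D hiding (left; right)
    idx : ∀ a b ρ → Fin (ℓ ∸ 1) → Fin (length (path a b ρ))
    idx a b ρ = cast (trans ℓ≡ (sym (length≡ a b ρ)))
    toℕ-idx : ∀ a b ρ i → toℕ (idx a b ρ i) ≡ toℕ i
    toℕ-idx a b ρ i = toℕ-cast (trans ℓ≡ (sym (length≡ a b ρ))) i
    f : SVert s t r ℓ → V
    f (left a)      = Subdivision.left D a
    f (right b)     = Subdivision.right D b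
    f (mid a b ρ i) = at-index (path a b ρ) (idx a b ρ i)
    on-path : ∀ a b ρ i → f (mid a b ρ i) ∈ path a b ρ
    on-path a b ρ i = ∈-lookup (idx a b ρ i)
    mid-inj : ∀ a b ρ i a′ b′ ρ′ i′ → a ≡ a′ × b ≡ b′ × ρ ≡ ρ′ → f (mid a b ρ i) ≡ f (mid a′ b′ ρ′ i′) → mid a b ρ i ≡ mid a′ b′ ρ′ i′
    mid-inj a b ρ i a b ρ i′ (refl , refl , refl) e = cong (mid a b ρ) (toℕ-injective (trans (sym (toℕ-idx a b ρ i)) (trans (cong toℕ (index-injective (unique a b ρ) _ _ e)) (toℕ-idx a b ρ i′))))
    inj : ∀ {u v} → f u ≡ f v → u ≡ v
    inj {left a}      {left a′}         e = cong left (left-inj e)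
    inj {left a}      {right b}         e = ⊥-elim (left≢right e)
    inj {left a}      {mid a′ b ρ i}    e = ⊥-elim (path≢left (subst (_∈ path a′ b ρ) (sym e) (on-path a′ b ρ i)))
    inj {right b}     {left a}          e = ⊥-elim (left≢right (sym e))
    inj {right b}     {right b′}        e = cong right (right-inj e)
    inj {right b}     {mid a b′ ρ i}    e = ⊥-elim (path≢right (subst (_∈ path a b′ ρ) (sym e) (on-path a b′ ρ i)))
    inj {mid a b ρ i} {left a′}         e = ⊥-elim (path≢left (subst (_∈ path a b ρ) e (on-path a b ρ i)))
    inj {mid a b ρ i} {right b′}        e = ⊥-elim (path≢right (subst (_∈ path a b ρ) e (on-path a b ρ i)))
    inj {mid a b ρ i} {mid a′ b′ ρ′ i′} e = mid-inj a b ρ i a′ b′ ρ′ i′ (disjoint (on-path a b ρ i) (subst (_∈ path a′ b′ ρ′) (sym e) (on-path a′ b′ ρ′ i′))) e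
    edge : ∀ {u v} → SEdge s t r ℓ u v → Adj G (f u) (f v)
    edge (start a b ρ i q)  = adj⇒Adj _ _ (walk-start (walk a b ρ) (idx a b ρ i) (trans (toℕ-idx a b ρ i) q))
    edge (step a b ρ i j q) = adj⇒Adj _ _ (walk-step (walk a b ρ) (idx a b ρ i) (idx a b ρ j) (trans (cong suc (toℕ-idx a b ρ i)) (trans q (sym (toℕ-idx a b ρ j)))))
    edge (end a b ρ i q)    = adj⇒Adj _ _ (walk-end (walk a b ρ) (idx a b ρ i) (trans (cong suc (toℕ-idx a b ρ i)) (trans q (trans ℓ≡ (sym (length≡ a b ρ))))))

-- Numerical consequences

x^2k : ∀ x k → x ^ (2 * k) ≡ (x * x) ^ k
x^2k x k = trans (sym (^-*-assoc x 2 k)) (cong (_^ k) (cong (x *_) (*-identityʳ x)))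

scale-walk : ∀ {e hA a W hB b} k → e * hA ≤ a * W → e * hB ≤ b * W → e ^ (1 + 2 * k) * (hB * (hA * hB) ^ k) ≤ b * (a * b) ^ k * W ^ (1 + 2 * k)
scale-walk {e} {hA} {a} {W} {hB} {b} k hA≤ hB≤ = begin
  e ^ (1 + 2 * k) * (hB * (hA * hB) ^ k) ≡⟨ cong (λ z → e * z * (hB * (hA * hB) ^ k)) (x^2k e k) ⟩
  e * (e * e) ^ k * (hB * (hA * hB) ^ k) ≡⟨ solve 4 (λ e x h y → e :* x :* (h :* y) := e :* h :* (x :* y)) refl e ((e * e) ^ k) hB ((hA * hB) ^ k) ⟩
  e * hB * ((e * e) ^ k * (hA * hB) ^ k) ≡⟨ cong (e * hB *_) (trans (sym (^-distribʳ-* k (e * e) (hA * hB))) (cong (_^ k) (solve 3 (λ e x y → e :* e :* (x :* y) := e :* x :* (e :* y)) refl e hA hB))) ⟩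
  e * hB * (e * hA * (e * hB)) ^ k ≤⟨ *-mono-≤ hB≤ (^-monoˡ-≤ k (*-mono-≤ hA≤ hB≤)) ⟩
  b * W * (a * W * (b * W)) ^ k ≡⟨ cong (b * W *_) (trans (cong (_^ k) (solve 3 (λ a b w → a :* w :* (b :* w) := a :* b :* (w :* w)) refl a b W)) (trans (^-distribʳ-* k (a * b) (W * W)) (cong ((a * b) ^ k *_) (sym (x^2k W k))))) ⟩
  b * W * ((a * b) ^ k * W ^ (2 * k)) ≡⟨ solve 4 (λ b w x y → b :* w :* (x :* y) := b :* x :* (w :* y)) refl b W ((a * b) ^ k) (W ^ (2 * k)) ⟩
  b * (a * b) ^ k * W ^ (1 + 2 * k) ∎
  where open ≤-Reasoning

-- Both sides have degree `2 + 2 * k` in `W` once the side maxima are replaced by `a * W / e` and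
-- `b * W / e`, so `W` cancels.
scale-path : ∀ {W e hA a hB b E R} k → 0 < W → e * hA ≤ a * W → e * hB ≤ b * W → E * W ^ (2 + 2 * k) ≤ R * (W * (hB * (hA * hB) ^ k)) →
  E * e ^ (1 + 2 * k) ≤ R * (b * (a * b) ^ k)
scale-path {W} {e} {hA} {a} {hB} {b} {E} {R} k W>0 hA≤ hB≤ le = *-cancelʳ-≤ _ _ (W ^ (2 + 2 * k)) {{m^n≢0 W (2 + 2 * k) {{>-nonZero W>0}}}} (begin
  E * e ^ n′ * W ^ (2 + 2 * k) ≡⟨ solve 3 (λ x y z → x :* y :* z := y :* (x :* z)) refl E (e ^ n′) (W ^ (2 + 2 * k)) ⟩
  e ^ n′ * (E * W ^ (2 + 2 * k)) ≤⟨ *-monoʳ-≤ (e ^ n′) le ⟩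
  e ^ n′ * (R * (W * T)) ≡⟨ solve 4 (λ x r w t → x :* (r :* (w :* t)) := r :* w :* (x :* t)) refl (e ^ n′) R W T ⟩
  R * W * (e ^ n′ * T) ≤⟨ *-monoʳ-≤ (R * W) (scale-walk {e} {hA} {a} {W} {hB} {b} k hA≤ hB≤) ⟩
  R * W * (b * (a * b) ^ k * W ^ n′) ≡⟨ solve 4 (λ r w y z → r :* w :* (y :* z) := r :* y :* (w :* z)) refl R W (b * (a * b) ^ k) (W ^ n′) ⟩
  R * (b * (a * b) ^ k) * W ^ (2 + 2 * k) ∎)
  where
  open ≤-Reasoning
  n′ = 1 + 2 * k
  T = hB * (hA * hB) ^ k

scale-spider : ∀ {W e hA a hB b E R} k s′ c → 0 < W → e * hA ≤ a * W → e * hB ≤ b * W →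
  E * (W ^ (2 + 2 * k)) ^ suc s′ ≤ R * (W * (hA ^ s′ * (c * (hB * (hA * hB) ^ k)) ^ suc s′)) →
  E * (e ^ s′ * (e ^ (1 + 2 * k)) ^ suc s′) ≤ R * (a ^ s′ * (c * (b * (a * b) ^ k)) ^ suc s′)
scale-spider {W} {e} {hA} {a} {hB} {b} {E} {R} k s′ c W>0 hA≤ hB≤ le = *-cancelʳ-≤ _ _ ((W ^ n) ^ s) {{m^n≢0 (W ^ n) s {{m^n≢0 W n {{>-nonZero W>0}}}}}} (begin
  E * (e ^ s′ * (e ^ n′) ^ s) * (W ^ n) ^ s ≡⟨ solve 3 (λ x y z → x :* y :* z := y :* (x :* z)) refl E (e ^ s′ * (e ^ n′) ^ s) ((W ^ n) ^ s) ⟩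
  e ^ s′ * (e ^ n′) ^ s * (E * (W ^ n) ^ s) ≤⟨ *-monoʳ-≤ (e ^ s′ * (e ^ n′) ^ s) le ⟩
  e ^ s′ * (e ^ n′) ^ s * (R * (W * (hA ^ s′ * (c * T) ^ s))) ≡⟨ solve 6 (λ x y r w z q → x :* y :* (r :* (w :* (z :* q))) := r :* w :* (x :* z :* (y :* q))) refl (e ^ s′) ((e ^ n′) ^ s) R W (hA ^ s′) ((c * T) ^ s) ⟩
  R * W * (e ^ s′ * hA ^ s′ * ((e ^ n′) ^ s * (c * T) ^ s)) ≡⟨ cong (R * W *_) (cong₂ _*_ (sym (^-distribʳ-* s′ e hA)) (trans (sym (^-distribʳ-* s (e ^ n′) (c * T))) (cong (_^ s) (x*yz≡y*xz (e ^ n′) c T)))) ⟩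
  R * W * ((e * hA) ^ s′ * (c * (e ^ n′ * T)) ^ s) ≤⟨ *-monoʳ-≤ (R * W) (*-mono-≤ (^-monoˡ-≤ s′ hA≤) (^-monoˡ-≤ s (*-monoʳ-≤ c (scale-walk {e} {hA} {a} {W} {hB} {b} k hA≤ hB≤)))) ⟩
  R * W * ((a * W) ^ s′ * (c * (y * W ^ n′)) ^ s) ≡⟨ cong (R * W *_) (cong₂ _*_ (^-distribʳ-* s′ a W) (trans (cong (_^ s) (sym (*-assoc c y (W ^ n′)))) (^-distribʳ-* s (c * y) (W ^ n′)))) ⟩
  R * W * (a ^ s′ * W ^ s′ * ((c * y) ^ s * (W ^ n′) ^ s)) ≡⟨ solve 6 (λ r w x z v q → r :* w :* (x :* z :* (v :* q)) := r :* (x :* v) :* (w :* z :* q)) refl R W (a ^ s′) (W ^ s′) ((c * y) ^ s) ((W ^ n′) ^ s) ⟩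
  R * (a ^ s′ * (c * y) ^ s) * (W ^ s * (W ^ n′) ^ s) ≡⟨ cong (R * (a ^ s′ * (c * y) ^ s) *_) (sym (^-distribʳ-* s W (W ^ n′))) ⟩
  R * (a ^ s′ * (c * y) ^ s) * (W ^ n) ^ s ∎)
  where
  open ≤-Reasoning
  n = 2 + 2 * k
  n′ = 1 + 2 * k
  s = suc s′
  T = hB * (hA * hB) ^ k
  y = b * (a * b) ^ k

module _ (Γ : WeightedGraph) (Β : Bipartition Γ) where
  open Bipartition Β
  open Paths Γ Β

  walkBound-odd : ∀ k b → walkBound (1 + 2 * k) b ≡ h b * (h (not b) * h b) ^ k
  walkBound-odd zero    b = refl
  walkBound-odd (suc k) b = begin
    walkBound (1 + 2 * suc k) b ≡⟨ cong (λ x → walkBound (suc x) b) (*-suc 2 k) ⟩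
    h b * (h (not b) * walkBound (1 + 2 * k) (not (not b))) ≡⟨ cong (λ c → h b * (h (not b) * walkBound (1 + 2 * k) c)) (nn b) ⟩
    h b * (h (not b) * walkBound (1 + 2 * k) b) ≡⟨ cong (λ x → h b * (h (not b) * x)) (walkBound-odd k b) ⟩
    h b * (h (not b) * (h b * (h (not b) * h b) ^ k)) ≡⟨ cong (h b *_) (sym (*-assoc (h (not b)) (h b) _)) ⟩
    h b * (h (not b) * h b) ^ suc k ∎
    where
    open ≡-Reasoning
    nn : ∀ b → not (not b) ≡ b
    nn true  = refl
    nn false = refl

  flip-even : ∀ k → flip (2 + 2 * k) true ≡ true
  flip-even zero    = refl
  flip-even (suc k) = trans (cong (λ x → flip (2 + x) true) (*-suc 2 k)) (flip-even k)

-- Constants for spiders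

opaque
  stageC : ℕ → ℕ → ℕ → ℕ
  stageC s N A = suc (loss s (2 * A) * N)

  stageC-> : ∀ s N A → loss s (2 * A) * N < stageC s N A
  stageC-> s N A = ≤-refl

  -- Interleaved with `stageC`: the richness asked for at a stage has to beat the loss at the
  -- density reached there, and it determines the next density.
  stageA : ℕ → ℕ → ℕ → ℕ → ℕ
  stageA s n N zero    = 2
  stageA s n N (suc j) = 2 * stageA s n N j * (stageC s N (stageA s n N j) * (1 + s * n)) * (1 + s * n)

  stageA-zero : ∀ s n N → stageA s n N 0 ≡ 2
  stageA-zero s n N = refl

  stageA-suc : ∀ s n N j → stageA s n N (suc j) ≡ 2 * stageA s n N j * (stageC s N (stageA s n N j) * (1 + s * n)) * (1 + s * n)
  stageA-suc s n N j = refl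

  stageβ : ℕ → ℕ → ℕ → ℕ → ℕ
  stageβ s n N zero    = 1
  stageβ s n N (suc j) = stageβ s n N j * (stageC s N (stageA s n N j) * (1 + s * n))

  stageβ-zero : ∀ s n N → stageβ s n N 0 ≡ 1
  stageβ-zero s n N = refl

  stageβ-suc : ∀ s n N j → stageβ s n N (suc j) ≡ stageβ s n N j * (stageC s N (stageA s n N j) * (1 + s * n))
  stageβ-suc s n N j = refl

-- Sums over all indices serve as crude maxima for the constants of finitely many stages.
upTo-bound : ∀ J (f : ℕ → ℕ) j → j ≤ J → f j ≤ ∑ (upTo (suc J)) f
upTo-bound J f j le = ∑-∈ f (∈-upTo⁺ (s≤s le))

module SpiderConstants (s′ t k : ℕ) where
  private
    s n₀ n′ top : ℕ
    s = suc s′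
    n₀ = 2 + 2 * k
    n′ = 1 + 2 * k
    top = 1 + s * n₀

  opaque
    N : ℕ
    N = ((s + t) + s * (t * 1) * n′ + (1 + n′)) + (s + t * (1 + s * n′) + (s + s * n′))

    N-pair : (s + t) + s * (t * 1) * n′ + (1 + n′) ≤ N
    N-pair = m≤m+n ((s + t) + s * (t * 1) * n′ + (1 + n′)) (s + t * (1 + s * n′) + (s + s * n′))

    N-spread : s + t * (1 + s * n′) + (s + s * n′) ≤ N
    N-spread = m≤n+m (s + t * (1 + s * n′) + (s + s * n′)) ((s + t) + s * (t * 1) * n′ + (1 + n′))

    βm : ℕ
    βm = ∑ (upTo (suc top)) (stageβ s n₀ N)

    β≤βm : ∀ j → j ≤ top → stageβ s n₀ N j ≤ βm
    β≤βm j le = upTo-bound top (stageβ s n₀ N) j le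

    -- Chosen so that the spiders that are not light cannot fill the set surviving at any stage.
    E₀ : ℕ
    E₀ = suc (∑ (upTo (suc top)) (λ j → stageA s n₀ N j * (s * (n₀ * n₀ * 2))))

    E₀-pos : 0 < E₀
    E₀-pos = z<s

    A<E₀ : ∀ j → j ≤ top → stageA s n₀ N j * (s * (n₀ * n₀ * 2)) < E₀
    A<E₀ j le = s≤s (upTo-bound top (λ j → stageA s n₀ N j * (s * (n₀ * n₀ * 2))) j le)

    Δ₂ : ℕ
    Δ₂ = ∑ (upTo (suc top)) (λ j → degreeNeeded s n₀ (2 * stageA s n₀ N j) N s t)

    needed≤Δ₂ : ∀ j → j ≤ top → degreeNeeded s n₀ (2 * stageA s n₀ N j) N s t ≤ Δ₂
    needed≤Δ₂ j le = upTo-bound top (λ j → degreeNeeded s n₀ (2 * stageA s n₀ N j) N s t) j le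

-- Bounds under a minimum degree

module Bounds (Γ : WeightedGraph) (Β : Bipartition Γ) (δ : ℕ) (δ≤d : MinDegree Γ δ) where
  open WeightedGraph Γ using (vs; d; W; W-pos)
  open Bipartition Β using (h; side)
  open Trails Γ

  private
    E = ∑ vs (λ v → ⟦ side v ⟧ * d v)

  module _ (eG m a b : ℕ) (∑side : ∑ vs (λ v → ⟦ side v ⟧) ≡ m) (dbl : ∑ vs d ≡ 2 * E) (E>0 : 0 < E) (eG≤ : eG ≤ 2 * E)
           (hA : eG * h true ≤ a * W) (hB : eG * h false ≤ b * W) where

    private
      d>0 : 0 < ∑ vs d
      d>0 = subst (0 <_) (sym dbl) (≤-trans E>0 (m≤m+n E _))

    module _ (s t r k : ℕ) where
      open PathConstants s t r k 4 z<s

      first-bound : Δ ≤ δ →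
        Subdivision s t r (1 + 2 * k) ⊎ eG ^ (2 + 2 * k) ≤ 2 * (2 * (m * m * C ^ (1 + 2 * k))) * (b * (a * b) ^ k)
      first-bound Δ≤ = decide (path-dichotomy Γ Β δ δ≤d Δ≤ d>0)
        where
        open Paths Γ Β using (mass; heavy; total)
        open ≤-Reasoning
        n′ = 1 + 2 * k
        R₀ = 2 * (m * m * C ^ n′)
        T₀ = h false * (h true * h false) ^ k
        few : 4 * mass (heavy C n′) n′ ≤ total n′ → E * W ^ (2 + 2 * k) ≤ R₀ * (W * T₀)
        few heavy≤ = ≤-trans (FirstBound.few-light-pairs Γ Β C n′ (flip-even Γ Β k) heavy≤ (≤-reflexive dbl))
          (≤-reflexive (trans (cong₂ (λ x y → 2 * (x * x * (C ^ n′ * (W * y)))) ∑side (walkBound-odd Γ Β k false))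
            (solve 4 (λ m c w t → con 2 :* (m :* m :* (c :* (w :* t))) := con 2 :* (m :* m :* c) :* (w :* t)) refl m (C ^ n′) W T₀)))
        decide : Subdivision s t r n′ ⊎ (∀ i → i < 2 + 2 * k → 4 * mass (heavy C i) i ≤ total i) →
          Subdivision s t r n′ ⊎ eG ^ (2 + 2 * k) ≤ 2 * R₀ * (b * (a * b) ^ k)
        decide (inj₁ sub) = inj₁ sub
        decide (inj₂ heavy≤) = inj₂ (begin
          eG * eG ^ n′ ≤⟨ *-monoˡ-≤ (eG ^ n′) eG≤ ⟩
          2 * E * eG ^ n′ ≡⟨ *-assoc 2 E _ ⟩
          2 * (E * eG ^ n′) ≤⟨ *-monoʳ-≤ 2 (scale-path {W} {eG} {h true} {a} {h false} {b} {E} {R₀} k W-pos hA hB (few (heavy≤ n′ ≤-refl))) ⟩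
          2 * (R₀ * (b * (a * b) ^ k)) ≡⟨ sym (*-assoc 2 R₀ _) ⟩
          2 * R₀ * (b * (a * b) ^ k) ∎)

    module _ (s′ t k : ℕ) where
      open SpiderConstants s′ t k
      open PathConstants (suc s′) t 1 k E₀ E₀-pos

      second-bound : Δ ≤ δ → Δ₂ ≤ δ →
        Subdivision (suc s′) t 1 (1 + 2 * k) ⊎
        (eG ^ (2 + 2 * k)) ^ suc s′ ≤ 2 * (2 * (m ^ suc s′ * βm)) * (a ^ s′ * (C ^ (1 + 2 * k) * (b * (a * b) ^ k)) ^ suc s′)
      second-bound Δ≤ Δ₂≤ = decide (path-dichotomy Γ Β δ δ≤d Δ≤ d>0)
        where
        open Paths Γ Β using (mass; heavy; total)
        open ≤-Reasoning
        s n₀ n′ : ℕ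
        s = suc s′
        n₀ = 2 + 2 * k
        n′ = 1 + 2 * k
        module Top = TopSpiders Γ Β δ δ≤d s′ n′
        R₀ = 2 * (m ^ s * βm)
        T₀ = h false * (h true * h false) ^ k
        Goal = Subdivision s t 1 n′ ⊎ (eG ^ n₀) ^ s ≤ 2 * R₀ * (a ^ s′ * (C ^ n′ * (b * (a * b) ^ k)) ^ s)
        tot>0 : 0 < Spiders.totalMass Γ s n₀ Top.μ
        tot>0 = subst (0 <_) (sym Top.totalMass-value) (*-mono-≤ E>0 (m^n>0 (W ^ n₀) {{m^n≢0 W n₀ {{>-nonZero W-pos}}}} s))
        conclude : Spiders.totalMass Γ s n₀ Top.μ ≤ 2 * ((∑ vs (λ v → ⟦ side v ⟧)) ^ s * (βm * Top.maxWeight C)) ⊎ Subdivision s t 1 n′ → Goal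
        conclude (inj₂ sub) = inj₁ sub
        conclude (inj₁ few) = inj₂ (begin
          (eG * eG ^ n′) ^ s ≡⟨ ^-distribʳ-* s eG (eG ^ n′) ⟩
          eG * eG ^ s′ * (eG ^ n′) ^ s ≡⟨ *-assoc eG (eG ^ s′) _ ⟩
          eG * (eG ^ s′ * (eG ^ n′) ^ s) ≤⟨ *-monoˡ-≤ (eG ^ s′ * (eG ^ n′) ^ s) eG≤ ⟩
          2 * E * (eG ^ s′ * (eG ^ n′) ^ s) ≡⟨ *-assoc 2 E _ ⟩
          2 * (E * (eG ^ s′ * (eG ^ n′) ^ s)) ≤⟨ *-monoʳ-≤ 2 (scale-spider {W} {eG} {h true} {a} {h false} {b} {E} {R₀} k s′ (C ^ n′) W-pos hA hB few′) ⟩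
          2 * (R₀ * (a ^ s′ * (C ^ n′ * (b * (a * b) ^ k)) ^ s)) ≡⟨ sym (*-assoc 2 R₀ _) ⟩
          2 * R₀ * (a ^ s′ * (C ^ n′ * (b * (a * b) ^ k)) ^ s) ∎)
          where
          few′ : E * (W ^ n₀) ^ s ≤ R₀ * (W * (h true ^ s′ * (C ^ n′ * T₀) ^ s))
          few′ = ≤-trans (≤-reflexive (sym Top.totalMass-value)) (≤-trans few (≤-reflexive
            (trans (cong₂ (λ x y → 2 * (x ^ s * (βm * (W * (h true ^ s′ * (C ^ n′ * y) ^ s))))) ∑side (walkBound-odd Γ Β k false))
              (solve 3 (λ x b w → con 2 :* (x :* (b :* w)) := con 2 :* (x :* b) :* w) refl (m ^ s) βm (W * (h true ^ s′ * (C ^ n′ * T₀) ^ s))))))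
        decide : Subdivision s t 1 n′ ⊎ (∀ i → i < n₀ → E₀ * mass (heavy C i) i ≤ total i) → Goal
        decide (inj₁ sub) = inj₁ sub
        decide (inj₂ heavy≤) = conclude (Top.spider-dichotomy t k refl (stageA s n₀ N) (λ j → stageC s N (stageA s n₀ N j)) (stageβ s n₀ N) N C E₀ βm
              (stageA-suc s n₀ N) (stageβ-suc s n₀ N) (stageA-zero s n₀ N) (stageβ-zero s n₀ N) (λ j → stageC-> s N (stageA s n₀ N j))
              β≤βm A<E₀ (λ j le → ≤-trans (needed≤Δ₂ j le) Δ₂≤) N-pair N-spread C-pos heavy≤ (flip-even Γ Β k) (≤-reflexive dbl) tot>0)

module Concrete {m n : ℕ} (m>0 : 0 < m) (n>0 : 0 < n) (m≤n : m ≤ n) (G : BipGraph m n) (δ : ℕ) (dense : 4 * δ * n < edgeCount G) where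

  private
    module _ (co : Core m n G) where
      open Core co
      Γ = graph m n P
      Β = bipartition m n P
      eG = edgeCount G
      open WeightedGraph Γ using (vs; d)
      open Bipartition Β using (side)

      degree-left : ∀ i → 0 < d (inj₁ i) → eG ≤ 4 * m * d (inj₁ i)
      degree-left i lt = subst (λ x → eG ≤ 4 * m * x) (sym (d-row m n P i)) (rows i (subst (0 <_) (d-row m n P i) lt))

      degree-right : ∀ j → 0 < d (inj₂ j) → eG ≤ 4 * n * d (inj₂ j)
      degree-right j lt = subst (λ x → eG ≤ 4 * n * x) (sym (d-col m n P j)) (cols j (subst (0 <_) (d-col m n P j) lt))

      -- Since `m ≤ n`, the weaker bound `eG / (4 * n)` holds on both sides.
      δ≤d : MinDegree Γ δ
      δ≤d v lt = *-cancelˡ-≤ 4 (*-cancelʳ-≤ (4 * δ) (4 * d v) n {{>-nonZero n>0}} (≤-trans (<⇒≤ dense) (≤-trans (bound v lt) (≤-reflexive (reorder (d v))))))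
        where
        reorder : ∀ x → 4 * n * x ≡ 4 * x * n
        reorder x = solve 2 (λ n x → con 4 :* n :* x := con 4 :* x :* n) refl n x
        bound : ∀ v → 0 < d v → eG ≤ 4 * n * d v
        bound (inj₁ i) lt = ≤-trans (degree-left i lt) (*-monoˡ-≤ (d (inj₁ i)) (*-monoʳ-≤ 4 m≤n))
        bound (inj₂ j) lt = degree-right j lt

      eG≤ : eG ≤ 2 * ∑ vs (λ v → ⟦ side v ⟧ * d v)
      eG≤ = ≤-trans half-kept (≤-reflexive (cong (2 *_) (sym (∑-left m n P))))

      E>0 : 0 < ∑ vs (λ v → ⟦ side v ⟧ * d v)
      E>0 = 0<t≤c*x 2 (≤-<-trans z≤n dense) eG≤

      hAB = sideMax-bound m n P eG (4 * m) (4 * n) degree-left degree-right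

  module _ (s t r k : ℕ) where
    open PathConstants s t r k 4 z<s

    first-bound : Δ ≤ δ → SubdivFree s t r (suc k) G →
      edgeCount G ^ (2 + 2 * k) ≤ 2 * (2 * (m * m * C ^ (1 + 2 * k))) * (4 * n * (4 * m * (4 * n)) ^ k)
    first-bound Δ≤ free with core m n m>0 n>0 G
    ... | co with Bounds.first-bound (Γ co) (Β co) δ (δ≤d co) (eG co) m (4 * m) (4 * n) (∑-side m n (Core.P co)) (∑-degrees m n (Core.P co)) (E>0 co) (eG≤ co) (proj₁ (hAB co)) (proj₂ (hAB co)) s t r k Δ≤
    ...   | inj₁ sub = ⊥-elim (free (Embed.contains G (Core.P co) (Core.P⊆G co) (cong (_∸ 1) (*-suc 2 k)) sub))
    ...   | inj₂ le = le

  module _ (s′ t k : ℕ) where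
    open SpiderConstants s′ t k
    open PathConstants (suc s′) t 1 k E₀ E₀-pos

    second-bound : Δ ≤ δ → Δ₂ ≤ δ → SubdivFree (suc s′) t 1 (suc k) G →
      (edgeCount G ^ (2 + 2 * k)) ^ suc s′ ≤ 2 * (2 * (m ^ suc s′ * βm)) * ((4 * m) ^ s′ * (C ^ (1 + 2 * k) * (4 * n * (4 * m * (4 * n)) ^ k)) ^ suc s′)
    second-bound Δ≤ Δ₂≤ free with core m n m>0 n>0 G
    ... | co with Bounds.second-bound (Γ co) (Β co) δ (δ≤d co) (eG co) m (4 * m) (4 * n) (∑-side m n (Core.P co)) (∑-degrees m n (Core.P co)) (E>0 co) (eG≤ co) (proj₁ (hAB co)) (proj₂ (hAB co)) s′ t k Δ≤ Δ₂≤
    ...   | inj₁ sub = ⊥-elim (free (Embed.contains G (Core.P co) (Core.P⊆G co) (cong (_∸ 1) (*-suc 2 k)) sub))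
    ...   | inj₂ le = le

-- Collecting powers and the final constant

16mn : ∀ m n k → (4 * m * (4 * n)) ^ k ≡ 16 ^ k * (m ^ k * n ^ k)
16mn m n k = trans (cong (_^ k) (solve 2 (λ m n → con 4 :* m :* (con 4 :* n) := con 16 :* (m :* n)) refl m n))
  (trans (^-distribʳ-* k 16 (m * n)) (cong (16 ^ k *_) (^-distribʳ-* k m n)))

collect-first : ∀ m n k c → 2 * (2 * (m * m * c)) * (4 * n * (4 * m * (4 * n)) ^ k) ≡ 16 * c * 16 ^ k * m ^ (suc k + 1) * n ^ suc k
collect-first m n k c = begin
  2 * (2 * (m * m * c)) * (4 * n * (4 * m * (4 * n)) ^ k) ≡⟨ cong (λ z → 2 * (2 * (m * m * c)) * (4 * n * z)) (16mn m n k) ⟩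
  2 * (2 * (m * m * c)) * (4 * n * (16 ^ k * (m ^ k * n ^ k))) ≡⟨ solve 6 (λ m n c x y z → con 2 :* (con 2 :* (m :* m :* c)) :* (con 4 :* n :* (x :* (y :* z))) := con 16 :* c :* x :* (m :* (y :* m)) :* (n :* z)) refl m n c (16 ^ k) (m ^ k) (n ^ k) ⟩
  16 * c * 16 ^ k * (m * (m ^ k * m)) * (n * n ^ k) ≡⟨ cong (λ z → 16 * c * 16 ^ k * (m * z) * n ^ suc k) (sym (trans (^-distribˡ-+-* m k 1) (cong (m ^ k *_) (*-identityʳ m)))) ⟩
  16 * c * 16 ^ k * m ^ (suc k + 1) * n ^ suc k ∎
  where open ≡-Reasoning

collect-second : ∀ m n k s′ β c → let s = suc s′ in
  2 * (2 * (m ^ s * β)) * ((4 * m) ^ s′ * (c * (4 * n * (4 * m * (4 * n)) ^ k)) ^ s) ≡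
  4 * β * (4 ^ s′ * (c * (4 * 16 ^ k)) ^ s) * m ^ (suc k * s + s ∸ 1) * n ^ (suc k * s)
collect-second m n k s′ β c = begin
  2 * (2 * (m ^ s * β)) * ((4 * m) ^ s′ * (c * (4 * n * (4 * m * (4 * n)) ^ k)) ^ s)
    ≡⟨ cong₂ (λ y z → 2 * (2 * (m ^ s * β)) * (y * z)) (^-distribʳ-* s′ 4 m) inner ⟩
  2 * (2 * (m ^ s * β)) * (4 ^ s′ * m ^ s′ * (D ^ s * (m ^ (k * s) * n ^ (suc k * s))))
    ≡⟨ solve 7 (λ x b p y d z q → con 2 :* (con 2 :* (x :* b)) :* (p :* y :* (d :* (z :* q))) := con 4 :* b :* (p :* d) :* (x :* z :* y) :* q) refl (m ^ s) β (4 ^ s′) (m ^ s′) (D ^ s) (m ^ (k * s)) (n ^ (suc k * s)) ⟩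
  4 * β * (4 ^ s′ * D ^ s) * (m ^ s * m ^ (k * s) * m ^ s′) * n ^ (suc k * s)
    ≡⟨ cong (λ z → 4 * β * (4 ^ s′ * D ^ s) * z * n ^ (suc k * s)) (trans (cong (_* m ^ s′) (sym (^-distribˡ-+-* m s (k * s)))) (trans (sym (^-distribˡ-+-* m (suc k * s) s′)) (cong (m ^_) (sym (cong (_∸ 1) (+-suc (suc k * s) s′)))))) ⟩
  4 * β * (4 ^ s′ * D ^ s) * m ^ (suc k * s + s ∸ 1) * n ^ (suc k * s) ∎
  where
  open ≡-Reasoning
  s = suc s′
  D = c * (4 * 16 ^ k)
  inner : (c * (4 * n * (4 * m * (4 * n)) ^ k)) ^ s ≡ D ^ s * (m ^ (k * s) * n ^ (suc k * s))
  inner = trans (cong (_^ s) (trans (cong (λ z → c * (4 * n * z)) (16mn m n k)) (solve 5 (λ c n x y z → c :* (con 4 :* n :* (x :* (y :* z))) := c :* (con 4 :* x) :* (y :* (n :* z))) refl c n (16 ^ k) (m ^ k) (n ^ k))))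
    (trans (^-distribʳ-* s D (m ^ k * n ^ suc k)) (cong (D ^ s *_) (trans (^-distribʳ-* s (m ^ k) (n ^ suc k)) (cong₂ _*_ (^-*-assoc m k s) (^-*-assoc n (suc k) s)))))

-- The two summands C n log m and C^K (...) of the bound: below the first there is nothing to prove.
split-bound : ∀ {e n ℓ C D K X} → 1 ≤ ℓ → D ≤ C → 0 < K → (C * n < e → e ^ K ≤ D * X) → (e ∸ C * n * ℓ) ^ K ≤ C ^ K * X
split-bound {e} {n} {ℓ} {C} {D} {suc K} {X} 1≤ℓ D≤C _ h with e ≤? C * n * ℓ
... | yes le = ≤-trans (≤-reflexive (cong (_^ suc K) (m≤n⇒m∸n≡0 le))) z≤n
... | no gt = begin
  (e ∸ C * n * ℓ) ^ suc K ≤⟨ ^-monoˡ-≤ (suc K) (m∸n≤m e (C * n * ℓ)) ⟩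
  e ^ suc K ≤⟨ h (≤-<-trans (≤-trans (≤-reflexive (sym (*-identityʳ (C * n)))) (*-monoʳ-≤ (C * n) 1≤ℓ)) (≰⇒> gt)) ⟩
  D * X ≤⟨ *-monoˡ-≤ X (≤-trans D≤C (C≤C^ C K)) ⟩
  C ^ suc K * X ∎
  where
  open ≤-Reasoning
  C≤C^ : ∀ C K → C ≤ C ^ suc K
  C≤C^ zero    K = z≤n
  C≤C^ (suc C) K = ≤-trans (≤-reflexive (sym (*-identityʳ (suc C)))) (*-monoʳ-≤ (suc C) (m^n>0 (suc C) K))

module FinalConstant (r s′ t k : ℕ) where
  open SpiderConstants s′ t k using (βm; Δ₂; E₀; E₀-pos)
  module P₁ = PathConstants (suc s′) t r k 4 z<s
  module P₂ = PathConstants (suc s′) t 1 k E₀ E₀-pos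

  D₁ D₂ δ₁ δ₂ : ℕ
  D₁ = 16 * P₁.C ^ (1 + 2 * k) * 16 ^ k
  D₂ = 4 * βm * (4 ^ s′ * (P₂.C ^ (1 + 2 * k) * (4 * 16 ^ k)) ^ suc s′)
  δ₁ = P₁.Δ
  δ₂ = P₂.Δ + Δ₂

  opaque
    -- Dominates the factors `D₁` and `D₂` in front of the powers, and the edge densities `4 * δ₁`
    -- and `4 * δ₂` from which on the minimum degree is large enough.
    constant : ℕ
    constant = suc (D₁ + D₂ + (4 * δ₁ + 4 * δ₂))

    constant-pos : 0 < constant
    constant-pos = z<s

    parts : D₁ ≤ constant × D₂ ≤ constant × 4 * δ₁ ≤ constant × 4 * δ₂ ≤ constant
    parts = four D₁ D₂ (4 * δ₁) (4 * δ₂)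
      where
      four : ∀ a b c e → a ≤ suc (a + b + (c + e)) × b ≤ suc (a + b + (c + e)) × c ≤ suc (a + b + (c + e)) × e ≤ suc (a + b + (c + e))
      four a b c e = m≤n⇒m≤1+n (≤-trans (m≤m+n a b) (m≤m+n (a + b) (c + e))) , m≤n⇒m≤1+n (≤-trans (m≤n+m b a) (m≤m+n (a + b) (c + e))) ,
        m≤n⇒m≤1+n (≤-trans (m≤m+n c e) (m≤n+m (c + e) (a + b))) , m≤n⇒m≤1+n (≤-trans (m≤n+m e c) (m≤n+m (c + e) (a + b)))

module _ (r s′ t k : ℕ) {m n : ℕ} (2≤m : 2 ≤ m) (m≤n : m ≤ n) (G : BipGraph m n) where
  open FinalConstant r s′ t k
  private
    s = suc s′
    m>0 : 0 < m
    m>0 = ≤-trans (s≤s z≤n) 2≤m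
    n>0 : 0 < n
    n>0 = ≤-trans m>0 m≤n
    -- This lets the linear term `constant * n` be absorbed by the logarithmic one.
    1≤log : 1 ≤ ⌊log₂ m ⌋
    1≤log = ⌊log₂⌋-mono-≤ 2≤m
    dense : ∀ δ → 4 * δ ≤ constant → constant * n < edges G → 4 * δ * n < edgeCount G
    dense δ le lt = ≤-<-trans (*-monoˡ-≤ n le) (subst (constant * n <_) (edges≡edgeCount G) lt)
    2sk : 2 * suc k ≡ 2 + 2 * k
    2sk = *-suc 2 k

  first-final : SubdivFree s t r (suc k) G → (edges G ∸ constant * n * ⌊log₂ m ⌋) ^ (2 * suc k) ≤ constant ^ (2 * suc k) * m ^ (suc k + 1) * n ^ suc k
  first-final free = ≤-trans (split-bound {edges G} {n} {⌊log₂ m ⌋} {constant} {D₁} {2 * suc k} {m ^ (suc k + 1) * n ^ suc k} 1≤log (proj₁ parts) z<s λ lt →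
      ≤-trans (≤-reflexive (cong₂ _^_ (edges≡edgeCount G) 2sk))
        (≤-trans (Concrete.first-bound m>0 n>0 m≤n G δ₁ (dense δ₁ (proj₁ (proj₂ (proj₂ parts))) lt) s t r k ≤-refl free)
          (≤-reflexive (trans (collect-first m n k (P₁.C ^ (1 + 2 * k))) (*-assoc D₁ (m ^ (suc k + 1)) (n ^ suc k))))))
    (≤-reflexive (sym (*-assoc (constant ^ (2 * suc k)) (m ^ (suc k + 1)) (n ^ suc k))))

  second-final : SubdivFree s t 1 (suc k) G → (edges G ∸ constant * n * ⌊log₂ m ⌋) ^ (2 * suc k * s) ≤ constant ^ (2 * suc k * s) * m ^ (suc k * s + s ∸ 1) * n ^ (suc k * s)
  second-final free = ≤-trans (split-bound {edges G} {n} {⌊log₂ m ⌋} {constant} {D₂} {2 * suc k * s} {m ^ (suc k * s + s ∸ 1) * n ^ (suc k * s)} 1≤log (proj₁ (proj₂ parts)) z<s λ lt →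
      ≤-trans (≤-reflexive (trans (cong₂ _^_ (edges≡edgeCount G) (cong (_* s) 2sk)) (sym (^-*-assoc (edgeCount G) (2 + 2 * k) s))))
        (≤-trans (Concrete.second-bound m>0 n>0 m≤n G δ₂ (dense δ₂ (proj₂ (proj₂ (proj₂ parts))) lt) s′ t k (m≤m+n P₂.Δ _) (m≤n+m _ P₂.Δ) free)
          (≤-reflexive (trans (collect-second m n k s′ (SpiderConstants.βm s′ t k) (P₂.C ^ (1 + 2 * k))) (*-assoc D₂ (m ^ (suc k * s + s ∸ 1)) (n ^ (suc k * s)))))))
    (≤-reflexive (sym (*-assoc (constant ^ (2 * suc k * s)) (m ^ (suc k * s + s ∸ 1)) (n ^ (suc k * s)))))

-- The powers `2 * k` and `2 * k * s` clear the fractional exponents. Truncated subtraction moves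
-- the logarithmic term to the left: an excess of 0 is the case in which that term alone suffices.
theorem1p6 : (k r s t : ℕ) → 0 < k → 0 < r → 0 < s → 0 < t →
    Σ ℕ λ C → 0 < C ×
    ((m n : ℕ) → 2 ≤ m → m ≤ n → (G : BipGraph m n) →
    (SubdivFree s t r k G →
    (edges G ∸ C * n * ⌊log₂ m ⌋) ^ (2 * k)
    ≤ C ^ (2 * k) * m ^ (k + 1) * n ^ k)
    × (SubdivFree s t 1 k G →
    (edges G ∸ C * n * ⌊log₂ m ⌋) ^ (2 * k * s)
    ≤ C ^ (2 * k * s) * m ^ (k * s + s ∸ 1) * n ^ (k * s)))
-- The inner `k` is one less than in the statement, so legs have length `2 + 2 * k` and paths have
-- `1 + 2 * k` interior vertices.
theorem1p6 (suc k) r (suc s′) t _ _ _ _ =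
  FinalConstant.constant r s′ t k , FinalConstant.constant-pos r s′ t k , λ m n 2≤m m≤n G → first-final r s′ t k 2≤m m≤n G , second-final r s′ t k 2≤m m≤n G
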